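{- For $|q|<1$, $$\mathrm{C}\Phi_7(q)=\frac{1}{(q;q)_\infty^7}\left(1-\frac78\sum_{k=1}^\infty\Big(\frac k7\Big)\frac{k^2q^k}{1-q^k}+\frac{343}{8}\sum_{k=1}^\infty\Big(\frac k7\Big)\frac{q^k+q^{2k}}{(1-q^k)^3}\right)$$ $$=\frac{1}{(q^7;q^7)_\infty}+49q\frac{(q^7;q^7)_\infty^3}{(q;q)_\infty^4}+343q^2\frac{(q^7;q^7)_\infty^7}{(q;q)_\infty^8}=\frac{1}{(q^7;q^7)_\infty}+7\sum_{j=1}^\infty p(7j-2)q^j.$$
   Context: A $k$-colored generalized Frobenius symbol is a two-row array with $d\ge 0$ columns whose entries are colored nonnegative integers $\ell_c$ ($\ell\ge 0$, color $c\in\{1,\dots,k\}$), each row strictly decreasing with respect to the total order $0_1\prec 0_2\prec\cdots\prec 0_k\prec 1_1\prec\cdots\prec 1_k\prec 2_1\prec\cdots$. It is a $k$-colored generalized Frobenius partition of $n=d+\sum(\text{integer values of all entries})$. $c\phi_k(n)$ is the number of such partitions of $n$ (with $c\phi_k(0)=1$), and $\mathrm{C}\Phi_k(q)=\sum_{n\ge0}c\phi_k(n)q^n$. $(a;q)_\infty=\prod_{j\ge1}(1-aq^{j-1})$, $p(n)$ is the number of ordinary partitions of $n$, and $\left(\frac{k}{7}\right)$ is the Legendre symbol. -}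

module Defs where

open import Data.Nat as ℕ using (ℕ; zero; suc; _∸_; _<_; _≥_)
open import Data.Nat.Divisibility using (_∣?_)
open import Data.Nat.ListAction using (sum)
open import Data.Bool.ListAction using (any)
open import Data.Nat.DivMod using (_%_)
open import Data.Integer as ℤ using (ℤ; +_)
open import Data.Rational using (ℚ; 0ℚ; 1ℚ; _+_; _*_; -_; _-_; _/_)
open import Data.Fin using (Fin; toℕ)
open import Data.List as List using (List; []; _∷_; length; map; upTo)
open import Data.List.Relation.Unary.Linked using (Linked)
open import Data.List.Relation.Unary.All using (All)
open import Data.Bool using (Bool; true; false; if_then_else_)
open import Data.Product using (_×_)
open import Data.Sum using (_⊎_)
open import Relation.Binary.PropositionalEquality using (_≡_)
open import Relation.Nullary.Decidable using (⌊_⌋)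

record Entry (k : ℕ) : Set where
  constructor _[_]
  field
    value : ℕ
    color : Fin k
open Entry public

_≺_ : ∀ {k} → Entry k → Entry k → Set
x ≺ y = (value x < value y) ⊎ ((value x ≡ value y) × (toℕ (color x) < toℕ (color y)))

StrictlyDecreasing : ∀ {k} → List (Entry k) → Set
StrictlyDecreasing = Linked (λ x y → y ≺ x)

rowSum : ∀ {k} → List (Entry k) → ℕ
rowSum r = sum (map value r)

record FrobSymbol (k n : ℕ) : Set where
  field
    top    : List (Entry k)
    bottom : List (Entry k)
    topDec : StrictlyDecreasing top
    botDec : StrictlyDecreasing bottom
    sameLength : length top ≡ length bottom
    weight : length top ℕ.+ (rowSum top ℕ.+ rowSum bottom) ≡ n

record Partition (n : ℕ) : Set where
  field
    parts : List ℕ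
    nonincreasing : Linked _≥_ parts
    positive : All (λ m → 0 < m) parts
    total : sum parts ≡ n

PS : Set
PS = ℕ → ℚ

ℚ[_] : ℕ → ℚ
ℚ[ n ] = + n / 1

ℤ→ℚ : ℤ → ℚ
ℤ→ℚ z = z / 1

Σ< : ℕ → (ℕ → ℚ) → ℚ
Σ< zero f = 0ℚ
Σ< (suc n) f = Σ< n f + f n

-- Σ_{i=a}^{b} f i  (empty if b < a)
Σ[_to_] : ℕ → ℕ → (ℕ → ℚ) → ℚ
Σ[ a to b ] f = Σ< (suc b ∸ a) (λ i → f (a ℕ.+ i))

oneS : PS
oneS zero = 1ℚ
oneS (suc n) = 0ℚ

X^ : ℕ → PS
X^ m n = if ⌊ n ℕ.≟ m ⌋ then 1ℚ else 0ℚ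

_+ₛ_ : PS → PS → PS
(f +ₛ g) n = f n + g n

_-ₛ_ : PS → PS → PS
(f -ₛ g) n = f n - g n

_·ₛ_ : ℚ → PS → PS
(c ·ₛ f) n = c * f n

_*ₛ_ : PS → PS → PS
(f *ₛ g) n = Σ[ 0 to n ] (λ i → f i * g (n ∸ i))

_^ₛ_ : PS → ℕ → PS
f ^ₛ zero = oneS
f ^ₛ suc e = f *ₛ (f ^ₛ e)

-- Reciprocal of a series with constant term 1:
-- c_0 = 1, c_{n+1} = - Σ_{i=0}^{n} f(i+1) c_{n-i}.
-- invRev f n = [c_n, c_{n-1}, ..., c_0].
private
  dotShift : PS → List ℚ → ℕ → ℚ
  dotShift f [] i = 0ℚ
  dotShift f (c ∷ cs) i = f (suc i) * c + dotShift f cs (suc i)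

invRev : PS → ℕ → List ℚ
invRev f zero = 1ℚ ∷ []
invRev f (suc n) = let prev = invRev f n in (- dotShift f prev 0) ∷ prev

inv : PS → PS
inv f n with invRev f n
... | [] = 0ℚ
... | c ∷ _ = c

-- (q^m ; q^m)_∞ = Π_{j≥1} (1 - q^{mj}); for m ≥ 1 its n-th coefficient
-- equals that of the finite product Π_{j=1}^{n} (1 - q^{mj}).
finProd : ℕ → ℕ → PS
finProd m zero = oneS
finProd m (suc N) = finProd m N *ₛ (oneS -ₛ X^ (m ℕ.* suc N))

qPoch : ℕ → PS
qPoch m n = finProd m n n

isSquareMod : (p a : ℕ) .{{_ : ℕ.NonZero p}} → Bool
isSquareMod p a = any (λ x → ⌊ (x ℕ.* x) % p ℕ.≟ a % p ⌋) (upTo p)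

legendre : (a p : ℕ) .{{_ : ℕ.NonZero p}} → ℤ
legendre a p = if ⌊ p ∣? a ⌋ then + 0 else (if isSquareMod p a then + 1 else ℤ.-[1+ 0 ])

-- Σ_{k≥1} T k, where each T k has no terms below q^k; coefficient n is
-- then the coefficient of the finite sum Σ_{k=1}^{n} T k.
ΣLambert : (ℕ → PS) → PS
ΣLambert T n = Σ[ 1 to n ] (λ k → T k n)

lambert1 : PS
lambert1 = ΣLambert (λ k → (ℤ→ℚ (legendre k 7) * ℚ[ k ℕ.* k ]) ·ₛ (X^ k *ₛ inv (oneS -ₛ X^ k)))

lambert2 : PS
lambert2 = ΣLambert (λ k → ℤ→ℚ (legendre k 7) ·ₛ ((X^ k +ₛ X^ (2 ℕ.* k)) *ₛ inv ((oneS -ₛ X^ k) ^ₛ 3)))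

rhs1 : PS
rhs1 = inv (qPoch 1 ^ₛ 7) *ₛ ((oneS -ₛ ((+ 7 / 8) ·ₛ lambert1)) +ₛ ((+ 343 / 8) ·ₛ lambert2))

rhs2 : PS
rhs2 = inv (qPoch 7)
     +ₛ ((ℚ[ 49 ] ·ₛ (X^ 1 *ₛ ((qPoch 7 ^ₛ 3) *ₛ inv (qPoch 1 ^ₛ 4))))
     +ₛ (ℚ[ 343 ] ·ₛ (X^ 2 *ₛ ((qPoch 7 ^ₛ 7) *ₛ inv (qPoch 1 ^ₛ 8)))))

rhs3 : (ℕ → ℕ) → PS
rhs3 p = inv (qPoch 7) +ₛ ΣpTerm
  where
  ΣpTerm : PS
  ΣpTerm zero = 0ℚ
  ΣpTerm (suc j) = ℚ[ 7 ] * ℚ[ p (7 ℕ.* suc j ∸ 2) ]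

{-# OPTIONS --safe #-}
module Submission where

-- The four members are series in q; E₁ = (q;q)_∞ and E₇ = (q⁷;q⁷)_∞.
--
-- Lambert series. Modulo 7, E₁ = A(q⁷) + q B(q⁷) - q² E(q⁷) + q⁵ D(q⁷) with E(q⁷) = (q⁴⁹;q⁴⁹)_∞, and the
-- missing exponents of Jacobi's series for E₁³ give polynomial relations between A, B, D and E, modulo
-- which the identities between sections are polynomial identities. The series with the cubic poles is a
-- combination of third logarithmic derivatives of theta functions; a rearrangement of fourfold theta series
-- (Weierstrass) evaluates each of them, and the quintuple product identity expresses the result through A,
-- B, D and E. The series with the coefficients k² agrees with it up to the factor (n/7) in the coefficients
-- with 7 ∤ n and is fixed by n ↦ 7n, so its value follows from the 7-dissection of the expected one.
--
-- Partitions. The section 5 of 1/E₁ is the section 5 of the cofactor of E₁ in its norm; the norm is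
-- determined by its logarithmic derivative.
--
-- Frobenius partitions. The constant term in z of the triple product to the seventh power gives
-- E₁⁷ CΦ₇ = Σ q^(Σ s(s-1)/2) over s ∈ ℤ⁷ with Σ s = 0. Twisting by seventh roots of unity, where
-- ∏ (1 + ζⁱ y) = 1 + y⁷, evaluates the same sum with the weight 1 - 7 [Σ i sᵢ ≡ 6 mod 7] as E₁⁷/E₇. The
-- class 6 is isometric to the 7-cores of size 5 mod 7, whose generating series is a section of E₇⁷/E₁.

open import Defs hiding (X^)
open import Algebra.Bundles using (CommutativeRing)
open import Data.Bool using (Bool; true; false; T; if_then_else_)
open import Data.Bool.ListAction using (any)
open import Data.Empty using (⊥-elim)
open import Data.Fin as Fin using (Fin)
open import Data.Integer as Z using (ℤ; +_; -[1+_]; +[1+_])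
open import Data.List as List using (List; []; _∷_; _++_; filter; cartesianProduct; downFrom; length; replicate)
open import Data.List.Membership.Propositional using (_∈_; _∉_)
open import Data.List.Relation.Unary.All as All using (All; []; _∷_)
open import Data.List.Relation.Unary.AllPairs as AllPairs using ([]; _∷_; AllPairs)
open import Data.List.Relation.Unary.Any using (here; there)
open import Data.List.Relation.Unary.Linked as Linked using (Linked)
open import Data.List.Relation.Unary.Unique.Propositional using (Unique)
open import Data.Nat as N using (ℕ; zero; suc; _∸_; _≤_; _<_; z≤n; s≤s)
open import Data.Nat.Induction using (<-rec)
open import Data.Nat.ListAction using (sum)
open import Data.Nat.Primality using (Prime; prime?; euclidsLemma)
open import Data.Nat.Tactic.RingSolver using () renaming (solve-∀ to ℕ-solve-∀)
open import Data.Product using (Σ; _×_; _,_; proj₁; proj₂)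
open import Data.Rational as ℚ using (ℚ; 0ℚ; 1ℚ)
open import Data.Sum using (_⊎_; inj₁; inj₂; [_,_]′)
open import Data.Unit using (⊤; tt)
open import Data.Vec as Vec using (Vec; []; _∷_)
open import Data.Vec.N-ary using (N-ary; _$ⁿ_)
open import Function using (_∘_)
open import Function.Bundles using (_↔_; Inverse)
open import Level using (0ℓ)
open import Relation.Binary.Definitions using (DecidableEquality)
open import Relation.Binary.PropositionalEquality as ≡ using (_≡_; refl; cong; cong₂; subst; sym; trans; _≢_)
open import Relation.Nullary using (¬_; Dec; yes; no; contradiction; does)
open import Relation.Nullary.Decidable using (¬?; toSum; from-yes; isYes≗does; ⌊_⌋; _⊎-dec_; _×-dec_)
import Algebra.Properties.Group
import Algebra.Properties.Ring
import Algebra.Properties.Semiring.Exp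
import Data.Fin.Properties as Finₚ
import Data.Integer.DivMod as ℤDivMod
import Data.Integer.Properties as Zₚ
import Data.List.Membership.DecPropositional as DecMembership
import Data.List.Membership.Propositional.Properties as ∈ₚ
import Data.List.Properties as Listₚ
import Data.List.Relation.Unary.All.Properties as Allₚ
import Data.List.Relation.Unary.AllPairs.Properties as AllPairsₚ
import Data.List.Relation.Unary.Linked.Properties as Linkedₚ
import Data.List.Relation.Unary.Unique.Propositional.Properties as Uniqueₚ
import Data.Nat.DivMod as DivMod
import Data.Nat.Divisibility as ℕ∣
import Data.Nat.Properties as Nₚ
import Data.Product.Properties as ×ₚ
import Data.Rational.Properties as ℚₚ
import Data.Rational.Unnormalised as ℚᵘ
import Data.Rational.Unnormalised.Properties as ℚᵘₚ
import Data.Vec.Properties as Vecₚ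
import Relation.Binary.Reasoning.Setoid

-- Normalisation of polynomial expressions

-- The members are modular of level 7, but no space of modular forms is available to compare
-- finitely many coefficients in, so each identity has to be reduced to something finite by hand.
-- Polynomials in A, B, D, E modulo their four relations take over the role of such a space: a claim
-- about sections becomes a membership in an ideal, and the long lists of coefficients are the
-- multipliers of that membership, which normalisation checks. A variable z and a seventh root of
-- unity ζ are never adjoined to ℚ. A Laurent series in them is a power series in q over a group
-- ring of ℤ² and is observed only through pairings with functions on ℤ². The weight s ↦ sᵏ on the
-- exponent of z gives the k-th derivative at z = 1, a weight supported at 0 gives the constant
-- term, and restricting the test functions to those killed by 1 + ζ + ⋯ + ζ⁶ makes ζ a primitive
-- root of unity. The class 6 in the twist could be any nonzero class as far as the product is
-- concerned; it is the class in which the vectors matching the cores lie.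

module IntegerImage (R : CommutativeRing 0ℓ 0ℓ) where
  open CommutativeRing R renaming (refl to ≈-refl; sym to ≈-sym; trans to ≈-trans)
  open Algebra.Properties.Ring ring using (-‿involutive; -‿+-comm; -0#≈0#; -‿distribˡ-*; -‿distribʳ-*)
  open Relation.Binary.Reasoning.Setoid setoid

  fromℕ : ℕ → Carrier
  fromℕ zero = 0#
  fromℕ (suc n) = 1# + fromℕ n

  fromℤ : ℤ → Carrier
  fromℤ (+ n) = fromℕ n
  fromℤ -[1+ n ] = - fromℕ (suc n)

  fromℕ-+ : ∀ m n → fromℕ (m N.+ n) ≈ fromℕ m + fromℕ n
  fromℕ-+ zero n = ≈-sym (+-identityˡ _)
  fromℕ-+ (suc m) n = ≈-trans (+-congˡ (fromℕ-+ m n)) (≈-sym (+-assoc _ _ _))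

  fromℕ-* : ∀ m n → fromℕ (m N.* n) ≈ fromℕ m * fromℕ n
  fromℕ-* zero n = ≈-sym (zeroˡ _)
  fromℕ-* (suc m) n = begin
    fromℕ (n N.+ m N.* n)            ≈⟨ fromℕ-+ n (m N.* n) ⟩
    fromℕ n + fromℕ (m N.* n)        ≈⟨ +-cong (≈-sym (*-identityˡ _)) (fromℕ-* m n) ⟩
    1# * fromℕ n + fromℕ m * fromℕ n ≈⟨ distribʳ _ _ _ ⟨
    (1# + fromℕ m) * fromℕ n         ∎

  fromℤ-⊖ : ∀ m n → fromℤ (m Z.⊖ n) ≈ fromℕ m + - fromℕ n
  fromℤ-⊖ zero zero = ≈-sym (-‿inverseʳ _)
  fromℤ-⊖ zero (suc n) = ≈-sym (+-identityˡ _)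
  fromℤ-⊖ (suc m) zero = ≈-trans (≈-sym (+-identityʳ _)) (+-congˡ (≈-sym -0#≈0#))
  fromℤ-⊖ (suc m) (suc n) = begin
    fromℤ (suc m Z.⊖ suc n)                    ≈⟨ reflexive (cong fromℤ (Zₚ.[1+m]⊖[1+n]≡m⊖n m n)) ⟩
    fromℤ (m Z.⊖ n)                            ≈⟨ fromℤ-⊖ m n ⟩
    fromℕ m + - fromℕ n                        ≈⟨ +-congʳ (+-identityʳ _) ⟨
    (fromℕ m + 0#) + - fromℕ n                 ≈⟨ +-congʳ (+-congˡ (-‿inverseʳ 1#)) ⟨
    (fromℕ m + (1# + - 1#)) + - fromℕ n        ≈⟨ +-congʳ (+-assoc _ _ _) ⟨
    ((fromℕ m + 1#) + - 1#) + - fromℕ n        ≈⟨ +-assoc _ _ _ ⟩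
    (fromℕ m + 1#) + (- 1# + - fromℕ n)        ≈⟨ +-cong (+-comm _ _) (-‿+-comm _ _) ⟩
    (1# + fromℕ m) + - (1# + fromℕ n)          ∎

  fromℤ-+ : ∀ x y → fromℤ (x Z.+ y) ≈ fromℤ x + fromℤ y
  fromℤ-+ (+ m) (+ n) = fromℕ-+ m n
  fromℤ-+ (+ m) -[1+ n ] = fromℤ-⊖ m (suc n)
  fromℤ-+ -[1+ m ] (+ n) = ≈-trans (fromℤ-⊖ n (suc m)) (+-comm _ _)
  fromℤ-+ -[1+ m ] -[1+ n ] = begin
    - fromℕ (suc (suc (m N.+ n)))        ≈⟨ -‿cong (reflexive (cong (λ k → fromℕ (suc k)) (sym (Nₚ.+-suc m n)))) ⟩
    - fromℕ (suc m N.+ suc n)            ≈⟨ -‿cong (fromℕ-+ (suc m) (suc n)) ⟩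
    - (fromℕ (suc m) + fromℕ (suc n))    ≈⟨ -‿+-comm _ _ ⟨
    - fromℕ (suc m) + - fromℕ (suc n)    ∎

  fromℤ-neg : ∀ x → fromℤ (Z.- x) ≈ - fromℤ x
  fromℤ-neg (+ zero) = ≈-sym -0#≈0#
  fromℤ-neg +[1+ n ] = ≈-refl
  fromℤ-neg -[1+ n ] = ≈-sym (-‿involutive _)

  fromℤ-*1 : ∀ m y → fromℤ (+ m Z.* y) ≈ fromℕ m * fromℤ y
  fromℤ-*1 m (+ n) = ≈-trans (reflexive (cong fromℤ (sym (Zₚ.pos-* m n)))) (fromℕ-* m n)
  fromℤ-*1 m -[1+ n ] = begin
    fromℤ (+ m Z.* (Z.- (+ suc n)))   ≈⟨ reflexive (cong fromℤ (sym (Zₚ.neg-distribʳ-* (+ m) (+ suc n)))) ⟩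
    fromℤ (Z.- (+ m Z.* + suc n))     ≈⟨ fromℤ-neg (+ m Z.* + suc n) ⟩
    - fromℤ (+ m Z.* + suc n)         ≈⟨ -‿cong (fromℤ-*1 m (+ suc n)) ⟩
    - (fromℕ m * fromℕ (suc n))       ≈⟨ -‿distribʳ-* _ _ ⟩
    fromℕ m * - fromℕ (suc n)         ∎

  fromℤ-* : ∀ x y → fromℤ (x Z.* y) ≈ fromℤ x * fromℤ y
  fromℤ-* (+ m) y = fromℤ-*1 m y
  fromℤ-* -[1+ m ] y = begin
    fromℤ ((Z.- (+ suc m)) Z.* y)     ≈⟨ reflexive (cong fromℤ (sym (Zₚ.neg-distribˡ-* (+ suc m) y))) ⟩
    fromℤ (Z.- (+ suc m Z.* y))       ≈⟨ fromℤ-neg (+ suc m Z.* y) ⟩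
    - fromℤ (+ suc m Z.* y)           ≈⟨ -‿cong (fromℤ-*1 (suc m) y) ⟩
    - (fromℕ (suc m) * fromℤ y)       ≈⟨ -‿distribˡ-* _ _ ⟩
    - fromℕ (suc m) * fromℤ y         ∎

  fromℤ-1 : fromℤ (+ 1) ≈ 1#
  fromℤ-1 = +-identityʳ 1#

-- `:1` is kept apart from `con (+ 1)` because the latter evaluates to `1# + 0#`, while goals
-- contain `1#` itself.
data Expr (n : ℕ) : Set where
  var : Fin n → Expr n
  con : ℤ → Expr n
  :1 : Expr n
  _:+_ _:*_ _:-_ : Expr n → Expr n → Expr n
  :-_ : Expr n → Expr n
  _:^_ : Expr n → ℕ → Expr n

infixl 6 _:+_ _:-_
infixl 7 _:*_
infix 8 :-_
infixr 9 _:^_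

-- Sparse polynomials: exponent vectors with their coefficients.
Poly : ℕ → Set
Poly n = List (Vec ℕ n × ℤ)

sameExponents : ∀ {n} → Vec ℕ n → Vec ℕ n → Bool
sameExponents [] [] = true
sameExponents (x ∷ xs) (y ∷ ys) = if x N.≡ᵇ y then sameExponents xs ys else false

insertTerm : ∀ {n} → Vec ℕ n × ℤ → Poly n → Poly n
insertTerm t [] = t ∷ []
insertTerm (m , c) ((m′ , c′) ∷ p) =
  if sameExponents m m′ then (m′ , c Z.+ c′) ∷ p else (m′ , c′) ∷ insertTerm (m , c) p

addPoly : ∀ {n} → Poly n → Poly n → Poly n
addPoly [] q = q
addPoly (t ∷ p) q = addPoly p (insertTerm t q)

negPoly : ∀ {n} → Poly n → Poly n
negPoly [] = []
negPoly ((m , c) ∷ p) = (m , Z.- c) ∷ negPoly p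

mulTerm : ∀ {n} → Vec ℕ n × ℤ → Poly n → Poly n → Poly n
mulTerm t [] r = r
mulTerm (m , c) ((m′ , c′) ∷ q) r =
  mulTerm (m , c) q (insertTerm (Vec.zipWith N._+_ m m′ , c Z.* c′) r)

mulPoly : ∀ {n} → Poly n → Poly n → Poly n
mulPoly [] q = []
mulPoly (t ∷ p) q = mulTerm t q (mulPoly p q)

unitVec : ∀ {n} → Fin n → Vec ℕ n
unitVec Fin.zero = 1 ∷ Vec.replicate _ 0
unitVec (Fin.suc i) = 0 ∷ unitVec i

toPoly : ∀ {n} → Expr n → Poly n
powPoly : ∀ {n} → Poly n → ℕ → Poly n

toPoly (var i) = (unitVec i , + 1) ∷ []
toPoly (con (+ zero)) = []
toPoly (con +[1+ n ]) = (Vec.replicate _ 0 , +[1+ n ]) ∷ []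
toPoly (con -[1+ n ]) = (Vec.replicate _ 0 , -[1+ n ]) ∷ []
toPoly :1 = (Vec.replicate _ 0 , + 1) ∷ []
toPoly (e :+ f) = addPoly (toPoly e) (toPoly f)
toPoly (e :* f) = mulPoly (toPoly e) (toPoly f)
toPoly (e :- f) = addPoly (toPoly e) (negPoly (toPoly f))
toPoly (:- e) = negPoly (toPoly e)
toPoly (e :^ k) = powPoly (toPoly e) k

powPoly p zero = (Vec.replicate _ 0 , + 1) ∷ []
powPoly p (suc k) = mulPoly p (powPoly p k)

-- Cancelled terms stay in the list with coefficient 0, so the zero polynomial is recognised by its
-- coefficients and not by emptiness.
vanishes : ∀ {n} → Poly n → Bool
vanishes [] = true
vanishes ((m , + 0) ∷ p) = vanishes p
vanishes (_ ∷ p) = false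

nat : ∀ {n} → ℕ → Expr n
nat n = con (+ n)

infixr 5 _∙_
_∙_ : {A : Set} {x y z : A} → x ≡ y → y ≡ z → x ≡ z
_∙_ = trans

variables : ∀ {n} → Vec (Expr n) n
variables = Vec.tabulate var

linearCombination : ∀ {n} → List (Expr n × Expr n) → Expr n
linearCombination [] = nat 0
linearCombination ((c , r) ∷ cs) = c :* r :+ linearCombination cs

module RingSolver (R : CommutativeRing 0ℓ 0ℓ) where
  open CommutativeRing R renaming (refl to ≈-refl; sym to ≈-sym; trans to ≈-trans)
  open Algebra.Properties.Ring ring using (-‿involutive; -‿+-comm; -0#≈0#; -‿distribˡ-*; -‿distribʳ-*; x≈y⇒x∙y⁻¹≈ε; x∙y⁻¹≈ε⇒x≈y)
  open Algebra.Properties.Semiring.Exp semiring using (_^_; ^-homo-*; ^-congˡ) public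
  open Relation.Binary.Reasoning.Setoid setoid
  open IntegerImage R public

  ⟦_⟧ : ∀ {n} → Expr n → Vec Carrier n → Carrier
  ⟦ var i ⟧ ρ = Vec.lookup ρ i
  ⟦ con z ⟧ ρ = fromℤ z
  ⟦ :1 ⟧ ρ = 1#
  ⟦ e :+ f ⟧ ρ = ⟦ e ⟧ ρ + ⟦ f ⟧ ρ
  ⟦ e :* f ⟧ ρ = ⟦ e ⟧ ρ * ⟦ f ⟧ ρ
  ⟦ e :- f ⟧ ρ = ⟦ e ⟧ ρ - ⟦ f ⟧ ρ
  ⟦ :- e ⟧ ρ = - ⟦ e ⟧ ρ
  ⟦ e :^ k ⟧ ρ = ⟦ e ⟧ ρ ^ k

  ⟦_⟧ₘ : ∀ {n} → Vec ℕ n → Vec Carrier n → Carrier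
  ⟦ [] ⟧ₘ [] = 1#
  ⟦ e ∷ m ⟧ₘ (x ∷ ρ) = x ^ e * ⟦ m ⟧ₘ ρ

  ⟦_⟧ₚ : ∀ {n} → Poly n → Vec Carrier n → Carrier
  ⟦ [] ⟧ₚ ρ = 0#
  ⟦ (m , c) ∷ p ⟧ₚ ρ = fromℤ c * ⟦ m ⟧ₘ ρ + ⟦ p ⟧ₚ ρ

  private
    interchange : ∀ a b c d → (a * b) * (c * d) ≈ (a * c) * (b * d)
    interchange a b c d = begin
      (a * b) * (c * d) ≈⟨ *-assoc a b _ ⟩
      a * (b * (c * d)) ≈⟨ *-congˡ (*-assoc b c d) ⟨
      a * ((b * c) * d) ≈⟨ *-congˡ (*-congʳ (*-comm b c)) ⟩
      a * ((c * b) * d) ≈⟨ *-congˡ (*-assoc c b d) ⟩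
      a * (c * (b * d)) ≈⟨ *-assoc a c _ ⟨
      (a * c) * (b * d) ∎

    swap-+ : ∀ a b c → a + (b + c) ≈ b + (a + c)
    swap-+ a b c = begin
      a + (b + c) ≈⟨ +-assoc a b c ⟨
      (a + b) + c ≈⟨ +-congʳ (+-comm a b) ⟩
      (b + a) + c ≈⟨ +-assoc b a c ⟩
      b + (a + c) ∎

  sameExponents-sound : ∀ {n} (m m′ : Vec ℕ n) ρ → T (sameExponents m m′) → ⟦ m ⟧ₘ ρ ≈ ⟦ m′ ⟧ₘ ρ
  sameExponents-sound [] [] [] _ = ≈-refl
  sameExponents-sound (x ∷ m) (y ∷ m′) (r ∷ ρ) t with x N.≡ᵇ y in eq
  ... | true rewrite Nₚ.≡ᵇ⇒≡ x y (subst T (sym eq) tt) = *-congˡ (sameExponents-sound m m′ ρ t)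

  insertTerm-sound : ∀ {n} m c (p : Poly n) ρ → ⟦ insertTerm (m , c) p ⟧ₚ ρ ≈ fromℤ c * ⟦ m ⟧ₘ ρ + ⟦ p ⟧ₚ ρ
  insertTerm-sound m c [] ρ = ≈-refl
  insertTerm-sound m c ((m′ , c′) ∷ p) ρ with sameExponents m m′ in eq
  ... | false = ≈-trans (+-congˡ (insertTerm-sound m c p ρ)) (swap-+ _ _ _)
  ... | true = begin
    fromℤ (c Z.+ c′) * ⟦ m′ ⟧ₘ ρ + ⟦ p ⟧ₚ ρ                  ≈⟨ +-congʳ (*-congʳ (fromℤ-+ c c′)) ⟩
    (fromℤ c + fromℤ c′) * ⟦ m′ ⟧ₘ ρ + ⟦ p ⟧ₚ ρ              ≈⟨ +-congʳ (distribʳ _ _ _) ⟩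
    (fromℤ c * ⟦ m′ ⟧ₘ ρ + fromℤ c′ * ⟦ m′ ⟧ₘ ρ) + ⟦ p ⟧ₚ ρ  ≈⟨ +-assoc _ _ _ ⟩
    fromℤ c * ⟦ m′ ⟧ₘ ρ + (fromℤ c′ * ⟦ m′ ⟧ₘ ρ + ⟦ p ⟧ₚ ρ)  ≈⟨ +-congʳ (*-congˡ (sameExponents-sound m m′ ρ (subst T (sym eq) tt))) ⟨
    fromℤ c * ⟦ m ⟧ₘ ρ + (fromℤ c′ * ⟦ m′ ⟧ₘ ρ + ⟦ p ⟧ₚ ρ)   ∎

  addPoly-sound : ∀ {n} (p q : Poly n) ρ → ⟦ addPoly p q ⟧ₚ ρ ≈ ⟦ p ⟧ₚ ρ + ⟦ q ⟧ₚ ρ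
  addPoly-sound [] q ρ = ≈-sym (+-identityˡ _)
  addPoly-sound ((m , c) ∷ p) q ρ = begin
    ⟦ addPoly p (insertTerm (m , c) q) ⟧ₚ ρ               ≈⟨ addPoly-sound p _ ρ ⟩
    ⟦ p ⟧ₚ ρ + ⟦ insertTerm (m , c) q ⟧ₚ ρ                ≈⟨ +-congˡ (insertTerm-sound m c q ρ) ⟩
    ⟦ p ⟧ₚ ρ + (fromℤ c * ⟦ m ⟧ₘ ρ + ⟦ q ⟧ₚ ρ)            ≈⟨ swap-+ _ _ _ ⟩
    fromℤ c * ⟦ m ⟧ₘ ρ + (⟦ p ⟧ₚ ρ + ⟦ q ⟧ₚ ρ)            ≈⟨ +-assoc _ _ _ ⟨
    (fromℤ c * ⟦ m ⟧ₘ ρ + ⟦ p ⟧ₚ ρ) + ⟦ q ⟧ₚ ρ            ∎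

  negPoly-sound : ∀ {n} (p : Poly n) ρ → ⟦ negPoly p ⟧ₚ ρ ≈ - ⟦ p ⟧ₚ ρ
  negPoly-sound [] ρ = ≈-sym -0#≈0#
  negPoly-sound ((m , c) ∷ p) ρ = begin
    fromℤ (Z.- c) * ⟦ m ⟧ₘ ρ + ⟦ negPoly p ⟧ₚ ρ ≈⟨ +-cong (*-congʳ (fromℤ-neg c)) (negPoly-sound p ρ) ⟩
    - fromℤ c * ⟦ m ⟧ₘ ρ + - ⟦ p ⟧ₚ ρ           ≈⟨ +-congʳ (-‿distribˡ-* _ _) ⟨
    - (fromℤ c * ⟦ m ⟧ₘ ρ) + - ⟦ p ⟧ₚ ρ         ≈⟨ -‿+-comm _ _ ⟩
    - (fromℤ c * ⟦ m ⟧ₘ ρ + ⟦ p ⟧ₚ ρ)           ∎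

  monomial-* : ∀ {n} (m m′ : Vec ℕ n) ρ → ⟦ Vec.zipWith N._+_ m m′ ⟧ₘ ρ ≈ ⟦ m ⟧ₘ ρ * ⟦ m′ ⟧ₘ ρ
  monomial-* [] [] [] = ≈-sym (*-identityˡ _)
  monomial-* (x ∷ m) (y ∷ m′) (r ∷ ρ) =
    ≈-trans (*-cong (^-homo-* r x y) (monomial-* m m′ ρ)) (interchange _ _ _ _)

  mulTerm-sound : ∀ {n} m c (q r : Poly n) ρ →
                  ⟦ mulTerm (m , c) q r ⟧ₚ ρ ≈ (fromℤ c * ⟦ m ⟧ₘ ρ) * ⟦ q ⟧ₚ ρ + ⟦ r ⟧ₚ ρ
  mulTerm-sound m c [] r ρ = ≈-sym (≈-trans (+-congʳ (zeroʳ _)) (+-identityˡ _))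
  mulTerm-sound m c ((m′ , c′) ∷ q) r ρ = begin
    ⟦ mulTerm (m , c) q (insertTerm (mm , c Z.* c′) r) ⟧ₚ ρ      ≈⟨ mulTerm-sound m c q _ ρ ⟩
    t * ⟦ q ⟧ₚ ρ + ⟦ insertTerm (mm , c Z.* c′) r ⟧ₚ ρ           ≈⟨ +-congˡ (insertTerm-sound mm (c Z.* c′) r ρ) ⟩
    t * ⟦ q ⟧ₚ ρ + (fromℤ (c Z.* c′) * ⟦ mm ⟧ₘ ρ + ⟦ r ⟧ₚ ρ)     ≈⟨ +-congˡ (+-congʳ (*-cong (fromℤ-* c c′) (monomial-* m m′ ρ))) ⟩
    t * ⟦ q ⟧ₚ ρ + ((fromℤ c * fromℤ c′) * (⟦ m ⟧ₘ ρ * ⟦ m′ ⟧ₘ ρ) + ⟦ r ⟧ₚ ρ) ≈⟨ +-congˡ (+-congʳ (interchange _ _ _ _)) ⟩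
    t * ⟦ q ⟧ₚ ρ + (t * (fromℤ c′ * ⟦ m′ ⟧ₘ ρ) + ⟦ r ⟧ₚ ρ)       ≈⟨ swap-+ _ _ _ ⟩
    t * (fromℤ c′ * ⟦ m′ ⟧ₘ ρ) + (t * ⟦ q ⟧ₚ ρ + ⟦ r ⟧ₚ ρ)       ≈⟨ +-assoc _ _ _ ⟨
    (t * (fromℤ c′ * ⟦ m′ ⟧ₘ ρ) + t * ⟦ q ⟧ₚ ρ) + ⟦ r ⟧ₚ ρ       ≈⟨ +-congʳ (distribˡ _ _ _) ⟨
    t * (fromℤ c′ * ⟦ m′ ⟧ₘ ρ + ⟦ q ⟧ₚ ρ) + ⟦ r ⟧ₚ ρ             ∎
    where mm = Vec.zipWith N._+_ m m′
          t = fromℤ c * ⟦ m ⟧ₘ ρ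

  mulPoly-sound : ∀ {n} (p q : Poly n) ρ → ⟦ mulPoly p q ⟧ₚ ρ ≈ ⟦ p ⟧ₚ ρ * ⟦ q ⟧ₚ ρ
  mulPoly-sound [] q ρ = ≈-sym (zeroˡ _)
  mulPoly-sound ((m , c) ∷ p) q ρ = begin
    ⟦ mulTerm (m , c) q (mulPoly p q) ⟧ₚ ρ                       ≈⟨ mulTerm-sound m c q _ ρ ⟩
    (fromℤ c * ⟦ m ⟧ₘ ρ) * ⟦ q ⟧ₚ ρ + ⟦ mulPoly p q ⟧ₚ ρ         ≈⟨ +-congˡ (mulPoly-sound p q ρ) ⟩
    (fromℤ c * ⟦ m ⟧ₘ ρ) * ⟦ q ⟧ₚ ρ + ⟦ p ⟧ₚ ρ * ⟦ q ⟧ₚ ρ        ≈⟨ distribʳ _ _ _ ⟨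
    (fromℤ c * ⟦ m ⟧ₘ ρ + ⟦ p ⟧ₚ ρ) * ⟦ q ⟧ₚ ρ                   ∎

  monomial-1 : ∀ {n} (ρ : Vec Carrier n) → ⟦ Vec.replicate _ 0 ⟧ₘ ρ ≈ 1#
  monomial-1 [] = ≈-refl
  monomial-1 (x ∷ ρ) = ≈-trans (*-identityˡ _) (monomial-1 ρ)

  unitVec-sound : ∀ {n} (i : Fin n) ρ → ⟦ unitVec i ⟧ₘ ρ ≈ Vec.lookup ρ i
  unitVec-sound Fin.zero (x ∷ ρ) =
    ≈-trans (*-cong (*-identityʳ x) (monomial-1 ρ)) (*-identityʳ x)
  unitVec-sound (Fin.suc i) (x ∷ ρ) = ≈-trans (*-identityˡ _) (unitVec-sound i ρ)

  constant-sound : ∀ {n} c (ρ : Vec Carrier n) → ⟦ (Vec.replicate _ 0 , c) ∷ [] ⟧ₚ ρ ≈ fromℤ c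
  constant-sound c ρ = ≈-trans (+-identityʳ _) (≈-trans (*-congˡ (monomial-1 ρ)) (*-identityʳ _))

  toPoly-sound : ∀ {n} (e : Expr n) ρ → ⟦ toPoly e ⟧ₚ ρ ≈ ⟦ e ⟧ ρ
  powPoly-sound : ∀ {n} (p : Poly n) k ρ → ⟦ powPoly p k ⟧ₚ ρ ≈ ⟦ p ⟧ₚ ρ ^ k

  toPoly-sound (var i) ρ =
    ≈-trans (+-identityʳ _) (≈-trans (*-cong fromℤ-1 (unitVec-sound i ρ)) (*-identityˡ _))
  toPoly-sound (con (+ zero)) ρ = ≈-refl
  toPoly-sound (con +[1+ n ]) ρ = constant-sound +[1+ n ] ρ
  toPoly-sound (con -[1+ n ]) ρ = constant-sound -[1+ n ] ρ
  toPoly-sound :1 ρ = ≈-trans (constant-sound (+ 1) ρ) fromℤ-1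
  toPoly-sound (e :+ f) ρ = ≈-trans (addPoly-sound (toPoly e) _ ρ) (+-cong (toPoly-sound e ρ) (toPoly-sound f ρ))
  toPoly-sound (e :* f) ρ = ≈-trans (mulPoly-sound (toPoly e) _ ρ) (*-cong (toPoly-sound e ρ) (toPoly-sound f ρ))
  toPoly-sound (e :- f) ρ = ≈-trans (addPoly-sound (toPoly e) _ ρ)
    (+-cong (toPoly-sound e ρ) (≈-trans (negPoly-sound (toPoly f) ρ) (-‿cong (toPoly-sound f ρ))))
  toPoly-sound (:- e) ρ = ≈-trans (negPoly-sound (toPoly e) ρ) (-‿cong (toPoly-sound e ρ))
  toPoly-sound (e :^ k) ρ = ≈-trans (powPoly-sound (toPoly e) k ρ) (^-congˡ k (toPoly-sound e ρ))

  powPoly-sound p zero ρ = ≈-trans (constant-sound (+ 1) ρ) fromℤ-1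
  powPoly-sound p (suc k) ρ = ≈-trans (mulPoly-sound p _ ρ) (*-congˡ (powPoly-sound p k ρ))

  vanishes-sound : ∀ {n} (p : Poly n) ρ → T (vanishes p) → ⟦ p ⟧ₚ ρ ≈ 0#
  vanishes-sound [] ρ _ = ≈-refl
  vanishes-sound ((m , + zero) ∷ p) ρ t =
    ≈-trans (+-cong (zeroˡ _) (vanishes-sound p ρ t)) (+-identityˡ _)

  -- The hidden argument reduces to the unit type once the difference of the two sides normalises to
  -- zero coefficients, so the computation takes place during type checking.
  prove : ∀ {n} (e f : Expr n) → {_ : T (vanishes (toPoly (e :- f)))} → (ρ : Vec Carrier n) → ⟦ e ⟧ ρ ≈ ⟦ f ⟧ ρ
  prove e f {t} ρ = x∙y⁻¹≈ε⇒x≈y _ _ (≈-trans (≈-sym (toPoly-sound (e :- f) ρ)) (vanishes-sound (toPoly (e :- f)) ρ t))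

  solve : ∀ n (f : N-ary n (Expr n) (Expr n × Expr n)) →
          {_ : T (vanishes (toPoly (proj₁ (f $ⁿ variables) :- proj₂ (f $ⁿ variables))))} →
          (ρ : Vec Carrier n) → ⟦ proj₁ (f $ⁿ variables) ⟧ ρ ≈ ⟦ proj₂ (f $ⁿ variables) ⟧ ρ
  solve n f {t} ρ = prove (proj₁ (f $ⁿ variables)) (proj₂ (f $ⁿ variables)) {t} ρ

  -- The list pairs multipliers with generators and is a certificate that e - f lies in the ideal of
  -- the generators; the vanishing of the generators at ρ is the only information about ρ that
  -- enters.
  proveModulo : ∀ {n} (e f : Expr n) (cs : List (Expr n × Expr n)) → {_ : T (vanishes (toPoly (e :- (f :+ linearCombination cs))))} →
                (ρ : Vec Carrier n) → All (λ cr → ⟦ proj₂ cr ⟧ ρ ≈ 0#) cs → ⟦ e ⟧ ρ ≈ ⟦ f ⟧ ρ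
  proveModulo e f cs {t} ρ zs = ≈-trans (prove e (f :+ linearCombination cs) {t} ρ) (≈-trans (+-congˡ (zero-combination cs zs)) (+-identityʳ _))
    where
    zero-combination : ∀ cs → All (λ cr → ⟦ proj₂ cr ⟧ ρ ≈ 0#) cs → ⟦ linearCombination cs ⟧ ρ ≈ 0#
    zero-combination [] [] = ≈-refl
    zero-combination (cr ∷ cs) (z ∷ zs) = ≈-trans (+-cong (≈-trans (*-congˡ z) (zeroʳ _)) (zero-combination cs zs)) (+-identityˡ _)

-- Formal power series

module FiniteSums (K : CommutativeRing 0ℓ 0ℓ) where
  open CommutativeRing K renaming (refl to ≈-refl; sym to ≈-sym; trans to ≈-trans)
  open RingSolver K
  open Relation.Binary.Reasoning.Setoid setoid

  sum< : ℕ → (ℕ → Carrier) → Carrier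
  sum< zero f = 0#
  sum< (suc n) f = sum< n f + f n

  sum<-cong : ∀ n {f g} → (∀ i → i < n → f i ≈ g i) → sum< n f ≈ sum< n g
  sum<-cong zero h = ≈-refl
  sum<-cong (suc n) h = +-cong (sum<-cong n (λ i i<n → h i (Nₚ.m<n⇒m<1+n i<n))) (h n Nₚ.≤-refl)

  sum<-zero : ∀ n {f} → (∀ i → i < n → f i ≈ 0#) → sum< n f ≈ 0#
  sum<-zero zero h = ≈-refl
  sum<-zero (suc n) h = ≈-trans (+-cong (sum<-zero n (λ i i<n → h i (Nₚ.m<n⇒m<1+n i<n))) (h n Nₚ.≤-refl)) (+-identityˡ _)

  sum<-+ : ∀ n f g → sum< n (λ i → f i + g i) ≈ sum< n f + sum< n g
  sum<-+ zero f g = ≈-sym (+-identityˡ _)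
  sum<-+ (suc n) f g = ≈-trans (+-congʳ (sum<-+ n f g))
    (solve 4 (λ a b c d → (a :+ b) :+ (c :+ d) , (a :+ c) :+ (b :+ d)) (_ ∷ _ ∷ _ ∷ _ ∷ []))

  sum<-*ˡ : ∀ n c f → sum< n (λ i → c * f i) ≈ c * sum< n f
  sum<-*ˡ zero c f = ≈-sym (zeroʳ c)
  sum<-*ˡ (suc n) c f = ≈-trans (+-congʳ (sum<-*ˡ n c f)) (≈-sym (distribˡ _ _ _))

  sum<-front : ∀ n f → sum< (suc n) f ≈ f 0 + sum< n (λ i → f (suc i))
  sum<-front zero f = +-comm _ _
  sum<-front (suc n) f = ≈-trans (+-congʳ (sum<-front n f)) (+-assoc _ _ _)

  sum<-append : ∀ m n f → sum< (m N.+ n) f ≈ sum< m f + sum< n (λ i → f (m N.+ i))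
  sum<-append m zero f rewrite Nₚ.+-identityʳ m = ≈-sym (+-identityʳ _)
  sum<-append m (suc n) f rewrite Nₚ.+-suc m n = ≈-trans (+-congʳ (sum<-append m n f)) (+-assoc _ _ _)

  conv : (ℕ → Carrier) → (ℕ → Carrier) → ℕ → Carrier
  conv f g n = sum< (suc n) (λ i → f i * g (n ∸ i))

  tail : (ℕ → Carrier) → ℕ → Carrier
  tail f n = f (suc n)

  conv-front : ∀ f g n → conv f g (suc n) ≈ f 0 * g (suc n) + conv (tail f) g n
  conv-front f g n = sum<-front (suc n) (λ i → f i * g (suc n ∸ i))

  conv-back : ∀ f g n → conv f g (suc n) ≈ conv f (tail g) n + f (suc n) * g 0
  conv-back f g n = +-cong
    (sum<-cong (suc n) (λ i i≤n → *-congˡ (reflexive (cong g (Nₚ.+-∸-assoc 1 (Nₚ.≤-pred i≤n))))))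
    (*-congˡ (reflexive (cong g (Nₚ.n∸n≡0 n))))

  conv-cong< : ∀ n {f f′ g g′} → (∀ i → i ≤ n → f i ≈ f′ i) → (∀ i → i ≤ n → g i ≈ g′ i) →
               conv f g n ≈ conv f′ g′ n
  conv-cong< n p q = sum<-cong (suc n) (λ i i≤n → *-cong (p i (Nₚ.≤-pred i≤n)) (q (n ∸ i) (Nₚ.m∸n≤m n i)))

  conv-cong : ∀ n {f f′ g g′} → (∀ i → f i ≈ f′ i) → (∀ i → g i ≈ g′ i) → conv f g n ≈ conv f′ g′ n
  conv-cong n p q = conv-cong< n (λ i _ → p i) (λ i _ → q i)

  conv-comm : ∀ n f g → conv f g n ≈ conv g f n
  conv-comm zero f g = +-congˡ (*-comm _ _)
  conv-comm (suc n) f g = begin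
    conv f g (suc n)                      ≈⟨ conv-front f g n ⟩
    f 0 * g (suc n) + conv (tail f) g n   ≈⟨ +-cong (*-comm _ _) (conv-comm n (tail f) g) ⟩
    g (suc n) * f 0 + conv g (tail f) n   ≈⟨ +-comm _ _ ⟩
    conv g (tail f) n + g (suc n) * f 0   ≈⟨ conv-back g f n ⟨
    conv g f (suc n)                      ∎

  conv-+ˡ : ∀ n f g h → conv (λ i → f i + g i) h n ≈ conv f h n + conv g h n
  conv-+ˡ n f g h = ≈-trans (sum<-cong (suc n) (λ i _ → distribʳ _ _ _)) (sum<-+ (suc n) _ _)

  conv-*ˡ : ∀ n c f g → conv (λ i → c * f i) g n ≈ c * conv f g n
  conv-*ˡ n c f g = ≈-trans (sum<-cong (suc n) (λ i _ → *-assoc _ _ _)) (sum<-*ˡ (suc n) c _)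

  conv-assoc : ∀ n f g h → conv (conv f g) h n ≈ conv f (conv g h) n
  conv-assoc zero f g h =
    solve 3 (λ a b c → nat 0 :+ (nat 0 :+ a :* b) :* c , nat 0 :+ a :* (nat 0 :+ b :* c)) (f 0 ∷ g 0 ∷ h 0 ∷ [])
  conv-assoc (suc n) f g h = begin
    conv (conv f g) h (suc n)
      ≈⟨ conv-front (conv f g) h n ⟩
    conv f g 0 * h (suc n) + conv (tail (conv f g)) h n
      ≈⟨ +-congˡ (conv-cong n {g = h} (λ i → conv-front f g i) (λ _ → ≈-refl)) ⟩
    conv f g 0 * h (suc n) + conv (λ i → f 0 * tail g i + conv (tail f) g i) h n
      ≈⟨ +-congˡ (conv-+ˡ n _ _ h) ⟩
    conv f g 0 * h (suc n) + (conv (λ i → f 0 * tail g i) h n + conv (conv (tail f) g) h n)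
      ≈⟨ +-congˡ (+-cong (conv-*ˡ n (f 0) (tail g) h) (conv-assoc n (tail f) g h)) ⟩
    conv f g 0 * h (suc n) + (f 0 * conv (tail g) h n + conv (tail f) (conv g h) n)
      ≈⟨ solve 5 (λ a b c d e → (nat 0 :+ a :* b) :* c :+ (a :* d :+ e) , a :* (b :* c :+ d) :+ e)
           (f 0 ∷ g 0 ∷ h (suc n) ∷ conv (tail g) h n ∷ conv (tail f) (conv g h) n ∷ []) ⟩
    f 0 * (g 0 * h (suc n) + conv (tail g) h n) + conv (tail f) (conv g h) n
      ≈⟨ +-congʳ (*-congˡ (conv-front g h n)) ⟨
    f 0 * conv g h (suc n) + conv (tail f) (conv g h) n
      ≈⟨ conv-front f (conv g h) n ⟨
    conv f (conv g h) (suc n) ∎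

  unit : ℕ → ℕ → Carrier
  unit zero zero = 1#
  unit zero (suc n) = 0#
  unit (suc m) zero = 0#
  unit (suc m) (suc n) = unit m n

  conv-zeroˡ : ∀ n g → conv (λ _ → 0#) g n ≈ 0#
  conv-zeroˡ n g = sum<-zero (suc n) (λ i _ → zeroˡ _)

  conv-identityˡ : ∀ n g → conv (unit 0) g n ≈ g n
  conv-identityˡ zero g = ≈-trans (+-identityˡ _) (*-identityˡ _)
  conv-identityˡ (suc n) g = ≈-trans (conv-front (unit 0) g n)
    (≈-trans (+-cong (*-identityˡ _) (conv-zeroˡ n g)) (+-identityʳ _))

  conv-unit : ∀ m n g → conv (unit m) g (m N.+ n) ≈ g n
  conv-unit zero n g = conv-identityˡ n g
  conv-unit (suc m) n g = ≈-trans (conv-front (unit (suc m)) g (m N.+ n))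
    (≈-trans (+-cong (zeroˡ _) (conv-unit m n g)) (+-identityˡ _))

  conv-unit-< : ∀ m n g → n < m → conv (unit m) g n ≈ 0#
  conv-unit-< (suc m) zero g _ = ≈-trans (+-identityˡ _) (zeroˡ _)
  conv-unit-< (suc m) (suc n) g (s≤s n<m) = ≈-trans (conv-front (unit (suc m)) g n)
    (≈-trans (+-cong (zeroˡ _) (conv-unit-< m n g n<m)) (+-identityˡ _))

  unit-shift : ∀ m n k → unit (m N.+ n) (m N.+ k) ≡ unit n k
  unit-shift zero n k = refl
  unit-shift (suc m) n k = unit-shift m n k

  unit-< : ∀ m n → n < m → unit m n ≡ 0#
  unit-< (suc m) zero _ = refl
  unit-< (suc m) (suc n) (s≤s p) = unit-< m n p

module PowerSeries (K : CommutativeRing 0ℓ 0ℓ) where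
  private module K = CommutativeRing K
  open FiniteSums K public using (conv; tail; unit)
  private
    module F = FiniteSums K
    module KR = Algebra.Properties.Ring K.ring

  -- Without eta, and with `_≋_` a record as well, the operations stay folded, so that unification
  -- can infer the series from an equation between them.
  record Ser : Set where
    no-eta-equality
    constructor ser
    field at : ℕ → K.Carrier
  open Ser public

  infix 4 _≋_ _≈[_]_
  record _≋_ (f g : Ser) : Set where
    constructor coeffs
    field coeff : ∀ n → at f n K.≈ at g n
  open _≋_ public

  infixl 6 _⊕_
  infixl 7 _⊛_
  _⊕_ _⊛_ : Ser → Ser → Ser
  (f ⊕ g) .at n = at f n K.+ at g n
  (f ⊛ g) .at n = conv (at f) (at g) n

  ⊖_ : Ser → Ser
  (⊖ f) .at n = K.- at f n

  zeroSer : Ser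
  zeroSer .at n = K.0#

  X^ : ℕ → Ser
  X^ m .at = unit m

  seriesRing : CommutativeRing 0ℓ 0ℓ
  seriesRing = record
    { Carrier = Ser ; _≈_ = _≋_ ; _+_ = _⊕_ ; _*_ = _⊛_ ; -_ = ⊖_ ; 0# = zeroSer ; 1# = X^ 0
    ; isCommutativeRing = record
      { isRing = record
        { +-isAbelianGroup = record
          { isGroup = record
            { isMonoid = record
              { isSemigroup = record
                { isMagma = record
                  { isEquivalence = record
                    { refl = coeffs λ n → K.refl
                    ; sym = λ p → coeffs λ n → K.sym (coeff p n)
                    ; trans = λ p q → coeffs λ n → K.trans (coeff p n) (coeff q n) }
                  ; ∙-cong = λ p q → coeffs λ n → K.+-cong (coeff p n) (coeff q n) }
                ; assoc = λ f g h → coeffs λ n → K.+-assoc _ _ _ }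
              ; identity = (λ f → coeffs λ n → K.+-identityˡ _) , (λ f → coeffs λ n → K.+-identityʳ _) }
            ; inverse = (λ f → coeffs λ n → K.-‿inverseˡ _) , (λ f → coeffs λ n → K.-‿inverseʳ _)
            ; ⁻¹-cong = λ p → coeffs λ n → K.-‿cong (coeff p n) }
          ; comm = λ f g → coeffs λ n → K.+-comm _ _ }
        ; *-cong = λ p q → coeffs λ n → F.conv-cong n (coeff p) (coeff q)
        ; *-assoc = λ f g h → coeffs λ n → F.conv-assoc n (at f) (at g) (at h)
        ; *-identity = (λ f → coeffs λ n → F.conv-identityˡ n (at f))
                     , (λ f → coeffs λ n → K.trans (F.conv-comm n (at f) _) (F.conv-identityˡ n (at f)))
        ; distrib = (λ f g h → coeffs λ n → K.trans (F.conv-comm n (at f) _)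
                       (K.trans (F.conv-+ˡ n (at g) (at h) (at f))
                         (K.+-cong (F.conv-comm n (at g) (at f)) (F.conv-comm n (at h) (at f)))))
                  , (λ f g h → coeffs λ n → F.conv-+ˡ n (at g) (at h) (at f)) }
      ; *-comm = λ f g → coeffs λ n → F.conv-comm n (at f) (at g) } }

  open CommutativeRing seriesRing public
    using (_-_; setoid)
    renaming (_+_ to _+_; _*_ to _*_; -_ to -_; 0# to 0#; 1# to 1#;
              refl to ≋-refl; sym to ≋-sym; trans to infixr 5 _⟫_; reflexive to ≋-reflexive;
              +-cong to +-cong; +-congˡ to +-congˡ; +-congʳ to +-congʳ;
              *-cong to *-cong; *-congˡ to *-congˡ; *-congʳ to *-congʳ; -‿cong to -‿cong;
              +-comm to +-comm; +-assoc to +-assoc; *-comm to *-comm; *-assoc to *-assoc;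
              +-identityˡ to +-identityˡ; +-identityʳ to +-identityʳ; *-identityˡ to *-identityˡ;
              *-identityʳ to *-identityʳ; zeroˡ to zeroˡ; zeroʳ to zeroʳ; distribˡ to distribˡ;
              distribʳ to distribʳ; -‿inverseˡ to -‿inverseˡ; -‿inverseʳ to -‿inverseʳ)
  open RingSolver seriesRing public using (solve; _^_; ^-homo-*; ^-congˡ; fromℕ; fromℤ; fromℤ-+; fromℤ-*; fromℤ-neg; fromℤ-1)

  at-X^* : ∀ m n f → at (X^ m * f) (m N.+ n) K.≈ at f n
  at-X^* m n f = F.conv-unit m n (at f)

  at-X^*-< : ∀ m n f → n < m → at (X^ m * f) n K.≈ K.0#
  at-X^*-< m n f = F.conv-unit-< m n (at f)

  X^-+ : ∀ m n → X^ m * X^ n ≋ X^ (m N.+ n)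
  X^-+ m n = coeffs go
    where
    go : ∀ k → at (X^ m * X^ n) k K.≈ unit (m N.+ n) k
    go k with k Nₚ.<? m
    ... | yes k<m = K.trans (at-X^*-< m k (X^ n) k<m)
                      (K.sym (K.reflexive (F.unit-< (m N.+ n) k (Nₚ.≤-trans k<m (Nₚ.m≤m+n m n)))))
    ... | no k≮m with Nₚ.m≤n⇒∃[o]m+o≡n (Nₚ.≮⇒≥ k≮m)
    ... | o , refl = K.trans (at-X^* m o (X^ n)) (K.reflexive (sym (F.unit-shift m n o)))

  X^-* : ∀ m k → X^ m ^ k ≋ X^ (k N.* m)
  X^-* m zero = ≋-refl
  X^-* m (suc k) = *-congˡ (X^-* m k) ⟫ X^-+ m (k N.* m)

  constant : K.Carrier → Ser
  constant c .at zero = c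
  constant c .at (suc n) = K.0#

  at-constant* : ∀ c f n → at (constant c * f) n K.≈ c K.* at f n
  at-constant* c f zero = K.+-identityˡ _
  at-constant* c f (suc n) = K.trans (F.conv-front (at (constant c)) (at f) n)
    (K.trans (K.+-congˡ (F.conv-zeroˡ n (at f))) (K.+-identityʳ _))

  -- Congruence modulo q^N. It takes the place of a topology on series: every limit is a family of
  -- such congruences.
  record _≈[_]_ (f : Ser) (N : ℕ) (g : Ser) : Set where
    constructor below
    field upto : ∀ n → n < N → at f n K.≈ at g n
  open _≈[_]_ public

  ≈[]-refl : ∀ {N f} → f ≈[ N ] f
  ≈[]-refl = below λ _ _ → K.refl

  ≈[]-sym : ∀ {N f g} → f ≈[ N ] g → g ≈[ N ] f
  ≈[]-sym p = below λ n l → K.sym (upto p n l)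

  ≈[]-trans : ∀ {N f g h} → f ≈[ N ] g → g ≈[ N ] h → f ≈[ N ] h
  ≈[]-trans p q = below λ n l → K.trans (upto p n l) (upto q n l)

  ≋⇒≈[] : ∀ {N f g} → f ≋ g → f ≈[ N ] g
  ≋⇒≈[] p = below λ n _ → coeff p n

  ≈[]⇒≋ : ∀ {f g} → (∀ N → f ≈[ N ] g) → f ≋ g
  ≈[]⇒≋ p = coeffs λ n → upto (p (suc n)) n Nₚ.≤-refl

  ≈[]-mono : ∀ {M N f g} → M ≤ N → f ≈[ N ] g → f ≈[ M ] g
  ≈[]-mono M≤N p = below λ n n<M → upto p n (Nₚ.≤-trans n<M M≤N)

  ≈[]-+ : ∀ {N f f′ g g′} → f ≈[ N ] f′ → g ≈[ N ] g′ → f + g ≈[ N ] f′ + g′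
  ≈[]-+ p q = below λ n l → K.+-cong (upto p n l) (upto q n l)

  ≈[]-* : ∀ {N f f′ g g′} → f ≈[ N ] f′ → g ≈[ N ] g′ → f * g ≈[ N ] f′ * g′
  ≈[]-* p q = below λ n l → F.conv-cong< n (λ i i≤n → upto p i (Nₚ.≤-<-trans i≤n l)) (λ i i≤n → upto q i (Nₚ.≤-<-trans i≤n l))

  ≈[]-neg : ∀ {N f f′} → f ≈[ N ] f′ → - f ≈[ N ] - f′
  ≈[]-neg p = below λ n l → K.-‿cong (upto p n l)

  ≈[]-^ : ∀ {N f f′} k → f ≈[ N ] f′ → f ^ k ≈[ N ] f′ ^ k
  ≈[]-^ zero p = ≈[]-refl
  ≈[]-^ (suc k) p = ≈[]-* p (≈[]-^ k p)

  Vanishes : ℕ → Ser → Set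
  Vanishes N f = f ≈[ N ] 0#

  X^-vanishes : ∀ m → Vanishes m (X^ m)
  X^-vanishes m = below λ n l → K.reflexive (F.unit-< m n l)

  Vanishes-*ˡ : ∀ {N f} g → Vanishes N f → Vanishes N (g * f)
  Vanishes-*ˡ g p = ≈[]-trans (≈[]-* ≈[]-refl p) (≋⇒≈[] (zeroʳ g))

  Vanishes-*ʳ : ∀ {N f} g → Vanishes N f → Vanishes N (f * g)
  Vanishes-*ʳ g p = ≈[]-trans (≈[]-* p ≈[]-refl) (≋⇒≈[] (zeroˡ g))

  Vanishes-* : ∀ {M N f g} → Vanishes M f → Vanishes N g → Vanishes (M N.+ N) (f * g)
  Vanishes-* {M} {N} {f} {g} p q = below λ n n<M+N → F.sum<-zero (suc n) (λ i i≤n → go n i (Nₚ.≤-pred i≤n) n<M+N)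
    where
    go : ∀ n i → i ≤ n → n < M N.+ N → at f i K.* at g (n ∸ i) K.≈ K.0#
    go n i i≤n n<M+N with i Nₚ.<? M
    ... | yes i<M = K.trans (K.*-congʳ (upto p i i<M)) (K.zeroˡ _)
    ... | no i≮M = K.trans (K.*-congˡ (upto q (n ∸ i) (Nₚ.+-cancelˡ-< i _ _
            (subst (_< i N.+ N) (sym (Nₚ.m+[n∸m]≡n i≤n))
              (Nₚ.≤-trans n<M+N (Nₚ.+-monoˡ-≤ N (Nₚ.≮⇒≥ i≮M))))))) (K.zeroʳ _)

  difference-vanishes : ∀ {N f g} → f ≈[ N ] g → Vanishes N (f - g)
  difference-vanishes {g = g} p = ≈[]-trans (≈[]-+ p ≈[]-refl) (≋⇒≈[] (-‿inverseʳ g))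

  vanishing-difference : ∀ {N f g} → Vanishes N (f - g) → f ≈[ N ] g
  vanishing-difference {f = f} {g} p = ≈[]-trans
    (≋⇒≈[] (solve 2 (λ a b → a , (a :- b) :+ b) (f ∷ g ∷ [])))
    (≈[]-trans (≈[]-+ p ≈[]-refl) (≋⇒≈[] (+-identityˡ g)))

  record Monic (f : Ser) : Set where
    constructor monic
    field leading : at f 0 K.≈ K.1#
  open Monic public

  Monic-* : ∀ {f g} → Monic f → Monic g → Monic (f * g)
  Monic-* p q = monic (K.trans (K.+-identityˡ _) (K.trans (K.*-cong (leading p) (leading q)) (K.*-identityˡ _)))

  Monic-^ : ∀ {f} k → Monic f → Monic (f ^ k)
  Monic-^ zero p = monic K.refl
  Monic-^ (suc k) p = Monic-* p (Monic-^ k p)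

  -- Once g vanishes below k, the coefficient of q^k in f g is the product of f's constant term 1
  -- with the k-th coefficient of g; induction on k.
  Monic-vanishes : ∀ {N f g} → Monic f → Vanishes N (f * g) → Vanishes N g
  Monic-vanishes {N} {f} {g} (monic f0) p = go N Nₚ.≤-refl
    where
    go : ∀ k → k ≤ N → Vanishes k g
    step : ∀ k → k < N → Vanishes k g → at g k K.≈ K.0#
    go zero _ = below λ _ ()
    go (suc k) k<N = below λ n n≤k → [ upto (go k (Nₚ.<⇒≤ k<N)) n
                                     , (λ { refl → step n k<N (go k (Nₚ.<⇒≤ k<N)) }) ]′ (Nₚ.m≤n⇒m<n∨m≡n (Nₚ.≤-pred n≤k))
    lead : ∀ k → Vanishes k g → at (f * g) k K.≈ at f 0 K.* at g k
    lead zero _ = K.+-identityˡ _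
    lead (suc k) v = K.trans (F.conv-front (at f) (at g) k) (K.trans
      (K.+-congˡ (F.sum<-zero (suc k) (λ i _ → K.trans (K.*-congˡ (upto v (k ∸ i) (s≤s (Nₚ.m∸n≤m k i)))) (K.zeroʳ _))))
      (K.+-identityʳ _))
    step k k<N v = K.trans (K.sym (K.*-identityˡ _)) (K.trans (K.*-congʳ (K.sym f0))
      (K.trans (K.sym (lead k v)) (upto p k k<N)))

  Monic-cancel[] : ∀ {N f g h} → Monic f → f * g ≈[ N ] f * h → g ≈[ N ] h
  Monic-cancel[] {f = f} {g} {h} f0 p = vanishing-difference (Monic-vanishes f0
    (≈[]-trans (≋⇒≈[] (solve 3 (λ a b c → a :* (b :- c) , a :* b :- a :* c) (f ∷ g ∷ h ∷ []))) (difference-vanishes p)))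

  Monic-cancel : ∀ {f g h} → Monic f → f * g ≋ f * h → g ≋ h
  Monic-cancel f0 p = ≈[]⇒≋ λ N → Monic-cancel[] f0 (≋⇒≈[] p)

  -- The modulus of convergence is fixed as the identity: the M-th member is correct modulo q^M.
  -- Products, powers and sparser subsequences then converge without any bookkeeping of rates.
  Tends : (ℕ → Ser) → Ser → Set
  Tends u s = ∀ N M → N ≤ M → u M ≈[ N ] s

  Tends-unique : ∀ {u s t} → Tends u s → Tends u t → s ≋ t
  Tends-unique p q = ≈[]⇒≋ λ N → ≈[]-trans (≈[]-sym (p N N Nₚ.≤-refl)) (q N N Nₚ.≤-refl)

  Tends-cong : ∀ {u v s} → (∀ n → u n ≋ v n) → Tends u s → Tends v s
  Tends-cong h p N M l = ≈[]-trans (≈[]-sym (≋⇒≈[] (h M))) (p N M l)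

  Tends-* : ∀ {u v s t} → Tends u s → Tends v t → Tends (λ n → u n * v n) (s * t)
  Tends-* p q N M l = ≈[]-* (p N M l) (q N M l)

  Tends-^ : ∀ {u s} k → Tends u s → Tends (λ n → u n ^ k) (s ^ k)
  Tends-^ k p N M l = ≈[]-^ k (p N M l)

  Tends-sub : ∀ {u s} (φ : ℕ → ℕ) → (∀ n → n ≤ φ n) → Tends u s → Tends (λ n → u (φ n)) s
  Tends-sub φ h p N M l = p N (φ M) (Nₚ.≤-trans l (h M))

-- Formal sums over infinite index sets

module Summation (K : CommutativeRing 0ℓ 0ℓ) where
  private module K = CommutativeRing K
  open PowerSeries K

  ∑ : {I : Set} → (I → Ser) → List I → Ser
  ∑ f [] = 0#
  ∑ f (i ∷ L) = f i + ∑ f L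

  module _ {I : Set} where
    ∑-cong[] : ∀ {N} {f g : I → Ser} L → (∀ i → i ∈ L → f i ≈[ N ] g i) → ∑ f L ≈[ N ] ∑ g L
    ∑-cong[] [] h = ≈[]-refl
    ∑-cong[] (i ∷ L) h = ≈[]-+ (h i (here refl)) (∑-cong[] L (λ j j∈ → h j (there j∈)))

    ∑-cong : ∀ {f g : I → Ser} L → (∀ i → f i ≋ g i) → ∑ f L ≋ ∑ g L
    ∑-cong L h = ≈[]⇒≋ λ N → ∑-cong[] L (λ i _ → ≋⇒≈[] (h i))

    ∑-vanishes : ∀ {N} {f : I → Ser} L → (∀ i → i ∈ L → Vanishes N (f i)) → Vanishes N (∑ f L)
    ∑-vanishes [] h = ≈[]-refl
    ∑-vanishes (i ∷ L) h = ≈[]-trans (≈[]-+ (h i (here refl)) (∑-vanishes L (λ j j∈ → h j (there j∈)))) (≋⇒≈[] (+-identityˡ 0#))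

    ∑-+ : ∀ (f g : I → Ser) L → ∑ (λ i → f i + g i) L ≋ ∑ f L + ∑ g L
    ∑-+ f g [] = ≋-sym (+-identityˡ 0#)
    ∑-+ f g (i ∷ L) = +-congˡ (∑-+ f g L)
      ⟫ solve 4 (λ a b c d → (a :+ b) :+ (c :+ d) , (a :+ c) :+ (b :+ d)) (f i ∷ g i ∷ ∑ f L ∷ ∑ g L ∷ [])

    ∑-*ˡ : ∀ c (f : I → Ser) L → ∑ (λ i → c * f i) L ≋ c * ∑ f L
    ∑-*ˡ c f [] = ≋-sym (zeroʳ c)
    ∑-*ˡ c f (i ∷ L) = +-congˡ (∑-*ˡ c f L) ⟫ ≋-sym (distribˡ c (f i) (∑ f L))

    ∑-++ : ∀ (f : I → Ser) L M → ∑ f (L ++ M) ≋ ∑ f L + ∑ f M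
    ∑-++ f [] M = ≋-sym (+-identityˡ _)
    ∑-++ f (i ∷ L) M = +-congˡ (∑-++ f L M) ⟫ ≋-sym (+-assoc (f i) (∑ f L) (∑ f M))

  ∑-map : ∀ {I J : Set} (f : J → Ser) (e : I → J) L → ∑ f (List.map e L) ≋ ∑ (f ∘ e) L
  ∑-map f e [] = ≋-refl
  ∑-map f e (i ∷ L) = +-congˡ (∑-map f e L)

  ∑-product : ∀ {I J : Set} (f : I → Ser) (g : J → Ser) L M →
              ∑ (λ ij → f (proj₁ ij) * g (proj₂ ij)) (cartesianProduct L M) ≋ ∑ f L * ∑ g M
  ∑-product f g [] M = ≋-sym (zeroˡ _)
  ∑-product f g (i ∷ L) M = ∑-++ h (List.map (i ,_) M) _ ⟫ +-cong (∑-map h (i ,_) M ⟫ ∑-*ˡ (f i) g M) (∑-product f g L M)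
    ⟫ ≋-sym (distribʳ (∑ g M) (f i) (∑ f L))
    where h = λ ij → f (proj₁ ij) * g (proj₂ ij)

  module _ {I : Set} (_≟_ : DecidableEquality I) where
    open DecMembership _≟_ using (_∈?_)

    others : I → List I → List I
    others i = filter (λ j → ¬? (i ≟ j))

    ∑-others : ∀ (f : I → Ser) i M → Unique M → i ∈ M → ∑ f M ≋ f i + ∑ f (others i M)
    ∑-others f i (j ∷ M) (j≢ ∷ u) i∈ with i ≟ j
    ... | yes refl rewrite Listₚ.filter-all (λ j → ¬? (i ≟ j)) j≢ = ≋-refl
    ∑-others f i (j ∷ M) (j≢ ∷ u) (here refl) | no i≢j = contradiction refl i≢j
    ∑-others f i (j ∷ M) (j≢ ∷ u) (there i∈) | no i≢j =
      +-congˡ (∑-others f i M u i∈)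
        ⟫ solve 3 (λ a b c → a :+ (b :+ c) , b :+ (a :+ c)) (f j ∷ f i ∷ ∑ f (others i M) ∷ [])

    -- Induction on `L`: an index shared with `M` is taken out of `M` by `others`, and an index on
    -- one side only contributes nothing modulo q^N.
    ∑-covers : ∀ {N} {f : I → Ser} L M → Unique L → Unique M →
               (∀ i → i ∈ L → i ∉ M → Vanishes N (f i)) → (∀ i → i ∈ M → i ∉ L → Vanishes N (f i)) →
               ∑ f L ≈[ N ] ∑ f M
    ∑-covers [] M _ _ _ h = ≈[]-sym (∑-vanishes M (λ i i∈ → h i i∈ (λ ())))
    ∑-covers {f = f} (i ∷ L) M (i≢ ∷ uL) uM hL hM with i ∈? M
    ... | no i∉M = ≈[]-trans
      (≈[]-+ (hL i (here refl) i∉M)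
        (∑-covers L M uL uM (λ j j∈ → hL j (there j∈))
          (λ j j∈M j∉L → hM j j∈M (λ { (here refl) → i∉M j∈M ; (there j∈) → j∉L j∈ }))))
      (≋⇒≈[] (+-identityˡ _))
    ... | yes i∈M = ≈[]-trans
      (≈[]-+ ≈[]-refl (∑-covers L (others i M) uL (Uniqueₚ.filter⁺ _ uM)
        (λ j j∈L j∉ → hL j (there j∈L) (λ j∈M → j∉ (∈ₚ.∈-filter⁺ _ j∈M (λ { refl → All.lookup i≢ j∈L refl }))))
        (λ j j∈ j∉L → let j∈M , i≢j = ∈ₚ.∈-filter⁻ _ {xs = M} j∈ in
          hM j j∈M (λ { (here refl) → i≢j refl ; (there j∈L) → j∉L j∈L }))))
      (≈[]-sym (≋⇒≈[] (∑-others f i M uM i∈M)))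

  -- The finite set of indices that matter depends on the precision: outside `support N` every term
  -- is divisible by q^N. Uniqueness keeps a term from being counted twice.
  record Summable {I : Set} (f : I → Ser) : Set where
    field
      support : ℕ → List I
      unique : ∀ N → Unique (support N)
      outside : ∀ N i → i ∉ support N → Vanishes N (f i)

  record HasSum {I : Set} (f : I → Ser) (s : Ser) : Set where
    field
      summable : Summable f
      sums : ∀ N → ∑ f (Summable.support summable N) ≈[ N ] s
    open Summable summable public

  total : {I : Set} {f : I → Ser} → Summable f → Ser
  total {f = f} S .at n = at (∑ f (Summable.support S (suc n))) n

  module _ {I : Set} (_≟_ : DecidableEquality I) where
    HasSum-total : {f : I → Ser} (S : Summable f) → HasSum f (total S)
    HasSum-total {f} S = record { summable = S ; sums = λ N → below λ n n<N →
        upto (∑-covers _≟_ {suc n} {f} (support N) (support (suc n)) (unique N) (unique (suc n))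
          (λ i _ → outside (suc n) i) (λ i _ i∉ → ≈[]-mono n<N (outside N i i∉))) n Nₚ.≤-refl }
      where open Summable S

    HasSum-unique : {f : I → Ser} {s t : Ser} → HasSum f s → HasSum f t → s ≋ t
    HasSum-unique {f} p q = ≈[]⇒≋ λ N → ≈[]-trans (≈[]-sym (P.sums N)) (≈[]-trans
      (∑-covers _≟_ {N} {f} (P.support N) (Q.support N) (P.unique N) (Q.unique N) (λ i _ → Q.outside N i) (λ i _ → P.outside N i))
      (Q.sums N))
      where module P = HasSum p
            module Q = HasSum q

    HasSum-approx : {f : I → Ser} {s : Ser} → HasSum f s → ∀ N L → Unique L →
                    (∀ i → i ∉ L → Vanishes N (f i)) → ∑ f L ≈[ N ] s
    HasSum-approx {f} p N L u o = ≈[]-trans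
      (∑-covers _≟_ {N} {f} L (support N) u (unique N) (λ i _ → outside N i) (λ i _ → o i)) (sums N)
      where open HasSum p

    HasSum-+ : {f g : I → Ser} {s t : Ser} → HasSum f s → HasSum g t → HasSum (λ i → f i + g i) (s + t)
    HasSum-+ {f} {g} {s} {t} p q = record
      { summable = record
        { support = both
        ; unique = both-unique
        ; outside = λ N i i∉ → ≈[]-trans (≈[]-+ (P.outside N i (i∉ ∘ inP N i)) (Q.outside N i (i∉ ∘ inQ N i))) (≋⇒≈[] (+-identityˡ 0#)) }
      ; sums = λ N → ≈[]-trans (≋⇒≈[] (∑-+ f g (both N))) (≈[]-+
          (HasSum-approx p N (both N) (both-unique N) (λ i i∉ → P.outside N i (i∉ ∘ inP N i)))
          (HasSum-approx q N (both N) (both-unique N) (λ i i∉ → Q.outside N i (i∉ ∘ inQ N i)))) }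
      where
      module P = HasSum p
      module Q = HasSum q
      open DecMembership _≟_ using (_∈?_)
      new : ℕ → List I
      new N = filter (λ i → ¬? (i ∈? P.support N)) (Q.support N)
      both : ℕ → List I
      both N = P.support N ++ new N
      both-unique : ∀ N → Unique (both N)
      both-unique N = Uniqueₚ.++⁺ (P.unique N) (Uniqueₚ.filter⁺ _ (Q.unique N))
        (λ { (i∈P , i∈new) → proj₂ (∈ₚ.∈-filter⁻ (λ i → ¬? (i ∈? P.support N)) {xs = Q.support N} i∈new) i∈P })
      inP : ∀ N i → i ∈ P.support N → i ∈ both N
      inP N i = ∈ₚ.∈-++⁺ˡ
      inQ : ∀ N i → i ∈ Q.support N → i ∈ both N
      inQ N i i∈ with i ∈? P.support N
      ... | yes i∈P = ∈ₚ.∈-++⁺ˡ i∈P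
      ... | no i∉P = ∈ₚ.∈-++⁺ʳ (P.support N) (∈ₚ.∈-filter⁺ _ i∈ i∉P)

  HasSum-cong : {I : Set} {f g : I → Ser} {s t : Ser} → (∀ i → f i ≋ g i) → s ≋ t → HasSum f s → HasSum g t
  HasSum-cong h e p = record
    { summable = record { support = support ; unique = unique
      ; outside = λ N i i∉ → ≈[]-trans (≈[]-sym (≋⇒≈[] (h i))) (outside N i i∉) }
    ; sums = λ N → ≈[]-trans (≈[]-sym (≋⇒≈[] (∑-cong (support N) h))) (≈[]-trans (sums N) (≋⇒≈[] e)) }
    where open HasSum p

  Summable-*ˡ : {I : Set} {f : I → Ser} (c : I → Ser) → Summable f → Summable (λ i → c i * f i)
  Summable-*ˡ c S = record { support = support ; unique = unique ; outside = λ N i i∉ → Vanishes-*ˡ (c i) (outside N i i∉) }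
    where open Summable S

  HasSum-*ˡ : {I : Set} {f : I → Ser} {s : Ser} (c : Ser) → HasSum f s → HasSum (λ i → c * f i) (c * s)
  HasSum-*ˡ {f = f} c p = record
    { summable = Summable-*ˡ (λ _ → c) summable
    ; sums = λ N → ≈[]-trans (≋⇒≈[] (∑-*ˡ c f (support N))) (≈[]-* ≈[]-refl (sums N)) }
    where open HasSum p

  HasSum-0 : {I : Set} {f : I → Ser} → (∀ i → f i ≋ 0#) → HasSum f 0#
  HasSum-0 h = record
    { summable = record { support = λ _ → [] ; unique = λ _ → [] ; outside = λ N i _ → ≋⇒≈[] (h i) }
    ; sums = λ N → ≈[]-refl }

  HasSum-1 : {I : Set} {f : I → Ser} (_≟_ : DecidableEquality I) (k : I) → (∀ i → i ≢ k → f i ≋ 0#) → HasSum f (f k)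
  HasSum-1 _≟_ k h = record
    { summable = record { support = λ _ → k ∷ [] ; unique = λ _ → [] ∷ []
                        ; outside = λ N i i∉ → ≋⇒≈[] (h i (λ { refl → i∉ (here refl) })) }
    ; sums = λ N → ≋⇒≈[] (+-identityʳ _) }

  -- A partial bijection between the index sets outside of which both families vanish.
  record Reindexing {I J : Set} (f : I → Ser) (g : J → Ser) : Set1 where
    field
      to : I → J
      Relevant : I → Set
      relevant? : ∀ i → Dec (Relevant i)
      irrelevant : ∀ i → ¬ Relevant i → f i ≋ 0#
      agree : ∀ i → Relevant i → f i ≋ g (to i)
      injective : ∀ i i′ → Relevant i → Relevant i′ → to i ≡ to i′ → i ≡ i′
      onto : ∀ j → g j ≋ 0# ⊎ Σ I (λ i → Relevant i × to i ≡ j)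

  module _ {I J : Set} {f : I → Ser} {g : J → Ser} (R : Reindexing f g) where
    open Reindexing R

    private
      image : List I → List J
      image [] = []
      image (i ∷ L) with relevant? i
      ... | yes _ = to i ∷ image L
      ... | no _ = image L

      image⁺ : ∀ {i} L → i ∈ L → Relevant i → to i ∈ image L
      image⁺ (i ∷ L) (here refl) r with relevant? i
      ... | yes _ = here refl
      ... | no ¬r = contradiction r ¬r
      image⁺ (k ∷ L) (there i∈) r with relevant? k
      ... | yes _ = there (image⁺ L i∈ r)
      ... | no _ = image⁺ L i∈ r

      image⁻ : ∀ {j} L → j ∈ image L → Σ I (λ i → i ∈ L × Relevant i × to i ≡ j)
      image⁻ (k ∷ L) j∈ with relevant? k
      image⁻ (k ∷ L) (here refl) | yes r = k , here refl , r , refl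
      image⁻ (k ∷ L) (there j∈) | yes r = let i , i∈ , p = image⁻ L j∈ in i , there i∈ , p
      image⁻ (k ∷ L) j∈ | no _ = let i , i∈ , p = image⁻ L j∈ in i , there i∈ , p

      image-unique : ∀ L → Unique L → Unique (image L)
      image-unique [] _ = []
      image-unique (k ∷ L) (k≢ ∷ u) with relevant? k
      ... | no _ = image-unique L u
      ... | yes r = All.tabulate (λ {j} j∈ e → let i , i∈ , ri , ei = image⁻ L j∈ in
                      All.lookup k≢ i∈ (injective k i r ri (e ∙ sym ei))) ∷ image-unique L u

      image-sum : ∀ L → ∑ f L ≋ ∑ g (image L)
      image-sum [] = ≋-refl
      image-sum (i ∷ L) with relevant? i
      ... | yes r = +-cong (agree i r) (image-sum L)
      ... | no ¬r = +-cong (irrelevant i ¬r) (image-sum L) ⟫ +-identityˡ _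

    reindex : ∀ {s} → HasSum f s → HasSum g s
    reindex p = record
      { summable = record
        { support = λ N → image (support N)
        ; unique = λ N → image-unique (support N) (unique N)
        ; outside = λ N j j∉ → [ (λ z → ≋⇒≈[] z)
            , (λ { (i , r , refl) → ≈[]-trans (≈[]-sym (≋⇒≈[] (agree i r)))
                   (outside N i (λ i∈ → j∉ (image⁺ (support N) i∈ r))) }) ]′ (onto j) }
      ; sums = λ N → ≈[]-trans (≈[]-sym (≋⇒≈[] (image-sum (support N)))) (sums N) }
      where open HasSum p

  bijection : {I J : Set} {f : I → Ser} {g : J → Ser} (to : I → J) (from : J → I) →
              (∀ i → from (to i) ≡ i) → (∀ j → to (from j) ≡ j) → (∀ i → f i ≋ g (to i)) → Reindexing f g
  bijection to from l r h = record
    { to = to ; Relevant = λ _ → ⊤ ; relevant? = λ _ → yes tt ; irrelevant = λ _ n → ⊥-elim (n tt)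
    ; agree = λ i _ → h i
    ; injective = λ i i′ _ _ e → sym (l i) ∙ cong from e ∙ l i′
    ; onto = λ j → inj₂ (from j , tt , r j) }

  HasSum-× : {I J : Set} (_≟_ : DecidableEquality I) {f : I → Ser} {g : J → Ser} {s t : Ser} → HasSum f s → HasSum g t →
             HasSum (λ ij → f (proj₁ ij) * g (proj₂ ij)) (s * t)
  HasSum-× _≟_ {f} {g} p q = record
    { summable = record
      { support = λ N → cartesianProduct (P.support N) (Q.support N)
      ; unique = λ N → Uniqueₚ.cartesianProduct⁺ (P.unique N) (Q.unique N)
      ; outside = out }
    ; sums = λ N → ≈[]-trans (≋⇒≈[] (∑-product f g (P.support N) (Q.support N))) (≈[]-* (P.sums N) (Q.sums N)) }
    where
    module P = HasSum p
    module Q = HasSum q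
    open DecMembership _≟_ using (_∈?_)
    out : ∀ N ij → ij ∉ cartesianProduct (P.support N) (Q.support N) → Vanishes N (f (proj₁ ij) * g (proj₂ ij))
    out N (i , j) ij∉ with i ∈? P.support N
    ... | no i∉ = Vanishes-*ʳ (g j) (P.outside N i i∉)
    ... | yes i∈ = Vanishes-*ˡ (f i) (Q.outside N j (λ j∈ → ij∉ (∈ₚ.∈-cartesianProduct⁺ i∈ j∈)))

  -- Products over a vector of indices; the k-th factor is taken from the k-th family.
  productFamily : {I : Set} → (ℕ → I → Ser) → ∀ {n} → Vec I n → Ser
  productFamily F [] = 1#
  productFamily F (i ∷ v) = F 0 i * productFamily (λ k → F (suc k)) v

  productSeq : (ℕ → Ser) → ℕ → Ser
  productSeq S zero = 1#
  productSeq S (suc n) = S 0 * productSeq (λ k → S (suc k)) n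

  HasSum-Vec : {I : Set} → DecidableEquality I → ∀ {F : ℕ → I → Ser} {S : ℕ → Ser} n →
               (∀ k → HasSum (F k) (S k)) → HasSum (productFamily F {n}) (productSeq S n)
  HasSum-Vec _≟_ zero h = record
    { summable = record { support = λ _ → [] ∷ [] ; unique = λ _ → [] ∷ []
                        ; outside = λ { N [] i∉ → ⊥-elim (i∉ (here refl)) } }
    ; sums = λ N → ≋⇒≈[] (+-identityʳ _) }
  HasSum-Vec _≟_ {F} (suc n) h = reindex
    (bijection (λ iv → proj₁ iv ∷ proj₂ iv) (λ { (i ∷ v) → i , v }) (λ _ → refl) (λ { (i ∷ v) → refl }) (λ _ → ≋-refl))
    (HasSum-× _≟_ (h 0) (HasSum-Vec _≟_ {λ k → F (suc k)} n (λ k → h (suc k))))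

  restrict : {I : Set} {P : I → Set} → (∀ i → Dec (P i)) → (I → Ser) → I → Ser
  restrict P? f i = if does (P? i) then f i else 0#

  Summable-restrict : {I : Set} {P : I → Set} (P? : ∀ i → Dec (P i)) {f : I → Ser} → Summable f → Summable (restrict P? f)
  Summable-restrict P? {f} S = record { support = support ; unique = unique ; outside = out }
    where
    open Summable S
    out : ∀ N i → i ∉ support N → Vanishes N (restrict P? f i)
    out N i i∉ with does (P? i)
    ... | true = outside N i i∉
    ... | false = ≈[]-refl

  HasSum-split : {I : Set} → DecidableEquality I → {P : I → Set} (P? : ∀ i → Dec (P i)) {f : I → Ser} {s a b : Ser} →
                 HasSum f s → HasSum (restrict P? f) a → HasSum (restrict (λ i → ¬? (P? i)) f) b → s ≋ a + b
  HasSum-split _≟_ P? {f} p q r = HasSum-unique _≟_ p (HasSum-cong pieces ≋-refl (HasSum-+ _≟_ q r))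
    where
    pieces : ∀ i → restrict P? f i + restrict (λ j → ¬? (P? j)) f i ≋ f i
    pieces i with P? i
    ... | yes _ = +-identityʳ _
    ... | no _ = +-identityˡ _

-- The triple product

-- The number n(n - 1)/2, which is the exponent belonging to the n-th power of z in the triple
-- product.
triangle : ℕ → ℕ
triangle zero = 0
triangle (suc n) = n N.+ triangle n

≤-suc-triangle : ∀ n → n ≤ suc (triangle n)
≤-suc-triangle zero = z≤n
≤-suc-triangle (suc n) = s≤s (Nₚ.m≤m+n n _)

-- A view that exposes the difference of the two numbers, so that `i ⊖ n` can be rewritten as an
-- explicit nonnegative or negative integer.
data Comparison : ℕ → ℕ → Set where
  above : ∀ n k → Comparison (n N.+ k) n
  under : ∀ i k → Comparison i (i N.+ suc k)

comparison : ∀ i n → Comparison i n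
comparison i zero = above 0 i
comparison zero (suc n) = under 0 n
comparison (suc i) (suc n) with comparison i n
... | above .n k = above (suc n) k
... | under .i k = under (suc i) k

⊖-above : ∀ n k → (n N.+ k) Z.⊖ n ≡ + k
⊖-above n k = Zₚ.⊖-≥ (Nₚ.m≤m+n n k) ∙ cong +_ (Nₚ.m+n∸m≡n n k)

⊖-under : ∀ i k → i Z.⊖ (i N.+ suc k) ≡ -[1+ k ]
⊖-under i k = Zₚ.⊖-≤ (Nₚ.m≤m+n i _) ∙ cong (λ x → Z.- (+ x)) (Nₚ.m+n∸m≡n i (suc k))

⊖-injectiveˡ : ∀ {i j} n → i Z.⊖ n ≡ j Z.⊖ n → i ≡ j
⊖-injectiveˡ {i} {j} n e = Zₚ.+-injective (Algebra.Properties.Group.∙-cancelʳ (CommutativeRing.+-group Zₚ.+-*-commutativeRing) (Z.- (+ n)) (+ i) (+ j)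
  (Zₚ.m-n≡m⊖n i n ∙ e ∙ sym (Zₚ.m-n≡m⊖n j n)))

module TripleProduct (K : CommutativeRing 0ℓ 0ℓ) where
  private module K = CommutativeRing K
  open PowerSeries K
  open Summation K
  open FiniteSums seriesRing using (sum<; sum<-cong; sum<-+; sum<-*ˡ; sum<-front)

  module WithBase (b′ : ℕ) where
    -- The i-th power of the base q^b with b = `suc b′`. It is tied to `X^` by an equation only and
    -- therefore stays folded in goals.
    Q : ℕ → Ser
    Q i .at = unit (i N.* suc b′)

    Q≋X^ : ∀ i → Q i ≋ X^ (i N.* suc b′)
    Q≋X^ i = coeffs λ _ → K.refl

    Q-0 : Q 0 ≋ 1#
    Q-0 = coeffs λ _ → K.refl

    Q-+ : ∀ i j → Q i * Q j ≋ Q (i N.+ j)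
    Q-+ i j = *-cong (Q≋X^ i) (Q≋X^ j) ⟫ X^-+ _ _
      ⟫ ≋-reflexive (cong X^ (sym (Nₚ.*-distribʳ-+ (suc b′) i j))) ⟫ ≋-sym (Q≋X^ (i N.+ j))

    Q-vanishes : ∀ i → Vanishes i (Q i)
    Q-vanishes i = ≈[]-trans (≋⇒≈[] (Q≋X^ i)) (≈[]-mono (Nₚ.m≤m*n i (suc b′)) (X^-vanishes _))

    qfac : ℕ → Ser
    qfac zero = 1#
    qfac (suc n) = qfac n * (1# - Q (suc n))

    Monic-1-Q : ∀ n → Monic (1# - Q (suc n))
    Monic-1-Q n = monic (K.trans (K.+-congˡ (K.trans (K.-‿cong (upto (Q-vanishes (suc n)) 0 (s≤s z≤n)))
      (K.trans (K.sym (K.+-identityˡ _)) (K.-‿inverseʳ _)))) (K.+-identityʳ _))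

    Monic-qfac : ∀ n → Monic (qfac n)
    Monic-qfac zero = monic K.refl
    Monic-qfac (suc n) = Monic-* (Monic-qfac n) (Monic-1-Q n)

    1-Q≈1 : ∀ i → 1# - Q i ≈[ i ] 1#
    1-Q≈1 i = ≈[]-trans (≈[]-+ ≈[]-refl (≈[]-neg (Q-vanishes i)))
      (≋⇒≈[] (solve 1 (λ a → a :- nat 0 , a) (1# ∷ [])))

    qfac-stable : ∀ {i j} → i ≤ j → qfac j ≈[ suc i ] qfac i
    qfac-stable {i} {j} i≤j with Nₚ.m≤n⇒∃[o]m+o≡n i≤j
    ... | o , refl = go o
      where
      go : ∀ o → qfac (i N.+ o) ≈[ suc i ] qfac i
      go zero rewrite Nₚ.+-identityʳ i = ≈[]-refl
      go (suc o) rewrite Nₚ.+-suc i o = ≈[]-trans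
        (≈[]-* (go o) (≈[]-mono (s≤s (Nₚ.m≤m+n i o)) (1-Q≈1 (suc (i N.+ o)))))
        (≋⇒≈[] (*-identityʳ _))

    -- The Gaussian binomial coefficient of i + j over i in the base q^b, indexed by the two
    -- complementary sizes.
    gauss : ℕ → ℕ → Ser
    gauss zero j = 1#
    gauss (suc i) zero = 1#
    gauss (suc i) (suc j) = gauss i (suc j) + Q (suc i) * gauss (suc i) j

    gauss-0 : ∀ i → gauss i 0 ≋ 1#
    gauss-0 zero = ≋-refl
    gauss-0 (suc i) = ≋-refl

    gauss-qfac : ∀ i j → gauss i j * (qfac i * qfac j) ≋ qfac (i N.+ j)
    gauss-qfac zero j = *-identityˡ _ ⟫ *-identityˡ _
    gauss-qfac (suc i) zero rewrite Nₚ.+-identityʳ i = *-identityˡ _ ⟫ *-identityʳ _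
    gauss-qfac (suc i) (suc j) = begin
      (gauss i (suc j) + Q (suc i) * gauss (suc i) j) * ((qfac i * (1# - Q (suc i))) * (qfac j * (1# - Q (suc j))))
        ≈⟨ solve 7 (λ g h a b u v o → (g :+ u :* h) :* ((a :* (o :- u)) :* (b :* (o :- v))) ,
             (g :* (a :* (b :* (o :- v)))) :* (o :- u) :+ (h :* ((a :* (o :- u)) :* b)) :* (u :* (o :- v)))
             (gauss i (suc j) ∷ gauss (suc i) j ∷ qfac i ∷ qfac j ∷ Q (suc i) ∷ Q (suc j) ∷ 1# ∷ []) ⟩
      (gauss i (suc j) * (qfac i * qfac (suc j))) * (1# - Q (suc i)) + (gauss (suc i) j * (qfac (suc i) * qfac j)) * (Q (suc i) * (1# - Q (suc j)))
        ≈⟨ +-cong (*-congʳ (gauss-qfac i (suc j) ⟫ ≋-reflexive (cong qfac (Nₚ.+-suc i j)))) (*-congʳ (gauss-qfac (suc i) j)) ⟩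
      qfac (suc i N.+ j) * (1# - Q (suc i)) + qfac (suc i N.+ j) * (Q (suc i) * (1# - Q (suc j)))
        ≈⟨ solve 3 (λ f u v → f :* (:1 :- u) :+ f :* (u :* (:1 :- v)) , f :* (:1 :- u :* v)) (qfac (suc i N.+ j) ∷ Q (suc i) ∷ Q (suc j) ∷ []) ⟩
      qfac (suc i N.+ j) * (1# - Q (suc i) * Q (suc j))
        ≈⟨ *-congˡ (+-congˡ (-‿cong (Q-+ (suc i) (suc j) ⟫ ≋-reflexive (cong Q (Nₚ.+-suc (suc i) j))))) ⟩
      qfac (suc i N.+ j) * (1# - Q (suc (suc i N.+ j)))
        ≈⟨ ≋-reflexive (cong qfac (sym (Nₚ.+-suc (suc i) j))) ⟩
      qfac (suc i N.+ suc j) ∎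
      where open Relation.Binary.Reasoning.Setoid setoid

    -- The Pascal rule with the roles of the two sizes exchanged. The recursion hides this symmetry,
    -- the factorial formula `gauss-qfac` shows it, and the factorials can be cancelled.
    gauss-dual : ∀ i j → gauss (suc i) (suc j) ≋ Q (suc j) * gauss i (suc j) + gauss (suc i) j
    gauss-dual i j = Monic-cancel (Monic-* (Monic-qfac (suc i)) (Monic-qfac (suc j))) (begin
      (qfac (suc i) * qfac (suc j)) * gauss (suc i) (suc j) ≈⟨ *-comm _ _ ⟩
      gauss (suc i) (suc j) * (qfac (suc i) * qfac (suc j)) ≈⟨ gauss-qfac (suc i) (suc j) ⟩
      qfac (suc i N.+ suc j) ≈⟨ ≋-reflexive (cong qfac (Nₚ.+-suc (suc i) j)) ⟩
      qfac (suc i N.+ j) * (1# - Q (suc (suc i N.+ j)))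
        ≈⟨ *-congˡ (+-congˡ (-‿cong (Q-+ (suc i) (suc j) ⟫ ≋-reflexive (cong Q (Nₚ.+-suc (suc i) j))))) ⟨
      qfac (suc i N.+ j) * (1# - Q (suc i) * Q (suc j))
        ≈⟨ solve 3 (λ f u v → f :* (:1 :- u :* v) , v :* (f :* (:1 :- u)) :+ f :* (:1 :- v)) (qfac (suc i N.+ j) ∷ Q (suc i) ∷ Q (suc j) ∷ []) ⟩
      Q (suc j) * (qfac (suc i N.+ j) * (1# - Q (suc i))) + qfac (suc i N.+ j) * (1# - Q (suc j))
        ≈⟨ +-cong (*-congˡ (*-congʳ (gauss-qfac i (suc j) ⟫ ≋-reflexive (cong qfac (Nₚ.+-suc i j))))) (*-congʳ (gauss-qfac (suc i) j)) ⟨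
      Q (suc j) * ((gauss i (suc j) * (qfac i * qfac (suc j))) * (1# - Q (suc i))) + (gauss (suc i) j * (qfac (suc i) * qfac j)) * (1# - Q (suc j))
        ≈⟨ solve 7 (λ g h a b u v o → v :* ((g :* (a :* (b :* (o :- v)))) :* (o :- u)) :+ (h :* ((a :* (o :- u)) :* b)) :* (o :- v) ,
              ((a :* (o :- u)) :* (b :* (o :- v))) :* (v :* g :+ h))
             (gauss i (suc j) ∷ gauss (suc i) j ∷ qfac i ∷ qfac j ∷ Q (suc i) ∷ Q (suc j) ∷ 1# ∷ []) ⟩
      (qfac (suc i) * qfac (suc j)) * (Q (suc j) * gauss i (suc j) + gauss (suc i) j) ∎)
      where open Relation.Binary.Reasoning.Setoid setoid

    -- Modulo q^(i + 1) the factor `qfac M` is `qfac i`, and the product of `qfac i` with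
    -- `gauss i j` is the quotient of `qfac (i + j)` by `qfac j`, two factorials that agree to this
    -- precision.
    qfac-gauss-≤ : ∀ {i j M} → i ≤ j → i ≤ M → qfac M * gauss i j ≈[ suc i ] 1#
    qfac-gauss-≤ {i} {j} {M} i≤j i≤M = ≈[]-trans (≈[]-* (qfac-stable i≤M) ≈[]-refl)
      (Monic-cancel[] (Monic-qfac j) (≈[]-trans
        (≋⇒≈[] (solve 3 (λ a b c → b :* (a :* c) , c :* (a :* b)) (qfac i ∷ qfac j ∷ gauss i j ∷ []) ⟫ gauss-qfac i j))
        (≈[]-trans (qfac-stable (Nₚ.m≤m+n i j)) (≈[]-trans (≈[]-sym (qfac-stable i≤j)) (≋⇒≈[] (≋-sym (*-identityʳ _)))))))

    qfac-gauss-≥ : ∀ {i j M} → j ≤ i → j ≤ M → qfac M * gauss i j ≈[ suc j ] 1#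
    qfac-gauss-≥ {i} {j} {M} j≤i j≤M = ≈[]-trans (≈[]-* (qfac-stable j≤M) ≈[]-refl)
      (Monic-cancel[] (Monic-qfac i) (≈[]-trans
        (≋⇒≈[] (solve 3 (λ a b c → a :* (b :* c) , c :* (a :* b)) (qfac i ∷ qfac j ∷ gauss i j ∷ []) ⟫ gauss-qfac i j))
        (≈[]-trans (qfac-stable (Nₚ.m≤n+m j i)) (≈[]-trans (≈[]-sym (qfac-stable j≤i)) (≋⇒≈[] (≋-sym (*-identityʳ _)))))))

    -- An inverse of z need not exist among the series; w stands for q^b / z, so that the factors 1
    -- + w q^(bn) are those with negative powers of z in the classical product.
    module At (z w : Ser) (zw : z * w ≋ X^ (suc b′)) where
      open Relation.Binary.Reasoning.Setoid setoid

      -- The term zˢ q^(b s(s - 1)/2). For s = -m it equals w^m q^(b m(m - 1)/2), since each z⁻¹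
      -- absorbs one q^b.
      term : ℤ → Ser
      term (+ n) = z ^ n * Q (triangle n)
      term -[1+ n ] = w ^ suc n * Q (triangle (suc n))

      zw≋Q1 : z * w ≋ Q 1
      zw≋Q1 = zw ⟫ ≋-reflexive (cong X^ (sym (Nₚ.*-identityˡ (suc b′)))) ⟫ ≋-sym (Q≋X^ 1)

      private
        gather : ∀ a {i j k} → i N.+ j ≡ k → (a * Q i) * Q j ≋ a * Q k
        gather a {i} {j} refl = *-assoc a (Q i) (Q j) ⟫ *-congˡ (Q-+ i j)

      -- With s = i - n the hypothesis reads m = s + j. Passing from s to s + 1 multiplies a term by
      -- z q^(bs), which leaves q^(bj) over.
      term-z : ∀ i n m j → i N.+ j ≡ m N.+ n → term (i Z.⊖ n) * (z * Q m) ≋ term (suc i Z.⊖ n) * Q j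
      term-z i n m j e with comparison i n
      ... | above .n k rewrite ⊖-above n k | sym (Nₚ.+-suc n k) | ⊖-above n (suc k) = begin
        (z ^ k * Q (triangle k)) * (z * Q m) ≈⟨ solve 4 (λ a b c d → (a :* b) :* (c :* d) , (c :* a) :* b :* d) (z ^ k ∷ Q (triangle k) ∷ z ∷ Q m ∷ []) ⟩
        z ^ suc k * Q (triangle k) * Q m ≈⟨ gather (z ^ suc k) (cong (triangle k N.+_) (sym m≡) ∙ lem k j (triangle k)) ⟩
        z ^ suc k * Q (k N.+ triangle k N.+ j) ≈⟨ gather (z ^ suc k) refl ⟨
        z ^ suc k * Q (k N.+ triangle k) * Q j ∎
        where
        m≡ : k N.+ j ≡ m
        m≡ = Nₚ.+-cancelˡ-≡ n _ _ (sym (Nₚ.+-assoc n k j) ∙ e ∙ Nₚ.+-comm m n)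
        lem : ∀ k j t → t N.+ (k N.+ j) ≡ k N.+ t N.+ j
        lem = ℕ-solve-∀
      ... | under .i zero rewrite ⊖-under i 0 | trans (Nₚ.+-suc i 0) (cong suc (Nₚ.+-identityʳ i)) | Zₚ.n⊖n≡0 (suc i) = begin
        (w * 1# * Q 0) * (z * Q m) ≈⟨ solve 4 (λ a b c d → (a :* :1 :* b) :* (c :* d) , (c :* a) :* b :* d) (w ∷ Q 0 ∷ z ∷ Q m ∷ []) ⟩
        (z * w) * Q 0 * Q m ≈⟨ *-congʳ (*-congʳ zw≋Q1) ⟩
        Q 1 * Q 0 * Q m ≈⟨ gather (Q 1) {0} {m} refl ⟩
        Q 1 * Q m ≈⟨ Q-+ 1 m ⟩
        Q (suc m) ≈⟨ ≋-reflexive (cong Q j≡) ⟨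
        Q j ≈⟨ _⟫_ (*-congʳ (*-identityˡ _ ⟫ Q-0)) (*-identityˡ _) ⟨
        1# * Q 0 * Q j ∎
        where
        j≡ : j ≡ suc m
        j≡ = Nₚ.+-cancelˡ-≡ i _ _ (e ∙ lem m i)
          where lem : ∀ m i → m N.+ suc i ≡ i N.+ suc m
                lem = ℕ-solve-∀
      ... | under .i (suc k) rewrite ⊖-under i (suc k) = begin
        (w ^ suc (suc k) * Q (triangle (suc (suc k)))) * (z * Q m)
          ≈⟨ solve 5 (λ w v a z d → (w :* v :* a) :* (z :* d) , v :* (z :* w) :* a :* d) (w ∷ w ^ suc k ∷ Q (triangle (suc (suc k))) ∷ z ∷ Q m ∷ []) ⟩
        w ^ suc k * (z * w) * Q (triangle (suc (suc k))) * Q m ≈⟨ *-congʳ (*-congʳ (*-congˡ zw≋Q1)) ⟩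
        w ^ suc k * Q 1 * Q (triangle (suc (suc k))) * Q m ≈⟨ *-congʳ (gather (w ^ suc k) refl) ⟩
        w ^ suc k * Q (1 N.+ triangle (suc (suc k))) * Q m ≈⟨ gather (w ^ suc k) (lem1 k m (triangle (suc k)) ∙ cong (triangle (suc k) N.+_) (sym j≡)) ⟩
        w ^ suc k * Q (triangle (suc k) N.+ j) ≈⟨ gather (w ^ suc k) refl ⟨
        w ^ suc k * Q (triangle (suc k)) * Q j ≈⟨ ≋-reflexive (cong (λ s → term s * Q j) (⊖-lem′ i k)) ⟨
        term (suc i Z.⊖ (i N.+ suc (suc k))) * Q j ∎
        where
        ⊖-lem′ : ∀ i k → suc i Z.⊖ (i N.+ suc (suc k)) ≡ -[1+ k ]
        ⊖-lem′ i k = cong (suc i Z.⊖_) (Nₚ.+-suc i (suc k)) ∙ ⊖-under (suc i) k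
        j≡ : j ≡ m N.+ suc (suc k)
        j≡ = Nₚ.+-cancelˡ-≡ i _ _ (e ∙ lem m i k)
          where lem : ∀ m i k → m N.+ (i N.+ suc (suc k)) ≡ i N.+ (m N.+ suc (suc k))
                lem = ℕ-solve-∀
        lem1 : ∀ k m t → 1 N.+ (suc k N.+ t) N.+ m ≡ t N.+ (m N.+ suc (suc k))
        lem1 = ℕ-solve-∀

      term-w : ∀ i n → term (i Z.⊖ n) * (w * Q n) ≋ term (i Z.⊖ suc n) * Q i
      term-w i n with comparison i n
      ... | above .n zero rewrite ⊖-above n 0 | Nₚ.+-identityʳ n | trans (cong (n Z.⊖_) (sym (Nₚ.+-suc n 0 ∙ cong suc (Nₚ.+-identityʳ n)))) (⊖-under n 0) =
        solve 3 (λ w q o → :1 :* o :* (w :* q) , w :* :1 :* o :* q) (w ∷ Q n ∷ Q 0 ∷ [])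
      ... | above .n (suc k) rewrite ⊖-above n (suc k) | trans (cong (Z._⊖ suc n) (Nₚ.+-suc n k)) (⊖-above (suc n) k) = begin
        (z ^ suc k * Q (k N.+ triangle k)) * (w * Q n)
          ≈⟨ solve 5 (λ z v a w d → (z :* v :* a) :* (w :* d) , v :* (z :* w) :* a :* d) (z ∷ z ^ k ∷ Q (k N.+ triangle k) ∷ w ∷ Q n ∷ []) ⟩
        z ^ k * (z * w) * Q (k N.+ triangle k) * Q n ≈⟨ *-congʳ (*-congʳ (*-congˡ zw≋Q1)) ⟩
        z ^ k * Q 1 * Q (k N.+ triangle k) * Q n ≈⟨ *-congʳ (gather (z ^ k) refl) ⟩
        z ^ k * Q (1 N.+ (k N.+ triangle k)) * Q n ≈⟨ gather (z ^ k) (lem k n (triangle k)) ⟩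
        z ^ k * Q (triangle k N.+ (n N.+ suc k)) ≈⟨ gather (z ^ k) refl ⟨
        z ^ k * Q (triangle k) * Q (n N.+ suc k) ∎
        where lem : ∀ k n t → 1 N.+ (k N.+ t) N.+ n ≡ t N.+ (n N.+ suc k)
              lem = ℕ-solve-∀
      ... | under .i k rewrite ⊖-under i k | trans (cong (i Z.⊖_) (sym (Nₚ.+-suc i (suc k)))) (⊖-under i (suc k)) = begin
        (w ^ suc k * Q (triangle (suc k))) * (w * Q (i N.+ suc k))
          ≈⟨ solve 4 (λ v a w d → (v :* a) :* (w :* d) , (w :* v) :* a :* d) (w ^ suc k ∷ Q (triangle (suc k)) ∷ w ∷ Q (i N.+ suc k) ∷ []) ⟩
        w ^ suc (suc k) * Q (triangle (suc k)) * Q (i N.+ suc k) ≈⟨ gather (w ^ suc (suc k)) (lem i k (triangle (suc k))) ⟩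
        w ^ suc (suc k) * Q (triangle (suc (suc k)) N.+ i) ≈⟨ gather (w ^ suc (suc k)) refl ⟨
        w ^ suc (suc k) * Q (triangle (suc (suc k))) * Q i ∎
        where lem : ∀ i k t → t N.+ (i N.+ suc k) ≡ (suc k N.+ t) N.+ i
              lem = ℕ-solve-∀

      prodZ prodW : ℕ → Ser
      prodZ zero = 1#
      prodZ (suc m) = prodZ m * (1# + z * Q m)
      prodW zero = 1#
      prodW (suc n) = prodW n * (1# + w * Q n)

      finiteSum : ℕ → ℕ → Ser
      finiteSum m n = sum< (suc (m N.+ n)) (λ i → term (i Z.⊖ n) * gauss i (m N.+ n ∸ i))

      private
        -- The common shape of the two Pascal steps: a sum with one term more is the overlap of two
        -- sums, one of them moved by one place.
        shifted : ∀ M (t a c : ℕ → Ser) → t 0 ≋ a 0 → (∀ i → i < M → t (suc i) ≋ a (suc i) + c i) → t (suc M) ≋ c M →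
                  sum< (suc (suc M)) t ≋ sum< (suc M) a + sum< (suc M) c
        shifted M t a c t0 tᵢ tₘ = begin
          sum< (suc M) t + t (suc M)                                       ≈⟨ +-cong (sum<-front M t) tₘ ⟩
          (t 0 + sum< M (λ i → t (suc i))) + c M                           ≈⟨ +-congʳ (+-cong t0 (sum<-cong M tᵢ ⟫ sum<-+ M _ _)) ⟩
          (a 0 + (sum< M (λ i → a (suc i)) + sum< M c)) + c M
            ≈⟨ solve 4 (λ a b c d → (a :+ (b :+ c)) :+ d , (a :+ b) :+ (c :+ d)) (a 0 ∷ sum< M (λ i → a (suc i)) ∷ sum< M c ∷ c M ∷ []) ⟩
          (a 0 + sum< M (λ i → a (suc i))) + (sum< M c + c M)              ≈⟨ +-congʳ (sum<-front M a) ⟨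
          sum< (suc M) a + sum< (suc M) c ∎

        rest : ∀ {i M} → i < M → Σ ℕ (λ j → M ∸ i ≡ suc j × M ∸ suc i ≡ j)
        rest {i} {M} i<M = M ∸ suc i , Nₚ.+-cancelˡ-≡ i _ _ (Nₚ.m+[n∸m]≡n (Nₚ.<⇒≤ i<M)
          ∙ sym (Nₚ.m+[n∸m]≡n i<M) ∙ sym (Nₚ.+-suc i _)) , refl

        split : ∀ M (u : ℕ → Ser) v → sum< M u * (1# + v) ≋ sum< M u + sum< M (λ i → u i * v)
        split M u v = solve 2 (λ s v → s :* (:1 :+ v) , s :+ v :* s) (sum< M u ∷ v ∷ [])
          ⟫ +-congˡ (≋-sym (sum<-*ˡ M v u) ⟫ sum<-cong M (λ i _ → *-comm _ _))

      stepZ : ∀ m n → finiteSum m n * (1# + z * Q m) ≋ finiteSum (suc m) n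
      stepZ m n = split (suc M) u (z * Q m) ⟫ +-congˡ (sum<-cong (suc M) (λ i i≤M → moved i (Nₚ.≤-pred i≤M)))
        ⟫ ≋-sym (shifted M t u c (*-congˡ ≋-refl) mid top)
        where
        M = m N.+ n
        u = λ i → term (i Z.⊖ n) * gauss i (M ∸ i)
        t = λ i → term (i Z.⊖ n) * gauss i (suc M ∸ i)
        c = λ i → term (suc i Z.⊖ n) * (Q (M ∸ i) * gauss i (M ∸ i))
        moved : ∀ i → i ≤ M → u i * (z * Q m) ≋ c i
        moved i i≤M = solve 3 (λ a b c → (a :* b) :* c , (a :* c) :* b) (term (i Z.⊖ n) ∷ gauss i (M ∸ i) ∷ z * Q m ∷ [])
          ⟫ *-congʳ (term-z i n m (M ∸ i) (Nₚ.m+[n∸m]≡n i≤M)) ⟫ *-assoc _ _ _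
        mid : ∀ i → i < M → t (suc i) ≋ u (suc i) + c i
        mid i i<M with rest i<M
        ... | j , e , e′ rewrite e | e′ = *-congˡ (gauss-dual i j ⟫ +-comm _ _) ⟫ distribˡ _ _ _
        top : t (suc M) ≋ c M
        top rewrite Nₚ.n∸n≡0 M = *-congˡ (≋-sym (*-congʳ Q-0 ⟫ *-identityˡ _ ⟫ gauss-0 M))

      stepW : ∀ m n → finiteSum m n * (1# + w * Q n) ≋ finiteSum m (suc n)
      stepW m n = split (suc M) u (w * Q n) ⟫ +-comm _ _ ⟫ +-cong (sum<-cong (suc M) (λ i _ → moved i)) (sum<-cong (suc M) (λ i _ → renamed i))
        ⟫ ≋-sym (shifted M t a c (*-congˡ (≋-sym (*-congʳ Q-0 ⟫ *-identityˡ _))) mid top)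
          ⟫ ≋-reflexive (cong (λ k → sum< (suc k) (λ i → term (i Z.⊖ suc n) * gauss i (k ∸ i))) (sym (Nₚ.+-suc m n)))
        where
        M = m N.+ n
        u = λ i → term (i Z.⊖ n) * gauss i (M ∸ i)
        t = λ i → term (i Z.⊖ suc n) * gauss i (suc M ∸ i)
        a = λ i → term (i Z.⊖ suc n) * (Q i * gauss i (M ∸ i))
        c = λ i → term (suc i Z.⊖ suc n) * gauss i (M ∸ i)
        moved : ∀ i → u i * (w * Q n) ≋ a i
        moved i = solve 3 (λ a b c → (a :* b) :* c , (a :* c) :* b) (term (i Z.⊖ n) ∷ gauss i (M ∸ i) ∷ w * Q n ∷ [])
          ⟫ *-congʳ (term-w i n) ⟫ *-assoc _ _ _
        renamed : ∀ i → u i ≋ c i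
        renamed i = ≋-reflexive (cong (λ s → term s * gauss i (M ∸ i)) (sym (Zₚ.[1+m]⊖[1+n]≡m⊖n i n)))
        mid : ∀ i → i < M → t (suc i) ≋ a (suc i) + c i
        mid i i<M with rest i<M
        ... | j , e , e′ rewrite e | e′ = *-congˡ (+-comm _ _) ⟫ distribˡ _ _ _
        top : t (suc M) ≋ c M
        top rewrite Nₚ.n∸n≡0 M = *-congˡ (≋-sym (gauss-0 M))

      -- One linear factor is adjoined at a time: a factor with z by `gauss-dual`, a factor with w
      -- by the recursion of `gauss`.
      finite-triple-product : ∀ m n → prodZ m * prodW n ≋ finiteSum m n
      finite-triple-product zero zero = *-identityˡ 1# ⟫ ≋-sym Q-0 ⟫ solve 1 (λ o → o , nat 0 :+ :1 :* o :* :1) (Q 0 ∷ [])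
      finite-triple-product (suc m) zero = solve 2 (λ a b → (a :* b) :* :1 , (a :* :1) :* b) (prodZ m ∷ 1# + z * Q m ∷ [])
        ⟫ *-congʳ (finite-triple-product m zero) ⟫ stepZ m zero
      finite-triple-product m (suc n) = ≋-sym (*-assoc (prodZ m) (prodW n) _)
        ⟫ *-congʳ (finite-triple-product m n) ⟫ stepW m n

      term-vanishes-z : ∀ k → Vanishes (triangle k) (term (+ k))
      term-vanishes-z k = Vanishes-*ˡ _ (Q-vanishes (triangle k))

      window : ℕ → List ℤ
      window N = List.map (Z._⊖ N) (downFrom (suc (N N.+ N)))

      term-summable : Summable term
      term-summable = record
        { support = window
        ; unique = λ N → Uniqueₚ.map⁺ (⊖-injectiveˡ N) (Uniqueₚ.downFrom⁺ (suc (N N.+ N)))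
        ; outside = out }
        where
        out : ∀ N s → s ∉ window N → Vanishes N (term s)
        out N (+ k) s∉ = ≈[]-mono (Nₚ.≤-pred (Nₚ.≤-trans k>N (≤-suc-triangle k))) (term-vanishes-z k)
          where
          k>N : N < k
          k>N = Nₚ.≰⇒> λ k≤N → s∉ (subst (_∈ window N) (⊖-above N k)
            (∈ₚ.∈-map⁺ (Z._⊖ N) (∈ₚ.∈-downFrom⁺ (s≤s (Nₚ.+-monoʳ-≤ N k≤N)))))
        out N -[1+ k ] s∉ = ≈[]-mono (Nₚ.≤-pred (Nₚ.≤-trans k>N (≤-suc-triangle (suc k)))) (Vanishes-*ˡ _ (Q-vanishes (triangle (suc k))))
          where
          k>N : N < suc k
          k>N = Nₚ.≰⇒> λ k≤N → s∉ (subst (_∈ window N)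
            (cong ((N ∸ suc k) Z.⊖_) (sym (Nₚ.m∸n+n≡m k≤N)) ∙ ⊖-under (N ∸ suc k) k)
            (∈ₚ.∈-map⁺ (Z._⊖ N) (∈ₚ.∈-downFrom⁺ (s≤s (Nₚ.≤-trans (Nₚ.m∸n≤m N (suc k)) (Nₚ.m≤m+n N N))))))

      theta : Ser
      theta = total term-summable

      HasSum-theta : HasSum term theta
      HasSum-theta = HasSum-total Zₚ._≟_ term-summable

      private
        ∑-downFrom : ∀ N n → ∑ term (List.map (Z._⊖ N) (downFrom n)) ≋ sum< n (λ i → term (i Z.⊖ N))
        ∑-downFrom N zero = ≋-refl
        ∑-downFrom N (suc n) = +-comm _ _ ⟫ +-congʳ (∑-downFrom N n)

        sum<-cong[] : ∀ n {N f g} → (∀ i → i < n → f i ≈[ N ] g i) → sum< n f ≈[ N ] sum< n g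
        sum<-cong[] zero h = ≈[]-refl
        sum<-cong[] (suc n) h = ≈[]-+ (sum<-cong[] n (λ i i<n → h i (Nₚ.m<n⇒m<1+n i<n))) (h n Nₚ.≤-refl)

        close : ∀ {N o p a g} → N ≤ p N.+ o → Vanishes p a → g ≈[ o ] 1# → a * g ≈[ N ] a
        close {a = a} {g} N≤ va g≈1 = vanishing-difference (≈[]-mono N≤ (≈[]-trans
          (≋⇒≈[] (solve 2 (λ a g → a :* g :- a , a :* (g :- :1)) (a ∷ g ∷ []))) (Vanishes-* va (difference-vanishes g≈1))))

        bound : ∀ k i → i N.+ suc k ≤ triangle (suc k) N.+ suc i
        bound k i = subst (_≤ triangle (suc k) N.+ suc i) (Nₚ.+-suc k i ∙ cong suc (Nₚ.+-comm k i) ∙ sym (Nₚ.+-suc i k))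
          (Nₚ.+-monoˡ-≤ (suc i) (Nₚ.m≤m+n k (triangle k)))

        -- The precision to which `qfac M` times the Gaussian coefficient is 1 drops towards both
        -- ends of the window; there the power of q inside the term makes up for the loss.
        close-term : ∀ M i → i ≤ M N.+ M → term (i Z.⊖ M) * (qfac M * gauss i (M N.+ M ∸ i)) ≈[ M ] term (i Z.⊖ M)
        close-term M i i≤2M with comparison i M
        ... | under .i k rewrite ⊖-under i k = close (bound k i)
                (Vanishes-*ˡ (w ^ suc k) (Q-vanishes (triangle (suc k))))
                (qfac-gauss-≤ i≤j (Nₚ.m≤m+n i _))
              where
              i≤j : i ≤ M N.+ M ∸ i
              i≤j = Nₚ.m+n≤o⇒m≤o∸n i (Nₚ.+-mono-≤ (Nₚ.m≤m+n i _) (Nₚ.m≤m+n i _))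
        ... | above .M k = subst (λ s → term s * (qfac M * gauss (M N.+ k) (M N.+ M ∸ (M N.+ k))) ≈[ M ] term s) (sym (⊖-above M k))
                (close M≤ (term-vanishes-z k) (qfac-gauss-≥ j≤i j≤M))
              where
              j≡ : M N.+ M ∸ (M N.+ k) ≡ M ∸ k
              j≡ = Nₚ.[m+n]∸[m+o]≡n∸o M M k
              j≤M : M N.+ M ∸ (M N.+ k) ≤ M
              j≤M = subst (_≤ M) (sym j≡) (Nₚ.m∸n≤m M k)
              j≤i : M N.+ M ∸ (M N.+ k) ≤ M N.+ k
              j≤i = Nₚ.≤-trans j≤M (Nₚ.m≤m+n M k)
              k≤M : k ≤ M
              k≤M = Nₚ.+-cancelˡ-≤ M k M i≤2M
              M≤ : M ≤ triangle k N.+ suc (M N.+ M ∸ (M N.+ k))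
              M≤ rewrite j≡ | Nₚ.+-suc (triangle k) (M ∸ k) =
                subst (_≤ suc (triangle k N.+ (M ∸ k))) (Nₚ.m+[n∸m]≡n k≤M) (Nₚ.+-monoˡ-≤ (M ∸ k) (≤-suc-triangle k))

      triple-product : Tends (λ M → qfac M * (prodZ M * prodW M)) theta
      triple-product N M N≤M = ≈[]-mono N≤M (≈[]-trans (≋⇒≈[] expand) (≈[]-trans
        (sum<-cong[] (suc (M N.+ M)) (λ i i≤ → close-term M i (Nₚ.≤-pred i≤)))
        (≈[]-trans (≋⇒≈[] (≋-sym (∑-downFrom M (suc (M N.+ M))))) (HasSum.sums HasSum-theta M))))
        where
        expand : qfac M * (prodZ M * prodW M) ≋ sum< (suc (M N.+ M)) (λ i → term (i Z.⊖ M) * (qfac M * gauss i (M N.+ M ∸ i)))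
        expand = *-congˡ (finite-triple-product M M) ⟫ ≋-sym (sum<-*ˡ (suc (M N.+ M)) (qfac M) _)
          ⟫ sum<-cong (suc (M N.+ M)) (λ i _ → solve 3 (λ a b c → a :* (b :* c) , b :* (a :* c)) (qfac M ∷ term (i Z.⊖ M) ∷ gauss i (M N.+ M ∸ i) ∷ []))

-- Pairings of Laurent series

ℤ² : Set
ℤ² = ℤ × ℤ

_⊞_ : ℤ² → ℤ² → ℤ²
(a , b) ⊞ (c , d) = a Z.+ c , b Z.+ d

⊞-assoc : ∀ x y z → (x ⊞ y) ⊞ z ≡ x ⊞ (y ⊞ z)
⊞-assoc (a , b) (c , d) (e , f) = cong₂ _,_ (Zₚ.+-assoc a c e) (Zₚ.+-assoc b d f)

⊞-comm : ∀ x y → x ⊞ y ≡ y ⊞ x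
⊞-comm (a , b) (c , d) = cong₂ _,_ (Zₚ.+-comm a c) (Zₚ.+-comm b d)

origin : ℤ²
origin = + 0 , + 0

⊞-identityˡ : ∀ x → origin ⊞ x ≡ x
⊞-identityˡ (a , b) = cong₂ _,_ (Zₚ.+-identityˡ a) (Zₚ.+-identityˡ b)

⊞-identityʳ : ∀ x → x ⊞ origin ≡ x
⊞-identityʳ (a , b) = cong₂ _,_ (Zₚ.+-identityʳ a) (Zₚ.+-identityʳ b)

_·_ : ℤ → ℤ² → ℤ²
s · (a , b) = s Z.* a , s Z.* b

-- The quotient of the group ring K[ℤ²] by the elements that pair to zero with every function in
-- the translation invariant class Φ. For Φ everything this is K[ℤ²] itself.
module GroupRing (K : CommutativeRing 0ℓ 0ℓ) (Φ : (ℤ² → CommutativeRing.Carrier K) → Set)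
                 (translate : ∀ φ g → Φ φ → Φ (λ h → φ (g ⊞ h))) where
  open CommutativeRing K renaming (refl to ≈-refl; sym to ≈-sym; trans to ≈-trans)
  open RingSolver K using (solve)
  open Algebra.Properties.Ring ring using (-0#≈0#; -‿+-comm; -‿distribˡ-*)

  Elt : Set
  Elt = List (Carrier × ℤ²)

  pair : (ℤ² → Carrier) → Elt → Carrier
  pair φ [] = 0#
  pair φ ((c , g) ∷ l) = c * φ g + pair φ l

  pair-cong : ∀ {φ ψ} l → (∀ g → φ g ≈ ψ g) → pair φ l ≈ pair ψ l
  pair-cong [] h = ≈-refl
  pair-cong ((c , g) ∷ l) h = +-cong (*-congˡ (h g)) (pair-cong l h)

  negate : Elt → Elt
  negate = List.map (λ cg → - proj₁ cg , proj₂ cg)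

  scale : Carrier → ℤ² → Elt → Elt
  scale c g = List.map (λ dh → c * proj₁ dh , g ⊞ proj₂ dh)

  infixl 7 _⋆_
  _⋆_ : Elt → Elt → Elt
  [] ⋆ m = []
  ((c , g) ∷ l) ⋆ m = scale c g m ++ l ⋆ m

  pair-++ : ∀ φ l m → pair φ (l ++ m) ≈ pair φ l + pair φ m
  pair-++ φ [] m = ≈-sym (+-identityˡ _)
  pair-++ φ ((c , g) ∷ l) m = ≈-trans (+-congˡ (pair-++ φ l m)) (≈-sym (+-assoc _ _ _))

  pair-negate : ∀ φ l → pair φ (negate l) ≈ - pair φ l
  pair-negate φ [] = ≈-sym -0#≈0#
  pair-negate φ ((c , g) ∷ l) = ≈-trans (+-cong (≈-sym (-‿distribˡ-* _ _)) (pair-negate φ l)) (-‿+-comm _ _)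

  pair-scale : ∀ φ c g m → pair φ (scale c g m) ≈ c * pair (λ h → φ (g ⊞ h)) m
  pair-scale φ c g [] = ≈-sym (zeroʳ c)
  pair-scale φ c g ((d , h) ∷ m) = ≈-trans (+-cong (*-assoc _ _ _) (pair-scale φ c g m)) (≈-sym (distribˡ _ _ _))

  pair-⋆ : ∀ φ l m → pair φ (l ⋆ m) ≈ pair (λ g → pair (λ h → φ (g ⊞ h)) m) l
  pair-⋆ φ [] m = ≈-refl
  pair-⋆ φ ((c , g) ∷ l) m = ≈-trans (pair-++ φ (scale c g m) (l ⋆ m)) (+-cong (pair-scale φ c g m) (pair-⋆ φ l m))

  pair-zero : ∀ l → pair (λ _ → 0#) l ≈ 0#
  pair-zero [] = ≈-refl
  pair-zero ((c , g) ∷ l) = ≈-trans (+-cong (zeroʳ c) (pair-zero l)) (+-identityˡ _)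

  pair-+ : ∀ φ ψ l → pair (λ g → φ g + ψ g) l ≈ pair φ l + pair ψ l
  pair-+ φ ψ [] = ≈-sym (+-identityˡ _)
  pair-+ φ ψ ((c , g) ∷ l) = ≈-trans (+-congˡ (pair-+ φ ψ l))
    (solve 5 (λ c x y a b → c :* (x :+ y) :+ (a :+ b) , (c :* x :+ a) :+ (c :* y :+ b)) (c ∷ φ g ∷ ψ g ∷ pair φ l ∷ pair ψ l ∷ []))

  pair-* : ∀ c φ l → pair (λ g → c * φ g) l ≈ c * pair φ l
  pair-* c φ [] = ≈-sym (zeroʳ c)
  pair-* c φ ((d , g) ∷ l) = ≈-trans (+-congˡ (pair-* c φ l))
    (solve 4 (λ c d x a → d :* (c :* x) :+ c :* a , c :* (d :* x :+ a)) (c ∷ d ∷ φ g ∷ pair φ l ∷ []))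

  pair-swap : ∀ (φ : ℤ² → ℤ² → Carrier) l m → pair (λ g → pair (φ g) m) l ≈ pair (λ h → pair (λ g → φ g h) l) m
  pair-swap φ [] m = ≈-sym (pair-zero m)
  pair-swap φ ((c , g) ∷ l) m = ≈-trans (+-cong (≈-sym (pair-* c (φ g) m)) (pair-swap φ l m))
    (≈-sym (pair-+ (λ h → c * φ g h) (λ h → pair (λ g′ → φ g′ h) l) m))

  pair-⋆-comm : ∀ φ l m → pair φ (l ⋆ m) ≈ pair φ (m ⋆ l)
  pair-⋆-comm φ l m = ≈-trans (pair-⋆ φ l m) (≈-trans (pair-swap (λ g h → φ (g ⊞ h)) l m)
    (≈-trans (pair-cong m (λ h → pair-cong l (λ g → reflexive (cong φ (⊞-comm g h))))) (≈-sym (pair-⋆ φ m l))))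

  infix 4 _≃_
  record _≃_ (l m : Elt) : Set where
    constructor tested
    field test : ∀ φ → Φ φ → pair φ l ≈ pair φ m
  open _≃_ public

  ⋆-congˡ : ∀ l {m m′} → m ≃ m′ → l ⋆ m ≃ l ⋆ m′
  ⋆-congˡ l {m} {m′} p = tested λ φ Φφ → ≈-trans (pair-⋆ φ l m)
    (≈-trans (go φ Φφ l) (≈-sym (pair-⋆ φ l m′)))
    where
    go : ∀ φ → Φ φ → ∀ l → pair (λ g → pair (λ h → φ (g ⊞ h)) m) l ≈ pair (λ g → pair (λ h → φ (g ⊞ h)) m′) l
    go φ Φφ [] = ≈-refl
    go φ Φφ ((c , g) ∷ l) = +-cong (*-congˡ (test p _ (translate φ g Φφ))) (go φ Φφ l)

  ⋆-cong : ∀ {l l′ m m′} → l ≃ l′ → m ≃ m′ → l ⋆ m ≃ l′ ⋆ m′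
  ⋆-cong {l} {l′} {m} {m′} p q = tested λ φ Φφ → ≈-trans (test (⋆-congˡ l q) φ Φφ)
    (≈-trans (pair-⋆-comm φ l m′) (≈-trans (test (⋆-congˡ m′ p) φ Φφ) (pair-⋆-comm φ m′ l′)))

  ⋆-assoc : ∀ l m n → (l ⋆ m) ⋆ n ≃ l ⋆ (m ⋆ n)
  ⋆-assoc l m n = tested λ φ Φφ → ≈-trans (pair-⋆ φ (l ⋆ m) n) (≈-trans (pair-⋆ _ l m)
    (≈-trans (pair-cong l (λ g → ≈-trans
        (pair-cong m (λ h → pair-cong n (λ k → reflexive (cong φ (⊞-assoc g h k)))))
        (≈-sym (pair-⋆ (λ h → φ (g ⊞ h)) m n))))
      (≈-sym (pair-⋆ φ l (m ⋆ n)))))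

  single : Carrier → ℤ² → Elt
  single c g = (c , g) ∷ []

  pair-single : ∀ φ c g → pair φ (single c g) ≈ c * φ g
  pair-single φ c g = +-identityʳ _

  single-⋆ : ∀ c g d h → single c g ⋆ single d h ≃ single (c * d) (g ⊞ h)
  single-⋆ c g d h = tested λ φ _ → ≈-refl

  single-cong : ∀ {c d g h} → c ≈ d → g ≡ h → single c g ≃ single d h
  single-cong p refl = tested λ φ _ → +-congʳ (*-congʳ p)

  one⋆ : ∀ m → single 1# origin ⋆ m ≃ m
  one⋆ m = tested λ φ _ → ≈-trans (pair-⋆ φ (single 1# origin) m)
    (≈-trans (pair-single (λ g → pair (λ h → φ (g ⊞ h)) m) 1# origin) (≈-trans (*-identityˡ _) (pair-cong m (λ h → reflexive (cong φ (⊞-identityˡ h))))))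

  private
    commutes : ∀ l m → l ⋆ m ≃ m ⋆ l
    commutes l m = tested λ φ _ → pair-⋆-comm φ l m
    ≃-trans : ∀ {l m n} → l ≃ m → m ≃ n → l ≃ n
    ≃-trans p q = tested λ φ Φφ → ≈-trans (test p φ Φφ) (test q φ Φφ)
    distribʳ⋆ : ∀ l m n → (m ++ n) ⋆ l ≃ m ⋆ l ++ n ⋆ l
    distribʳ⋆ l m n = tested λ φ _ → ≈-trans (pair-⋆ φ (m ++ n) l) (≈-trans (pair-++ _ m n)
      (≈-sym (≈-trans (pair-++ φ (m ⋆ l) (n ⋆ l)) (+-cong (pair-⋆ φ m l) (pair-⋆ φ n l)))))
    ++-cong : ∀ {l l′ m m′} → l ≃ l′ → m ≃ m′ → l ++ m ≃ l′ ++ m′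
    ++-cong {l} {l′} {m} {m′} p q = tested λ φ Φφ → ≈-trans (pair-++ φ l m)
      (≈-trans (+-cong (test p φ Φφ) (test q φ Φφ)) (≈-sym (pair-++ φ l′ m′)))
    ++-comm : ∀ l m → l ++ m ≃ m ++ l
    ++-comm l m = tested λ φ _ → ≈-trans (pair-++ φ l m) (≈-trans (+-comm _ _) (≈-sym (pair-++ φ m l)))
    ++-inverse : ∀ l → negate l ++ l ≃ []
    ++-inverse l = tested λ φ _ → ≈-trans (pair-++ φ (negate l) l) (≈-trans (+-congʳ (pair-negate φ l)) (-‿inverseˡ _))

  groupRing : CommutativeRing 0ℓ 0ℓ
  groupRing = record
    { Carrier = Elt ; _≈_ = _≃_ ; _+_ = _++_ ; _*_ = _⋆_ ; -_ = negate ; 0# = [] ; 1# = single 1# origin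
    ; isCommutativeRing = record
      { isRing = record
        { +-isAbelianGroup = record
          { isGroup = record
            { isMonoid = record
              { isSemigroup = record
                { isMagma = record
                  { isEquivalence = record
                    { refl = tested λ _ _ → ≈-refl
                    ; sym = λ p → tested λ φ Φφ → ≈-sym (test p φ Φφ)
                    ; trans = ≃-trans }
                  ; ∙-cong = ++-cong }
                ; assoc = λ l m n → tested λ φ _ → ≈-trans (pair-++ φ (l ++ m) n) (≈-trans (+-congʳ (pair-++ φ l m))
                    (≈-trans (+-assoc _ _ _) (≈-sym (≈-trans (pair-++ φ l (m ++ n)) (+-congˡ (pair-++ φ m n)))))) }
              ; identity = (λ l → tested λ _ _ → ≈-refl)
                         , (λ l → tested λ φ _ → ≈-trans (pair-++ φ l []) (+-identityʳ _)) }
            ; inverse = ++-inverse , (λ l → ≃-trans (++-comm l (negate l)) (++-inverse l))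
            ; ⁻¹-cong = λ {l} {m} p → tested λ φ Φφ → ≈-trans (pair-negate φ l) (≈-trans (-‿cong (test p φ Φφ)) (≈-sym (pair-negate φ m))) }
          ; comm = ++-comm }
        ; *-cong = ⋆-cong
        ; *-assoc = ⋆-assoc
        ; *-identity = one⋆ , (λ m → ≃-trans (commutes m (single 1# origin)) (one⋆ m))
        ; distrib = (λ l m n → ≃-trans (commutes l (m ++ n)) (≃-trans (distribʳ⋆ l m n) (++-cong (commutes m l) (commutes n l))))
                  , distribʳ⋆ }
      ; *-comm = commutes } }

-- The integer rs + (r + r′) s(s - 1)/2, the exponent of q in the term s of the triple product with
-- z = q^r and w = q^r′. Negative s are written with r′ so that no subtraction occurs.
exponent : ℕ → ℕ → ℤ → ℕ
exponent r r′ (+ n) = n N.* r N.+ triangle n N.* (r N.+ r′)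
exponent r r′ -[1+ n ] = suc n N.* r′ N.+ triangle (suc n) N.* (r N.+ r′)

module Pairing (K : CommutativeRing 0ℓ 0ℓ) (Φ : (ℤ² → CommutativeRing.Carrier K) → Set)
               (translate : ∀ φ g → Φ φ → Φ (λ h → φ (g ⊞ h))) where
  private module K = CommutativeRing K
  open GroupRing K Φ translate public
  private
    module S = PowerSeries K
    module Sum = Summation K
    module R = RingSolver K
  module L = PowerSeries groupRing
  module LSum = Summation groupRing
  open L using (ser)

  -- Coefficientwise in q. The pairing is linear but not multiplicative, so a product in z is
  -- evaluated by removing its factors one at a time.
  pairₛ : (ℤ² → K.Carrier) → L.Ser → S.Ser
  pairₛ φ f .S.at n = pair φ (L.at f n)

  module _ {φ : ℤ² → K.Carrier} (Φφ : Φ φ) where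
    pairₛ-cong : ∀ {f g} → f L.≋ g → pairₛ φ f S.≋ pairₛ φ g
    pairₛ-cong p = S.coeffs λ n → test (L.coeff p n) φ Φφ

    pairₛ-cong[] : ∀ {N f g} → f L.≈[ N ] g → pairₛ φ f S.≈[ N ] pairₛ φ g
    pairₛ-cong[] p = S.below λ n l → test (L.upto p n l) φ Φφ

    pairₛ-X^ : ∀ m f → pairₛ φ (L.X^ m L.* f) S.≋ S.X^ m S.* pairₛ φ f
    pairₛ-X^ m f = S.coeffs go
      where
      go : ∀ n → pair φ (L.at (L.X^ m L.* f) n) K.≈ S.at (S.X^ m S.* pairₛ φ f) n
      go n with n Nₚ.<? m
      ... | yes n<m = K.trans (test (L.at-X^*-< m n f n<m) φ Φφ) (K.sym (S.at-X^*-< m n (pairₛ φ f) n<m))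
      ... | no n≮m with Nₚ.m≤n⇒∃[o]m+o≡n (Nₚ.≮⇒≥ n≮m)
      ... | o , refl = K.trans (test (L.at-X^* m o f) φ Φφ) (K.sym (S.at-X^* m o (pairₛ φ f)))

    HasSum-pair : {I : Set} {f : I → L.Ser} {s : L.Ser} → LSum.HasSum f s → Sum.HasSum (λ i → pairₛ φ (f i)) (pairₛ φ s)
    HasSum-pair {I} {f} {s} p = record
      { summable = record { support = support ; unique = unique
                          ; outside = λ N i i∉ → S.≈[]-trans (pairₛ-cong[] (outside N i i∉)) (S.below λ _ _ → K.refl) }
      ; sums = λ N → S.≈[]-trans (S.≋⇒≈[] (S.≋-sym (pairₛ-∑ (support N)))) (pairₛ-cong[] (sums N)) }
      where
      open LSum.HasSum p
      pairₛ-∑ : ∀ L → pairₛ φ (LSum.∑ f L) S.≋ Sum.∑ (λ i → pairₛ φ (f i)) L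
      pairₛ-∑ [] = S.coeffs λ _ → K.refl
      pairₛ-∑ (i ∷ L) = S._⟫_ (S.coeffs λ n → pair-++ φ (L.at (f i) n) _) (S.+-congˡ (pairₛ-∑ L))

    pairₛ-single : ∀ c g f → pairₛ φ (L.constant (single c g) L.* f) S.≋ S.constant c S.* pairₛ (λ h → φ (g ⊞ h)) f
    pairₛ-single c g f = S.coeffs λ n → K.trans (test (L.at-constant* (single c g) f n) φ Φφ)
      (K.trans (pair-⋆ φ (single c g) (L.at f n)) (K.trans (pair-single (λ g → pair (λ h → φ (g ⊞ h)) (L.at f n)) c g)
        (K.sym (S.at-constant* c (pairₛ (λ h → φ (g ⊞ h)) f) n))))

  pairₛ-+ : ∀ φ f g → pairₛ φ (f L.+ g) S.≋ pairₛ φ f S.+ pairₛ φ g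
  pairₛ-+ φ f g = S.coeffs λ n → pair-++ φ (L.at f n) (L.at g n)

  pairₛ-neg : ∀ φ f → pairₛ φ (L.- f) S.≋ S.- pairₛ φ f
  pairₛ-neg φ f = S.coeffs λ n → pair-negate φ (L.at f n)

  pairₛ-qfac : ∀ {φ} → Φ φ → ∀ b′ m f → pairₛ φ (TripleProduct.WithBase.qfac groupRing b′ m L.* f) S.≋ TripleProduct.WithBase.qfac K b′ m S.* pairₛ φ f
  pairₛ-qfac Φφ b′ zero f = S._⟫_ (pairₛ-cong Φφ (L.*-identityˡ f)) (S.≋-sym (S.*-identityˡ _))
  pairₛ-qfac {φ} Φφ b′ (suc m) f = S._⟫_ (pairₛ-cong Φφ (L.*-assoc (BL.qfac m) _ f)) (S._⟫_ (pairₛ-qfac Φφ b′ m _)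
    (S._⟫_ (S.*-congˡ (S._⟫_ (pairₛ-cong Φφ (L.*-congʳ (L.+-congˡ (L.-‿cong (BL.Q≋X^ (suc m)))) L.⟫ L.solve 2 (λ x f → (:1 :- x) :* f , f :+ :- (x :* f)) (L.X^ (suc m N.* suc b′) ∷ f ∷ [])))
      (S._⟫_ (pairₛ-+ φ f _) (S._⟫_ (S.+-congˡ (S._⟫_ (pairₛ-neg φ (L.X^ (suc m N.* suc b′) L.* f)) (S.-‿cong (pairₛ-X^ Φφ (suc m N.* suc b′) f))))
        (S._⟫_ (S.solve 2 (λ x f → f :+ :- (x :* f) , (:1 :- x) :* f) (S.X^ (suc m N.* suc b′) ∷ pairₛ φ f ∷ [])) (S.*-congʳ (S.+-congˡ (S.-‿cong (S.≋-sym (BS.Q≋X^ (suc m)))))))))))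
      (S.≋-sym (S.*-assoc (BS.qfac m) _ _))))
    where
    module BL = TripleProduct.WithBase groupRing b′
    module BS = TripleProduct.WithBase K b′

  pairₛ-congˡ : ∀ {φ ψ} f → (∀ g → φ g K.≈ ψ g) → pairₛ φ f S.≋ pairₛ ψ f
  pairₛ-congˡ f h = S.coeffs λ n → pair-cong (L.at f n) h

  monomial : K.Carrier → ℤ² → ℕ → L.Ser
  monomial c g e = L.constant (single c g) L.* L.X^ e

  private
    L-const-* : ∀ c g d h → L.constant (single c g) L.* L.constant (single d h) L.≋ L.constant (single (c K.* d) (g ⊞ h))
    L-const-* c g d h = L.coeffs λ { zero → CommutativeRing.trans groupRing (L.at-constant* (single c g) (L.constant (single d h)) 0) (single-⋆ c g d h)
                                   ; (suc n) → CommutativeRing.trans groupRing (L.at-constant* (single c g) (L.constant (single d h)) (suc n)) (CommutativeRing.refl groupRing) }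

  monomial-* : ∀ c g e d h e′ → monomial c g e L.* monomial d h e′ L.≋ monomial (c K.* d) (g ⊞ h) (e N.+ e′)
  monomial-* c g e d h e′ = L.solve 4 (λ a x b y → (a :* x) :* (b :* y) , (a :* b) :* (x :* y)) (L.constant (single c g) ∷ L.X^ e ∷ L.constant (single d h) ∷ L.X^ e′ ∷ [])
    L.⟫ L.*-cong (L-const-* c g d h) (L.X^-+ e e′)

  monomial-cong : ∀ {c d g h e e′} → c K.≈ d → g ≡ h → e ≡ e′ → monomial c g e L.≋ monomial d h e′
  monomial-cong p refl refl = L.*-congʳ (L.coeffs λ { zero → single-cong p refl ; (suc n) → CommutativeRing.refl groupRing })

  monomial-1 : monomial K.1# origin 0 L.≋ L.1#
  monomial-1 = L.*-identityʳ _ L.⟫ (L.coeffs λ { zero → CommutativeRing.refl groupRing ; (suc n) → CommutativeRing.refl groupRing })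

  monomial-X^ : ∀ e → monomial K.1# origin e L.≋ L.X^ e
  monomial-X^ e = L.*-congʳ (L.≋-sym (L.*-identityʳ _) L.⟫ monomial-1) L.⟫ L.*-identityˡ _

  pairₛ-monomial : ∀ {φ} → Φ φ → ∀ c g e → pairₛ φ (monomial c g e) S.≋ S.constant (c K.* φ g) S.* S.X^ e
  pairₛ-monomial {φ} Φφ c g e = S.coeffs λ n → K.trans (test (L.at-constant* (single c g) (L.X^ e) n) φ Φφ)
    (K.trans (go e n) (K.sym (S.at-constant* (c K.* φ g) (S.X^ e) n)))
    where
    go : ∀ e n → pair φ (single c g ⋆ L.unit e n) K.≈ (c K.* φ g) K.* S.unit e n
    go zero zero = K.trans (K.+-identityʳ _) (K.trans (K.*-cong (K.*-identityʳ c) (K.reflexive (cong φ (⊞-identityʳ g)))) (K.sym (K.*-identityʳ _)))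
    go zero (suc n) = K.sym (K.zeroʳ _)
    go (suc e) zero = K.sym (K.zeroʳ _)
    go (suc e) (suc n) = go e n

  monomial-^ : ∀ c a b e n → monomial c (a , b) e L.^ n L.≋ monomial (c R.^ n) (+ n Z.* a , + n Z.* b) (n N.* e)
  monomial-^ c a b e zero = L.≋-sym monomial-1 L.⟫ monomial-cong K.refl (sym (cong₂ _,_ (Zₚ.*-zeroˡ a) (Zₚ.*-zeroˡ b))) refl
  monomial-^ c a b e (suc n) = L.*-congˡ (monomial-^ c a b e n) L.⟫ monomial-* _ _ _ _ _ _
    L.⟫ monomial-cong K.refl (cong₂ _,_ (sym (suc* a)) (sym (suc* b))) refl
    where
    suc* : ∀ a → + suc n Z.* a ≡ a Z.+ + n Z.* a
    suc* a = Zₚ.suc-* (+ n) a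

  -- The specialisation z = σ q^r [g]. The sign σ = -1 with g = (1 , 0) gives the alternating theta
  -- series; σ = 1 gives the lattice sums, where g records the exponents of z and of ζ.
  module MonomialTheta (σ : K.Carrier) (σ²≈1 : σ K.* σ K.≈ K.1#) (g : ℤ²) (r r′ b′ : ℕ) (r+r′ : r N.+ r′ ≡ suc b′) where
    private module B = TripleProduct.WithBase groupRing b′
    zᵐ wᵐ : L.Ser
    zᵐ = monomial σ g r
    wᵐ = monomial σ (Z.- proj₁ g , Z.- proj₂ g) r′

    zw : zᵐ L.* wᵐ L.≋ L.X^ (suc b′)
    zw = monomial-* σ g r σ _ r′ L.⟫ monomial-cong σ²≈1 (cong₂ _,_ (Zₚ.+-inverseʳ (proj₁ g)) (Zₚ.+-inverseʳ (proj₂ g))) r+r′ L.⟫ monomial-X^ (suc b′)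

    open B.At zᵐ wᵐ zw public
    open B public

    term-monomial : ∀ s → term s L.≋ monomial (σ R.^ Z.∣ s ∣) (s · g) (exponent r r′ s)
    term-monomial (+ n) = L.*-cong (monomial-^ σ (proj₁ g) (proj₂ g) r n) (B.Q≋X^ (triangle n) L.⟫ L.≋-sym (monomial-X^ _))
      L.⟫ monomial-* _ _ _ _ _ _ L.⟫ monomial-cong (K.*-identityʳ _) (⊞-identityʳ ((+ n) · g))
        (cong (λ b → n N.* r N.+ triangle n N.* b) (sym r+r′))
    term-monomial -[1+ n ] = L.*-cong (monomial-^ σ _ _ r′ (suc n)) (B.Q≋X^ (triangle (suc n)) L.⟫ L.≋-sym (monomial-X^ _))
      L.⟫ monomial-* _ _ _ _ _ _ L.⟫ monomial-cong (K.*-identityʳ _)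
        (⊞-identityʳ ((+ suc n) · (Z.- proj₁ g , Z.- proj₂ g)) ∙ cong₂ _,_ (flip (proj₁ g)) (flip (proj₂ g)))
        (cong (λ b → suc n N.* r′ N.+ triangle (suc n) N.* b) (sym r+r′))
      where
      flip : ∀ a → + suc n Z.* (Z.- a) ≡ -[1+ n ] Z.* a
      flip a = sym (Zₚ.neg-distribʳ-* (+ suc n) a) ∙ Zₚ.neg-distribˡ-* (+ suc n) a

-- Signs, exponents and theta series over ℚ

ℚ-ring ℤ-ring : CommutativeRing 0ℓ 0ℓ
ℚ-ring = ℚₚ.+-*-commutativeRing
ℤ-ring = Zₚ.+-*-commutativeRing

module ℤSolver = RingSolver ℤ-ring
open ℤSolver using () renaming (solve to solveℤ)
module ℚSolver = RingSolver ℚ-ring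

open PowerSeries ℚ-ring
open Summation ℚ-ring
open RingSolver seriesRing using (⟦_⟧; prove; proveModulo)
module LaurentSeries = Pairing ℚ-ring (λ _ → ⊤) (λ _ _ _ → tt)

signℕ : ℕ → ℤ
signℕ zero = + 1
signℕ (suc n) = Z.- signℕ n

sign : ℤ → ℤ
sign s = signℕ Z.∣ s ∣

signℕ-+ : ∀ m n → signℕ (m N.+ n) ≡ signℕ m Z.* signℕ n
signℕ-+ zero n = sym (Zₚ.*-identityˡ _)
signℕ-+ (suc m) n = cong Z.-_ (signℕ-+ m n) ∙ Zₚ.neg-distribˡ-* (signℕ m) (signℕ n)

sign-⊖ : ∀ m n → sign (m Z.⊖ n) ≡ signℕ m Z.* signℕ n
sign-⊖ zero zero = refl
sign-⊖ zero (suc n) = sym (Zₚ.*-identityˡ _)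
sign-⊖ (suc m) zero = sym (Zₚ.*-identityʳ _)
sign-⊖ (suc m) (suc n) = cong sign (Zₚ.[1+m]⊖[1+n]≡m⊖n m n) ∙ sign-⊖ m n
  ∙ solveℤ 2 (λ a b → a :* b , (:- a) :* (:- b)) (signℕ m ∷ signℕ n ∷ [])

sign-+ : ∀ x y → sign (x Z.+ y) ≡ sign x Z.* sign y
sign-+ (+ m) (+ n) = signℕ-+ m n
sign-+ (+ m) -[1+ n ] = sign-⊖ m (suc n)
sign-+ -[1+ m ] (+ n) = sign-⊖ n (suc m) ∙ Zₚ.*-comm (signℕ n) (signℕ (suc m))
sign-+ -[1+ m ] -[1+ n ] = cong signℕ (sym (Nₚ.+-suc (suc m) n)) ∙ signℕ-+ (suc m) (suc n)

sign-neg : ∀ x → sign (Z.- x) ≡ sign x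
sign-neg x = cong signℕ (Zₚ.∣-i∣≡∣i∣ x)

sign² : ∀ x → sign x Z.* sign x ≡ + 1
sign² x = go Z.∣ x ∣
  where
  go : ∀ n → signℕ n Z.* signℕ n ≡ + 1
  go zero = refl
  go (suc n) = solveℤ 1 (λ a → (:- a) :* (:- a) , a :* a) (signℕ n ∷ []) ∙ go n

sign-double : ∀ x → sign (x Z.+ x) ≡ + 1
sign-double x = sign-+ x x ∙ sign² x

+-injective2 : ∀ {m n} → + 2 Z.* + m ≡ + 2 Z.* + n → m ≡ n
+-injective2 {m} {n} e = Zₚ.+-injective (Zₚ.*-cancelˡ-≡ (+ 2) (+ m) (+ n) e)

triangle-ℤ : ∀ n → + 2 Z.* + triangle n ≡ + n Z.* + n Z.- + n
triangle-ℤ zero = refl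
triangle-ℤ (suc n) = begin
  + 2 Z.* (+ n Z.+ + triangle n)             ≡⟨ Zₚ.*-distribˡ-+ (+ 2) (+ n) (+ triangle n) ⟩
  + 2 Z.* + n Z.+ + 2 Z.* + triangle n       ≡⟨ cong (λ t → + 2 Z.* + n Z.+ t) (triangle-ℤ n) ⟩
  + 2 Z.* + n Z.+ (+ n Z.* + n Z.- + n)      ≡⟨ solveℤ 1 (λ n → nat 2 :* n :+ (n :* n :- n) , (:1 :+ n) :* (:1 :+ n) :- (:1 :+ n)) (+ n ∷ []) ⟩
  + suc n Z.* + suc n Z.- + suc n            ∎
  where open ≡.≡-Reasoning

exponent-ℤ : ∀ r r′ s → + 2 Z.* + exponent r r′ s ≡ + 2 Z.* s Z.* + r Z.+ (+ r Z.+ + r′) Z.* (s Z.* s Z.- s)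
exponent-ℤ r r′ (+ n) = begin
  + 2 Z.* + (n N.* r N.+ triangle n N.* (r N.+ r′))
    ≡⟨ cong (λ t → + 2 Z.* t) (cong₂ Z._+_ (Zₚ.pos-* n r) (Zₚ.pos-* (triangle n) (r N.+ r′))) ⟩
  + 2 Z.* (+ n Z.* + r Z.+ + triangle n Z.* (+ r Z.+ + r′))
    ≡⟨ solveℤ 4 (λ n r t b → nat 2 :* (n :* r :+ t :* b) , nat 2 :* n :* r :+ b :* (nat 2 :* t)) (+ n ∷ + r ∷ + triangle n ∷ + r Z.+ + r′ ∷ []) ⟩
  + 2 Z.* + n Z.* + r Z.+ (+ r Z.+ + r′) Z.* (+ 2 Z.* + triangle n)
    ≡⟨ cong (λ t → + 2 Z.* + n Z.* + r Z.+ (+ r Z.+ + r′) Z.* t) (triangle-ℤ n) ⟩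
  + 2 Z.* + n Z.* + r Z.+ (+ r Z.+ + r′) Z.* (+ n Z.* + n Z.- + n) ∎
  where open ≡.≡-Reasoning
exponent-ℤ r r′ -[1+ m ] = begin
  + 2 Z.* + (n N.* r′ N.+ triangle n N.* (r N.+ r′))
    ≡⟨ cong (λ t → + 2 Z.* t) (cong₂ Z._+_ (Zₚ.pos-* n r′) (Zₚ.pos-* (triangle n) (r N.+ r′))) ⟩
  + 2 Z.* (+ n Z.* + r′ Z.+ + triangle n Z.* (+ r Z.+ + r′))
    ≡⟨ solveℤ 4 (λ n r t b → nat 2 :* (n :* r :+ t :* b) , nat 2 :* n :* r :+ b :* (nat 2 :* t)) (+ n ∷ + r′ ∷ + triangle n ∷ + r Z.+ + r′ ∷ []) ⟩
  + 2 Z.* + n Z.* + r′ Z.+ (+ r Z.+ + r′) Z.* (+ 2 Z.* + triangle n)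
    ≡⟨ cong (λ t → + 2 Z.* + n Z.* + r′ Z.+ (+ r Z.+ + r′) Z.* t) (triangle-ℤ n) ⟩
  + 2 Z.* + n Z.* + r′ Z.+ (+ r Z.+ + r′) Z.* (+ n Z.* + n Z.- + n)
    ≡⟨ solveℤ 3 (λ n r r′ → nat 2 :* n :* r′ :+ (r :+ r′) :* (n :* n :- n) ,
          nat 2 :* (:- n) :* r :+ (r :+ r′) :* ((:- n) :* (:- n) :- (:- n))) (+ n ∷ + r ∷ + r′ ∷ []) ⟩
  + 2 Z.* -[1+ m ] Z.* + r Z.+ (+ r Z.+ + r′) Z.* (-[1+ m ] Z.* -[1+ m ] Z.- -[1+ m ]) ∎
  where open ≡.≡-Reasoning
        n = suc m

term⟨_,_⟩ : ℤ → ℕ → Ser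
term⟨ x , e ⟩ = fromℤ x * X^ e

term-* : ∀ x e y f → term⟨ x , e ⟩ * term⟨ y , f ⟩ ≋ term⟨ x Z.* y , e N.+ f ⟩
term-* x e y f = solve 4 (λ a b c d → (a :* b) :* (c :* d) , (a :* c) :* (b :* d)) (fromℤ x ∷ X^ e ∷ fromℤ y ∷ X^ f ∷ [])
  ⟫ *-cong (≋-sym (fromℤ-* x y)) (X^-+ e f)

term-cong : ∀ {x y e f} → x ≡ y → e ≡ f → term⟨ x , e ⟩ ≋ term⟨ y , f ⟩
term-cong refl refl = ≋-refl

term-scale : ∀ x y e → fromℤ x * term⟨ y , e ⟩ ≋ term⟨ x Z.* y , e ⟩
term-scale x y e = ≋-sym (*-assoc (fromℤ x) (fromℤ y) (X^ e)) ⟫ *-congʳ (≋-sym (fromℤ-* x y))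

constant-+ : ∀ c d → constant (c ℚ.+ d) ≋ constant c + constant d
constant-+ c d = coeffs λ { zero → refl ; (suc n) → sym (ℚₚ.+-identityˡ 0ℚ) }

constant-neg : ∀ c → constant (ℚ.- c) ≋ - constant c
constant-neg c = coeffs λ { zero → refl ; (suc n) → refl }

constant-1 : constant 1ℚ ≋ 1#
constant-1 = coeffs λ { zero → refl ; (suc n) → refl }

constant-0 : constant 0ℚ ≋ 0#
constant-0 = coeffs λ { zero → refl ; (suc n) → refl }

constant-fromℤ : ∀ x → constant (ℚSolver.fromℤ x) ≋ fromℤ x
constant-fromℤ x = go x
  where
  goℕ : ∀ n → constant (ℚSolver.fromℕ n) ≋ fromℕ n
  goℕ zero = constant-0
  goℕ (suc n) = constant-+ 1ℚ (ℚSolver.fromℕ n) ⟫ +-cong constant-1 (goℕ n)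
  go : ∀ x → constant (ℚSolver.fromℤ x) ≋ fromℤ x
  go (+ n) = goℕ n
  go -[1+ n ] = constant-neg _ ⟫ -‿cong (goℕ (suc n))

cancel-2 : ∀ {f g} → f + f ≋ g + g → f ≋ g
cancel-2 {f} {g} p = coeffs λ n → halve (at f n) (at g n) (coeff p n)
  where
  double : ∀ x → x ℚ.+ x ≡ (1ℚ ℚ.+ 1ℚ) ℚ.* x
  double x = ℚSolver.solve 1 (λ x → x :+ x , (:1 :+ :1) :* x) (x ∷ [])
  halve : ∀ x y → x ℚ.+ x ≡ y ℚ.+ y → x ≡ y
  halve x y e = begin
    x                            ≡⟨ ℚₚ.*-identityˡ x ⟨
    (ℚ.½ ℚ.* (1ℚ ℚ.+ 1ℚ)) ℚ.* x  ≡⟨ ℚₚ.*-assoc ℚ.½ (1ℚ ℚ.+ 1ℚ) x ⟩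
    ℚ.½ ℚ.* ((1ℚ ℚ.+ 1ℚ) ℚ.* x)  ≡⟨ cong (ℚ.½ ℚ.*_) (sym (double x) ∙ e ∙ double y) ⟩
    ℚ.½ ℚ.* ((1ℚ ℚ.+ 1ℚ) ℚ.* y)  ≡⟨ ℚₚ.*-assoc ℚ.½ (1ℚ ℚ.+ 1ℚ) y ⟨
    (ℚ.½ ℚ.* (1ℚ ℚ.+ 1ℚ)) ℚ.* y  ≡⟨ ℚₚ.*-identityˡ y ⟩
    y                            ∎
    where open ≡.≡-Reasoning

cancel-neg : ∀ {f} → f ≋ - f → f ≋ 0#
cancel-neg {f} p = cancel-2 (+-congˡ p ⟫ -‿inverseʳ f ⟫ ≋-sym (+-identityˡ 0#))

-- (q^b ; q^b)_∞ with b = suc b′.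
module _ (b′ : ℕ) where
  private module B = TripleProduct.WithBase ℚ-ring b′

  poch : Ser
  poch .at n = at (B.qfac n) n

  poch-tends : Tends B.qfac poch
  poch-tends N M N≤M = below λ n n<N → upto (B.qfac-stable (Nₚ.≤-trans (Nₚ.<⇒≤ n<N) N≤M)) n Nₚ.≤-refl

  Monic-poch : Monic poch
  Monic-poch = monic refl

module Theta (r r′ b′ : ℕ) (r+r′ : r N.+ r′ ≡ suc b′) where
  open LaurentSeries using (pairₛ; pairₛ-cong; pairₛ-cong[]; pairₛ-single; pairₛ-X^; pairₛ-+; pairₛ-congˡ; pairₛ-monomial; HasSum-pair; module L; monomial)
  module M = LaurentSeries.MonomialTheta (ℚ.- 1ℚ) refl (+ 1 , + 0) r r′ b′ r+r′
  private module B = TripleProduct.WithBase ℚ-ring b′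

  -- Sends zˢ to w(s). For w = 1 this sets z = 1, and for w(s) = sᵏ it applies z d/dz k times before
  -- setting z = 1.
  weighted : (ℤ → ℤ) → ℤ² → ℚ
  weighted w (s , _) = ℚSolver.fromℤ (w s)

  moment : (ℤ → ℤ) → L.Ser → Ser
  moment w = pairₛ (weighted w)

  theta : (ℤ → ℤ) → Ser
  theta w .at n = at (moment w M.theta) n

  moment-theta : ∀ w → moment w M.theta ≋ theta w
  moment-theta w = coeffs λ _ → refl

  private
    sign-power : ∀ n → (ℚ.- 1ℚ) ℚSolver.^ n ≡ ℚSolver.fromℤ (signℕ n)
    sign-power zero = refl
    sign-power (suc n) = cong ((ℚ.- 1ℚ) ℚ.*_) (sign-power n)
      ∙ ℚSolver.solve 1 (λ a → (:- :1) :* a , :- a) (ℚSolver.fromℤ (signℕ n) ∷ []) ∙ sym (ℚSolver.fromℤ-neg (signℕ n))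

  HasSum-theta : ∀ w → HasSum (λ s → term⟨ sign s Z.* w s , exponent r r′ s ⟩) (theta w)
  HasSum-theta w = HasSum-cong (λ s → pairₛ-cong tt (M.term-monomial s) ⟫ pairₛ-monomial tt _ (s · (+ 1 , + 0)) (exponent r r′ s)
    ⟫ *-congʳ (≋-reflexive (cong constant (cong₂ ℚ._*_ (sign-power Z.∣ s ∣) (cong (λ t → ℚSolver.fromℤ (w t)) (Zₚ.*-identityʳ s))
      ∙ sym (ℚSolver.fromℤ-* (sign s) (w s)))) ⟫ constant-fromℤ (sign s Z.* w s))) (moment-theta w)
    (HasSum-pair tt M.HasSum-theta)

  -- Multiplication by a power of z translates the weight, so a linear factor acts on moments as a
  -- difference operator.
  moment-factor : ∀ c e w i f → moment w ((L.1# L.+ monomial (ℚ.- 1ℚ) (c , + 0) e L.* M.Q i) L.* f) ≋ moment w f - X^ (e N.+ i N.* suc b′) * moment (λ s → w (c Z.+ s)) f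
  moment-factor c e w i f = pairₛ-cong tt (L.solve 4 (λ c x q f → (:1 :+ (c :* x) :* q) :* f , f :+ c :* ((x :* q) :* f)) (C ∷ L.X^ e ∷ M.Q i ∷ f ∷ [])
      L.⟫ L.+-congˡ (L.*-congˡ (L.*-congʳ (L.*-congˡ (M.Q≋X^ i) L.⟫ L.X^-+ e (i N.* suc b′)))))
    ⟫ pairₛ-+ (weighted w) f _ ⟫ +-congˡ (pairₛ-single tt (ℚ.- 1ℚ) (c , + 0) (L.X^ (e N.+ i N.* suc b′) L.* f)
      ⟫ *-cong (constant-neg 1ℚ ⟫ -‿cong constant-1) (pairₛ-X^ tt (e N.+ i N.* suc b′) f) ⟫ solve 1 (λ a → (:- :1) :* a , :- a) (_ ∷ []))
    where C = L.constant (LaurentSeries.single (ℚ.- 1ℚ) (c , + 0))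

  moment-z : ∀ w i f → moment w ((L.1# L.+ M.zᵐ L.* M.Q i) L.* f) ≋ moment w f - X^ (r N.+ i N.* suc b′) * moment (λ s → w (+ 1 Z.+ s)) f
  moment-z = moment-factor (+ 1) r

  moment-w : ∀ w i f → moment w ((L.1# L.+ M.wᵐ L.* M.Q i) L.* f) ≋ moment w f - X^ (r′ N.+ i N.* suc b′) * moment (λ s → w (-[1+ 0 ] Z.+ s)) f
  moment-w = moment-factor -[1+ 0 ] r′

  moment-qfac : ∀ w n f → moment w (M.qfac n L.* f) ≋ B.qfac n * moment w f
  moment-qfac w = LaurentSeries.pairₛ-qfac tt b′

  theta-tends : ∀ w → Tends (λ m → moment w (M.qfac m L.* (M.prodZ m L.* M.prodW m))) (theta w)
  theta-tends w N m N≤m = ≈[]-trans (pairₛ-cong[] tt (M.triple-product N m N≤m)) (≋⇒≈[] (moment-theta w))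

  zFactors wFactors : ℕ → Ser
  zFactors zero = 1#
  zFactors (suc i) = zFactors i * (1# - X^ (r N.+ i N.* suc b′))
  wFactors zero = 1#
  wFactors (suc i) = wFactors i * (1# - X^ (r′ N.+ i N.* suc b′))

  one : ℤ → ℤ
  one _ = + 1

  moment-prodZ : ∀ n f → moment one (M.prodZ n L.* f) ≋ zFactors n * moment one f
  moment-prodZ zero f = pairₛ-cong tt (L.*-identityˡ f) ⟫ ≋-sym (*-identityˡ _)
  moment-prodZ (suc n) f = pairₛ-cong tt (L.*-assoc (M.prodZ n) _ f) ⟫ moment-prodZ n _
    ⟫ *-congˡ (moment-z one n f ⟫ solve 2 (λ x f → f :- x :* f , (:1 :- x) :* f) (X^ (r N.+ n N.* suc b′) ∷ moment one f ∷ []))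
      ⟫ ≋-sym (*-assoc _ _ _)

  moment-prodW : ∀ n f → moment one (M.prodW n L.* f) ≋ wFactors n * moment one f
  moment-prodW zero f = pairₛ-cong tt (L.*-identityˡ f) ⟫ ≋-sym (*-identityˡ _)
  moment-prodW (suc n) f = pairₛ-cong tt (L.*-assoc (M.prodW n) _ f) ⟫ moment-prodW n _
    ⟫ *-congˡ (moment-w one n f ⟫ solve 2 (λ x f → f :- x :* f , (:1 :- x) :* f) (X^ (r′ N.+ n N.* suc b′) ∷ moment one f ∷ []))
      ⟫ ≋-sym (*-assoc _ _ _)

  moment-1 : ∀ w → moment w L.1# ≋ fromℤ (w (+ 0))
  moment-1 w = pairₛ-cong tt (L.≋-sym LaurentSeries.monomial-1) ⟫ pairₛ-monomial tt 1ℚ origin 0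
    ⟫ *-identityʳ _ ⟫ ≋-reflexive (cong constant (ℚₚ.*-identityˡ (ℚSolver.fromℤ (w (+ 0))))) ⟫ constant-fromℤ (w (+ 0))

  -- A constant weight is invariant under translation, so every linear factor leaves the pairing as
  -- an ordinary factor 1 - q^k.
  theta-product : Tends (λ m → B.qfac m * (zFactors m * wFactors m)) (theta one)
  theta-product = Tends-cong (λ m → moment-qfac one m _ ⟫ *-congˡ (moment-prodZ m (M.prodW m)
    ⟫ *-congˡ (pairₛ-cong tt (L.≋-sym (L.*-identityʳ (M.prodW m))) ⟫ moment-prodW m L.1#
      ⟫ *-congˡ (moment-1 one ⟫ fromℤ-1) ⟫ *-identityʳ _))) (theta-tends one)

-- The auxiliary function of Defs.invRev is private; it is recovered here by unification, after
-- generalising its index argument.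
mutual
  dot : PS → List ℚ → ℕ → ℚ
  dot = _

  inv-suc : ∀ f (n i : ℕ) → i ≡ 0 → inv f (suc n) ≡ ℚ.- dot f (invRev f n) i
  inv-suc f n i eq with invRev f n
  ... | w with 0
  inv-suc f n i refl | w | .i = refl

module Fℚ = FiniteSums ℚ-ring

dot-conv : ∀ f n i → dot f (invRev f n) i ≡ conv (λ j → f (suc (i N.+ j))) (inv f) n
dot-conv f zero i rewrite Nₚ.+-identityʳ i = ℚₚ.+-comm (f (suc i) ℚ.* 1ℚ) 0ℚ
dot-conv f (suc n) i = cong₂ (λ j c → f (suc j) ℚ.* inv f (suc n) ℚ.+ c) (sym (Nₚ.+-identityʳ i))
    (dot-conv f n (suc i) ∙ Fℚ.conv-cong n {g = inv f} (λ j → cong (λ k → f (suc k)) (sym (Nₚ.+-suc i j))) (λ _ → refl))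
  ∙ sym (Fℚ.conv-front (λ j → f (suc (i N.+ j))) (inv f) n)

infix 8 _⁻¹
_⁻¹ : Ser → Ser
(f ⁻¹) .at = inv (at f)

⁻¹-inverse : ∀ {f} → Monic f → f * f ⁻¹ ≋ 1#
⁻¹-inverse {f} f0 = coeffs λ
  { zero → ℚₚ.+-identityˡ (at f 0 ℚ.* 1ℚ) ∙ ℚₚ.*-identityʳ (at f 0) ∙ leading f0
  ; (suc n) → Fℚ.conv-front (at f) (inv (at f)) n ∙ cong₂ ℚ._+_ (cong₂ ℚ._*_ (leading f0) (inv-suc (at f) n 0 refl ∙ cong ℚ.-_ (dot-conv (at f) n 0))
        ∙ ℚₚ.*-identityˡ (ℚ.- conv (tail (at f)) (inv (at f)) n)) refl
      ∙ ℚₚ.+-inverseˡ (conv (tail (at f)) (inv (at f)) n) }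

⁻¹-unique : ∀ {f g} → Monic f → f * g ≋ 1# → g ≋ f ⁻¹
⁻¹-unique f0 e = Monic-cancel f0 (e ⟫ ≋-sym (⁻¹-inverse f0))

divide : ∀ {f g h} → Monic f → f * g ≋ h → g ≋ h * f ⁻¹
divide {f} {g} {h} f0 e = Monic-cancel f0 (e ⟫ ≋-sym (solve 3 (λ f h i → f :* (h :* i) , h :* (f :* i)) (f ∷ h ∷ f ⁻¹ ∷ []) ⟫ *-congˡ (⁻¹-inverse f0) ⟫ *-identityʳ h))

Monic-1-X^ : ∀ n → Monic (1# - X^ (suc n))
Monic-1-X^ n = monic refl

-- The factors of (q^b; q^b)_∞, with b = c + 1, are sorted by their index modulo 3: the residues 1,
-- 2 and 0 give the three products of a triple product with base q^(3b).
pentagonal : ∀ c → Theta.theta (suc c) (suc c N.+ suc c) (c N.+ (suc c N.+ suc c)) refl (λ _ → + 1) ≋ poch c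
pentagonal c = Tends-unique T.theta-product (Tends-cong triple (Tends-sub (N._* 3) (λ n → Nₚ.m≤m*n n 3) (poch-tends c)))
  where
  module T = Theta (suc c) (suc c N.+ suc c) (c N.+ (suc c N.+ suc c)) refl
  module B1 = TripleProduct.WithBase ℚ-ring c
  module B3 = TripleProduct.WithBase ℚ-ring (c N.+ (suc c N.+ suc c))
  factor : ∀ n {e} → n N.* suc c ≡ e → 1# - B1.Q n ≋ 1# - X^ e
  factor n refl = +-congˡ (-‿cong (B1.Q≋X^ n))
  lem1 : ∀ m c → suc (m N.* 3) N.* suc c ≡ suc c N.+ m N.* (suc c N.+ (suc c N.+ suc c))
  lem1 = ℕ-solve-∀
  lem2 : ∀ m c → suc (suc (m N.* 3)) N.* suc c ≡ suc c N.+ suc c N.+ m N.* (suc c N.+ (suc c N.+ suc c))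
  lem2 = ℕ-solve-∀
  lem3 : ∀ m c → suc (suc (suc (m N.* 3))) N.* suc c ≡ suc m N.* (suc c N.+ (suc c N.+ suc c))
  lem3 = ℕ-solve-∀
  triple : ∀ m → B1.qfac (m N.* 3) ≋ B3.qfac m * (T.zFactors m * T.wFactors m)
  triple zero = ≋-sym (*-identityˡ _ ⟫ *-identityˡ _)
  triple (suc m) = *-cong (*-cong (*-cong (triple m) (factor _ (lem1 m c))) (factor _ (lem2 m c))) (factor _ (lem3 m c))
    ⟫ solve 6 (λ a b c x y z → (((a :* (b :* c)) :* x) :* y) :* z , (a :* z) :* ((b :* x) :* (c :* y)))
        (B3.qfac m ∷ T.zFactors m ∷ T.wFactors m ∷ 1# - X^ (suc c N.+ m N.* (suc c N.+ (suc c N.+ suc c))) ∷ 1# - X^ (suc c N.+ suc c N.+ m N.* (suc c N.+ (suc c N.+ suc c))) ∷ 1# - X^ (suc m N.* (suc c N.+ (suc c N.+ suc c))) ∷ [])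
      ⟫ *-congʳ (*-congˡ (+-congˡ (-‿cong (≋-sym (B3.Q≋X^ (suc m))))))

-- Pairing (1 - z)F with the weight s ↦ s leaves minus the value of F at z = 1.
jacobi : ∀ b′ → Theta.theta 0 (suc b′) b′ refl (λ s → s) ≋ - (poch b′ ^ 3)
jacobi b′ = Tends-unique (Tends-sub suc Nₚ.n≤1+n (T.theta-tends position))
  (λ N m N≤m → ≈[]-trans (≋⇒≈[] (finiteValue m)) (≈[]-neg (≈[]-* (poch-tends b′ N (suc m) (Nₚ.m≤n⇒m≤1+n N≤m))
    (≈[]-* (poch-tends b′ N m N≤m) (≈[]-trans (poch-tends b′ N (suc m) (Nₚ.m≤n⇒m≤1+n N≤m)) (≋⇒≈[] (≋-sym (*-identityʳ _))))))))
  where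
  position : ℤ → ℤ
  position s = s
  module T = Theta 0 (suc b′) b′ refl
  module B = TripleProduct.WithBase ℚ-ring b′
  open LaurentSeries using (pairₛ-cong; pair-cong; pair-+; module L)
  prodZ′ : ℕ → L.Ser
  prodZ′ zero = L.1#
  prodZ′ (suc m) = prodZ′ m L.* (L.1# L.+ T.M.zᵐ L.* T.M.Q (suc m))
  front : ∀ m → T.M.prodZ (suc m) L.≋ (L.1# L.+ T.M.zᵐ L.* T.M.Q 0) L.* prodZ′ m
  front zero = L.*-comm _ _
  front (suc m) = L.*-congʳ (front m) L.⟫ L.*-assoc _ _ _
  moment-suc : ∀ f → T.moment (λ s → + 1 Z.+ s) f ≋ T.moment T.one f + T.moment position f
  moment-suc f = coeffs λ n → pair-cong (L.at f n) (λ { (s , _) → ℚSolver.fromℤ-+ (+ 1) s }) ∙ pair-+ (T.weighted T.one) (T.weighted position) (L.at f n)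
  moment-first : ∀ f → T.moment position ((L.1# L.+ T.M.zᵐ L.* T.M.Q 0) L.* f) ≋ - T.moment T.one f
  moment-first f = T.moment-z position 0 f ⟫ +-congˡ (-‿cong (*-identityˡ _ ⟫ moment-suc f))
    ⟫ solve 2 (λ a b → b :- (a :+ b) , :- a) (T.moment T.one f ∷ T.moment position f ∷ [])
  moment-prodZ′ : ∀ m f → T.moment T.one (prodZ′ m L.* f) ≋ B.qfac m * T.moment T.one f
  moment-prodZ′ zero f = pairₛ-cong tt (L.*-identityˡ f) ⟫ ≋-sym (*-identityˡ _)
  moment-prodZ′ (suc m) f = pairₛ-cong tt (L.*-assoc (prodZ′ m) _ f) ⟫ moment-prodZ′ m _
    ⟫ *-congˡ (T.moment-z T.one (suc m) f ⟫ +-congˡ (-‿cong (*-congʳ (≋-sym (B.Q≋X^ (suc m)))))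
       ⟫ solve 2 (λ x f → f :- x :* f , (:1 :- x) :* f) (B.Q (suc m) ∷ T.moment T.one f ∷ []))
      ⟫ ≋-sym (*-assoc _ _ _)
  wFactors-qfac : ∀ m → T.wFactors m ≋ B.qfac m
  wFactors-qfac zero = ≋-refl
  wFactors-qfac (suc m) = *-cong (wFactors-qfac m) (+-congˡ (-‿cong (≋-sym (B.Q≋X^ (suc m)))))
  moment-prodW : ∀ m → T.moment T.one (T.M.prodW m) ≋ B.qfac m
  moment-prodW m = pairₛ-cong tt (L.≋-sym (L.*-identityʳ (T.M.prodW m))) ⟫ T.moment-prodW m L.1#
    ⟫ *-cong (wFactors-qfac m) (T.moment-1 T.one ⟫ fromℤ-1) ⟫ *-identityʳ _
  finiteValue : ∀ m → T.moment position (T.M.qfac (suc m) L.* (T.M.prodZ (suc m) L.* T.M.prodW (suc m))) ≋ - (B.qfac (suc m) * (B.qfac m * B.qfac (suc m)))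
  finiteValue m = T.moment-qfac position (suc m) _ ⟫ *-congˡ (pairₛ-cong tt (L.*-congʳ (front m) L.⟫ L.*-assoc _ (prodZ′ m) _)
      ⟫ moment-first (prodZ′ m L.* T.M.prodW (suc m)) ⟫ -‿cong (moment-prodZ′ m (T.M.prodW (suc m)) ⟫ *-congˡ (moment-prodW (suc m))))
    ⟫ solve 2 (λ a b → a :* (:- b) , :- (a :* b)) (B.qfac (suc m) ∷ B.qfac m * B.qfac (suc m) ∷ [])

-- Third logarithmic derivatives

module _ where
  open FiniteSums seriesRing using (sum<)

  sum<-limit : (ℕ → Ser) → Ser
  sum<-limit a .at n = at (sum< (suc n) a) n

  sum<-tends : ∀ a → (∀ i → Vanishes i (a i)) → Tends (λ n → sum< n a) (sum<-limit a)
  sum<-tends a v N M N≤M = below λ n n<N → stable n M (Nₚ.≤-trans n<N N≤M)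
    where
    stable : ∀ n M → n < M → at (sum< M a) n ≡ at (sum< (suc n) a) n
    stable n (suc M) (s≤s n≤M) with Nₚ.m≤n⇒∃[o]m+o≡n n≤M
    ... | o , refl = go o
      where
      go : ∀ o → at (sum< (suc (n N.+ o)) a) n ≡ at (sum< (suc n) a) n
      go zero rewrite Nₚ.+-identityʳ n = refl
      go (suc o) rewrite Nₚ.+-suc n o = cong (at (sum< (suc (n N.+ o)) a) n ℚ.+_) (upto (v (suc (n N.+ o))) n (s≤s (Nₚ.m≤m+n n o)))
        ∙ ℚₚ.+-identityʳ (at (sum< (suc (n N.+ o)) a) n) ∙ go o

-- Numerator W of the third logarithmic derivative (log f)''' = W / f⁴ of a function with derivatives J1, J2, J3.
thirdLog : Ser → Ser → Ser → Ser → Ser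
thirdLog J0 J1 J2 J3 = J0 ^ 3 * J3 - fromℤ (+ 3) * (J0 ^ 2 * (J1 * J2)) + fromℤ (+ 2) * (J0 * J1 ^ 3)

thirdLog-cong : ∀ {a a′ b b′ c c′ d d′} → a ≋ a′ → b ≋ b′ → c ≋ c′ → d ≋ d′ → thirdLog a b c d ≋ thirdLog a′ b′ c′ d′
thirdLog-cong p q s t = +-cong (+-cong (*-cong (^-congˡ 3 p) t) (-‿cong (*-congˡ (*-cong (^-congˡ 2 p) (*-cong q s)))))
  (*-congˡ (*-cong p (^-congˡ 3 q)))

thirdLog-cong[] : ∀ {N a a′ b b′ c c′ d d′} → a ≈[ N ] a′ → b ≈[ N ] b′ → c ≈[ N ] c′ → d ≈[ N ] d′ →
                  thirdLog a b c d ≈[ N ] thirdLog a′ b′ c′ d′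
thirdLog-cong[] p q s t = ≈[]-+ (≈[]-+ (≈[]-* (≈[]-^ 3 p) t) (≈[]-neg (≈[]-* ≈[]-refl (≈[]-* (≈[]-^ 2 p) (≈[]-* q s)))))
  (≈[]-* ≈[]-refl (≈[]-* p (≈[]-^ 3 q)))

-- The arguments are the moments of a function with value qt and logarithmic derivatives a, b, c;
-- the third cumulant returns c. The factor q is free of z and passes through.
thirdLog-log : ∀ q t a b c → thirdLog (q * t) (q * (t * a)) (q * (t * (a * a + b))) (q * (t * (a * a * a + fromℤ (+ 3) * (a * b) + c))) ≋ (q * t) ^ 4 * c
thirdLog-log q t a b c = solve 5 (λ q t a b c →
  (q :* t) :^ 3 :* (q :* (t :* (a :* a :* a :+ nat 3 :* (a :* b) :+ c))) :- nat 3 :* ((q :* t) :^ 2 :* ((q :* (t :* a)) :* (q :* (t :* (a :* a :+ b))))) :+ nat 2 :* ((q :* t) :* (q :* (t :* a)) :^ 3) ,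
  (q :* t) :^ 4 :* c) (q ∷ t ∷ a ∷ b ∷ c ∷ [])

-- `cubicPole j` is the sum of m² q^(jm) over m ≥ 1, that is, minus the third derivative of log (1 -
-- z q^j) with respect to z d/dz at z = 1.
geometric cubicPole : ℕ → Ser
geometric j = (1# - X^ j) ⁻¹
cubicPole j = X^ j * (1# + X^ j) * geometric j ^ 3

power : ℕ → ℤ → ℤ
power k s = s ℤSolver.^ k

module LogDerivative (r0 r0′ b′ : ℕ) (r+r′ : suc r0 N.+ suc r0′ ≡ suc b′) where
  open Theta (suc r0) (suc r0′) b′ r+r′
  open LaurentSeries using (pairₛ-cong; pairₛ-congˡ; pair-cong; pair-+; pair-negate; module L)
  open FiniteSums seriesRing using (sum<)
  private
    module B = TripleProduct.WithBase ℚ-ring b′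

    moment-≡ : ∀ {w w′} f → (∀ s → w s ≡ w′ s) → moment w f ≋ moment w′ f
    moment-≡ f h = pairₛ-congˡ f (λ { (s , _) → cong ℚSolver.fromℤ (h s) })

    moment-+ : ∀ w w′ f → moment (λ s → w s Z.+ w′ s) f ≋ moment w f + moment w′ f
    moment-+ w w′ f = coeffs λ n → pair-cong (L.at f n) (λ { (s , _) → ℚSolver.fromℤ-+ (w s) (w′ s) })
      ∙ pair-+ (weighted w) (weighted w′) (L.at f n)

    moment-* : ∀ c w f → moment (λ s → c Z.* w s) f ≋ fromℤ c * moment w f
    moment-* c w f = coeffs λ n → pair-cong (L.at f n) (λ { (s , _) → ℚSolver.fromℤ-* c (w s) })
      ∙ LaurentSeries.pair-* (ℚSolver.fromℤ c) (weighted w) (L.at f n)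
        ∙ sym (at-constant* (ℚSolver.fromℤ c) (moment w f) n) ∙ coeff (*-congʳ {x = moment w f} (constant-fromℤ c)) n

    J : ℕ → L.Ser → Ser
    J k f = moment (power k) f

    combine : ∀ a0 a1 a2 a3 f → moment (λ s → a0 Z.* power 0 s Z.+ (a1 Z.* power 1 s Z.+ (a2 Z.* power 2 s Z.+ a3 Z.* power 3 s))) f
              ≋ fromℤ a0 * J 0 f + (fromℤ a1 * J 1 f + (fromℤ a2 * J 2 f + fromℤ a3 * J 3 f))
    combine a0 a1 a2 a3 f = moment-+ (λ s → a0 Z.* power 0 s) w1 f ⟫ +-cong (moment-* a0 (power 0) f) (moment-+ (λ s → a1 Z.* power 1 s) w2 f
      ⟫ +-cong (moment-* a1 (power 1) f) (moment-+ (λ s → a2 Z.* power 2 s) (λ s → a3 Z.* power 3 s) f ⟫ +-cong (moment-* a2 (power 2) f) (moment-* a3 (power 3) f)))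
      where
      w2 w1 : ℤ → ℤ
      w2 s = a2 Z.* power 2 s Z.+ a3 Z.* power 3 s
      w1 s = a1 Z.* power 1 s Z.+ (a2 Z.* power 2 s Z.+ a3 Z.* power 3 s)

  -- l0, l1 and l2 are the first three derivatives of log f at z = 1. Writing the moments through
  -- them, and not conversely, avoids dividing by the value t.
  record LogData (f : L.Ser) (t l0 l1 l2 : Ser) : Set where
    field
      d0 : J 0 f ≋ t
      d1 : J 1 f ≋ t * l0
      d2 : J 2 f ≋ t * (l0 * l0 + l1)
      d3 : J 3 f ≋ t * (l0 * l0 * l0 + fromℤ (+ 3) * (l0 * l1) + l2)

  LogData-cong : ∀ {f g t t′ l0 l1 l2} → f L.≋ g → t ≋ t′ → LogData f t l0 l1 l2 → LogData g t′ l0 l1 l2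
  LogData-cong p q D = record
    { d0 = pairₛ-cong tt (L.≋-sym p) ⟫ d0 ⟫ q
    ; d1 = pairₛ-cong tt (L.≋-sym p) ⟫ d1 ⟫ *-congʳ q
    ; d2 = pairₛ-cong tt (L.≋-sym p) ⟫ d2 ⟫ *-congʳ q
    ; d3 = pairₛ-cong tt (L.≋-sym p) ⟫ d3 ⟫ *-congʳ q }
    where open LogData D

  LogData-1 : LogData L.1# 1# 0# 0# 0#
  LogData-1 = record
    { d0 = moment-1 (power 0) ⟫ fromℤ-1
    ; d1 = moment-1 (power 1) ⟫ ≋-sym (zeroʳ 1#)
    ; d2 = moment-1 (power 2) ⟫ solve 0 (nat 0 , :1 :* (nat 0 :* nat 0 :+ nat 0)) []
    ; d3 = moment-1 (power 3) ⟫ solve 0 (nat 0 , :1 :* (nat 0 :* nat 0 :* nat 0 :+ nat 3 :* (nat 0 :* nat 0) :+ nat 0)) [] }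

  -- Multiplication by 1 - y z^ε with y = q^(j+1) and ε = ±1.
  module Step {f t l0 l1 l2} (D : LogData f t l0 l1 l2) (ε : ℤ) (ε² : ε Z.* ε ≡ + 1) (j : ℕ) (f′ : L.Ser)
              (shifted : ∀ w → moment w f′ ≋ moment w f - X^ (suc j) * moment (λ s → w (ε Z.+ s)) f) where
    open LogData D
    private
      y u σ : Ser
      y = X^ (suc j)
      u = geometric (suc j)
      σ = fromℤ ε

      next : ∀ k {x} → J k f ≋ x → ∀ a0 a1 a2 a3 {x0 x1 x2 x3} → fromℤ a0 ≋ x0 → fromℤ a1 ≋ x1 → fromℤ a2 ≋ x2 → fromℤ a3 ≋ x3 →
             (∀ s → power k (ε Z.+ s) ≡ a0 Z.* power 0 s Z.+ (a1 Z.* power 1 s Z.+ (a2 Z.* power 2 s Z.+ a3 Z.* power 3 s))) →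
             J k f′ ≋ x - y * (x0 * t + (x1 * (t * l0) + (x2 * (t * (l0 * l0 + l1)) + x3 * (t * (l0 * l0 * l0 + fromℤ (+ 3) * (l0 * l1) + l2)))))
      next k d a0 a1 a2 a3 e0 e1 e2 e3 h = shifted (power k) ⟫ +-cong d (-‿cong (*-congˡ (moment-≡ f h ⟫ combine a0 a1 a2 a3 f
        ⟫ +-cong (*-cong e0 d0) (+-cong (*-cong e1 d1) (+-cong (*-cong e2 d2) (*-cong e3 d3))))))

      τ Y A B C U S m2 m3 A′ B′ : Expr 7
      τ = var (Fin.# 0)
      Y = var (Fin.# 1)
      A = var (Fin.# 2)
      B = var (Fin.# 3)
      C = var (Fin.# 4)
      U = var (Fin.# 5)
      S = var (Fin.# 6)
      m2 = A :* A :+ B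
      m3 = A :* A :* A :+ nat 3 :* (A :* B) :+ C
      A′ = A :- S :* (Y :* U)
      B′ = B :- Y :* U :^ 2

      new : Expr 7 → Expr 7 → Expr 7 → Expr 7 → Expr 7 → Expr 7
      new x x0 x1 x2 x3 = x :- Y :* (x0 :* τ :+ (x1 :* (τ :* A) :+ (x2 :* (τ :* m2) :+ x3 :* (τ :* m3))))

      -- The two relations to which the multipliers below refer: u inverts 1 - y, and σ is a sign.
      inverse square : Expr 7
      inverse = (:1 :- Y) :* U :- :1
      square = S :* S :- :1

      ρ : Vec Ser 7
      ρ = t ∷ y ∷ l0 ∷ l1 ∷ l2 ∷ u ∷ σ ∷ []

      relations : ∀ (c d : Expr 7) → All (λ cr → ⟦ proj₂ cr ⟧ ρ ≋ 0#) ((c , inverse) ∷ (d , square) ∷ [])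
      relations _ _ = _⟫_ (+-congʳ (⁻¹-inverse (Monic-1-X^ j))) (-‿inverseʳ 1#) ∷ _⟫_ (+-congʳ (≋-sym (fromℤ-* ε ε) ⟫ ≋-reflexive (cong fromℤ ε²) ⟫ fromℤ-1)) (-‿inverseʳ 1#) ∷ []

    -- At z = 1 the logarithm of the new factor has the derivatives -ε y/(1 - y), -y/(1 - y)² and -ε
    -- y(1 + y)/(1 - y)³, and logarithmic derivatives of a product add up.
    step : LogData f′ (t * (1# - y)) (l0 - σ * (y * u)) (l1 - y * u ^ 2) (l2 - σ * (y * (1# + y) * u ^ 3))
    step = record
      { d0 = next 0 d0 (+ 1) (+ 0) (+ 0) (+ 0) ≋-refl ≋-refl ≋-refl ≋-refl (λ s → solveℤ 1 (λ s → :1 , nat 1 :* :1 :+ (nat 0 :* (s :^ 1) :+ (nat 0 :* (s :^ 2) :+ nat 0 :* (s :^ 3)))) (s ∷ []))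
             ⟫ prove (new τ (nat 1) (nat 0) (nat 0) (nat 0)) (τ :* (:1 :- Y)) ρ
      ; d1 = next 1 d1 ε (+ 1) (+ 0) (+ 0) ≋-refl ≋-refl ≋-refl ≋-refl (λ s → solveℤ 2 (λ ε s → (ε :+ s) :^ 1 , ε :* :1 :+ (nat 1 :* (s :^ 1) :+ (nat 0 :* (s :^ 2) :+ nat 0 :* (s :^ 3)))) (ε ∷ s ∷ []))
             ⟫ ≋-sym (proveModulo (τ :* (:1 :- Y) :* A′) (new (τ :* A) S (nat 1) (nat 0) (nat 0))
               ((:- (S :* τ :* Y) , inverse) ∷ (nat 0 , square) ∷ []) ρ (relations _ _))
      ; d2 = next 2 d2 (+ 1) (+ 2 Z.* ε) (+ 1) (+ 0) ≋-refl (fromℤ-* (+ 2) ε) ≋-refl ≋-refl second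
             ⟫ ≋-sym (proveModulo (τ :* (:1 :- Y) :* (A′ :* A′ :+ B′)) (new (τ :* m2) (nat 1) (nat 2 :* S) (nat 1) (nat 0))
               ((:- (nat 2 :* S :* τ :* Y :* A) :- τ :* Y :* ((:1 :- Y) :* U :+ :1) , inverse) ∷ ((:1 :- Y) :* τ :* U :^ 2 :* Y :^ 2 , square) ∷ []) ρ (relations _ _))
      ; d3 = next 3 d3 ε (+ 3) (+ 3 Z.* ε) (+ 1) ≋-refl ≋-refl (fromℤ-* (+ 3) ε) ≋-refl third
             ⟫ ≋-sym (proveModulo (τ :* (:1 :- Y) :* (A′ :* A′ :* A′ :+ nat 3 :* (A′ :* B′) :+ (C :- S :* (Y :* (:1 :+ Y) :* U :^ 3)))) (new (τ :* m3) S (nat 3) (nat 3 :* S) (nat 1))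
               ((:- (nat 3 :* S :* τ :* Y :* m2) :- nat 3 :* A :* τ :* Y :* ((:1 :- Y) :* U :+ :1) :- S :* τ :* Y :* (((:1 :- Y) :* U) :^ 2 :+ (:1 :- Y) :* U :+ :1) , inverse) ∷
                ((:1 :- Y) :* τ :* (nat 3 :* A :* Y :^ 2 :* U :^ 2 :- S :* Y :^ 3 :* U :^ 3) , square) ∷ []) ρ (relations _ _)) }
      where
      second : ∀ s → power 2 (ε Z.+ s) ≡ + 1 Z.* power 0 s Z.+ ((+ 2 Z.* ε) Z.* power 1 s Z.+ (+ 1 Z.* power 2 s Z.+ + 0 Z.* power 3 s))
      second s = solveℤ 2 (λ ε s → (ε :+ s) :^ 2 , (ε :* ε) :* :1 :+ ((nat 2 :* ε) :* (s :^ 1) :+ (nat 1 :* (s :^ 2) :+ nat 0 :* (s :^ 3)))) (ε ∷ s ∷ [])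
        ∙ cong (λ k → k Z.* power 0 s Z.+ ((+ 2 Z.* ε) Z.* power 1 s Z.+ (+ 1 Z.* power 2 s Z.+ + 0 Z.* power 3 s))) ε²
      third : ∀ s → power 3 (ε Z.+ s) ≡ ε Z.* power 0 s Z.+ (+ 3 Z.* power 1 s Z.+ ((+ 3 Z.* ε) Z.* power 2 s Z.+ + 1 Z.* power 3 s))
      third s = solveℤ 2 (λ ε s → (ε :+ s) :^ 3 , (ε :* ε) :* ε :+ ((nat 3 :* (ε :* ε)) :* (s :^ 1) :+ ((nat 3 :* ε) :* (s :^ 2) :+ nat 1 :* (s :^ 3)))) (ε ∷ s ∷ [])
        ∙ cong (λ k → k Z.* ε Z.+ ((+ 3 Z.* k) Z.* power 1 s Z.+ ((+ 3 Z.* ε) Z.* power 2 s Z.+ + 1 Z.* power 3 s))) ε²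
          ∙ solveℤ 2 (λ ε s → nat 1 :* ε :+ ((nat 3 :* nat 1) :* (s :^ 1) :+ ((nat 3 :* ε) :* (s :^ 2) :+ nat 1 :* (s :^ 3))) ,
             ε :* :1 :+ (nat 3 :* (s :^ 1) :+ ((nat 3 :* ε) :* (s :^ 2) :+ nat 1 :* (s :^ 3)))) (ε ∷ s ∷ [])

  polesZ polesW : ℕ → Ser
  polesZ i = cubicPole (suc r0 N.+ i N.* suc b′)
  polesW i = cubicPole (suc r0′ N.+ i N.* suc b′)

  private
    relabel : ∀ {f t l0 l1 l2 l2′} → l2 ≋ l2′ → LogData f t l0 l1 l2 → LogData f t l0 l1 l2′
    relabel e D = record { LogData D ; d3 = LogData.d3 D ⟫ *-congˡ (+-congˡ e) }

    -- The first two logarithmic derivatives are left existential, because `thirdLog-log` extracts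
    -- the third, the one followed here.
    dataW : ∀ n → Σ Ser λ l0 → Σ Ser λ l1 → LogData (M.prodW n) (wFactors n) l0 l1 (sum< n polesW)
    dataW zero = 0# , 0# , LogData-1
    dataW (suc n) = let _ , _ , D = dataW n in _ , _ , relabel (solve 2 (λ a b → a :- con -[1+ 0 ] :* b , a :+ b) (sum< n polesW ∷ polesW n ∷ []))
      (LogData-cong (L.*-comm _ _) ≋-refl (Step.step D -[1+ 0 ] refl (r0′ N.+ n N.* suc b′) _ (λ w → moment-w w n (M.prodW n))))

    dataZ : ∀ m n → Σ Ser λ l0 → Σ Ser λ l1 → LogData (M.prodZ m L.* M.prodW n) (zFactors m * wFactors n) l0 l1 (sum< n polesW - sum< m polesZ)
    dataZ zero n = let l0 , l1 , D = dataW n in l0 , l1 , relabel (solve 1 (λ a → a , a :- nat 0) (sum< n polesW ∷ [])) (LogData-cong (L.≋-sym (L.*-identityˡ _)) (≋-sym (*-identityˡ _)) D)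
    dataZ (suc m) n = let _ , _ , D = dataZ m n in _ , _ , relabel (solve 3 (λ a b c → (a :- b) :- nat 1 :* c , a :- (b :+ c)) (sum< n polesW ∷ sum< m polesZ ∷ polesZ m ∷ []))
      (LogData-cong
        (L.solve 3 (λ a b c → a :* (b :* c) , (b :* a) :* c) (_ ∷ M.prodZ m ∷ M.prodW n ∷ []))
        (solve 3 (λ a b c → (a :* b) :* c , (a :* c) :* b) (zFactors m ∷ wFactors n ∷ _ ∷ []))
        (Step.step D (+ 1) refl (r0 N.+ m N.* suc b′) _ (λ w → moment-z w m (M.prodZ m L.* M.prodW n))))

  cubicPole-vanishes : ∀ j → Vanishes j (cubicPole j)
  cubicPole-vanishes j = Vanishes-*ʳ (geometric j ^ 3) (Vanishes-*ʳ (1# + X^ j) (X^-vanishes j))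

  poleSum : Ser
  poleSum = sum<-limit polesW - sum<-limit polesZ

  thirdLog-theta : thirdLog (theta (power 0)) (theta (power 1)) (theta (power 2)) (theta (power 3)) ≋ theta (power 0) ^ 4 * poleSum
  thirdLog-theta = Tends-unique {λ m → thirdLog (J 0 (P m)) (J 1 (P m)) (J 2 (P m)) (J 3 (P m))}
    (λ N m N≤m → thirdLog-cong[] (theta-tends (power 0) N m N≤m) (theta-tends (power 1) N m N≤m) (theta-tends (power 2) N m N≤m) (theta-tends (power 3) N m N≤m))
    (λ N m N≤m → ≈[]-trans (≋⇒≈[] (finite m)) (≈[]-* (≈[]-^ {f = J 0 (P m)} {f′ = theta (power 0)} 4 (theta-tends (power 0) N m N≤m))
      (≈[]-+ (sum<-tends polesW (λ i → ≈[]-mono (small r0′ i) (cubicPole-vanishes _)) N m N≤m)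
             (≈[]-neg (sum<-tends polesZ (λ i → ≈[]-mono (small r0 i) (cubicPole-vanishes _)) N m N≤m)))))
    where
    small : ∀ a i → i ≤ suc a N.+ i N.* suc b′
    small a i = Nₚ.≤-trans (Nₚ.m≤m*n i (suc b′)) (Nₚ.m≤n+m _ (suc a))
    P : ℕ → L.Ser
    P m = M.qfac m L.* (M.prodZ m L.* M.prodW m)
    finite : ∀ m → thirdLog (J 0 (P m)) (J 1 (P m)) (J 2 (P m)) (J 3 (P m)) ≋ J 0 (P m) ^ 4 * (sum< m polesW - sum< m polesZ)
    finite m = go (proj₂ (proj₂ (dataZ m m)))
      where
      scaled : ∀ k {x} → J k (M.prodZ m L.* M.prodW m) ≋ x → J k (P m) ≋ B.qfac m * x
      scaled k e = moment-qfac (power k) m (M.prodZ m L.* M.prodW m) ⟫ *-congˡ e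
      go : ∀ {l0 l1 l2} → LogData (M.prodZ m L.* M.prodW m) (zFactors m * wFactors m) l0 l1 l2 →
           thirdLog (J 0 (P m)) (J 1 (P m)) (J 2 (P m)) (J 3 (P m)) ≋ J 0 (P m) ^ 4 * l2
      go {l0} {l1} {l2} D = thirdLog-cong (scaled 0 (LogData.d0 D)) (scaled 1 (LogData.d1 D)) (scaled 2 (LogData.d2 D)) (scaled 3 (LogData.d3 D))
        ⟫ thirdLog-log (B.qfac m) (zFactors m * wFactors m) l0 l1 l2
          ⟫ *-congʳ (^-congˡ 4 (≋-sym (scaled 0 (LogData.d0 D))))

-- Parity and sign-reversing involutions

half : ℤ → ℤ
half (+ n) = + N.⌊ n /2⌋
half -[1+ n ] = -[1+ N.⌊ n /2⌋ ]

half-double : ∀ z → half (z Z.+ z) ≡ z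
half-double (+ n) = cong +_ (sym (Nₚ.n≡⌊n+n/2⌋ n))
half-double -[1+ n ] = cong -[1+_] (sym (Nₚ.n≡⌈n+n/2⌉ n))

-- Stated through `half`, evenness is decided by one comparison and carries its own witness.
Even : ℤ → Set
Even x = x ≡ half x Z.+ half x

even? : ∀ x → Dec (Even x)
even? x = x Zₚ.≟ half x Z.+ half x

double-even : ∀ z → Even (z Z.+ z)
double-even z = cong₂ Z._+_ (sym (half-double z)) (sym (half-double z))

even-sign : ∀ x → Even x → sign x ≡ + 1
even-sign x e = cong sign e ∙ sign-double (half x)

odd-sign : ∀ z → sign (+ 1 Z.+ (z Z.+ z)) ≡ -[1+ 0 ]
odd-sign z = sign-+ (+ 1) (z Z.+ z) ∙ cong (-[1+ 0 ] Z.*_) (sign-double z)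

odd-not-even : ∀ z → ¬ Even (+ 1 Z.+ (z Z.+ z))
odd-not-even z e with trans (sym (odd-sign z)) (even-sign (+ 1 Z.+ (z Z.+ z)) e)
... | ()

parityℕ : ∀ n → (Σ ℕ λ k → n ≡ k N.+ k) ⊎ (Σ ℕ λ k → n ≡ suc (k N.+ k))
parityℕ zero = inj₁ (0 , refl)
parityℕ (suc n) with parityℕ n
... | inj₁ (k , refl) = inj₂ (k , refl)
... | inj₂ (k , refl) = inj₁ (suc k , cong suc (sym (Nₚ.+-suc k k)))

not-even-odd : ∀ x → ¬ Even x → Σ ℤ λ z → x ≡ + 1 Z.+ (z Z.+ z)
not-even-odd (+ n) ¬e with parityℕ n
... | inj₁ (k , refl) = contradiction (double-even (+ k)) ¬e
... | inj₂ (k , refl) = + k , refl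
not-even-odd -[1+ n ] ¬e with parityℕ n
... | inj₁ (k , refl) = -[1+ k ] , refl
... | inj₂ (k , refl) = contradiction (double-even -[1+ k ]) ¬e

not-even-sign : ∀ x → ¬ Even x → sign x ≡ -[1+ 0 ]
not-even-sign x ¬e = let z , e = not-even-odd x ¬e in trans (cong sign e) (odd-sign z)

restrict-yes : ∀ {I : Set} {P : I → Set} (P? : ∀ i → Dec (P i)) (f : I → Ser) i → P i → restrict P? f i ≋ f i
restrict-yes P? f i p with P? i
... | yes _ = ≋-refl
... | no ¬p = contradiction p ¬p

restrict-no : ∀ {I : Set} {P : I → Set} (P? : ∀ i → Dec (P i)) (f : I → Ser) i → ¬ P i → restrict P? f i ≋ 0#
restrict-no P? f i ¬p with P? i
... | yes p = contradiction p ¬p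
... | no _ = ≋-refl

neg-0 : - 0# ≋ 0#
neg-0 = solve 0 (:- nat 0 , nat 0) []

HasSum-neg : {I : Set} {f : I → Ser} {s : Ser} → HasSum f s → HasSum (λ i → - f i) (- s)
HasSum-neg {f = f} {s} p = HasSum-cong (λ i → solve 1 (λ a → (:- :1) :* a , :- a) (f i ∷ [])) (solve 1 (λ a → (:- :1) :* a , :- a) (s ∷ [])) (HasSum-*ˡ (- 1#) p)

restricted-sum : {I : Set} → DecidableEquality I → {P : I → Set} (P? : ∀ i → Dec (P i)) {f : I → Ser} {s : Ser} →
                 HasSum f s → Σ Ser (HasSum (restrict P? f))
restricted-sum _≟_ P? p = _ , HasSum-total _≟_ (Summable-restrict P? (HasSum.summable p))

-- The involution carries the family to its negative, so the sum equals its own negative, and 2 is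
-- invertible in ℚ.
antisymmetric-sum : {I : Set} → DecidableEquality I → {P : I → Set} (P? : ∀ i → Dec (P i)) {f : I → Ser} {s : Ser} (τ : I → I) →
  (∀ i → ¬ P i → f i ≋ 0#) → (∀ i → P i → P (τ i)) → (∀ i → P i → τ (τ i) ≡ i) → (∀ i → P i → f i ≋ - f (τ i)) →
  HasSum f s → s ≋ 0#
antisymmetric-sum _≟_ {P} P? {f} τ off pres inv anti p = cancel-neg (HasSum-unique _≟_ (HasSum-cong (λ i → ≋-refl) ≋-refl (reindex R p))
    (HasSum-neg p))
  where
  R : Reindexing f (λ i → - f i)
  R = record
    { to = τ ; Relevant = P ; relevant? = P? ; irrelevant = off ; agree = anti
    ; injective = λ i i′ pi pi′ e → sym (inv i pi) ∙ cong τ e ∙ inv i′ pi′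
    ; onto = λ j → [ (λ pj → inj₂ (τ j , pres j pj , inv j pj)) , (λ ¬pj → inj₁ (-‿cong (off j ¬pj) ⟫ neg-0)) ]′ (split (P? j)) }
    where
    split : ∀ {A : Set} → Dec A → A ⊎ ¬ A
    split (yes a) = inj₁ a
    split (no ¬a) = inj₂ ¬a

Quad : Set
Quad = ℤ × (ℤ × (ℤ × ℤ))

_≟4_ : DecidableEquality Quad
_≟4_ = ×ₚ.≡-dec Zₚ._≟_ (×ₚ.≡-dec Zₚ._≟_ (×ₚ.≡-dec Zₚ._≟_ Zₚ._≟_))

HasSum-quad : {f g h k : ℤ → Ser} {a b c d : Ser} → HasSum f a → HasSum g b → HasSum h c → HasSum k d →
              HasSum {Quad} (λ { (s1 , s2 , s3 , s4) → f s1 * (g s2 * (h s3 * k s4)) }) (a * (b * (c * d)))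
HasSum-quad p q r s = HasSum-× Zₚ._≟_ p (HasSum-× Zₚ._≟_ q (HasSum-× Zₚ._≟_ r s))

quadSum : Quad → ℤ
quadSum (s1 , s2 , s3 , s4) = s1 Z.+ (s2 Z.+ (s3 Z.+ s4))

diff1 diff2 diff3 : Quad → ℤ
diff1 (s1 , s2 , s3 , s4) = s1 Z.+ s2 Z.- s3 Z.- s4
diff2 (s1 , s2 , s3 , s4) = s1 Z.- s2 Z.+ s3 Z.- s4
diff3 (s1 , s2 , s3 , s4) = s1 Z.- s2 Z.- s3 Z.+ s4

-- Summed against four copies of one theta series, this product of three differences gives 4 times
-- `thirdLog`. It turns a quartic expression in moments into a single weight on ℤ⁴, to which a
-- change of lattice coordinates can be applied.
diffProduct : Quad → ℤ
diffProduct s = diff1 s Z.* (diff2 s Z.* diff3 s)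

fromℤ-sub : ∀ x y → fromℤ (x Z.- y) ≋ fromℤ x - fromℤ y
fromℤ-sub x y = fromℤ-+ x (Z.- y) ⟫ +-congˡ (fromℤ-neg y)

fromℤ-diffProduct : ∀ s1 s2 s3 s4 → fromℤ (diffProduct (s1 , s2 , s3 , s4)) ≋
  (fromℤ s1 + fromℤ s2 - fromℤ s3 - fromℤ s4) * ((fromℤ s1 - fromℤ s2 + fromℤ s3 - fromℤ s4) * (fromℤ s1 - fromℤ s2 - fromℤ s3 + fromℤ s4))
fromℤ-diffProduct s1 s2 s3 s4 = fromℤ-* (diff1 s) (diff2 s Z.* diff3 s) ⟫ *-cong
  (fromℤ-sub (s1 Z.+ s2 Z.- s3) s4 ⟫ +-congʳ (fromℤ-sub (s1 Z.+ s2) s3 ⟫ +-congʳ (fromℤ-+ s1 s2)))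
  (fromℤ-* (diff2 s) (diff3 s) ⟫ *-cong
    (fromℤ-sub (s1 Z.- s2 Z.+ s3) s4 ⟫ +-congʳ (fromℤ-+ (s1 Z.- s2) s3 ⟫ +-congʳ (fromℤ-sub s1 s2)))
    (fromℤ-+ (s1 Z.- s2 Z.- s3) s4 ⟫ +-congʳ (fromℤ-sub (s1 Z.- s2) s3 ⟫ +-congʳ (fromℤ-sub s1 s2))))
  where s = s1 , s2 , s3 , s4

-- The expansion of diffProduct as a sum of monomials: coefficients and exponents.
diffMonomials : List (ℤ × (ℕ × ℕ × ℕ × ℕ))
diffMonomials =
  (+ 1 , 3 , 0 , 0 , 0) ∷ (+ 1 , 0 , 3 , 0 , 0) ∷ (+ 1 , 0 , 0 , 3 , 0) ∷ (+ 1 , 0 , 0 , 0 , 3) ∷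
  (-[1+ 0 ] , 2 , 1 , 0 , 0) ∷ (-[1+ 0 ] , 2 , 0 , 1 , 0) ∷ (-[1+ 0 ] , 2 , 0 , 0 , 1) ∷
  (-[1+ 0 ] , 1 , 2 , 0 , 0) ∷ (-[1+ 0 ] , 0 , 2 , 1 , 0) ∷ (-[1+ 0 ] , 0 , 2 , 0 , 1) ∷
  (-[1+ 0 ] , 1 , 0 , 2 , 0) ∷ (-[1+ 0 ] , 0 , 1 , 2 , 0) ∷ (-[1+ 0 ] , 0 , 0 , 2 , 1) ∷
  (-[1+ 0 ] , 1 , 0 , 0 , 2) ∷ (-[1+ 0 ] , 0 , 1 , 0 , 2) ∷ (-[1+ 0 ] , 0 , 0 , 1 , 2) ∷
  (+ 2 , 1 , 1 , 1 , 0) ∷ (+ 2 , 1 , 1 , 0 , 1) ∷ (+ 2 , 1 , 0 , 1 , 1) ∷ (+ 2 , 0 , 1 , 1 , 1) ∷ []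

combination : {A : Set} → (A → A → A) → A → (ℤ → A → A) → (ℕ × ℕ × ℕ × ℕ → A) → List (ℤ × (ℕ × ℕ × ℕ × ℕ)) → A
combination _+_ z _*_ m [] = z
combination _+_ z _*_ m ((c , k) ∷ l) = (c * m k) + combination _+_ z _*_ m l

combinationₛ : (ℕ × ℕ × ℕ × ℕ → Ser) → List (ℤ × (ℕ × ℕ × ℕ × ℕ)) → Ser
combinationₛ = combination _+_ 0# (λ c x → fromℤ c * x)

combinationₑ : ∀ {n} → (ℕ × ℕ × ℕ × ℕ → Expr n) → List (ℤ × (ℕ × ℕ × ℕ × ℕ)) → Expr n
combinationₑ = combination _:+_ (nat 0) (λ c x → con c :* x)

combination-cong : ∀ {m m′} l → (∀ k → m k ≋ m′ k) → combinationₛ m l ≋ combinationₛ m′ l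
combination-cong [] h = ≋-refl
combination-cong ((c , k) ∷ l) h = +-cong (*-congˡ (h k)) (combination-cong l h)

HasSum-combination : {I : Set} → DecidableEquality I → ∀ {m : ℕ × ℕ × ℕ × ℕ → I → Ser} {v} l → (∀ k → HasSum (m k) (v k)) →
                     HasSum (λ i → combinationₛ (λ k → m k i) l) (combinationₛ v l)
HasSum-combination _≟_ [] h = HasSum-0 (λ _ → ≋-refl)
HasSum-combination _≟_ ((c , k) ∷ l) h = HasSum-+ _≟_ (HasSum-*ˡ (fromℤ c) (h k)) (HasSum-combination _≟_ l h)

fromℤ-power : ∀ k s → fromℤ (power k s) ≋ fromℤ s ^ k
fromℤ-power zero s = fromℤ-1
fromℤ-power (suc k) s = fromℤ-* s (power k s) ⟫ *-congˡ (fromℤ-power k s)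

thirdLog-combination : ∀ (t : ℕ → Ser) → combinationₛ (λ { (a , b , c , d) → t a * (t b * (t c * t d)) }) diffMonomials ≋
                       fromℤ (+ 4) * thirdLog (t 0) (t 1) (t 2) (t 3)
thirdLog-combination t = solve 4 (λ t0 t1 t2 t3 →
    combinationₑ (λ { (a , b , c , d) → v t0 t1 t2 t3 a :* (v t0 t1 t2 t3 b :* (v t0 t1 t2 t3 c :* v t0 t1 t2 t3 d)) }) diffMonomials ,
    nat 4 :* (t0 :^ 3 :* t3 :- nat 3 :* (t0 :^ 2 :* (t1 :* t2)) :+ nat 2 :* (t0 :* t1 :^ 3)))
    (t 0 ∷ t 1 ∷ t 2 ∷ t 3 ∷ [])
  where
  v : ∀ {n} → Expr n → Expr n → Expr n → Expr n → ℕ → Expr n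
  v a b c d 0 = a
  v a b c d 1 = b
  v a b c d 2 = c
  v a b c d _ = d

diffProduct-combination : ∀ (σ x s : ℕ → Ser) →
  combinationₛ (λ { (a , b , c , d) → (σ 0 * s 0 ^ a * x 0) * ((σ 1 * s 1 ^ b * x 1) * ((σ 2 * s 2 ^ c * x 2) * (σ 3 * s 3 ^ d * x 3))) }) diffMonomials ≋
  ((s 0 + s 1 - s 2 - s 3) * ((s 0 - s 1 + s 2 - s 3) * (s 0 - s 1 - s 2 + s 3))) * ((σ 0 * x 0) * ((σ 1 * x 1) * ((σ 2 * x 2) * (σ 3 * x 3))))
diffProduct-combination σ x s = solve 12 (λ σ0 σ1 σ2 σ3 x0 x1 x2 x3 s0 s1 s2 s3 →
    combinationₑ (λ { (a , b , c , d) → (σ0 :* s0 :^ a :* x0) :* ((σ1 :* s1 :^ b :* x1) :* ((σ2 :* s2 :^ c :* x2) :* (σ3 :* s3 :^ d :* x3))) }) diffMonomials ,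
    ((s0 :+ s1 :- s2 :- s3) :* ((s0 :- s1 :+ s2 :- s3) :* (s0 :- s1 :- s2 :+ s3))) :* ((σ0 :* x0) :* ((σ1 :* x1) :* ((σ2 :* x2) :* (σ3 :* x3)))))
    (σ 0 ∷ σ 1 ∷ σ 2 ∷ σ 3 ∷ x 0 ∷ x 1 ∷ x 2 ∷ x 3 ∷ s 0 ∷ s 1 ∷ s 2 ∷ s 3 ∷ [])

-- The rearrangement of fourfold theta series

reflect : ℤ → ℤ
reflect m = + 1 Z.- m

reflect-involutive : ∀ m → reflect (reflect m) ≡ m
reflect-involutive m = solveℤ 1 (λ m → :1 :- (:1 :- m) , m) (m ∷ [])

sign-reflect : ∀ m → sign (reflect m) ≡ Z.- sign m
sign-reflect m = sign-+ (+ 1) (Z.- m) ∙ cong (-[1+ 0 ] Z.*_) (sign-neg m)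
  ∙ solveℤ 1 (λ a → (:- :1) :* a , :- a) (sign m ∷ [])

exponent-reflect : ∀ b m → exponent 0 b (reflect m) ≡ exponent 0 b m
exponent-reflect b m = +-injective2 (exponent-ℤ 0 b (reflect m) ∙ solveℤ 3 (λ m b z → nat 2 :* (:1 :- m) :* nat 0 :+ (z :+ b) :* ((:1 :- m) :* (:1 :- m) :- (:1 :- m)) ,
     nat 2 :* m :* nat 0 :+ (z :+ b) :* (m :* m :- m)) (m ∷ + b ∷ + 0 ∷ [])
  ∙ sym (exponent-ℤ 0 b m))

all? : {I : Set} → ∀ (i : I) → Dec ⊤
all? _ = yes tt

-- Reflection m ↦ 1 - m kills every sum over the symmetric exponent 0 b with an antisymmetric coefficient.
reflected-sum : ∀ b (c : ℤ → ℤ) {s} → (∀ m → c (reflect m) ≡ Z.- c m) → HasSum (λ m → term⟨ c m , exponent 0 b m ⟩) s → s ≋ 0#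
reflected-sum b c h = antisymmetric-sum Zₚ._≟_ all? reflect (λ _ n → ⊥-elim (n tt)) (λ _ _ → tt) (λ m _ → reflect-involutive m)
  (λ m _ → solve 2 (λ a x → a :* x , :- ((:- a) :* x)) (fromℤ (c m) ∷ X^ (exponent 0 b m) ∷ [])
    ⟫ -‿cong (*-cong (≋-sym (fromℤ-neg (c m)) ⟫ ≋-reflexive (cong fromℤ (sym (h m)))) (≋-reflexive (cong X^ (sym (exponent-reflect b m))))))

odd : ℤ → ℤ
odd m = m Z.+ m Z.- + 1

odd-reflect : ∀ m → odd (reflect m) ≡ Z.- odd m
odd-reflect m = solveℤ 1 (λ m → (:1 :- m) :+ (:1 :- m) :- :1 , :- (m :+ m :- :1)) (m ∷ [])

alternating-sum : ∀ b′ → Theta.theta 0 (suc b′) b′ refl (λ _ → + 1) ≋ 0#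
alternating-sum b′ = reflected-sum (suc b′) (λ m → sign m Z.* + 1)
  (λ m → cong (Z._* + 1) (sign-reflect m) ∙ sym (Zₚ.neg-distribˡ-* (sign m) (+ 1))) (Theta.HasSum-theta 0 (suc b′) b′ refl (λ _ → + 1))

HasSum-odd-alternating : ∀ b′ → HasSum (λ m → term⟨ sign m Z.* odd m , exponent 0 (suc b′) m ⟩) (- (fromℤ (+ 2) * poch b′ ^ 3))
HasSum-odd-alternating b′ = HasSum-cong pieces combined
  (HasSum-+ Zₚ._≟_ (HasSum-*ˡ (fromℤ (+ 2)) (T.HasSum-theta (λ m → m))) (HasSum-neg (T.HasSum-theta (λ _ → + 1))))
  where
  module T = Theta 0 (suc b′) b′ refl
  pieces : ∀ m → fromℤ (+ 2) * term⟨ sign m Z.* m , exponent 0 (suc b′) m ⟩ + - term⟨ sign m Z.* + 1 , exponent 0 (suc b′) m ⟩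
           ≋ term⟨ sign m Z.* odd m , exponent 0 (suc b′) m ⟩
  pieces m = +-cong (*-congˡ (*-congʳ (fromℤ-* (sign m) m))) (-‿cong (*-congʳ (≋-reflexive (cong fromℤ (Zₚ.*-identityʳ (sign m))))))
    ⟫ solve 3 (λ σ m x → nat 2 :* (σ :* m :* x) :+ :- (σ :* x) , σ :* (m :+ m :- :1) :* x) (fromℤ (sign m) ∷ fromℤ m ∷ X^ (exponent 0 (suc b′) m) ∷ [])
      ⟫ *-congʳ (≋-sym (fromℤ-* (sign m) (odd m) ⟫ *-congˡ (fromℤ-sub (m Z.+ m) (+ 1) ⟫ +-cong (fromℤ-+ m m) (-‿cong fromℤ-1))))
  combined : fromℤ (+ 2) * T.theta (λ m → m) + - T.theta (λ _ → + 1) ≋ - (fromℤ (+ 2) * poch b′ ^ 3)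
  combined = +-cong (*-congˡ (jacobi b′)) (-‿cong (alternating-sum b′))
    ⟫ solve 1 (λ e → nat 2 :* (:- e) :+ :- nat 0 , :- (nat 2 :* e)) (poch b′ ^ 3 ∷ [])

-- The parameter d is the difference r′ - r, so that 2r and d are again complementary in the base b;
-- the theta function `T2` at the doubled argument needs them in this form.
module Weierstrass (r0 d : ℕ) where
  r r′ b′ b : ℕ
  r = suc r0
  r′ = r N.+ d
  b′ = r0 N.+ r′
  b = suc b′

  2r+d : (r N.+ r) N.+ d ≡ b
  2r+d = Nₚ.+-assoc r r d

  module T = Theta r r′ b′ refl
  module T2 = Theta (r N.+ r) d b′ 2r+d

  e : ℤ → ℕ
  e = exponent r r′

  energy : Quad → ℕ
  energy (s1 , s2 , s3 , s4) = e s1 N.+ (e s2 N.+ (e s3 N.+ e s4))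

  quadTerm : Quad → Ser
  quadTerm s = term⟨ sign (quadSum s) Z.* diffProduct s , energy s ⟩

  factored : ∀ k s → term⟨ sign s Z.* power k s , e s ⟩ ≋ fromℤ (sign s) * fromℤ s ^ k * X^ (e s)
  factored k s = *-congʳ (fromℤ-* (sign s) (power k s) ⟫ *-congˡ (fromℤ-power k s))

  collected : ∀ s1 s2 s3 s4 → combinationₛ (λ { (a , b , c , d) →
      term⟨ sign s1 Z.* power a s1 , e s1 ⟩ * (term⟨ sign s2 Z.* power b s2 , e s2 ⟩ * (term⟨ sign s3 Z.* power c s3 , e s3 ⟩ * term⟨ sign s4 Z.* power d s4 , e s4 ⟩)) }) diffMonomials
    ≋ quadTerm (s1 , s2 , s3 , s4)
  collected s1 s2 s3 s4 = combination-cong diffMonomials (λ { (a , b , c , d) → *-cong (factored a s1) (*-cong (factored b s2) (*-cong (factored c s3) (factored d s4))) })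
    ⟫ diffProduct-combination (pick (fromℤ (sign s1)) (fromℤ (sign s2)) (fromℤ (sign s3)) (fromℤ (sign s4)))
               (pick (X^ (e s1)) (X^ (e s2)) (X^ (e s3)) (X^ (e s4))) (pick (fromℤ s1) (fromℤ s2) (fromℤ s3) (fromℤ s4))
      ⟫ *-cong (≋-sym (fromℤ-diffProduct s1 s2 s3 s4))
          (*-congˡ (*-congˡ (term-* (sign s3) (e s3) (sign s4) (e s4)) ⟫ term-* (sign s2) (e s2) (sign s3 Z.* sign s4) (e s3 N.+ e s4))
            ⟫ term-* (sign s1) (e s1) _ _ ⟫ term-cong signs refl)
        ⟫ term-scale (diffProduct s) (sign (quadSum s)) (energy s) ⟫ term-cong (Zₚ.*-comm (diffProduct s) (sign (quadSum s))) refl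
    where
    s = s1 , s2 , s3 , s4
    pick : Ser → Ser → Ser → Ser → ℕ → Ser
    pick a b c d 0 = a
    pick a b c d 1 = b
    pick a b c d 2 = c
    pick a b c d _ = d
    signs : sign s1 Z.* (sign s2 Z.* (sign s3 Z.* sign s4)) ≡ sign (quadSum s)
    signs = sym (sign-+ s1 _ ∙ cong (sign s1 Z.*_) (sign-+ s2 _ ∙ cong (sign s2 Z.*_) (sign-+ s3 s4)))

  W : Ser
  W = thirdLog (T.theta (power 0)) (T.theta (power 1)) (T.theta (power 2)) (T.theta (power 3))

  HasSum-quadTerm : HasSum quadTerm (fromℤ (+ 4) * W)
  HasSum-quadTerm = HasSum-cong (λ { (s1 , s2 , s3 , s4) → collected s1 s2 s3 s4 }) (thirdLog-combination (λ k → T.theta (power k)))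
    (HasSum-combination _≟4_ diffMonomials (λ { (a , b , c , d) →
      HasSum-quad (T.HasSum-theta (power a)) (T.HasSum-theta (power b)) (T.HasSum-theta (power c)) (T.HasSum-theta (power d)) }))

  energyℤ : ℤ → ℤ → ℤ → ℤ → ℤ → ℤ → ℤ
  energyℤ r b s1 s2 s3 s4 = + 2 Z.* (s1 Z.+ (s2 Z.+ (s3 Z.+ s4))) Z.* r Z.+
    b Z.* (s1 Z.* s1 Z.+ (s2 Z.* s2 Z.+ (s3 Z.* s3 Z.+ s4 Z.* s4)) Z.- (s1 Z.+ (s2 Z.+ (s3 Z.+ s4))))

  double-sum4 : ∀ a b c d → + 2 Z.* + (a N.+ (b N.+ (c N.+ d))) ≡ + 2 Z.* + a Z.+ (+ 2 Z.* + b Z.+ (+ 2 Z.* + c Z.+ + 2 Z.* + d))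
  double-sum4 a b c d = solveℤ 4 (λ a b c d → nat 2 :* (a :+ (b :+ (c :+ d))) , nat 2 :* a :+ (nat 2 :* b :+ (nat 2 :* c :+ nat 2 :* d))) (+ a ∷ + b ∷ + c ∷ + d ∷ [])

  energy-ℤ : ∀ s1 s2 s3 s4 → + 2 Z.* + energy (s1 , s2 , s3 , s4) ≡ energyℤ (+ r) (+ r Z.+ + r′) s1 s2 s3 s4
  energy-ℤ s1 s2 s3 s4 = double-sum4 (e s1) (e s2) (e s3) (e s4)
    ∙ cong₂ Z._+_ (exponent-ℤ r r′ s1) (cong₂ Z._+_ (exponent-ℤ r r′ s2) (cong₂ Z._+_ (exponent-ℤ r r′ s3) (exponent-ℤ r r′ s4)))
      ∙ solveℤ 6 (λ r b s1 s2 s3 s4 →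
        (nat 2 :* s1 :* r :+ b :* (s1 :* s1 :- s1)) :+ ((nat 2 :* s2 :* r :+ b :* (s2 :* s2 :- s2)) :+ ((nat 2 :* s3 :* r :+ b :* (s3 :* s3 :- s3)) :+ (nat 2 :* s4 :* r :+ b :* (s4 :* s4 :- s4)))) ,
        nat 2 :* (s1 :+ (s2 :+ (s3 :+ s4))) :* r :+ b :* (s1 :* s1 :+ (s2 :* s2 :+ (s3 :* s3 :+ s4 :* s4)) :- (s1 :+ (s2 :+ (s3 :+ s4)))))
        (+ r ∷ + r Z.+ + r′ ∷ s1 ∷ s2 ∷ s3 ∷ s4 ∷ [])

  shiftBy : ℤ → Quad → Quad
  shiftBy h (s1 , s2 , s3 , s4) = s1 Z.- h , s2 Z.- h , s3 Z.+ h , s4 Z.+ h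

  halfDiff : Quad → ℤ
  halfDiff (s1 , s2 , s3 , s4) = half (quadSum (s1 , s2 , s3 , s4)) Z.- (s3 Z.+ s4)

  -- The reflection diff1 ↦ - diff1.
  flip : Quad → Quad
  flip s = shiftBy (halfDiff s) s

  EvenSum : Quad → Set
  EvenSum s = Even (quadSum s)

  evenSum? : ∀ s → Dec (EvenSum s)
  evenSum? s = even? (quadSum s)

  quadSum-shift : ∀ h s → quadSum (shiftBy h s) ≡ quadSum s
  quadSum-shift h (s1 , s2 , s3 , s4) = solveℤ 5 (λ h s1 s2 s3 s4 →
    (s1 :- h) :+ ((s2 :- h) :+ ((s3 :+ h) :+ (s4 :+ h))) , s1 :+ (s2 :+ (s3 :+ s4))) (h ∷ s1 ∷ s2 ∷ s3 ∷ s4 ∷ [])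

  flip-even : ∀ s → EvenSum s → EvenSum (flip s)
  flip-even s p = subst Even (sym (quadSum-shift (halfDiff s) s)) p

  solved : ∀ s1 s2 s3 s4 y → s1 Z.+ (s2 Z.+ (s3 Z.+ s4)) ≡ y → s1 ≡ y Z.- (s2 Z.+ (s3 Z.+ s4))
  solved s1 s2 s3 s4 y refl = solveℤ 4 (λ s1 s2 s3 s4 → s1 , (s1 :+ (s2 :+ (s3 :+ s4))) :- (s2 :+ (s3 :+ s4))) (s1 ∷ s2 ∷ s3 ∷ s4 ∷ [])

  shift-back : ∀ h s → shiftBy (Z.- h) (shiftBy h s) ≡ s
  shift-back h (s1 , s2 , s3 , s4) = cong₂ _,_ (minus s1) (cong₂ _,_ (minus s2) (cong₂ _,_ (plus s3) (plus s4)))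
    where
    minus : ∀ s → s Z.- h Z.- (Z.- h) ≡ s
    minus s = solveℤ 2 (λ s h → s :- h :- (:- h) , s) (s ∷ h ∷ [])
    plus : ∀ s → s Z.+ h Z.+ (Z.- h) ≡ s
    plus s = solveℤ 2 (λ s h → s :+ h :+ (:- h) , s) (s ∷ h ∷ [])

  flip-involutive : ∀ s → EvenSum s → flip (flip s) ≡ s
  flip-involutive s@(s1 , s2 , s3 , s4) p = cong (λ k → shiftBy k (flip s)) flipped ∙ shift-back h s
    where
    h = halfDiff s
    y = half (quadSum s)
    flipped : halfDiff (flip s) ≡ Z.- h
    flipped = cong (λ t → half t Z.- ((s3 Z.+ h) Z.+ (s4 Z.+ h))) (quadSum-shift h s)
      ∙ solveℤ 3 (λ y s3 s4 → y :- ((s3 :+ (y :- (s3 :+ s4))) :+ (s4 :+ (y :- (s3 :+ s4)))) , :- (y :- (s3 :+ s4))) (y ∷ s3 ∷ s4 ∷ [])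

  flip-diffProduct : ∀ s → EvenSum s → diffProduct (flip s) ≡ Z.- diffProduct s
  flip-diffProduct s@(s1 , s2 , s3 , s4) p = go s1 (half (quadSum s)) (solved s1 s2 s3 s4 _ p)
    where
    go : ∀ s1 y → s1 ≡ (y Z.+ y) Z.- (s2 Z.+ (s3 Z.+ s4)) →
         diffProduct (shiftBy (y Z.- (s3 Z.+ s4)) (s1 , s2 , s3 , s4)) ≡ Z.- diffProduct (s1 , s2 , s3 , s4)
    go _ y refl = solveℤ 4 (λ y s2 s3 s4 →
        let s1 = (y :+ y) :- (s2 :+ (s3 :+ s4)) ; h = y :- (s3 :+ s4) in
        ((s1 :- h) :+ (s2 :- h) :- (s3 :+ h) :- (s4 :+ h)) :* (((s1 :- h) :- (s2 :- h) :+ (s3 :+ h) :- (s4 :+ h)) :* ((s1 :- h) :- (s2 :- h) :- (s3 :+ h) :+ (s4 :+ h))) ,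
        :- ((s1 :+ s2 :- s3 :- s4) :* ((s1 :- s2 :+ s3 :- s4) :* (s1 :- s2 :- s3 :+ s4)))) (y ∷ s2 ∷ s3 ∷ s4 ∷ [])

  flip-energy : ∀ s → EvenSum s → energy (flip s) ≡ energy s
  flip-energy s@(s1 , s2 , s3 , s4) p = +-injective2 (energy-ℤ (s1 Z.- h) (s2 Z.- h) (s3 Z.+ h) (s4 Z.+ h) ∙ go s1 (half (quadSum s)) (solved s1 s2 s3 s4 _ p) ∙ sym (energy-ℤ s1 s2 s3 s4))
    where
    h = halfDiff s
    go : ∀ s1 y → s1 ≡ (y Z.+ y) Z.- (s2 Z.+ (s3 Z.+ s4)) →
         energyℤ (+ r) (+ r Z.+ + r′) (s1 Z.- (y Z.- (s3 Z.+ s4))) (s2 Z.- (y Z.- (s3 Z.+ s4))) (s3 Z.+ (y Z.- (s3 Z.+ s4))) (s4 Z.+ (y Z.- (s3 Z.+ s4)))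
         ≡ energyℤ (+ r) (+ r Z.+ + r′) s1 s2 s3 s4
    go _ y refl = solveℤ 6 (λ y s2 s3 s4 r b →
        let s1 = (y :+ y) :- (s2 :+ (s3 :+ s4)) ; h = y :- (s3 :+ s4)
            E = λ s1 s2 s3 s4 → nat 2 :* (s1 :+ (s2 :+ (s3 :+ s4))) :* r :+ b :* (s1 :* s1 :+ (s2 :* s2 :+ (s3 :* s3 :+ s4 :* s4)) :- (s1 :+ (s2 :+ (s3 :+ s4)))) in
        E (s1 :- h) (s2 :- h) (s3 :+ h) (s4 :+ h) , E s1 s2 s3 s4) (y ∷ s2 ∷ s3 ∷ s4 ∷ + r ∷ + r Z.+ + r′ ∷ [])

  -- For an even total, `diff1` is even and its reflection stays in ℤ⁴. The reflection keeps
  -- `diff2`, `diff3`, the total and the energy, and it reverses the weight.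
  even-part : ∀ {v} → HasSum (restrict evenSum? quadTerm) v → v ≋ 0#
  even-part = antisymmetric-sum _≟4_ evenSum? flip (restrict-no evenSum? quadTerm) flip-even flip-involutive
    (λ s p → restrict-yes evenSum? quadTerm s p ⟫ solve 2 (λ a x → a :* x , :- ((:- a) :* x)) (fromℤ (sign (quadSum s) Z.* diffProduct s) ∷ X^ (energy s) ∷ [])
        ⟫ -‿cong (*-cong (≋-sym (fromℤ-neg (sign (quadSum s) Z.* diffProduct s)) ⟫ ≋-reflexive (cong fromℤ (coefficient s p))) (≋-reflexive (cong X^ (sym (flip-energy s p)))))
      ⟫ -‿cong (≋-sym (restrict-yes evenSum? quadTerm (flip s) (flip-even s p))))
    where
    coefficient : ∀ s → EvenSum s → Z.- (sign (quadSum s) Z.* diffProduct s) ≡ sign (quadSum (flip s)) Z.* diffProduct (flip s)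
    coefficient s p = Zₚ.neg-distribʳ-* (sign (quadSum s)) (diffProduct s)
      ∙ sym (cong₂ Z._*_ (cong sign (quadSum-shift (halfDiff s) s)) (flip-diffProduct s p))

  e0 : ℤ → ℕ
  e0 m = r N.+ exponent (r N.+ r) d (m Z.- + 1)

  -- A quadruple s of odd total is described by m of even total, such that the total and the three
  -- differences of s are the numbers 2mᵢ - 1. In these coordinates weight and energy separate into
  -- one factor for each mᵢ; the constant -1 is the sign of the odd total.
  newTerm : Quad → Ser
  newTerm (m0 , m1 , m2 , m3) = term⟨ -[1+ 0 ] , e0 m0 ⟩ * (term⟨ odd m1 , exponent 0 b m1 ⟩ * (term⟨ odd m2 , exponent 0 b m2 ⟩ * term⟨ odd m3 , exponent 0 b m3 ⟩))

  newEnergy : Quad → ℕ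
  newEnergy (m0 , m1 , m2 , m3) = e0 m0 N.+ (exponent 0 b m1 N.+ (exponent 0 b m2 N.+ exponent 0 b m3))

  newTerm-collected : ∀ m0 m1 m2 m3 → newTerm (m0 , m1 , m2 , m3) ≋ term⟨ -[1+ 0 ] Z.* (odd m1 Z.* (odd m2 Z.* odd m3)) , newEnergy (m0 , m1 , m2 , m3) ⟩
  newTerm-collected m0 m1 m2 m3 = *-congˡ (*-congˡ (term-* (odd m2) _ (odd m3) _) ⟫ term-* (odd m1) _ (odd m2 Z.* odd m3) _)
    ⟫ term-* -[1+ 0 ] _ (odd m1 Z.* (odd m2 Z.* odd m3)) _

  signs4 : ∀ m0 m1 m2 m3 → sign m0 Z.* (sign m1 Z.* (sign m2 Z.* sign m3)) ≡ sign (quadSum (m0 , m1 , m2 , m3))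
  signs4 m0 m1 m2 m3 = sym (sign-+ m0 _ ∙ cong (sign m0 Z.*_) (sign-+ m1 _ ∙ cong (sign m1 Z.*_) (sign-+ m2 m3)))

  odd-summable : Σ Ser (HasSum (λ m → term⟨ odd m , exponent 0 b m ⟩))
  odd-summable = _ , HasSum-cong (λ m → term-scale (sign m) _ _ ⟫ term-cong (sym (Zₚ.*-assoc (sign m) (sign m) (odd m))
      ∙ cong (Z._* odd m) (sign² m) ∙ Zₚ.*-identityˡ (odd m)) refl) ≋-refl
    (HasSum-total Zₚ._≟_ (Summable-*ˡ (λ m → fromℤ (sign m)) (HasSum.summable (HasSum-odd-alternating b′))))

  shifted-theta : HasSum (λ m → term⟨ Z.- sign m , e0 m ⟩) (X^ r * T2.theta (λ _ → + 1))
  shifted-theta = reindex (bijection (λ k → + 1 Z.+ k) (λ m → m Z.- + 1)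
      (λ k → solveℤ 1 (λ k → :1 :+ k :- :1 , k) (k ∷ [])) (λ m → solveℤ 1 (λ m → :1 :+ (m :- :1) , m) (m ∷ []))
      (λ k → *-congʳ (≋-sym (*-identityˡ _) ⟫ *-congʳ (≋-sym fromℤ-1)) ⟫ term-* (+ 1) r (sign k Z.* + 1) (exponent (r N.+ r) d k)
        ⟫ term-cong (coefficient k) (cong (λ t → r N.+ exponent (r N.+ r) d t) (solveℤ 1 (λ k → k , :1 :+ k :- :1) (k ∷ [])))))
    (HasSum-*ˡ (X^ r) (T2.HasSum-theta (λ _ → + 1)))
    where
    coefficient : ∀ k → + 1 Z.* (sign k Z.* + 1) ≡ Z.- sign (+ 1 Z.+ k)
    coefficient k = solveℤ 1 (λ a → :1 :* (a :* :1) , :- ((:- :1) :* a)) (sign k ∷ []) ∙ cong Z.-_ (sym (sign-+ (+ 1) k))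

  constant-summable : Σ Ser (HasSum (λ m → term⟨ -[1+ 0 ] , e0 m ⟩))
  constant-summable = _ , HasSum-cong (λ m → term-scale (sign m) _ _ ⟫ term-cong (sym (Zₚ.neg-distribʳ-* (sign m) (sign m)) ∙ cong Z.-_ (sign² m)) refl) ≋-refl
    (HasSum-total Zₚ._≟_ (Summable-*ˡ (λ m → fromℤ (sign m)) (HasSum.summable shifted-theta)))

  E : Ser
  E = poch b′

  cube : Ser
  cube = - (fromℤ (+ 2) * E ^ 3)

  -- Without signs the weight 2m - 1 is antisymmetric under m ↦ 1 - m, while the exponent is
  -- symmetric, so each of the last three factors sums to zero.
  HasSum-new : HasSum newTerm 0#
  HasSum-new = HasSum-cong (λ _ → ≋-refl) (*-congˡ (*-congʳ vanishing ⟫ zeroˡ _) ⟫ zeroʳ _)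
    (HasSum-quad (proj₂ constant-summable) (proj₂ odd-summable) (proj₂ odd-summable) (proj₂ odd-summable))
    where
    vanishing : proj₁ odd-summable ≋ 0#
    vanishing = reflected-sum b odd odd-reflect (proj₂ odd-summable)

  HasSum-signed : HasSum (λ m → fromℤ (sign (quadSum m)) * newTerm m) ((X^ r * T2.theta (λ _ → + 1)) * (cube * (cube * cube)))
  HasSum-signed = HasSum-cong (λ { (m0 , m1 , m2 , m3) → pieces m0 m1 m2 m3 }) ≋-refl
    (HasSum-quad shifted-theta (HasSum-odd-alternating b′) (HasSum-odd-alternating b′) (HasSum-odd-alternating b′))
    where
    pieces : ∀ m0 m1 m2 m3 → term⟨ Z.- sign m0 , e0 m0 ⟩ * (term⟨ sign m1 Z.* odd m1 , exponent 0 b m1 ⟩ * (term⟨ sign m2 Z.* odd m2 , exponent 0 b m2 ⟩ * term⟨ sign m3 Z.* odd m3 , exponent 0 b m3 ⟩))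
             ≋ fromℤ (sign (quadSum (m0 , m1 , m2 , m3))) * newTerm (m0 , m1 , m2 , m3)
    pieces m0 m1 m2 m3 = *-cong (*-congʳ (≋-reflexive (cong fromℤ (solveℤ 1 (λ a → :- a , a :* (:- :1)) (sign m0 ∷ []))) ⟫ fromℤ-* (sign m0) -[1+ 0 ]))
        (*-cong (*-congʳ (fromℤ-* (sign m1) (odd m1))) (*-cong (*-congʳ (fromℤ-* (sign m2) (odd m2))) (*-congʳ (fromℤ-* (sign m3) (odd m3)))))
      ⟫ rearranged (fromℤ (sign m0)) (fromℤ (sign m1)) (fromℤ (sign m2)) (fromℤ (sign m3)) (fromℤ -[1+ 0 ]) (fromℤ (odd m1)) (fromℤ (odd m2)) (fromℤ (odd m3))
            (X^ (e0 m0)) (X^ (exponent 0 b m1)) (X^ (exponent 0 b m2)) (X^ (exponent 0 b m3))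
        ⟫ *-congʳ (≋-sym (fromℤ-* (sign m0) _ ⟫ *-congˡ (fromℤ-* (sign m1) _ ⟫ *-congˡ (fromℤ-* (sign m2) (sign m3))))
          ⟫ ≋-reflexive (cong fromℤ (signs4 m0 m1 m2 m3)))
      where
      rearranged : ∀ a b c d p q s t x y z w → ((a * p) * x) * (((b * q) * y) * (((c * s) * z) * ((d * t) * w))) ≋
                   (a * (b * (c * d))) * ((p * x) * ((q * y) * ((s * z) * (t * w))))
      rearranged a b c d p q s t x y z w = solve 12 (λ a b c d p q s t x y z w →
        ((a :* p) :* x) :* (((b :* q) :* y) :* (((c :* s) :* z) :* ((d :* t) :* w))) ,
        (a :* (b :* (c :* d))) :* ((p :* x) :* ((q :* y) :* ((s :* z) :* (t :* w))))) (a ∷ b ∷ c ∷ d ∷ p ∷ q ∷ s ∷ t ∷ x ∷ y ∷ z ∷ w ∷ [])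

  new-even : Σ Ser (HasSum (restrict evenSum? newTerm))
  new-even = restricted-sum _≟4_ evenSum? HasSum-new

  -- One plus the sign of the total is twice the indicator of even quadruples. The unsigned sum
  -- vanishes and the signed one is a product of four known series.
  twice-even : proj₁ new-even + proj₁ new-even ≋ (X^ r * T2.theta (λ _ → + 1)) * (cube * (cube * cube))
  twice-even = HasSum-unique _≟4_ (HasSum-+ _≟4_ (proj₂ new-even) (proj₂ new-even))
      (HasSum-cong pieces ≋-refl (HasSum-+ _≟4_ HasSum-new HasSum-signed)) ⟫ +-identityˡ _
    where
    pieces : ∀ m → newTerm m + fromℤ (sign (quadSum m)) * newTerm m ≋ restrict evenSum? newTerm m + restrict evenSum? newTerm m
    pieces m with evenSum? m
    ... | yes p rewrite even-sign (quadSum m) p = +-congˡ (*-congʳ fromℤ-1 ⟫ *-identityˡ _)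
    ... | no ¬p rewrite not-even-sign (quadSum m) ¬p = solve 1 (λ a → a :+ con -[1+ 0 ] :* a , nat 0 :+ nat 0) (newTerm m ∷ [])

  -- The total and the three differences are the rows of a Hadamard matrix of order 4, hence
  -- orthogonal, and this is its inverse in the coordinates m. Orthogonality is the reason that the
  -- energy separates.
  toOld : Quad → Quad
  toOld (m0 , m1 , m2 , m3) = y Z.- + 1 , y Z.- (m2 Z.+ m3) , y Z.- (m1 Z.+ m3) , y Z.- (m1 Z.+ m2)
    where y = half (quadSum (m0 , m1 , m2 , m3))

  fromOld : Quad → Quad
  fromOld s = half (quadSum s Z.+ + 1) , half (diff1 s Z.+ + 1) , half (diff2 s Z.+ + 1) , half (diff3 s Z.+ + 1)

  halved : ∀ {x} z → x ≡ z Z.+ z → half x ≡ z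
  halved z refl = half-double z

  -- The even quadruple with given half sum and last entries.
  oldAt : ℤ → ℤ → ℤ → ℤ → Quad
  oldAt y m1 m2 m3 = y Z.- + 1 , y Z.- (m2 Z.+ m3) , y Z.- (m1 Z.+ m3) , y Z.- (m1 Z.+ m2)

  firstOf : ℤ → ℤ → ℤ → ℤ → ℤ
  firstOf y m1 m2 m3 = (y Z.+ y) Z.- (m1 Z.+ (m2 Z.+ m3))

  quadSum-oldAt : ∀ y m1 m2 m3 → quadSum (oldAt y m1 m2 m3) ≡ + 1 Z.+ ((firstOf y m1 m2 m3 Z.- + 1) Z.+ (firstOf y m1 m2 m3 Z.- + 1))
  quadSum-oldAt y m1 m2 m3 = solveℤ 4 (λ y m1 m2 m3 → let m0 = (y :+ y) :- (m1 :+ (m2 :+ m3)) in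
    (y :- :1) :+ ((y :- (m2 :+ m3)) :+ ((y :- (m1 :+ m3)) :+ (y :- (m1 :+ m2)))) , :1 :+ ((m0 :- :1) :+ (m0 :- :1))) (y ∷ m1 ∷ m2 ∷ m3 ∷ [])

  diff1-oldAt : ∀ y m1 m2 m3 → diff1 (oldAt y m1 m2 m3) ≡ odd m1
  diff1-oldAt y m1 m2 m3 = solveℤ 4 (λ y m1 m2 m3 → (y :- :1) :+ (y :- (m2 :+ m3)) :- (y :- (m1 :+ m3)) :- (y :- (m1 :+ m2)) , m1 :+ m1 :- :1) (y ∷ m1 ∷ m2 ∷ m3 ∷ [])

  diff2-oldAt : ∀ y m1 m2 m3 → diff2 (oldAt y m1 m2 m3) ≡ odd m2
  diff2-oldAt y m1 m2 m3 = solveℤ 4 (λ y m1 m2 m3 → (y :- :1) :- (y :- (m2 :+ m3)) :+ (y :- (m1 :+ m3)) :- (y :- (m1 :+ m2)) , m2 :+ m2 :- :1) (y ∷ m1 ∷ m2 ∷ m3 ∷ [])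

  diff3-oldAt : ∀ y m1 m2 m3 → diff3 (oldAt y m1 m2 m3) ≡ odd m3
  diff3-oldAt y m1 m2 m3 = solveℤ 4 (λ y m1 m2 m3 → (y :- :1) :- (y :- (m2 :+ m3)) :- (y :- (m1 :+ m3)) :+ (y :- (m1 :+ m2)) , m3 :+ m3 :- :1) (y ∷ m1 ∷ m2 ∷ m3 ∷ [])

  fromOld-oldAt : ∀ y m1 m2 m3 → fromOld (oldAt y m1 m2 m3) ≡ (firstOf y m1 m2 m3 , m1 , m2 , m3)
  fromOld-oldAt y m1 m2 m3 = cong₂ _,_ (halved m0 (cong (Z._+ + 1) (quadSum-oldAt y m1 m2 m3)
      ∙ solveℤ 1 (λ m → :1 :+ ((m :- :1) :+ (m :- :1)) :+ :1 , m :+ m) (m0 ∷ [])))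
    (cong₂ _,_ (halved m1 (cong (Z._+ + 1) (diff1-oldAt y m1 m2 m3) ∙ unodd m1))
      (cong₂ _,_ (halved m2 (cong (Z._+ + 1) (diff2-oldAt y m1 m2 m3) ∙ unodd m2)) (halved m3 (cong (Z._+ + 1) (diff3-oldAt y m1 m2 m3) ∙ unodd m3))))
    where
    m0 = firstOf y m1 m2 m3
    unodd : ∀ m → odd m Z.+ + 1 ≡ m Z.+ m
    unodd m = solveℤ 1 (λ m → m :+ m :- :1 :+ :1 , m :+ m) (m ∷ [])

  fromOld-toOld : ∀ m → EvenSum m → fromOld (toOld m) ≡ m
  fromOld-toOld m@(m0 , m1 , m2 , m3) p = fromOld-oldAt (half (quadSum m)) m1 m2 m3 ∙ cong (_, m1 , m2 , m3) (sym (solved m0 m1 m2 m3 _ p))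

  toOld-odd : ∀ m → EvenSum m → ¬ EvenSum (toOld m)
  toOld-odd m@(m0 , m1 , m2 , m3) p q = odd-not-even (firstOf (half (quadSum m)) m1 m2 m3 Z.- + 1) (subst Even (quadSum-oldAt (half (quadSum m)) m1 m2 m3) q)

  oldAt-energy : ∀ y m1 m2 m3 → newEnergy (firstOf y m1 m2 m3 , m1 , m2 , m3) ≡ energy (oldAt y m1 m2 m3)
  oldAt-energy y m1 m2 m3 = +-injective2 (double-sum4 (e0 m0) (exponent 0 b m1) (exponent 0 b m2) (exponent 0 b m3)
    ∙ cong₂ Z._+_ (Zₚ.*-distribˡ-+ (+ 2) (+ r) (+ exponent (r N.+ r) d (m0 Z.- + 1)) ∙ cong (λ t → + 2 Z.* + r Z.+ t) (exponent-ℤ (r N.+ r) d (m0 Z.- + 1)))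
        (cong₂ Z._+_ (exponent-ℤ 0 b m1) (cong₂ Z._+_ (exponent-ℤ 0 b m2) (exponent-ℤ 0 b m3)))
      ∙ poly y m1 m2 m3 (+ r) (+ d) ∙ sym (energy-ℤ (y Z.- + 1) (y Z.- (m2 Z.+ m3)) (y Z.- (m1 Z.+ m3)) (y Z.- (m1 Z.+ m2))))
    where
    m0 = firstOf y m1 m2 m3
    jac : ℤ → ℤ → ℤ → ℤ
    jac r d m = + 2 Z.* m Z.* + 0 Z.+ (+ 0 Z.+ (r Z.+ (r Z.+ d))) Z.* (m Z.* m Z.- m)
    poly : ∀ y m1 m2 m3 r d → (+ 2 Z.* r Z.+ (+ 2 Z.* (firstOf y m1 m2 m3 Z.- + 1) Z.* (r Z.+ r) Z.+ ((r Z.+ r) Z.+ d) Z.* ((firstOf y m1 m2 m3 Z.- + 1) Z.* (firstOf y m1 m2 m3 Z.- + 1) Z.- (firstOf y m1 m2 m3 Z.- + 1))))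
            Z.+ (jac r d m1 Z.+ (jac r d m2 Z.+ jac r d m3)) ≡ energyℤ r (r Z.+ (r Z.+ d)) (y Z.- + 1) (y Z.- (m2 Z.+ m3)) (y Z.- (m1 Z.+ m3)) (y Z.- (m1 Z.+ m2))
    poly y m1 m2 m3 r d = solveℤ 6 (λ y m1 m2 m3 r d →
      let k = (y :+ y) :- (m1 :+ (m2 :+ m3)) :- :1
          J = λ m → nat 2 :* m :* nat 0 :+ (nat 0 :+ (r :+ (r :+ d))) :* (m :* m :- m)
          E = λ r b s1 s2 s3 s4 → nat 2 :* (s1 :+ (s2 :+ (s3 :+ s4))) :* r :+ b :* (s1 :* s1 :+ (s2 :* s2 :+ (s3 :* s3 :+ s4 :* s4)) :- (s1 :+ (s2 :+ (s3 :+ s4)))) in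
      (nat 2 :* r :+ (nat 2 :* k :* (r :+ r) :+ ((r :+ r) :+ d) :* (k :* k :- k))) :+ (J m1 :+ (J m2 :+ J m3)) ,
      E r (r :+ (r :+ d)) (y :- :1) (y :- (m2 :+ m3)) (y :- (m1 :+ m3)) (y :- (m1 :+ m2))) (y ∷ m1 ∷ m2 ∷ m3 ∷ r ∷ d ∷ [])

  oldAt-term : ∀ y m1 m2 m3 → newTerm (firstOf y m1 m2 m3 , m1 , m2 , m3) ≋ quadTerm (oldAt y m1 m2 m3)
  oldAt-term y m1 m2 m3 = newTerm-collected (firstOf y m1 m2 m3) m1 m2 m3 ⟫ term-cong
    (cong₂ Z._*_ (sym (cong sign (quadSum-oldAt y m1 m2 m3) ∙ odd-sign (firstOf y m1 m2 m3 Z.- + 1)))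
      (sym (cong₂ Z._*_ (diff1-oldAt y m1 m2 m3) (cong₂ Z._*_ (diff2-oldAt y m1 m2 m3) (diff3-oldAt y m1 m2 m3)))))
    (oldAt-energy y m1 m2 m3)

  oddSum? : ∀ s → Dec (¬ EvenSum s)
  oddSum? s = ¬? (evenSum? s)

  old-onto : ∀ s → ¬ EvenSum s → Σ Quad (λ m → EvenSum m × toOld m ≡ s)
  old-onto s@(s1 , s2 , s3 , s4) ¬p = let h , q = not-even-odd (quadSum s) ¬p in build h (solved s1 s2 s3 s4 _ q)
    where
    build : ∀ h → s1 ≡ (+ 1 Z.+ (h Z.+ h)) Z.- (s2 Z.+ (s3 Z.+ s4)) → Σ Quad (λ m → EvenSum m × toOld m ≡ s)
    build h q = m , subst Even (sym total≡) (double-even y) , cong (λ y → oldAt y m1 m2 m3) (halved y total≡)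
        ∙ cong₂ _,_ (solveℤ 4 (λ h s2 s3 s4 → (nat 2 :+ (h :+ h)) :- (s2 :+ (s3 :+ s4)) :- :1 , (:1 :+ (h :+ h)) :- (s2 :+ (s3 :+ s4))) (h ∷ s2 ∷ s3 ∷ s4 ∷ []) ∙ sym q)
          (cong₂ _,_ (solveℤ 4 (λ h s2 s3 s4 → (nat 2 :+ (h :+ h)) :- (s2 :+ (s3 :+ s4)) :- ((:1 :+ h :- (s2 :+ s4)) :+ (:1 :+ h :- (s2 :+ s3))) , s2) (h ∷ s2 ∷ s3 ∷ s4 ∷ []))
            (cong₂ _,_ (solveℤ 4 (λ h s2 s3 s4 → (nat 2 :+ (h :+ h)) :- (s2 :+ (s3 :+ s4)) :- ((:1 :+ h :- (s3 :+ s4)) :+ (:1 :+ h :- (s2 :+ s3))) , s3) (h ∷ s2 ∷ s3 ∷ s4 ∷ []))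
              (solveℤ 4 (λ h s2 s3 s4 → (nat 2 :+ (h :+ h)) :- (s2 :+ (s3 :+ s4)) :- ((:1 :+ h :- (s3 :+ s4)) :+ (:1 :+ h :- (s2 :+ s4))) , s4) (h ∷ s2 ∷ s3 ∷ s4 ∷ []))))
      where
      m1 = + 1 Z.+ h Z.- (s3 Z.+ s4)
      m2 = + 1 Z.+ h Z.- (s2 Z.+ s4)
      m3 = + 1 Z.+ h Z.- (s2 Z.+ s3)
      y = (+ 2 Z.+ (h Z.+ h)) Z.- (s2 Z.+ (s3 Z.+ s4))
      m : Quad
      m = + 1 Z.+ h , m1 , m2 , m3
      total≡ : quadSum m ≡ y Z.+ y
      total≡ = solveℤ 4 (λ h s2 s3 s4 → let y = (nat 2 :+ (h :+ h)) :- (s2 :+ (s3 :+ s4)) in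
        (:1 :+ h) :+ ((:1 :+ h :- (s3 :+ s4)) :+ ((:1 :+ h :- (s2 :+ s4)) :+ (:1 :+ h :- (s2 :+ s3)))) , y :+ y) (h ∷ s2 ∷ s3 ∷ s4 ∷ [])

  rearrangement : Reindexing (restrict evenSum? newTerm) (restrict oddSum? quadTerm)
  rearrangement = record
    { to = toOld ; Relevant = EvenSum ; relevant? = evenSum? ; irrelevant = restrict-no evenSum? newTerm
    ; agree = λ m p → restrict-yes evenSum? newTerm m p ⟫ moved m p ⟫ ≋-sym (restrict-yes oddSum? quadTerm (toOld m) (toOld-odd m p))
    ; injective = λ m m′ p p′ q → sym (fromOld-toOld m p) ∙ cong fromOld q ∙ fromOld-toOld m′ p′
    ; onto = λ s → onto s (evenSum? s) }
    where
    moved : ∀ m → EvenSum m → newTerm m ≋ quadTerm (toOld m)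
    moved (m0 , m1 , m2 , m3) p = ≋-reflexive (cong (λ t → newTerm (t , m1 , m2 , m3)) (solved m0 m1 m2 m3 _ p)) ⟫ oldAt-term (half (quadSum (m0 , m1 , m2 , m3))) m1 m2 m3
    onto : ∀ s → Dec (EvenSum s) → restrict oddSum? quadTerm s ≋ 0# ⊎ Σ Quad (λ m → EvenSum m × toOld m ≡ s)
    onto s (yes p) = inj₁ (restrict-no oddSum? quadTerm s (λ ¬p → ¬p p))
    onto s (no ¬p) = inj₂ (old-onto s ¬p)

  -- The theta form of ℘′(u) = -σ(2u)/σ(u)⁴: the third logarithmic derivative at r is a multiple of
  -- the theta function at 2r divided by the fourth power of that at r.
  weierstrass : thirdLog (T.theta (power 0)) (T.theta (power 1)) (T.theta (power 2)) (T.theta (power 3)) ≋ - (poch b′ ^ 9 * (X^ r * T2.theta (λ _ → + 1)))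
  -- Three halvings: 4W is the even part of the new series, twice that part is the signed product,
  -- and `cube` contributes (-2)³ to it.
  weierstrass = cancel-2 (cancel-2 (cancel-2 (solve 1 (λ w → w :+ w :+ (w :+ w) :+ (w :+ w :+ (w :+ w)) , nat 4 :* w :+ nat 4 :* w) (W ∷ [])
    ⟫ +-cong four four ⟫ twice-even ⟫ solve 2 (λ e t → let c = :- (nat 2 :* e :^ 3) in
      t :* (c :* (c :* c)) , let x = :- (e :^ 9 :* t) in x :+ x :+ (x :+ x) :+ (x :+ x :+ (x :+ x))) (E ∷ X^ r * T2.theta (λ _ → + 1) ∷ []))))
    where
    even-sum : Σ Ser (HasSum (restrict evenSum? quadTerm))
    even-sum = restricted-sum _≟4_ evenSum? HasSum-quadTerm
    four : fromℤ (+ 4) * W ≋ proj₁ new-even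
    four = HasSum-split _≟4_ evenSum? HasSum-quadTerm (proj₂ even-sum) (reindex rearrangement (proj₂ new-even))
      ⟫ +-congʳ (even-part (proj₂ even-sum)) ⟫ +-identityˡ _

-- The quintuple product

_≟2_ : DecidableEquality (ℤ × ℤ)
_≟2_ = ×ₚ.≡-dec Zₚ._≟_ Zₚ._≟_

-- The exponents f and g are specified through their doubles, because in the application they arise
-- as quotients by 7 of pentagonal numbers and not as values of `exponent`.
module Quintuple (r r′ b′ : ℕ) (r+r′ : r N.+ r′ ≡ suc b′) (d : ℕ) (2r+d : (r N.+ r) N.+ d ≡ suc b′)
  (f g : ℤ → ℕ)
  (f-ℤ : ∀ n → + 2 Z.* + f n ≡ + 2 Z.* (+ 3 Z.* n) Z.* + r Z.+ + suc b′ Z.* (+ 3 Z.* (n Z.* n) Z.- n))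
  (g-ℤ : ∀ n → + 2 Z.* + g n ≡ + 2 Z.* (+ 3 Z.* n Z.+ + 1) Z.* + r Z.+ + suc b′ Z.* (+ 3 Z.* (n Z.* n) Z.+ n))
  where
  b : ℕ
  b = suc b′
  module T = Theta r r′ b′ r+r′
  module T2 = Theta (r N.+ r) d b′ 2r+d
  module P = Theta (suc b′) (suc b′ N.+ suc b′) (b′ N.+ (suc b′ N.+ suc b′)) refl

  e e2 eₚ : ℤ → ℕ
  e = exponent r r′
  e2 = exponent (r N.+ r) d
  eₚ = exponent b (b N.+ b)

  e-ℤ : ∀ s → + 2 Z.* + e s ≡ + 2 Z.* s Z.* + r Z.+ + b Z.* (s Z.* s Z.- s)
  e-ℤ s = exponent-ℤ r r′ s ∙ cong (λ t → + 2 Z.* s Z.* + r Z.+ t Z.* (s Z.* s Z.- s)) (cong +_ r+r′)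

  e2-ℤ : ∀ s → + 2 Z.* + e2 s ≡ + 2 Z.* s Z.* (+ r Z.+ + r) Z.+ + b Z.* (s Z.* s Z.- s)
  e2-ℤ s = exponent-ℤ (r N.+ r) d s ∙ cong (λ t → + 2 Z.* s Z.* (+ r Z.+ + r) Z.+ t Z.* (s Z.* s Z.- s)) (cong +_ 2r+d)

  EvenPair : ℤ × ℤ → Set
  EvenPair (x , y) = Even (x Z.+ y)

  evenPair? : ∀ p → Dec (EvenPair p)
  evenPair? (x , y) = even? (x Z.+ y)

  oddPair? : ∀ p → Dec (¬ EvenPair p)
  oddPair? p = ¬? (evenPair? p)

  pairTerm : (ℤ → ℕ) → (ℤ → ℕ) → ℤ × ℤ → Ser
  pairTerm u v (x , y) = term⟨ sign (x Z.+ y) , u x N.+ v y ⟩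

  HasSum-pairTerm : ∀ {u v U V} → HasSum (λ x → term⟨ sign x , u x ⟩) U → HasSum (λ y → term⟨ sign y , v y ⟩) V → HasSum (pairTerm u v) (U * V)
  HasSum-pairTerm {u} {v} p q = HasSum-cong (λ { (x , y) → term-* (sign x) (u x) (sign y) (v y) ⟫ term-cong (sym (sign-+ x y)) refl }) ≋-refl (HasSum-× Zₚ._≟_ p q)

  unweighted : ∀ {u : ℤ → ℕ} {U} → HasSum (λ x → term⟨ sign x Z.* + 1 , u x ⟩) U → HasSum (λ x → term⟨ sign x , u x ⟩) U
  unweighted {u} p = HasSum-cong (λ x → term-cong (Zₚ.*-identityʳ (sign x)) refl) ≋-refl p

  FT GT ET : ℤ × ℤ → Ser
  FT = pairTerm e f
  GT = pairTerm e g
  ET = pairTerm eₚ e2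

  energies : ∀ (a b c d : ℕ) {p q s t : ℤ} → + 2 Z.* + a ≡ p → + 2 Z.* + b ≡ q → + 2 Z.* + c ≡ s → + 2 Z.* + d ≡ t → p Z.+ q ≡ s Z.+ t → a N.+ b ≡ c N.+ d
  energies a b c d refl refl refl refl h = +-injective2 (Zₚ.*-distribˡ-+ (+ 2) (+ a) (+ b) ∙ h ∙ sym (Zₚ.*-distribˡ-+ (+ 2) (+ c) (+ d)))

  halved : ∀ {x} z → x ≡ z Z.+ z → half x ≡ z
  halved z refl = half-double z

  solved : ∀ s n y → s Z.+ n ≡ y → s ≡ y Z.- n
  solved s n y refl = solveℤ 2 (λ s n → s , s :+ n :- n) (s ∷ n ∷ [])

  half⁻ : ℤ → ℤ
  half⁻ x = half (x Z.- + 1)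

  half⁻-odd : ∀ z → half⁻ (+ 1 Z.+ (z Z.+ z)) ≡ z
  half⁻-odd z = halved z (solveℤ 1 (λ z → :1 :+ (z :+ z) :- :1 , z :+ z) (z ∷ []))

  odd-half⁻ : ∀ x → ¬ Even x → x ≡ + 1 Z.+ (half⁻ x Z.+ half⁻ x)
  odd-half⁻ x ¬p with not-even-odd x ¬p
  ... | z , refl = cong (λ t → + 1 Z.+ (t Z.+ t)) (sym (half⁻-odd z))

  -- (s, n) with s + n = 2y corresponds to (m, k) = (y - n, y + n).
  evenMove evenBack : ℤ × ℤ → ℤ × ℤ
  evenMove (s , n) = half (s Z.+ n) Z.- n , half (s Z.+ n) Z.+ n
  evenBack (m , k) = half (m Z.+ k) Z.+ m , half (m Z.+ k) Z.- m

  evenMove-sum : ∀ y n → (y Z.- n) Z.+ (y Z.+ n) ≡ y Z.+ y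
  evenMove-sum y n = solveℤ 2 (λ y n → (y :- n) :+ (y :+ n) , y :+ y) (y ∷ n ∷ [])

  evenMove-even : ∀ p → EvenPair (evenMove p)
  evenMove-even (s , n) = subst Even (sym (evenMove-sum (half (s Z.+ n)) n)) (double-even (half (s Z.+ n)))

  evenBack-move : ∀ p → EvenPair p → evenBack (evenMove p) ≡ p
  evenBack-move (s , n) p = cong (λ z → z Z.+ (y Z.- n) , z Z.- (y Z.- n)) (halved y (evenMove-sum y n))
    ∙ cong₂ _,_ (solveℤ 2 (λ y n → y :+ (y :- n) , (y :+ y) :- n) (y ∷ n ∷ []) ∙ sym (solved s n _ p))
      (solveℤ 2 (λ y n → y :- (y :- n) , n) (y ∷ n ∷ []))
    where y = half (s Z.+ n)

  evenBack-sum : ∀ y m → (y Z.+ m) Z.+ (y Z.- m) ≡ y Z.+ y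
  evenBack-sum y m = solveℤ 2 (λ y n → (y :+ n) :+ (y :- n) , y :+ y) (y ∷ m ∷ [])

  evenMove-back : ∀ p → EvenPair p → evenMove (evenBack p) ≡ p
  evenMove-back (m , k) p = cong (λ z → z Z.- (y Z.- m) , z Z.+ (y Z.- m)) (halved y (evenBack-sum y m))
    ∙ cong₂ _,_ (solveℤ 2 (λ y n → y :- (y :- n) , n) (y ∷ m ∷ []))
      (solveℤ 2 (λ y n → y :+ (y :- n) , (y :+ y) :- n) (y ∷ m ∷ []) ∙ sym (solved k m _ (Zₚ.+-comm k m ∙ p)))
    where y = half (m Z.+ k)

  even-energy : ∀ y n → e ((y Z.+ y) Z.- n) N.+ f n ≡ eₚ (y Z.- n) N.+ e2 (y Z.+ n)
  even-energy y n = energies (e ((y Z.+ y) Z.- n)) (f n) (eₚ (y Z.- n)) (e2 (y Z.+ n)) (e-ℤ ((y Z.+ y) Z.- n)) (f-ℤ n) (exponent-ℤ b (b N.+ b) (y Z.- n)) (e2-ℤ (y Z.+ n))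
    (solveℤ 4 (λ y n r b → let s = (y :+ y) :- n ; m = y :- n ; k = y :+ n in
      (nat 2 :* s :* r :+ b :* (s :* s :- s)) :+ (nat 2 :* (nat 3 :* n) :* r :+ b :* (nat 3 :* (n :* n) :- n)) ,
      (nat 2 :* m :* b :+ (b :+ (b :+ b)) :* (m :* m :- m)) :+ (nat 2 :* k :* (r :+ r) :+ b :* (k :* k :- k)))
      (y ∷ n ∷ + r ∷ + b ∷ []))

  even-rearrangement : Reindexing (restrict evenPair? FT) (restrict evenPair? ET)
  even-rearrangement = record
    { to = evenMove ; Relevant = EvenPair ; relevant? = evenPair? ; irrelevant = restrict-no evenPair? FT
    ; agree = λ p q → restrict-yes evenPair? FT p q ⟫ moved p q ⟫ ≋-sym (restrict-yes evenPair? ET (evenMove p) (evenMove-even p))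
    ; injective = λ p p′ q q′ h → sym (evenBack-move p q) ∙ cong evenBack h ∙ evenBack-move p′ q′
    ; onto = λ p → onto p (evenPair? p) }
    where
    moved : ∀ p → EvenPair p → FT p ≋ ET (evenMove p)
    moved (s , n) p = term-cong (even-sign (s Z.+ n) p ∙ sym (even-sign _ (evenMove-even (s , n))))
      (cong (λ t → e t N.+ f n) (solved s n _ p) ∙ even-energy (half (s Z.+ n)) n)
    onto : ∀ p → Dec (EvenPair p) → restrict evenPair? ET p ≋ 0# ⊎ Σ (ℤ × ℤ) (λ q → EvenPair q × evenMove q ≡ p)
    onto p (no ¬q) = inj₁ (restrict-no evenPair? ET p ¬q)
    onto p@(m , k) (yes q) = inj₂ (evenBack p , subst Even (sym (evenBack-sum (half (m Z.+ k)) m)) (double-even (half (m Z.+ k))) , evenMove-back p q)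

  -- (s, n) with s + n = 1 + 2h corresponds to (m, k) = (n - h, h + n + 1).
  oddMove oddBack : ℤ × ℤ → ℤ × ℤ
  oddMove (s , n) = n Z.- half⁻ (s Z.+ n) , half⁻ (s Z.+ n) Z.+ n Z.+ + 1
  oddBack (m , k) = let n = half⁻ (m Z.+ k) in (+ 1 Z.+ ((n Z.- m) Z.+ (n Z.- m))) Z.- n , n

  oddMove-sum : ∀ h n → (n Z.- h) Z.+ (h Z.+ n Z.+ + 1) ≡ + 1 Z.+ (n Z.+ n)
  oddMove-sum h n = solveℤ 2 (λ h n → (n :- h) :+ (h :+ n :+ :1) , :1 :+ (n :+ n)) (h ∷ n ∷ [])

  oddMove-odd : ∀ p → ¬ EvenPair (oddMove p)
  oddMove-odd (s , n) q = odd-not-even n (subst Even (oddMove-sum (half⁻ (s Z.+ n)) n) q)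

  oddBack-move : ∀ p → ¬ EvenPair p → oddBack (oddMove p) ≡ p
  oddBack-move (s , n) ¬p = cong (λ z → (+ 1 Z.+ ((z Z.- (n Z.- h)) Z.+ (z Z.- (n Z.- h)))) Z.- z , z) (cong half⁻ (oddMove-sum h n) ∙ half⁻-odd n)
    ∙ cong (_, n) (solveℤ 2 (λ h n → (:1 :+ ((n :- (n :- h)) :+ (n :- (n :- h)))) :- n , (:1 :+ (h :+ h)) :- n) (h ∷ n ∷ []) ∙ sym (solved s n _ (odd-half⁻ _ ¬p)))
    where h = half⁻ (s Z.+ n)

  oddBack-sum : ∀ h n → ((+ 1 Z.+ (h Z.+ h)) Z.- n) Z.+ n ≡ + 1 Z.+ (h Z.+ h)
  oddBack-sum h n = solveℤ 2 (λ h n → ((:1 :+ (h :+ h)) :- n) :+ n , :1 :+ (h :+ h)) (h ∷ n ∷ [])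

  oddMove-back : ∀ p → ¬ EvenPair p → oddMove (oddBack p) ≡ p
  oddMove-back (m , k) ¬p = cong (λ h → n Z.- h , h Z.+ n Z.+ + 1) (cong half⁻ (oddBack-sum (n Z.- m) n) ∙ half⁻-odd (n Z.- m))
    ∙ cong₂ _,_ (solveℤ 2 (λ n m → n :- (n :- m) , m) (n ∷ m ∷ []))
      (solveℤ 2 (λ n m → n :- m :+ n :+ :1 , (:1 :+ (n :+ n)) :- m) (n ∷ m ∷ []) ∙ sym (solved k m _ (Zₚ.+-comm k m ∙ odd-half⁻ _ ¬p)))
    where n = half⁻ (m Z.+ k)

  odd-energy : ∀ h n → e ((+ 1 Z.+ (h Z.+ h)) Z.- n) N.+ g n ≡ eₚ (n Z.- h) N.+ e2 (h Z.+ n Z.+ + 1)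
  odd-energy h n = energies (e ((+ 1 Z.+ (h Z.+ h)) Z.- n)) (g n) (eₚ (n Z.- h)) (e2 (h Z.+ n Z.+ + 1)) (e-ℤ ((+ 1 Z.+ (h Z.+ h)) Z.- n)) (g-ℤ n) (exponent-ℤ b (b N.+ b) (n Z.- h)) (e2-ℤ (h Z.+ n Z.+ + 1))
    (solveℤ 4 (λ h n r b → let s = (:1 :+ (h :+ h)) :- n ; m = n :- h ; k = h :+ n :+ :1 in
      (nat 2 :* s :* r :+ b :* (s :* s :- s)) :+ (nat 2 :* (nat 3 :* n :+ :1) :* r :+ b :* (nat 3 :* (n :* n) :+ n)) ,
      (nat 2 :* m :* b :+ (b :+ (b :+ b)) :* (m :* m :- m)) :+ (nat 2 :* k :* (r :+ r) :+ b :* (k :* k :- k)))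
      (h ∷ n ∷ + r ∷ + b ∷ []))

  odd-rearrangement : Reindexing (restrict oddPair? GT) (restrict oddPair? ET)
  odd-rearrangement = record
    { to = oddMove ; Relevant = λ p → ¬ EvenPair p ; relevant? = oddPair? ; irrelevant = restrict-no oddPair? GT
    ; agree = λ p q → restrict-yes oddPair? GT p q ⟫ moved p q ⟫ ≋-sym (restrict-yes oddPair? ET (oddMove p) (oddMove-odd p))
    ; injective = λ p p′ q q′ h → sym (oddBack-move p q) ∙ cong oddBack h ∙ oddBack-move p′ q′
    ; onto = λ p → onto p (evenPair? p) }
    where
    moved : ∀ p → ¬ EvenPair p → GT p ≋ ET (oddMove p)
    moved (s , n) p = term-cong (not-even-sign (s Z.+ n) p ∙ sym (not-even-sign _ (oddMove-odd (s , n))))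
      (cong (λ t → e t N.+ g n) (solved s n _ (odd-half⁻ _ p)) ∙ odd-energy (half⁻ (s Z.+ n)) n)
    onto : ∀ p → Dec (EvenPair p) → restrict oddPair? ET p ≋ 0# ⊎ Σ (ℤ × ℤ) (λ q → ¬ EvenPair q × oddMove q ≡ p)
    onto p (yes q) = inj₁ (restrict-no oddPair? ET p (λ ¬q → ¬q q))
    onto p@(m , k) (no ¬q) = inj₂ (oddBack p , (λ q → odd-not-even (half⁻ (m Z.+ k) Z.- m) (subst Even (oddBack-sum (half⁻ (m Z.+ k) Z.- m) (half⁻ (m Z.+ k))) q)) , oddMove-back p ¬q)

  -- (s, n) with s + n = 1 + 2h in FT cancels (2n - h, h) in GT.
  crossMove crossBack : ℤ × ℤ → ℤ × ℤ
  crossMove (s , n) = let h = half⁻ (s Z.+ n) in (n Z.+ n) Z.- h , h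
  crossBack (s′ , h) = (+ 1 Z.+ (h Z.+ h)) Z.- half (s′ Z.+ h) , half (s′ Z.+ h)

  crossMove-sum : ∀ h n → ((n Z.+ n) Z.- h) Z.+ h ≡ n Z.+ n
  crossMove-sum h n = solveℤ 2 (λ h n → ((n :+ n) :- h) :+ h , n :+ n) (h ∷ n ∷ [])

  crossMove-even : ∀ p → EvenPair (crossMove p)
  crossMove-even (s , n) = subst Even (sym (crossMove-sum (half⁻ (s Z.+ n)) n)) (double-even n)

  crossBack-move : ∀ p → ¬ EvenPair p → crossBack (crossMove p) ≡ p
  crossBack-move (s , n) ¬p = cong (λ z → (+ 1 Z.+ (h Z.+ h)) Z.- z , z) (halved n (crossMove-sum h n))
    ∙ cong (_, n) (sym (solved s n _ (odd-half⁻ _ ¬p)))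
    where h = half⁻ (s Z.+ n)

  crossMove-back : ∀ p → EvenPair p → crossMove (crossBack p) ≡ p
  crossMove-back (s′ , h) p = cong (λ z → (y Z.+ y) Z.- z , z) (cong half⁻ (oddBack-sum h y) ∙ half⁻-odd h)
    ∙ cong (_, h) (sym (solved s′ h _ p))
    where y = half (s′ Z.+ h)

  cross-energy : ∀ h n → e ((+ 1 Z.+ (h Z.+ h)) Z.- n) N.+ f n ≡ e ((n Z.+ n) Z.- h) N.+ g h
  cross-energy h n = energies (e ((+ 1 Z.+ (h Z.+ h)) Z.- n)) (f n) (e ((n Z.+ n) Z.- h)) (g h) (e-ℤ ((+ 1 Z.+ (h Z.+ h)) Z.- n)) (f-ℤ n) (e-ℤ ((n Z.+ n) Z.- h)) (g-ℤ h)
    (solveℤ 4 (λ h n r b → let s = (:1 :+ (h :+ h)) :- n ; t = (n :+ n) :- h in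
      (nat 2 :* s :* r :+ b :* (s :* s :- s)) :+ (nat 2 :* (nat 3 :* n) :* r :+ b :* (nat 3 :* (n :* n) :- n)) ,
      (nat 2 :* t :* r :+ b :* (t :* t :- t)) :+ (nat 2 :* (nat 3 :* h :+ :1) :* r :+ b :* (nat 3 :* (h :* h) :+ h)))
      (h ∷ n ∷ + r ∷ + b ∷ []))

  cross-rearrangement : Reindexing (restrict oddPair? FT) (λ p → - restrict evenPair? GT p)
  cross-rearrangement = record
    { to = crossMove ; Relevant = λ p → ¬ EvenPair p ; relevant? = oddPair? ; irrelevant = restrict-no oddPair? FT
    ; agree = λ p q → restrict-yes oddPair? FT p q ⟫ moved p q ⟫ -‿cong (≋-sym (restrict-yes evenPair? GT (crossMove p) (crossMove-even p)))
    ; injective = λ p p′ q q′ h → sym (crossBack-move p q) ∙ cong crossBack h ∙ crossBack-move p′ q′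
    ; onto = λ p → onto p (evenPair? p) }
    where
    moved : ∀ p → ¬ EvenPair p → FT p ≋ - GT (crossMove p)
    moved (s , n) p = term-cong {y = -[1+ 0 ]} (not-even-sign (s Z.+ n) p) (cong (λ t → e t N.+ f n) (solved s n _ (odd-half⁻ _ p)) ∙ cross-energy (half⁻ (s Z.+ n)) n)
      ⟫ solve 1 (λ x → con -[1+ 0 ] :* x , :- (nat 1 :* x)) (_ ∷ [])
        ⟫ -‿cong (term-cong (sym (even-sign _ (crossMove-even (s , n)))) refl)
    onto : ∀ p → Dec (EvenPair p) → - restrict evenPair? GT p ≋ 0# ⊎ Σ (ℤ × ℤ) (λ q → ¬ EvenPair q × crossMove q ≡ p)
    onto p (no ¬q) = inj₁ (-‿cong (restrict-no evenPair? GT p ¬q) ⟫ neg-0)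
    onto p@(s′ , h) (yes q) = inj₂ (crossBack p , (λ q → odd-not-even h (subst Even (oddBack-sum h (half (s′ Z.+ h))) q)) , crossMove-back p q)

  -- The even pairs of `FT` and the odd pairs of `GT` together cover `ET`; the odd pairs of `FT`
  -- cancel the even pairs of `GT`.
  assemble : ∀ {x y z a b c d} → HasSum FT x → HasSum GT y → HasSum ET z →
    HasSum (restrict evenPair? FT) a → HasSum (restrict oddPair? FT) b → HasSum (restrict evenPair? GT) c → HasSum (restrict oddPair? GT) d → x + y ≋ z
  assemble {x} {y} {z} {a} {b} {c} {d} X Y Z A B C D = +-cong x≋ y≋ ⟫ +-congʳ (+-congˡ b≋)
    ⟫ solve 3 (λ a c d → (a :+ :- c) :+ (c :+ d) , a :+ d) (a ∷ c ∷ d ∷ []) ⟫ ≋-sym z≋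
    where
    x≋ : x ≋ a + b
    x≋ = HasSum-split _≟2_ evenPair? {f = FT} X A B
    y≋ : y ≋ c + d
    y≋ = HasSum-split _≟2_ evenPair? {f = GT} Y C D
    z≋ : z ≋ a + d
    z≋ = HasSum-split _≟2_ evenPair? {f = ET} Z (reindex even-rearrangement A) (reindex odd-rearrangement D)
    b≋ : b ≋ - c
    b≋ = HasSum-unique _≟2_ (reindex cross-rearrangement B) (HasSum-neg {f = restrict evenPair? GT} C)

  quintuple : ∀ {F G} → HasSum (λ n → term⟨ sign n , f n ⟩) F → HasSum (λ n → term⟨ sign n , g n ⟩) G →
              T.theta (λ _ → + 1) * (F + G) ≋ poch b′ * T2.theta (λ _ → + 1)
  quintuple {F} {G} hF hG = distribˡ (T.theta (λ _ → + 1)) F G ⟫ assemble sumF sumG sumE (proj₂ (restricted-sum _≟2_ evenPair? sumF)) (proj₂ (restricted-sum _≟2_ oddPair? sumF))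
      (proj₂ (restricted-sum _≟2_ evenPair? sumG)) (proj₂ (restricted-sum _≟2_ oddPair? sumG))
    ⟫ *-congʳ (pentagonal b′)
    where
    sumF : HasSum FT (T.theta (λ _ → + 1) * F)
    sumF = HasSum-pairTerm {e} {f} (unweighted {e} (T.HasSum-theta (λ _ → + 1))) hF
    sumG : HasSum GT (T.theta (λ _ → + 1) * G)
    sumG = HasSum-pairTerm {e} {g} (unweighted {e} (T.HasSum-theta (λ _ → + 1))) hG
    sumE : HasSum ET (P.theta (λ _ → + 1) * T2.theta (λ _ → + 1))
    sumE = HasSum-pairTerm {eₚ} {e2} (unweighted {eₚ} (P.HasSum-theta (λ _ → + 1))) (unweighted {e2} (T2.HasSum-theta (λ _ → + 1)))

-- 7-dissections

module Expansion (k′ : ℕ) where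
  private
    k : ℕ
    k = suc k′
    module F = FiniteSums ℚ-ring

  expand : Ser → Ser
  expand f .at n = if n DivMod.% k N.≡ᵇ 0 then at f (n DivMod./ k) else 0ℚ

  -- For r = 0 this is the operator U of level k. A series is recovered as the sum over r < k of q^r
  -- times the r-th section taken at q^k.
  section : ℕ → Ser → Ser
  section r f .at n = at f (r N.+ n N.* k)

  at-expand : ∀ f r n → r < k → at (expand f) (r N.+ n N.* k) ≡ (if r N.≡ᵇ 0 then at f n else 0ℚ)
  at-expand f r n r<k = cong₂ (λ a b → if a N.≡ᵇ 0 then at f b else 0ℚ)
    (DivMod.[m+kn]%n≡m%n r n k ∙ DivMod.m<n⇒m%n≡m r<k)
    (DivMod.+-distrib-/ r (n N.* k) bound ∙ cong₂ N._+_ (DivMod.m<n⇒m/n≡0 r<k) (DivMod.m*n/n≡m n k))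
    where
    bound : r DivMod.% k N.+ (n N.* k) DivMod.% k < k
    bound = subst (_< k) (sym (cong₂ N._+_ (DivMod.m<n⇒m%n≡m r<k) (DivMod.m*n%n≡0 n k) ∙ Nₚ.+-identityʳ r)) r<k

  split-index : ∀ m → Σ ℕ λ r → Σ ℕ λ n → r < k × m ≡ r N.+ n N.* k
  split-index m = m DivMod.% k , m DivMod./ k , DivMod.m%n<n m k , DivMod.m≡m%n+[m/n]*n m k

  sections-≋ : ∀ {f g} → (∀ r → r < k → section r f ≋ section r g) → f ≋ g
  sections-≋ {f} {g} h = coeffs λ m → let r , n , r<k , e = split-index m in
    trans (cong (at f) e) (coeff (h r r<k) n ∙ cong (at g) (sym e))

  section-cong : ∀ r {f g} → f ≋ g → section r f ≋ section r g
  section-cong r p = coeffs λ n → coeff p (r N.+ n N.* k)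

  section-+ : ∀ r f g → section r (f + g) ≋ section r f + section r g
  section-+ r f g = coeffs λ _ → refl

  section-neg : ∀ r f → section r (- f) ≋ - section r f
  section-neg r f = coeffs λ _ → refl

  section-0-expand : ∀ f → section 0 (expand f) ≋ f
  section-0-expand f = coeffs λ n → at-expand f 0 n (s≤s z≤n)

  section-suc-expand : ∀ r f → suc r < k → section (suc r) (expand f) ≋ 0#
  section-suc-expand r f l = coeffs λ n → at-expand f (suc r) n l

  expand-cong : ∀ {f g} → f ≋ g → expand f ≋ expand g
  expand-cong {f} {g} p = coeffs λ n → cong (λ x → if n DivMod.% k N.≡ᵇ 0 then x else 0ℚ) (coeff p (n DivMod./ k))

  private
    sum<-blocks : ∀ n r h → r < k → (∀ i j → suc i < k → h (suc i N.+ j N.* k) ≡ 0ℚ) →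
                  F.sum< (suc (r N.+ n N.* k)) h ≡ F.sum< (suc n) (λ j → h (j N.* k))
    sum<-blocks n r h r<k v = cong (λ t → F.sum< (suc t) h) (Nₚ.+-comm r (n N.* k))
      ∙ cong (λ t → F.sum< t h) (sym (Nₚ.+-suc (n N.* k) r))
        ∙ F.sum<-append (n N.* k) (suc r) h ∙ cong₂ ℚ._+_ (blocks n) (block n r r<k)
      where
      block : ∀ n r → r < k → F.sum< (suc r) (λ i → h (n N.* k N.+ i)) ≡ h (n N.* k)
      block n r r<k = F.sum<-front r (λ i → h (n N.* k N.+ i))
        ∙ cong₂ ℚ._+_ (cong h (Nₚ.+-identityʳ (n N.* k)))
          (F.sum<-zero r (λ i i<r → cong h (Nₚ.+-comm (n N.* k) (suc i)) ∙ v i n (Nₚ.≤-trans (s≤s i<r) r<k)))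
          ∙ ℚₚ.+-identityʳ (h (n N.* k))
      blocks : ∀ n → F.sum< (n N.* k) h ≡ F.sum< n (λ j → h (j N.* k))
      blocks zero = refl
      blocks (suc n) = cong (λ t → F.sum< t h) (Nₚ.+-comm k (n N.* k))
        ∙ F.sum<-append (n N.* k) k h ∙ cong₂ ℚ._+_ (blocks n) (block n k′ Nₚ.≤-refl)

  -- A series in q^k behaves as a scalar for dissections: in the convolution only the indices
  -- divisible by k survive, one in each block of length k.
  section-expand-* : ∀ r f g → r < k → section r (expand f * g) ≋ f * section r g
  section-expand-* r f g r<k = coeffs λ n → sum<-blocks n r (λ i → at (expand f) i ℚ.* at g (r N.+ n N.* k ∸ i)) r<k
      (λ i j l → cong (ℚ._* _) (at-expand f (suc i) j l) ∙ ℚₚ.*-zeroˡ (at g (r N.+ n N.* k ∸ (suc i N.+ j N.* k))))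
    ∙ F.sum<-cong (suc n) (λ j j≤n → cong₂ ℚ._*_ (at-expand f 0 j (s≤s z≤n)) (cong (at g) (index n j (Nₚ.≤-pred j≤n))))
    where
    index : ∀ n j → j ≤ n → r N.+ n N.* k ∸ j N.* k ≡ r N.+ (n ∸ j) N.* k
    index n j j≤n = Nₚ.+-∸-assoc r (Nₚ.*-monoˡ-≤ k j≤n) ∙ cong (r N.+_) (sym (Nₚ.*-distribʳ-∸ k n j))

  expand-* : ∀ f g → expand (f * g) ≋ expand f * expand g
  expand-* f g = sections-≋ go
    where
    go : ∀ r → r < k → section r (expand (f * g)) ≋ section r (expand f * expand g)
    go zero l = section-0-expand (f * g) ⟫ ≋-sym (section-expand-* 0 f (expand g) l ⟫ *-congˡ (section-0-expand g))
    go (suc r) l = section-suc-expand r (f * g) l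
      ⟫ ≋-sym (section-expand-* (suc r) f (expand g) l ⟫ *-congˡ (section-suc-expand r g l) ⟫ zeroʳ f)

  expand-+ : ∀ f g → expand (f + g) ≋ expand f + expand g
  expand-+ f g = coeffs λ n → go (n DivMod.% k N.≡ᵇ 0) (at f (n DivMod./ k)) (at g (n DivMod./ k))
    where
    go : ∀ c x y → (if c then x ℚ.+ y else 0ℚ) ≡ (if c then x else 0ℚ) ℚ.+ (if c then y else 0ℚ)
    go true x y = refl
    go false x y = refl

  expand-neg : ∀ f → expand (- f) ≋ - expand f
  expand-neg f = coeffs λ n → go (n DivMod.% k N.≡ᵇ 0) (at f (n DivMod./ k))
    where
    go : ∀ c x → (if c then ℚ.- x else 0ℚ) ≡ ℚ.- (if c then x else 0ℚ)
    go true x = refl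
    go false x = refl

  expand-0 : expand 0# ≋ 0#
  expand-0 = coeffs λ n → go (n DivMod.% k N.≡ᵇ 0)
    where
    go : ∀ c → (if c then 0ℚ else 0ℚ) ≡ 0ℚ
    go true = refl
    go false = refl

  expand-X^ : ∀ e → expand (X^ e) ≋ X^ (e N.* k)
  expand-X^ e = sections-≋ go
    where
    unit-* : ∀ e n → unit (e N.* k) (n N.* k) ≡ unit e n
    unit-* zero zero = refl
    unit-* zero (suc n) = refl
    unit-* (suc e) zero = refl
    unit-* (suc e) (suc n) = F.unit-shift k (e N.* k) (n N.* k) ∙ unit-* e n
    unit-miss : ∀ e r n → suc r < k → unit (e N.* k) (suc r N.+ n N.* k) ≡ 0ℚ
    unit-miss zero r n l = refl
    unit-miss (suc e) r zero l = F.unit-< (suc e N.* k) (suc r N.+ 0) (Nₚ.≤-trans (subst (_< k) (sym (Nₚ.+-identityʳ (suc r))) l) (Nₚ.m≤m+n k (e N.* k)))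
    unit-miss (suc e) r (suc n) l = cong (unit (k N.+ e N.* k)) (sym (Nₚ.+-assoc (suc r) k _) ∙ cong (N._+ n N.* k) (Nₚ.+-comm (suc r) k) ∙ Nₚ.+-assoc k (suc r) _)
      ∙ F.unit-shift k (e N.* k) (suc r N.+ n N.* k) ∙ unit-miss e r n l
    go : ∀ r → r < k → section r (expand (X^ e)) ≋ section r (X^ (e N.* k))
    go zero l = section-0-expand (X^ e) ⟫ (coeffs λ n → sym (unit-* e n))
    go (suc r) l = section-suc-expand r (X^ e) l ⟫ (coeffs λ n → sym (unit-miss e r n l))

  expand-1 : expand 1# ≋ 1#
  expand-1 = expand-X^ 0

  expand-^ : ∀ f e → expand (f ^ e) ≋ expand f ^ e
  expand-^ f zero = expand-1
  expand-^ f (suc e) = expand-* f (f ^ e) ⟫ *-congˡ (expand-^ f e)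

  expand-fromℤ : ∀ z → expand (fromℤ z) ≋ fromℤ z
  expand-fromℤ (+ n) = go n
    where
    go : ∀ n → expand (fromℕ n) ≋ fromℕ n
    go zero = expand-0
    go (suc n) = expand-+ 1# (fromℕ n) ⟫ +-cong expand-1 (go n)
  expand-fromℤ -[1+ n ] = expand-neg _ ⟫ -‿cong (expand-fromℤ (+ suc n))

  section-vanishes : ∀ r {N f} → Vanishes (r N.+ N N.* k) f → Vanishes N (section r f)
  section-vanishes r {N} v = below λ n n<N → upto v (r N.+ n N.* k) (Nₚ.+-monoʳ-< r (Nₚ.*-monoˡ-< k n<N))

  section-≈[] : ∀ r {N f g} → f ≈[ r N.+ N N.* k ] g → section r f ≈[ N ] section r g
  section-≈[] r {N} v = below λ n n<N → upto v (r N.+ n N.* k) (Nₚ.+-monoʳ-< r (Nₚ.*-monoˡ-< k n<N))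

  section-X^ : ∀ r e → r < k → section r (X^ (r N.+ e N.* k)) ≋ X^ e
  section-X^ r e l = (coeffs λ n → F.unit-shift r (e N.* k) (n N.* k))
    ⟫ section-cong 0 (≋-sym (expand-X^ e)) ⟫ section-0-expand (X^ e)

  section-X^-≢ : ∀ r s e → r < k → s < k → r ≢ s → section r (X^ (s N.+ e N.* k)) ≋ 0#
  section-X^-≢ r s e l l′ r≢s = coeffs λ n → unit-≢ (s N.+ e N.* k) (r N.+ n N.* k) (λ q → r≢s (sym (rem r n l) ∙ cong (λ t → t DivMod.% k) (sym q) ∙ rem s e l′))
    where
    rem : ∀ r n → r < k → (r N.+ n N.* k) DivMod.% k ≡ r
    rem r n l = DivMod.[m+kn]%n≡m%n r n k ∙ DivMod.m<n⇒m%n≡m l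
    unit-≢ : ∀ m n → m ≢ n → unit m n ≡ 0ℚ
    unit-≢ zero zero h = contradiction refl h
    unit-≢ zero (suc n) h = refl
    unit-≢ (suc m) zero h = refl
    unit-≢ (suc m) (suc n) h = unit-≢ m n (λ q → h (cong suc q))

  HasSum-section : ∀ r {I : Set} {f : I → Ser} {s} → HasSum f s → HasSum (λ i → section r (f i)) (section r s)
  HasSum-section r {f = f} p = record
    { summable = record { support = λ N → support (r N.+ N N.* k) ; unique = λ N → unique (r N.+ N N.* k)
                        ; outside = λ N i i∉ → section-vanishes r (outside (r N.+ N N.* k) i i∉) }
    ; sums = λ N → ≈[]-trans (≋⇒≈[] (≋-sym (section-∑ (support (r N.+ N N.* k))))) (section-≈[] r (sums (r N.+ N N.* k))) }
    where
    open HasSum p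
    open import Data.List using ([]; _∷_)
    section-∑ : ∀ L → section r (∑ f L) ≋ ∑ (λ i → section r (f i)) L
    section-∑ [] = coeffs λ _ → refl
    section-∑ (i ∷ L) = section-+ r (f i) (∑ f L) ⟫ +-congˡ (section-∑ L)

open Expansion 6 using (expand; section; section-cong; section-+; section-neg; section-expand-*; section-0-expand; section-suc-expand; sections-≋; expand-*; expand-+; expand-neg; expand-fromℤ; expand-1; expand-0; expand-cong; expand-X^; section-X^; section-X^-≢; HasSum-section; expand-^)

sum7 : (ℕ → Ser) → Ser
sum7 G = G 0 + G 1 + G 2 + G 3 + G 4 + G 5 + G 6

recompose : (ℕ → Ser) → Ser
recompose F = sum7 (λ s → X^ s * expand (F s))

section-shift : ∀ r s f {t} → r < 7 → section r (X^ s) ≋ t → section r (X^ s * expand f) ≋ t * f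
section-shift r s f {t} l h = section-cong r (*-comm (X^ s) (expand f)) ⟫ section-expand-* r f (X^ s) l
  ⟫ *-congˡ h ⟫ *-comm f t

delta : ∀ r s → r < 7 → s < 7 → section r (X^ s) ≋ (if r N.≡ᵇ s then 1# else 0#)
delta r s l l′ with r N.≡ᵇ s in q
... | true with Nₚ.≡ᵇ⇒≡ r s (subst T (sym q) tt)
... | refl = section-cong r (≋-reflexive (cong X^ (sym (Nₚ.+-identityʳ r)))) ⟫ Expansion.section-X^ 6 r 0 l
delta r s l l′ | false = section-cong r (≋-reflexive (cong X^ (sym (Nₚ.+-identityʳ s))))
  ⟫ Expansion.section-X^-≢ 6 r s 0 l l′ (λ { refl → subst T q (Nₚ.≡⇒≡ᵇ r r refl) })

section-sum7 : ∀ r G → section r (sum7 G) ≋ sum7 (λ s → section r (G s))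
section-sum7 r G = coeffs λ _ → refl

sum7-cong : ∀ {G H} → (∀ s → s < 7 → G s ≋ H s) → sum7 G ≋ sum7 H
sum7-cong h = +-cong (+-cong (+-cong (+-cong (+-cong (+-cong (h 0 (Nₚ.≤ᵇ⇒≤ 1 7 _)) (h 1 (Nₚ.≤ᵇ⇒≤ 2 7 _))) (h 2 (Nₚ.≤ᵇ⇒≤ 3 7 _))) (h 3 (Nₚ.≤ᵇ⇒≤ 4 7 _))) (h 4 (Nₚ.≤ᵇ⇒≤ 5 7 _))) (h 5 (Nₚ.≤ᵇ⇒≤ 6 7 _))) (h 6 (Nₚ.≤ᵇ⇒≤ 7 7 _))

section-recompose : ∀ F r → r < 7 → section r (recompose F) ≋ F r
section-recompose F r l = section-sum7 r (λ s → X^ s * expand (F s)) ⟫ sum7-cong {λ s → section r (X^ s * expand (F s))} {λ s → (if r N.≡ᵇ s then 1# else 0#) * F s} (λ s l′ → section-shift r s (F s) l (delta r s l l′)) ⟫ pick r l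
  where
  pick : ∀ r → r < 7 → sum7 (λ s → (if r N.≡ᵇ s then 1# else 0#) * F s) ≋ F r
  pick 0 _ = solve 7 (λ a b c d e f g → :1 :* a :+ nat 0 :* b :+ nat 0 :* c :+ nat 0 :* d :+ nat 0 :* e :+ nat 0 :* f :+ nat 0 :* g , a) (F 0 ∷ F 1 ∷ F 2 ∷ F 3 ∷ F 4 ∷ F 5 ∷ F 6 ∷ [])
  pick 1 _ = solve 7 (λ a b c d e f g → nat 0 :* a :+ :1 :* b :+ nat 0 :* c :+ nat 0 :* d :+ nat 0 :* e :+ nat 0 :* f :+ nat 0 :* g , b) (F 0 ∷ F 1 ∷ F 2 ∷ F 3 ∷ F 4 ∷ F 5 ∷ F 6 ∷ [])
  pick 2 _ = solve 7 (λ a b c d e f g → nat 0 :* a :+ nat 0 :* b :+ :1 :* c :+ nat 0 :* d :+ nat 0 :* e :+ nat 0 :* f :+ nat 0 :* g , c) (F 0 ∷ F 1 ∷ F 2 ∷ F 3 ∷ F 4 ∷ F 5 ∷ F 6 ∷ [])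
  pick 3 _ = solve 7 (λ a b c d e f g → nat 0 :* a :+ nat 0 :* b :+ nat 0 :* c :+ :1 :* d :+ nat 0 :* e :+ nat 0 :* f :+ nat 0 :* g , d) (F 0 ∷ F 1 ∷ F 2 ∷ F 3 ∷ F 4 ∷ F 5 ∷ F 6 ∷ [])
  pick 4 _ = solve 7 (λ a b c d e f g → nat 0 :* a :+ nat 0 :* b :+ nat 0 :* c :+ nat 0 :* d :+ :1 :* e :+ nat 0 :* f :+ nat 0 :* g , e) (F 0 ∷ F 1 ∷ F 2 ∷ F 3 ∷ F 4 ∷ F 5 ∷ F 6 ∷ [])
  pick 5 _ = solve 7 (λ a b c d e f g → nat 0 :* a :+ nat 0 :* b :+ nat 0 :* c :+ nat 0 :* d :+ nat 0 :* e :+ :1 :* f :+ nat 0 :* g , f) (F 0 ∷ F 1 ∷ F 2 ∷ F 3 ∷ F 4 ∷ F 5 ∷ F 6 ∷ [])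
  pick 6 _ = solve 7 (λ a b c d e f g → nat 0 :* a :+ nat 0 :* b :+ nat 0 :* c :+ nat 0 :* d :+ nat 0 :* e :+ nat 0 :* f :+ :1 :* g , g) (F 0 ∷ F 1 ∷ F 2 ∷ F 3 ∷ F 4 ∷ F 5 ∷ F 6 ∷ [])
  pick (suc (suc (suc (suc (suc (suc (suc r))))))) (s≤s (s≤s (s≤s (s≤s (s≤s (s≤s (s≤s ())))))))

recompose-section : ∀ f → recompose (λ r → section r f) ≋ f
recompose-section f = sections-≋ (λ r l → section-recompose (λ r → section r f) r l)

-- Cauchy product of 7-dissections; the variable x stands for q.
cauchy7 : {A : Set} → (A → A → A) → (A → A → A) → A → (ℕ → A) → (ℕ → A) → ℕ → A
cauchy7 _+_ _*_ x F G 0 = (F 0 * G 0) + (x * ((((((F 1 * G 6) + (F 2 * G 5)) + (F 3 * G 4)) + (F 4 * G 3)) + (F 5 * G 2)) + (F 6 * G 1)))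
cauchy7 _+_ _*_ x F G 1 = ((F 0 * G 1) + (F 1 * G 0)) + (x * (((((F 2 * G 6) + (F 3 * G 5)) + (F 4 * G 4)) + (F 5 * G 3)) + (F 6 * G 2)))
cauchy7 _+_ _*_ x F G 2 = (((F 0 * G 2) + (F 1 * G 1)) + (F 2 * G 0)) + (x * ((((F 3 * G 6) + (F 4 * G 5)) + (F 5 * G 4)) + (F 6 * G 3)))
cauchy7 _+_ _*_ x F G 3 = ((((F 0 * G 3) + (F 1 * G 2)) + (F 2 * G 1)) + (F 3 * G 0)) + (x * (((F 4 * G 6) + (F 5 * G 5)) + (F 6 * G 4)))
cauchy7 _+_ _*_ x F G 4 = (((((F 0 * G 4) + (F 1 * G 3)) + (F 2 * G 2)) + (F 3 * G 1)) + (F 4 * G 0)) + (x * ((F 5 * G 6) + (F 6 * G 5)))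
cauchy7 _+_ _*_ x F G 5 = ((((((F 0 * G 5) + (F 1 * G 4)) + (F 2 * G 3)) + (F 3 * G 2)) + (F 4 * G 1)) + (F 5 * G 0)) + (x * (F 6 * G 6))
cauchy7 _+_ _*_ x F G _ = ((((((F 0 * G 6) + (F 1 * G 5)) + (F 2 * G 4)) + (F 3 * G 3)) + (F 4 * G 2)) + (F 5 * G 1)) + (F 6 * G 0)

module _ {F F′ G G′ : ℕ → Ser} (h : ∀ i → i < 7 → F i ≋ F′ i) (h′ : ∀ i → i < 7 → G i ≋ G′ i) where
  m : ∀ i j {_ : T (i N.<ᵇ 7)} {_ : T (j N.<ᵇ 7)} → F i * G j ≋ F′ i * G′ j
  m i j {a} {b} = *-cong (h i (Nₚ.<ᵇ⇒< i 7 a)) (h′ j (Nₚ.<ᵇ⇒< j 7 b))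

  cauchy-cong : ∀ x r → r < 7 → cauchy7 _+_ _*_ x F G r ≋ cauchy7 _+_ _*_ x F′ G′ r
  cauchy-cong x 0 _ = +-cong (m 0 0) (*-congˡ (+-cong (+-cong (+-cong (+-cong (+-cong (m 1 6) (m 2 5)) (m 3 4)) (m 4 3)) (m 5 2)) (m 6 1)))
  cauchy-cong x 1 _ = +-cong (+-cong (m 0 1) (m 1 0)) (*-congˡ (+-cong (+-cong (+-cong (+-cong (m 2 6) (m 3 5)) (m 4 4)) (m 5 3)) (m 6 2)))
  cauchy-cong x 2 _ = +-cong (+-cong (+-cong (m 0 2) (m 1 1)) (m 2 0)) (*-congˡ (+-cong (+-cong (+-cong (m 3 6) (m 4 5)) (m 5 4)) (m 6 3)))
  cauchy-cong x 3 _ = +-cong (+-cong (+-cong (+-cong (m 0 3) (m 1 2)) (m 2 1)) (m 3 0)) (*-congˡ (+-cong (+-cong (m 4 6) (m 5 5)) (m 6 4)))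
  cauchy-cong x 4 _ = +-cong (+-cong (+-cong (+-cong (+-cong (m 0 4) (m 1 3)) (m 2 2)) (m 3 1)) (m 4 0)) (*-congˡ (+-cong (m 5 6) (m 6 5)))
  cauchy-cong x 5 _ = +-cong (+-cong (+-cong (+-cong (+-cong (+-cong (m 0 5) (m 1 4)) (m 2 3)) (m 3 2)) (m 4 1)) (m 5 0)) (*-congˡ (m 6 6))
  cauchy-cong x 6 _ = +-cong (+-cong (+-cong (+-cong (+-cong (+-cong (m 0 6) (m 1 5)) (m 2 4)) (m 3 3)) (m 4 2)) (m 5 1)) (m 6 0)
  cauchy-cong x (suc (suc (suc (suc (suc (suc (suc r))))))) (s≤s (s≤s (s≤s (s≤s (s≤s (s≤s (s≤s ())))))))

expand-⟦⟧ : ∀ {n} (e : Expr n) ρ → expand (⟦ e ⟧ ρ) ≋ ⟦ e ⟧ (Vec.map expand ρ)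
expand-⟦⟧ (var i) ρ = ≋-reflexive (sym (Vecₚ.lookup-map i expand ρ))
expand-⟦⟧ (con z) ρ = expand-fromℤ z
expand-⟦⟧ :1 ρ = expand-1
expand-⟦⟧ (e :+ f) ρ = expand-+ (⟦ e ⟧ ρ) (⟦ f ⟧ ρ) ⟫ +-cong (expand-⟦⟧ e ρ) (expand-⟦⟧ f ρ)
expand-⟦⟧ (e :* f) ρ = expand-* (⟦ e ⟧ ρ) (⟦ f ⟧ ρ) ⟫ *-cong (expand-⟦⟧ e ρ) (expand-⟦⟧ f ρ)
expand-⟦⟧ (e :- f) ρ = expand-+ (⟦ e ⟧ ρ) (- ⟦ f ⟧ ρ) ⟫ +-cong (expand-⟦⟧ e ρ) (expand-neg (⟦ f ⟧ ρ) ⟫ -‿cong (expand-⟦⟧ f ρ))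
expand-⟦⟧ (:- e) ρ = expand-neg (⟦ e ⟧ ρ) ⟫ -‿cong (expand-⟦⟧ e ρ)
expand-⟦⟧ (e :^ k) ρ = Expansion.expand-^ 6 (⟦ e ⟧ ρ) k ⟫ ^-congˡ k (expand-⟦⟧ e ρ)

powers : ∀ k → X^ k ≋ X^ 1 ^ k
powers k = ≋-sym (X^-* 1 k ⟫ ≋-reflexive (cong X^ (Nₚ.*-identityʳ k)))

recompose-polynomial : ∀ {F G : ℕ → Ser} → (∀ r → r < 7 → expand (F r) ≋ G r) → recompose F ≋ sum7 (λ s → X^ 1 ^ s * G s)
recompose-polynomial {F} {G} h = sum7-cong {λ s → X^ s * expand (F s)} {λ s → X^ 1 ^ s * G s} (λ s l → *-cong (powers s) (h s l))

entry : ∀ {n} → Expr n → Expr n → Expr n → Expr n → Expr n → Expr n → Expr n → ℕ → Expr n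
entry a b c d e f g 0 = a
entry a b c d e f g 1 = b
entry a b c d e f g 2 = c
entry a b c d e f g 3 = d
entry a b c d e f g 4 = e
entry a b c d e f g 5 = f
entry a b c d e f g _ = g

sum7ₑ : ∀ {n} → (ℕ → Expr n) → Expr n
sum7ₑ G = G 0 :+ G 1 :+ G 2 :+ G 3 :+ G 4 :+ G 5 :+ G 6

generic : ℕ → Expr 15
generic = cauchy7 _:+_ _:*_ (var (Fin.fromℕ 14)) (entry v0 v1 v2 v3 v4 v5 v6) (entry w0 w1 w2 w3 w4 w5 w6)
  where
  v0 = var (Fin.fromℕ< {0} (Nₚ.<ᵇ⇒< 0 15 tt))
  v1 = var (Fin.fromℕ< {1} (Nₚ.<ᵇ⇒< 1 15 tt))
  v2 = var (Fin.fromℕ< {2} (Nₚ.<ᵇ⇒< 2 15 tt))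
  v3 = var (Fin.fromℕ< {3} (Nₚ.<ᵇ⇒< 3 15 tt))
  v4 = var (Fin.fromℕ< {4} (Nₚ.<ᵇ⇒< 4 15 tt))
  v5 = var (Fin.fromℕ< {5} (Nₚ.<ᵇ⇒< 5 15 tt))
  v6 = var (Fin.fromℕ< {6} (Nₚ.<ᵇ⇒< 6 15 tt))
  w0 = var (Fin.fromℕ< {7} (Nₚ.<ᵇ⇒< 7 15 tt))
  w1 = var (Fin.fromℕ< {8} (Nₚ.<ᵇ⇒< 8 15 tt))
  w2 = var (Fin.fromℕ< {9} (Nₚ.<ᵇ⇒< 9 15 tt))
  w3 = var (Fin.fromℕ< {10} (Nₚ.<ᵇ⇒< 10 15 tt))
  w4 = var (Fin.fromℕ< {11} (Nₚ.<ᵇ⇒< 11 15 tt))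
  w5 = var (Fin.fromℕ< {12} (Nₚ.<ᵇ⇒< 12 15 tt))
  w6 = var (Fin.fromℕ< {13} (Nₚ.<ᵇ⇒< 13 15 tt))

-- Both factors are polynomials of degree below 7 in q over the series in q⁷. Reducing the product
-- by q⁷ = `expand` q leaves one polynomial identity in fifteen variables.
cauchy : ∀ f g r → r < 7 → section r (f * g) ≋ cauchy7 _+_ _*_ (X^ 1) (λ s → section s f) (λ s → section s g) r
cauchy f g r l = section-cong r product ⟫ section-recompose (cauchy7 _+_ _*_ (X^ 1) F G) r l
  where
  F G : ℕ → Ser
  F s = section s f
  G s = section s g
  ρ : Vec Ser 15
  ρ = F 0 ∷ F 1 ∷ F 2 ∷ F 3 ∷ F 4 ∷ F 5 ∷ F 6 ∷ G 0 ∷ G 1 ∷ G 2 ∷ G 3 ∷ G 4 ∷ G 5 ∷ G 6 ∷ X^ 1 ∷ []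
  ρ′ : Vec Ser 15
  ρ′ = expand (F 0) ∷ expand (F 1) ∷ expand (F 2) ∷ expand (F 3) ∷ expand (F 4) ∷ expand (F 5) ∷ expand (F 6) ∷
       expand (G 0) ∷ expand (G 1) ∷ expand (G 2) ∷ expand (G 3) ∷ expand (G 4) ∷ expand (G 5) ∷ expand (G 6) ∷ expand (X^ 1) ∷ []
  expanded : ∀ r → r < 7 → expand (cauchy7 _+_ _*_ (X^ 1) F G r) ≋ ⟦ generic r ⟧ ρ′
  expanded 0 _ = expand-⟦⟧ (generic 0) ρ
  expanded 1 _ = expand-⟦⟧ (generic 1) ρ
  expanded 2 _ = expand-⟦⟧ (generic 2) ρ
  expanded 3 _ = expand-⟦⟧ (generic 3) ρ
  expanded 4 _ = expand-⟦⟧ (generic 4) ρ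
  expanded 5 _ = expand-⟦⟧ (generic 5) ρ
  expanded 6 _ = expand-⟦⟧ (generic 6) ρ
  expanded (suc (suc (suc (suc (suc (suc (suc r))))))) (s≤s (s≤s (s≤s (s≤s (s≤s (s≤s (s≤s ())))))))
  seventh : expand (X^ 1) ≋ X^ 1 ^ 7
  seventh = expand-X^ 1 ⟫ powers 7
  substituted : ∀ x y a b c d e f g a′ b′ c′ d′ e′ f′ g′ → y ≋ x ^ 7 →
    sum7 (λ s → x ^ s * ⟦ generic s ⟧ (a ∷ b ∷ c ∷ d ∷ e ∷ f ∷ g ∷ a′ ∷ b′ ∷ c′ ∷ d′ ∷ e′ ∷ f′ ∷ g′ ∷ y ∷ [])) ≋
    (x ^ 0 * a + x ^ 1 * b + x ^ 2 * c + x ^ 3 * d + x ^ 4 * e + x ^ 5 * f + x ^ 6 * g) * (x ^ 0 * a′ + x ^ 1 * b′ + x ^ 2 * c′ + x ^ 3 * d′ + x ^ 4 * e′ + x ^ 5 * f′ + x ^ 6 * g′)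
  substituted x y a b c d e f g a′ b′ c′ d′ e′ f′ g′ h = +-cong (+-cong (+-cong (+-cong (+-cong (+-cong (*-congˡ (+-congˡ (*-congʳ h))) (*-congˡ (+-congˡ (*-congʳ h)))) (*-congˡ (+-congˡ (*-congʳ h)))) (*-congˡ (+-congˡ (*-congʳ h)))) (*-congˡ (+-congˡ (*-congʳ h)))) (*-congˡ (+-congˡ (*-congʳ h)))) ≋-refl
    ⟫ solve 15 (λ x a b c d e f g a′ b′ c′ d′ e′ f′ g′ →
      sum7ₑ (λ s → x :^ s :* cauchy7 _:+_ _:*_ (x :^ 7) (entry a b c d e f g) (entry a′ b′ c′ d′ e′ f′ g′) s) ,
      sum7ₑ (λ s → x :^ s :* entry a b c d e f g s) :* sum7ₑ (λ s → x :^ s :* entry a′ b′ c′ d′ e′ f′ g′ s))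
      (x ∷ a ∷ b ∷ c ∷ d ∷ e ∷ f ∷ g ∷ a′ ∷ b′ ∷ c′ ∷ d′ ∷ e′ ∷ f′ ∷ g′ ∷ [])
  product : f * g ≋ recompose (cauchy7 _+_ _*_ (X^ 1) F G)
  product = *-cong (≋-sym (recompose-section f) ⟫ recompose-polynomial {F} {λ s → expand (F s)} (λ r _ → ≋-refl))
            (≋-sym (recompose-section g) ⟫ recompose-polynomial {G} {λ s → expand (G s)} (λ r _ → ≋-refl))
    ⟫ ≋-sym (recompose-polynomial {cauchy7 _+_ _*_ (X^ 1) F G} {λ s → ⟦ generic s ⟧ ρ′} expanded
      ⟫ substituted (X^ 1) (expand (X^ 1)) (expand (F 0)) (expand (F 1)) (expand (F 2)) (expand (F 3)) (expand (F 4)) (expand (F 5)) (expand (F 6))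
        (expand (G 0)) (expand (G 1)) (expand (G 2)) (expand (G 3)) (expand (G 4)) (expand (G 5)) (expand (G 6)) seventh)

-- A 7-dissection given symbolically: section r f is the value of the r-th expression, where the first variable is q.
record Dissection {n} (f : Ser) (es : ℕ → Expr (suc n)) (ρ : Vec Ser n) : Set where
  constructor dissected
  field component : ∀ r → r < 7 → section r f ≋ ⟦ es r ⟧ (X^ 1 ∷ ρ)
open Dissection public

infixl 7 _⊙_
_⊙_ : ∀ {n} → (ℕ → Expr (suc n)) → (ℕ → Expr (suc n)) → ℕ → Expr (suc n)
_⊙_ = cauchy7 _:+_ _:*_ (var Fin.zero)

⟦cauchy⟧ : ∀ {n} (es fs : ℕ → Expr (suc n)) ρ r → r < 7 →
           ⟦ (es ⊙ fs) r ⟧ (X^ 1 ∷ ρ) ≡ cauchy7 _+_ _*_ (X^ 1) (λ s → ⟦ es s ⟧ (X^ 1 ∷ ρ)) (λ s → ⟦ fs s ⟧ (X^ 1 ∷ ρ)) r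
⟦cauchy⟧ es fs ρ 0 _ = refl
⟦cauchy⟧ es fs ρ 1 _ = refl
⟦cauchy⟧ es fs ρ 2 _ = refl
⟦cauchy⟧ es fs ρ 3 _ = refl
⟦cauchy⟧ es fs ρ 4 _ = refl
⟦cauchy⟧ es fs ρ 5 _ = refl
⟦cauchy⟧ es fs ρ 6 _ = refl
⟦cauchy⟧ es fs ρ (suc (suc (suc (suc (suc (suc (suc r))))))) (s≤s (s≤s (s≤s (s≤s (s≤s (s≤s (s≤s ())))))))

Dissection-* : ∀ {n f g} {es fs : ℕ → Expr (suc n)} {ρ} → Dissection f es ρ → Dissection g fs ρ → Dissection (f * g) (es ⊙ fs) ρ
Dissection-* {f = f} {g} {es} {fs} {ρ} p q = dissected λ r l → cauchy f g r l
  ⟫ cauchy-cong (component p) (component q) (X^ 1) r l ⟫ ≋-reflexive (sym (⟦cauchy⟧ es fs ρ r l))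

Dissection-+ : ∀ {n f g} {es fs : ℕ → Expr (suc n)} {ρ} → Dissection f es ρ → Dissection g fs ρ → Dissection (f + g) (λ r → es r :+ fs r) ρ
Dissection-+ {f = f} {g} p q = dissected λ r l → section-+ r f g ⟫ +-cong (component p r l) (component q r l)

Dissection-neg : ∀ {n f} {es : ℕ → Expr (suc n)} {ρ} → Dissection f es ρ → Dissection (- f) (λ r → :- es r) ρ
Dissection-neg {f = f} p = dissected λ r l → section-neg r f ⟫ -‿cong (component p r l)

only : ∀ {n} → ℕ → Expr n → ℕ → Expr n
only s e r = if r N.≡ᵇ s then e else nat 0

Dissection-expand : ∀ {n} (e : Expr (suc n)) ρ → Dissection (expand (⟦ e ⟧ (X^ 1 ∷ ρ))) (only 0 e) ρ
Dissection-expand e ρ = dissected λ { zero l → section-0-expand _ ; (suc r) l → section-suc-expand r _ l }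

Dissection-X^ : ∀ {n} s (ρ : Vec Ser n) → s < 7 → Dissection (X^ s) (only s :1) ρ
Dissection-X^ s ρ l′ = dissected λ r l → delta r s l l′ ⟫ ≋-reflexive (choose (r N.≡ᵇ s))
  where
  choose : ∀ c → (if c then 1# else 0#) ≡ ⟦ (if c then :1 else nat 0) ⟧ (X^ 1 ∷ ρ)
  choose true = refl
  choose false = refl

Dissection-recompose : ∀ {n} (es : ℕ → Expr (suc n)) ρ → Dissection (recompose (λ r → ⟦ es r ⟧ (X^ 1 ∷ ρ))) es ρ
Dissection-recompose es ρ = dissected (section-recompose (λ r → ⟦ es r ⟧ (X^ 1 ∷ ρ)))

-- Residue classes of exponents modulo 7

residue-unique : ∀ c c′ t → c < 7 → c′ < 7 → + c ≡ + c′ Z.+ t Z.* + 7 → c ≡ c′ × t ≡ + 0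
residue-unique c c′ (+ zero) l l′ e = Zₚ.+-injective e ∙ Nₚ.+-identityʳ c′ , refl
residue-unique c c′ +[1+ k ] l l′ e = ⊥-elim (Nₚ.<⇒≱ l (subst (7 ≤_) (sym (Zₚ.+-injective e)) (Nₚ.≤-trans (Nₚ.m≤m+n 7 (k N.* 7)) (Nₚ.m≤n+m _ c′))))
residue-unique c c′ -[1+ k ] l l′ e = ⊥-elim (Nₚ.<⇒≱ l′ (subst (7 ≤_) (Zₚ.+-injective flipped) (Nₚ.≤-trans (Nₚ.m≤m+n 7 (k N.* 7)) (Nₚ.m≤n+m _ c))))
  where
  flipped : + (c N.+ suc k N.* 7) ≡ + c′
  flipped = cong (Z._+ (+ (suc k N.* 7))) e ∙ Zₚ.+-assoc (+ c′) (-[1+ k ] Z.* + 7) (+ (suc k N.* 7))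
    ∙ cong (λ t → + c′ Z.+ t) (Zₚ.+-inverseˡ (+ (suc k N.* 7))) ∙ Zₚ.+-identityʳ (+ c′)

index : ℕ → ℤ → ℤ
index c n = + c Z.+ n Z.* + 7

index-unique : ∀ c c′ n n′ → c < 7 → c′ < 7 → index c n ≡ index c′ n′ → c ≡ c′ × n ≡ n′
index-unique c c′ n n′ l l′ e = let p , q = residue-unique c c′ (n′ Z.- n) l l′ shifted in p , back q
  where
  shifted : + c ≡ + c′ Z.+ (n′ Z.- n) Z.* + 7
  shifted = solveℤ 3 (λ c n s → c , (c :+ n :* s) :- n :* s) (+ c ∷ n ∷ + 7 ∷ [])
    ∙ cong (Z._- n Z.* + 7) e ∙ solveℤ 4 (λ c′ n n′ s → (c′ :+ n′ :* s) :- n :* s , c′ :+ (n′ :- n) :* s) (+ c′ ∷ n ∷ n′ ∷ + 7 ∷ [])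
  back : n′ Z.- n ≡ + 0 → n ≡ n′
  back q = solveℤ 2 (λ n n′ → n , n′ :- (n′ :- n)) (n ∷ n′ ∷ []) ∙ cong (λ t → n′ Z.- t) q ∙ Zₚ.+-identityʳ n′

residue : ℤ → ℕ
residue s = s ℤDivMod.%ℕ 7

quotient : ℤ → ℤ
quotient s = s ℤDivMod./ℕ 7

index-residue : ∀ s → s ≡ index (residue s) (quotient s)
index-residue s = ℤDivMod.a≡a%ℕn+[a/ℕn]*n s 7

residue<7 : ∀ s → residue s < 7
residue<7 s = ℤDivMod.n%ℕd<d s 7

residue-index : ∀ c n → c < 7 → residue (index c n) ≡ c × quotient (index c n) ≡ n
residue-index c n l = let p , q = index-unique c _ n _ l (residue<7 (index c n)) (index-residue (index c n)) in sym p , sym q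

-- Since 8 ≡ 1 mod 7, the residue of e can be read off 2e.
residue-of-double : ∀ e r y → r < 7 → + 2 Z.* + e ≡ + 2 Z.* + r Z.+ + 7 Z.* y → Σ ℕ λ e′ → e ≡ r N.+ e′ N.* 7 × + 2 Z.* + e′ ≡ y
residue-of-double e r y l h = finish (+ r Z.- + e Z.+ + 4 Z.* y) explicit
  where
  explicit : + e ≡ + r Z.+ (+ r Z.- + e Z.+ + 4 Z.* y) Z.* + 7
  explicit = solveℤ 1 (λ e → e , nat 4 :* (nat 2 :* e) :- nat 7 :* e) (+ e ∷ [])
    ∙ cong (λ t → + 4 Z.* t Z.- + 7 Z.* + e) h
      ∙ solveℤ 3 (λ e r y → nat 4 :* (nat 2 :* r :+ nat 7 :* y) :- nat 7 :* e , r :+ (r :- e :+ nat 4 :* y) :* nat 7) (+ e ∷ + r ∷ y ∷ [])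
  finish : ∀ t → + e ≡ + r Z.+ t Z.* + 7 → Σ ℕ λ e′ → e ≡ r N.+ e′ N.* 7 × + 2 Z.* + e′ ≡ y
  finish (+ e′) q = e′ , Zₚ.+-injective (q ∙ cong (λ t → + r Z.+ t) (sym (Zₚ.pos-* e′ 7))) , Zₚ.*-cancelˡ-≡ (+ 7) (+ 2 Z.* + e′) y
    (solveℤ 2 (λ r e′ → nat 7 :* (nat 2 :* e′) , nat 2 :* (r :+ e′ :* nat 7) :- nat 2 :* r) (+ r ∷ + e′ ∷ [])
      ∙ cong (λ t → + 2 Z.* t Z.- + 2 Z.* + r) (sym q) ∙ cong (Z._- + 2 Z.* + r) h
        ∙ solveℤ 2 (λ r y → nat 2 :* r :+ nat 7 :* y :- nat 2 :* r , nat 7 :* y) (+ r ∷ y ∷ []))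
  finish -[1+ k ] q = ⊥-elim (Nₚ.<⇒≱ l (subst (7 ≤_) (Zₚ.+-injective flipped) (Nₚ.≤-trans (Nₚ.m≤m+n 7 (k N.* 7)) (Nₚ.m≤n+m _ e))))
    where
    flipped : + (e N.+ suc k N.* 7) ≡ + r
    flipped = cong (Z._+ (+ (suc k N.* 7))) q ∙ Zₚ.+-assoc (+ r) (-[1+ k ] Z.* + 7) (+ (suc k N.* 7))
      ∙ cong (λ t → + r Z.+ t) (Zₚ.+-inverseˡ (+ (suc k N.* 7))) ∙ Zₚ.+-identityʳ (+ r)

section-fromℤ* : ∀ r x f → section r (fromℤ x * f) ≋ fromℤ x * section r f
section-fromℤ* r x f = coeffs λ n → coeff (*-congʳ {x = f} (≋-sym (constant-fromℤ x))) (r N.+ n N.* 7)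
  ∙ at-constant* (ℚSolver.fromℤ x) f (r N.+ n N.* 7) ∙ sym (at-constant* (ℚSolver.fromℤ x) (section r f) n)
    ∙ coeff (*-congʳ {x = section r f} (constant-fromℤ x)) n

section-term : ∀ r x e → r < 7 → section r term⟨ x , r N.+ e N.* 7 ⟩ ≋ term⟨ x , e ⟩
section-term r x e l = section-fromℤ* r x (X^ (r N.+ e N.* 7)) ⟫ *-congˡ (section-X^ r e l)

section-term-≢ : ∀ r s x e → r < 7 → s < 7 → r ≢ s → section r term⟨ x , s N.+ e N.* 7 ⟩ ≋ 0#
section-term-≢ r s x e l l′ r≢s = section-fromℤ* r x (X^ (s N.+ e N.* 7)) ⟫ *-congˡ (section-X^-≢ r s e l l′ r≢s) ⟫ zeroʳ (fromℤ x)

-- For a series of terms κ(s) q^(e(s)) whose exponent modulo 7 depends only on s modulo 7, a section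
-- collects those classes c of s whose value `res c` is the wanted residue.
module Classes (κ : ℤ → ℤ) (e : ℤ → ℕ) (res : ℕ → ℕ) (res<7 : ∀ c → res c < 7) (quot : ℕ → ℤ → ℕ)
               (e-class : ∀ c n → c < 7 → e (index c n) ≡ res c N.+ quot c n N.* 7) where
  classTerm : ℕ → ℤ → Ser
  classTerm r s = section r term⟨ κ s , e s ⟩

  e-residue : ∀ s → e s ≡ res (residue s) N.+ quot (residue s) (quotient s) N.* 7
  e-residue s = cong e (index-residue s) ∙ e-class (residue s) (quotient s) (residue<7 s)

  classTerm-≢ : ∀ r s → r < 7 → r ≢ res (residue s) → classTerm r s ≋ 0#
  classTerm-≢ r s l h = section-cong r (≋-reflexive (cong (λ t → term⟨ κ s , t ⟩) (e-residue s)))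
    ⟫ section-term-≢ r (res (residue s)) (κ s) (quot (residue s) (quotient s)) l (res<7 (residue s)) h

  classTerm-≡ : ∀ c s → c ≡ residue s → classTerm (res c) s ≋ term⟨ κ (index c (quotient s)) , quot c (quotient s) ⟩
  classTerm-≡ c s refl = section-cong (res c) (≋-reflexive (cong (λ t → term⟨ κ s , t ⟩) (e-residue s)))
    ⟫ section-term (res c) (κ s) (quot c (quotient s)) (res<7 c) ⟫ *-congʳ (≋-reflexive (cong (λ t → fromℤ (κ t)) (index-residue s)))

  HasClass : ℕ → ℤ → Set
  HasClass c s = c ≡ residue s

  hasClass? : ∀ c s → Dec (HasClass c s)
  hasClass? c s = c Nₚ.≟ residue s

  class-sum : ∀ c → c < 7 → ∀ {g : ℤ → Ser} → (∀ s → HasClass c s → g s ≋ classTerm (res c) s) → (∀ s → ¬ HasClass c s → g s ≋ 0#) →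
              ∀ {v} → HasSum g v → HasSum (λ n → term⟨ κ (index c n) , quot c n ⟩) v
  class-sum c l {g} agrees vanishes = reindex R
    where
    R : Reindexing g (λ n → term⟨ κ (index c n) , quot c n ⟩)
    R = record
      { to = quotient ; Relevant = HasClass c ; relevant? = hasClass? c ; irrelevant = vanishes
      ; agree = λ s p → agrees s p ⟫ classTerm-≡ c s p
      ; injective = λ s s′ p p′ q → index-residue s ∙ cong₂ index (sym p ∙ p′) q ∙ sym (index-residue s′)
      ; onto = λ n → inj₂ (index c n , sym (proj₁ (residue-index c n l)) , proj₂ (residue-index c n l)) }

  module _ {S : Ser} (h : HasSum (λ s → term⟨ κ s , e s ⟩) S) where
    no-class : ∀ r → r < 7 → (∀ c → c < 7 → r ≢ res c) → section r S ≋ 0#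
    no-class r l h′ = HasSum-unique Zₚ._≟_ (HasSum-section r h) (HasSum-0 (λ s → classTerm-≢ r s l (h′ (residue s) (residue<7 s))))

    one-class : ∀ c → c < 7 → (∀ c′ → c′ < 7 → res c ≡ res c′ → c ≡ c′) → HasSum (λ n → term⟨ κ (index c n) , quot c n ⟩) (section (res c) S)
    one-class c l h′ = class-sum c l (λ s _ → ≋-refl) (λ s ¬p → classTerm-≢ (res c) s (res<7 c) (λ q → ¬p (h′ (residue s) (residue<7 s) q))) (HasSum-section (res c) h)

    -- The two class sums remain existential: the quintuple product evaluates their combination
    -- only, never the single ones.
    two-classes : ∀ c d → c < 7 → d < 7 → c ≢ d → res c ≡ res d → (∀ c′ → c′ < 7 → res c ≡ res c′ → c ≡ c′ ⊎ d ≡ c′) →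
      Σ Ser λ v → Σ Ser λ w → HasSum (λ n → term⟨ κ (index c n) , quot c n ⟩) v × HasSum (λ n → term⟨ κ (index d n) , quot d n ⟩) w × section (res c) S ≋ v + w
    two-classes c d l l′ c≢d q h′ = _ , _ ,
        class-sum c l (λ s p → restrict-yes (hasClass? c) (classTerm (res c)) s p) (restrict-no (hasClass? c) (classTerm (res c))) (proj₂ left) ,
        class-sum d l′ (λ s p → restrict-yes other? (classTerm (res c)) s (λ p′ → c≢d (p′ ∙ sym p)) ⟫ ≋-reflexive (cong (λ r → classTerm r s) q)) second (proj₂ right) ,
        HasSum-split Zₚ._≟_ (hasClass? c) sections (proj₂ left) (proj₂ right)
      where
      sections : HasSum (classTerm (res c)) (section (res c) S)
      sections = HasSum-section (res c) h
      other? : ∀ s → Dec (¬ HasClass c s)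
      other? s = ¬? (hasClass? c s)
      left : Σ Ser (HasSum (restrict (hasClass? c) (classTerm (res c))))
      left = restricted-sum Zₚ._≟_ (hasClass? c) sections
      right : Σ Ser (HasSum (restrict other? (classTerm (res c))))
      right = restricted-sum Zₚ._≟_ other? sections
      second : ∀ s → ¬ HasClass d s → restrict other? (classTerm (res c)) s ≋ 0#
      second s ¬p = [ (λ p → restrict-no other? (classTerm (res c)) s (λ ¬p′ → ¬p′ p))
                    , (λ ¬p′ → restrict-yes other? (classTerm (res c)) s ¬p′
                        ⟫ classTerm-≢ (res c) s (res<7 c) (λ q′ → [ ¬p′ , ¬p ]′ (h′ (residue s) (residue<7 s) q′))) ]′ (toSum (hasClass? c s))

sign-7 : ∀ n → sign (n Z.* + 7) ≡ sign n
sign-7 n = cong sign (solveℤ 1 (λ n → n :* nat 7 , (n :+ (n :+ n)) :+ (n :+ (n :+ n)) :+ n) (n ∷ []))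
  ∙ sign-+ ((n Z.+ (n Z.+ n)) Z.+ (n Z.+ (n Z.+ n))) n ∙ cong (Z._* sign n) (sign-double (n Z.+ (n Z.+ n))) ∙ Zₚ.*-identityˡ (sign n)

sign-index : ∀ c n → sign (index c n) ≡ signℕ c Z.* sign n
sign-index c n = sign-+ (+ c) (n Z.* + 7) ∙ cong (signℕ c Z.*_) (sign-7 n)

by-cases : (P : ℕ → Set) → P 0 → P 1 → P 2 → P 3 → P 4 → P 5 → P 6 → ∀ c → c < 7 → P c
by-cases P p0 p1 p2 p3 p4 p5 p6 0 _ = p0
by-cases P p0 p1 p2 p3 p4 p5 p6 1 _ = p1
by-cases P p0 p1 p2 p3 p4 p5 p6 2 _ = p2
by-cases P p0 p1 p2 p3 p4 p5 p6 3 _ = p3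
by-cases P p0 p1 p2 p3 p4 p5 p6 4 _ = p4
by-cases P p0 p1 p2 p3 p4 p5 p6 5 _ = p5
by-cases P p0 p1 p2 p3 p4 p5 p6 6 _ = p6
by-cases P p0 p1 p2 p3 p4 p5 p6 (suc (suc (suc (suc (suc (suc (suc c))))))) (s≤s (s≤s (s≤s (s≤s (s≤s (s≤s (s≤s ())))))))

<7 : ∀ c {_ : T (c N.<ᵇ 7)} → c < 7
<7 c {t} = Nₚ.<ᵇ⇒< c 7 t

-- Sections of the series of Euler and Jacobi

module Pentagonal where
  e : ℤ → ℕ
  e = exponent 1 2

  res : ℕ → ℕ
  res 1 = 1
  res 2 = 5
  res 3 = 5
  res 4 = 1
  res 6 = 2
  res _ = 0

  -- Twice the quotient by 7 of the pentagonal number c(3c - 1)/2. Doubles are used throughout to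
  -- keep the exponents polynomial over ℤ.
  offset : ℕ → ℤ
  offset 3 = + 2
  offset 4 = + 6
  offset 5 = + 10
  offset 6 = + 14
  offset _ = + 0

  res<7 : ∀ c → res c < 7
  res<7 0 = <7 0
  res<7 1 = <7 1
  res<7 2 = <7 5
  res<7 3 = <7 5
  res<7 4 = <7 1
  res<7 5 = <7 0
  res<7 6 = <7 2
  res<7 (suc (suc (suc (suc (suc (suc (suc c))))))) = <7 0

  double : ℕ → ℤ → ℤ
  double c n = offset c Z.+ + 6 Z.* + c Z.* n Z.+ + 21 Z.* (n Z.* n) Z.- n

  start : ∀ c → c < 7 → + 3 Z.* (+ c Z.* + c) Z.- + c ≡ + 2 Z.* + res c Z.+ + 7 Z.* offset c
  start = by-cases _ refl refl refl refl refl refl refl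

  e-double : ∀ c n → c < 7 → + 2 Z.* + e (index c n) ≡ + 2 Z.* + res c Z.+ + 7 Z.* double c n
  e-double c n l = exponent-ℤ 1 2 (index c n) ∙ solveℤ 2 (λ c n → let s = c :+ n :* nat 7 in nat 2 :* s :* nat 1 :+ (nat 1 :+ nat 2) :* (s :* s :- s) ,
        (nat 3 :* (c :* c) :- c) :+ nat 7 :* (nat 6 :* c :* n :+ nat 21 :* (n :* n) :- n)) (+ c ∷ n ∷ [])
    ∙ cong (Z._+ + 7 Z.* (+ 6 Z.* + c Z.* n Z.+ + 21 Z.* (n Z.* n) Z.- n)) (start c l)
      ∙ solveℤ 4 (λ r o c n → nat 2 :* r :+ nat 7 :* o :+ nat 7 :* (nat 6 :* c :* n :+ nat 21 :* (n :* n) :- n) ,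
         nat 2 :* r :+ nat 7 :* (o :+ nat 6 :* c :* n :+ nat 21 :* (n :* n) :- n)) (+ res c ∷ offset c ∷ + c ∷ n ∷ [])

  split : ∀ c n → c < 7 → Σ ℕ λ e′ → e (index c n) ≡ res c N.+ e′ N.* 7 × + 2 Z.* + e′ ≡ double c n
  split c n l = residue-of-double (e (index c n)) (res c) (double c n) (res<7 c) (e-double c n l)

  quot : ℕ → ℤ → ℕ
  quot c n with c Nₚ.<? 7
  ... | yes l = proj₁ (split c n l)
  ... | no _ = 0

  e-class : ∀ c n → c < 7 → e (index c n) ≡ res c N.+ quot c n N.* 7
  e-class c n l with c Nₚ.<? 7
  ... | yes l′ = proj₁ (proj₂ (split c n l′))
  ... | no ¬l = contradiction l ¬l

  quot-ℤ : ∀ c n → c < 7 → + 2 Z.* + quot c n ≡ double c n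
  quot-ℤ c n l with c Nₚ.<? 7
  ... | yes l′ = proj₂ (proj₂ (split c n l′))
  ... | no ¬l = contradiction l ¬l

  κ : ℤ → ℤ
  κ s = sign s Z.* + 1

  module C = Classes κ e res res<7 quot e-class

  expansion : HasSum (λ s → term⟨ κ s , e s ⟩) (poch 0)
  expansion = HasSum-cong (λ _ → ≋-refl) (pentagonal 0) (Theta.HasSum-theta 1 2 2 refl (λ _ → + 1))

  κ-index : ∀ c n → κ (index c n) ≡ signℕ c Z.* sign n
  κ-index c n = Zₚ.*-identityʳ (sign (index c n)) ∙ sign-index c n

  section-3 : section 3 (poch 0) ≋ 0#
  section-3 = C.no-class expansion 3 (<7 3) (by-cases _ (λ ()) (λ ()) (λ ()) (λ ()) (λ ()) (λ ()) (λ ()))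

  section-4 : section 4 (poch 0) ≋ 0#
  section-4 = C.no-class expansion 4 (<7 4) (by-cases _ (λ ()) (λ ()) (λ ()) (λ ()) (λ ()) (λ ()) (λ ()))

  section-6 : section 6 (poch 0) ≋ 0#
  section-6 = C.no-class expansion 6 (<7 6) (by-cases _ (λ ()) (λ ()) (λ ()) (λ ()) (λ ()) (λ ()) (λ ()))

  -- With e = s(3s - 1)/2 one has 24e + 1 = (6s - 1)², and 6 is the one class in which 7 divides 6s
  -- - 1. There the series reproduces itself with q⁷ for q.
  section-2 : section 2 (poch 0) ≋ - poch 6
  section-2 = HasSum-unique Zₚ._≟_
    (reindex (bijection (λ n → + 1 Z.+ n) (λ m → m Z.- + 1) (λ n → solveℤ 1 (λ n → :1 :+ n :- :1 , n) (n ∷ []))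
        (λ m → solveℤ 1 (λ m → :1 :+ (m :- :1) , m) (m ∷ [])) agree)
      (C.one-class expansion 6 (<7 6) (by-cases _ (λ ()) (λ ()) (λ ()) (λ ()) (λ ()) (λ ()) (λ _ → refl))))
    (HasSum-neg (HasSum-cong (λ _ → ≋-refl) (pentagonal 6) (Theta.HasSum-theta 7 14 20 refl (λ _ → + 1))))
    where
    exponents : ∀ n → quot 6 n ≡ exponent 7 14 (+ 1 Z.+ n)
    exponents n = +-injective2 (quot-ℤ 6 n (<7 6) ∙ solveℤ 1 (λ n → nat 14 :+ nat 6 :* nat 6 :* n :+ nat 21 :* (n :* n) :- n ,
         nat 2 :* (:1 :+ n) :* nat 7 :+ (nat 7 :+ nat 14) :* ((:1 :+ n) :* (:1 :+ n) :- (:1 :+ n))) (n ∷ [])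
      ∙ sym (exponent-ℤ 7 14 (+ 1 Z.+ n)))
    agree : ∀ n → term⟨ κ (index 6 n) , quot 6 n ⟩ ≋ - term⟨ sign (+ 1 Z.+ n) Z.* + 1 , exponent 7 14 (+ 1 Z.+ n) ⟩
    agree n = term-cong {y = Z.- (sign (+ 1 Z.+ n) Z.* + 1)} (κ-index 6 n ∙ solveℤ 1 (λ a → nat 1 :* a , :- ((:- :1) :* a :* :1)) (sign n ∷ [])
        ∙ cong (λ t → Z.- (t Z.* + 1)) (sym (sign-+ (+ 1) n))) (exponents n)
      ⟫ *-congʳ (fromℤ-neg (sign (+ 1 Z.+ n) Z.* + 1)) ⟫ solve 2 (λ a x → (:- a) :* x , :- (a :* x)) (fromℤ (sign (+ 1 Z.+ n) Z.* + 1) ∷ X^ (exponent 7 14 (+ 1 Z.+ n)) ∷ [])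

  -- Two classes of the pentagonal series combine to the series of the quintuple product identity.
  module Pair (c d r r′ δ : ℕ) (r+r′ : r N.+ r′ ≡ 7) (2r+d : (r N.+ r) N.+ δ ≡ 7) (lc : c < 7) (ld : d < 7) (c≢d : c ≢ d) (res≡ : res c ≡ res d)
              (classes : ∀ c′ → c′ < 7 → res c ≡ res c′ → c ≡ c′ ⊎ d ≡ c′)
              (double-c : ∀ n → double c n ≡ + 2 Z.* (+ 3 Z.* n) Z.* + r Z.+ + 7 Z.* (+ 3 Z.* (n Z.* n) Z.- n))
              (double-d : ∀ n → double d (-[1+ 0 ] Z.- n) ≡ + 2 Z.* (+ 3 Z.* n Z.+ + 1) Z.* + r Z.+ + 7 Z.* (+ 3 Z.* (n Z.* n) Z.+ n))
              (sign-d : signℕ d ≡ Z.- signℕ c) where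
    module T = Theta r r′ 6 r+r′
    module T2 = Theta (r N.+ r) δ 6 2r+d

    unsign : ∀ m e → fromℤ (signℕ c) * term⟨ signℕ c Z.* m , e ⟩ ≋ term⟨ m , e ⟩
    unsign m e = term-scale (signℕ c) (signℕ c Z.* m) e ⟫ term-cong (sym (Zₚ.*-assoc (signℕ c) (signℕ c) m)
      ∙ cong (Z._* m) (sign² (+ c)) ∙ Zₚ.*-identityˡ m) refl

    result : T.theta (λ _ → + 1) * section (res c) (poch 0) ≋ fromℤ (signℕ c) * (poch 6 * T2.theta (λ _ → + 1))
    result = go (C.two-classes expansion c d lc ld c≢d res≡ classes)
      where
      go : (Σ Ser λ v → Σ Ser λ w → HasSum (λ n → term⟨ κ (index c n) , quot c n ⟩) v × HasSum (λ n → term⟨ κ (index d n) , quot d n ⟩) w × section (res c) (poch 0) ≋ v + w) →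
           T.theta (λ _ → + 1) * section (res c) (poch 0) ≋ fromℤ (signℕ c) * (poch 6 * T2.theta (λ _ → + 1))
      go (v , w , hv , hw , q) = *-congˡ q ⟫ combine
        where
        σ = fromℤ (signℕ c)
        σσ : σ * σ ≋ 1#
        σσ = ≋-sym (fromℤ-* (signℕ c) (signℕ c)) ⟫ ≋-reflexive (cong fromℤ (sign² (+ c))) ⟫ fromℤ-1
        F : HasSum (λ n → term⟨ sign n , quot c n ⟩) (σ * v)
        F = HasSum-cong (λ n → *-congˡ (term-cong (κ-index c n) refl) ⟫ unsign (sign n) (quot c n)) ≋-refl (HasSum-*ˡ σ hv)
        mirror : ℤ → ℤ
        mirror n = -[1+ 0 ] Z.- n
        mirror-mirror : ∀ n → mirror (mirror n) ≡ n
        mirror-mirror n = solveℤ 1 (λ n → (:- :1) :- ((:- :1) :- n) , n) (n ∷ [])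
        coefficient : ∀ n → κ (index d n) ≡ signℕ c Z.* sign (mirror n)
        coefficient n = κ-index d n ∙ cong (Z._* sign n) sign-d ∙ solveℤ 2 (λ a b → (:- a) :* b , a :* ((:- :1) :* b)) (signℕ c ∷ sign n ∷ [])
          ∙ cong (signℕ c Z.*_) (sym (sign-+ -[1+ 0 ] (Z.- n) ∙ cong (-[1+ 0 ] Z.*_) (sign-neg n)))
        G : HasSum (λ n → term⟨ sign n , quot d (mirror n) ⟩) (σ * w)
        G = reindex (bijection mirror mirror mirror-mirror mirror-mirror
              (λ n → *-congˡ (term-cong (coefficient n) refl) ⟫ unsign (sign (mirror n)) (quot d n)
                 ⟫ term-cong {sign (mirror n)} refl (cong (quot d) (sym (mirror-mirror n))))) (HasSum-*ˡ σ hw)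
        combine : T.theta (λ _ → + 1) * (v + w) ≋ σ * (poch 6 * T2.theta (λ _ → + 1))
        combine = *-congˡ (≋-sym (*-identityˡ (v + w)) ⟫ *-congʳ (≋-sym σσ))
          ⟫ solve 4 (λ t s v w → t :* (s :* s :* (v :+ w)) , s :* (t :* (s :* v :+ s :* w))) (T.theta (λ _ → + 1) ∷ σ ∷ v ∷ w ∷ [])
            ⟫ *-congˡ (Quintuple.quintuple r r′ 6 r+r′ δ 2r+d (quot c) (λ n → quot d (-[1+ 0 ] Z.- n))
              (λ n → quot-ℤ c n lc ∙ double-c n) (λ n → quot-ℤ d (-[1+ 0 ] Z.- n) ld ∙ double-d n) F G)

  -- Two classes share a residue when they add up to 5 modulo 7, because 3s² - s is symmetric about
  -- 1/6 and 1/3 ≡ 5. The pairs are 0 and 5, 1 and 4, 2 and 3.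
  quintuple-0 : Theta.theta 1 6 6 refl (λ _ → + 1) * section 0 (poch 0) ≋ poch 6 * Theta.theta 2 5 6 refl (λ _ → + 1)
  quintuple-0 = Pair.result 0 5 1 6 5 refl refl (<7 0) (<7 5) (λ ()) refl
      (by-cases _ (λ _ → inj₁ refl) (λ ()) (λ ()) (λ ()) (λ ()) (λ _ → inj₂ refl) (λ ()))
      (λ n → solveℤ 1 (λ n → nat 0 :+ nat 6 :* nat 0 :* n :+ nat 21 :* (n :* n) :- n , nat 2 :* (nat 3 :* n) :* nat 1 :+ nat 7 :* (nat 3 :* (n :* n) :- n)) (n ∷ []))
      (λ n → solveℤ 1 (λ n → let m = (:- :1) :- n in nat 10 :+ nat 6 :* nat 5 :* m :+ nat 21 :* (m :* m) :- m , nat 2 :* (nat 3 :* n :+ nat 1) :* nat 1 :+ nat 7 :* (nat 3 :* (n :* n) :+ n)) (n ∷ []))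
      refl
    ⟫ *-congʳ fromℤ-1 ⟫ *-identityˡ _

  quintuple-1 : Theta.theta 2 5 6 refl (λ _ → + 1) * section 1 (poch 0) ≋ - (poch 6 * Theta.theta 4 3 6 refl (λ _ → + 1))
  quintuple-1 = Pair.result 1 4 2 5 3 refl refl (<7 1) (<7 4) (λ ()) refl
      (by-cases _ (λ ()) (λ _ → inj₁ refl) (λ ()) (λ ()) (λ _ → inj₂ refl) (λ ()) (λ ()))
      (λ n → solveℤ 1 (λ n → nat 0 :+ nat 6 :* nat 1 :* n :+ nat 21 :* (n :* n) :- n , nat 2 :* (nat 3 :* n) :* nat 2 :+ nat 7 :* (nat 3 :* (n :* n) :- n)) (n ∷ []))
      (λ n → solveℤ 1 (λ n → let m = (:- :1) :- n in nat 6 :+ nat 6 :* nat 4 :* m :+ nat 21 :* (m :* m) :- m , nat 2 :* (nat 3 :* n :+ nat 1) :* nat 2 :+ nat 7 :* (nat 3 :* (n :* n) :+ n)) (n ∷ []))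
      refl
    ⟫ solve 1 (λ a → con -[1+ 0 ] :* a , :- a) (_ ∷ [])

  quintuple-5 : Theta.theta 3 4 6 refl (λ _ → + 1) * section 5 (poch 0) ≋ poch 6 * Theta.theta 6 1 6 refl (λ _ → + 1)
  quintuple-5 = Pair.result 2 3 3 4 1 refl refl (<7 2) (<7 3) (λ ()) refl
      (by-cases _ (λ ()) (λ ()) (λ _ → inj₁ refl) (λ _ → inj₂ refl) (λ ()) (λ ()) (λ ()))
      (λ n → solveℤ 1 (λ n → nat 0 :+ nat 6 :* nat 2 :* n :+ nat 21 :* (n :* n) :- n , nat 2 :* (nat 3 :* n) :* nat 3 :+ nat 7 :* (nat 3 :* (n :* n) :- n)) (n ∷ []))
      (λ n → solveℤ 1 (λ n → let m = (:- :1) :- n in nat 2 :+ nat 6 :* nat 3 :* m :+ nat 21 :* (m :* m) :- m , nat 2 :* (nat 3 :* n :+ nat 1) :* nat 3 :+ nat 7 :* (nat 3 :* (n :* n) :+ n)) (n ∷ []))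
      refl
    ⟫ *-congʳ fromℤ-1 ⟫ *-identityˡ _

module TriangularClasses where
  e : ℤ → ℕ
  e = exponent 0 1

  res : ℕ → ℕ
  res 2 = 1
  res 3 = 3
  res 4 = 6
  res 5 = 3
  res 6 = 1
  res _ = 0

  offset : ℕ → ℤ
  offset 5 = + 2
  offset 6 = + 4
  offset _ = + 0

  res<7 : ∀ c → res c < 7
  res<7 0 = s≤s z≤n
  res<7 1 = s≤s z≤n
  res<7 2 = s≤s (s≤s z≤n)
  res<7 3 = s≤s (s≤s (s≤s (s≤s z≤n)))
  res<7 4 = Nₚ.≤-refl
  res<7 5 = s≤s (s≤s (s≤s (s≤s z≤n)))
  res<7 6 = s≤s (s≤s z≤n)
  res<7 (suc (suc (suc (suc (suc (suc (suc c))))))) = s≤s z≤n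

  double : ℕ → ℤ → ℤ
  double c n = offset c Z.+ + 2 Z.* + c Z.* n Z.+ + 7 Z.* (n Z.* n) Z.- n

  start : ∀ c → c < 7 → + c Z.* + c Z.- + c ≡ + 2 Z.* + res c Z.+ + 7 Z.* offset c
  start = by-cases _ refl refl refl refl refl refl refl

  e-double : ∀ c n → c < 7 → + 2 Z.* + e (index c n) ≡ + 2 Z.* + res c Z.+ + 7 Z.* double c n
  e-double c n l = exponent-ℤ 0 1 (index c n) ∙ solveℤ 2 (λ c n → let s = c :+ n :* nat 7 in nat 2 :* s :* nat 0 :+ (nat 0 :+ nat 1) :* (s :* s :- s) ,
        (c :* c :- c) :+ nat 7 :* (nat 2 :* c :* n :+ nat 7 :* (n :* n) :- n)) (+ c ∷ n ∷ [])
    ∙ cong (Z._+ + 7 Z.* (+ 2 Z.* + c Z.* n Z.+ + 7 Z.* (n Z.* n) Z.- n)) (start c l)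
      ∙ solveℤ 4 (λ r o c n → nat 2 :* r :+ nat 7 :* o :+ nat 7 :* (nat 2 :* c :* n :+ nat 7 :* (n :* n) :- n) ,
         nat 2 :* r :+ nat 7 :* (o :+ nat 2 :* c :* n :+ nat 7 :* (n :* n) :- n)) (+ res c ∷ offset c ∷ + c ∷ n ∷ [])

  split : ∀ c n → c < 7 → Σ ℕ λ e′ → e (index c n) ≡ res c N.+ e′ N.* 7 × + 2 Z.* + e′ ≡ double c n
  split c n l = residue-of-double (e (index c n)) (res c) (double c n) (res<7 c) (e-double c n l)

  quot : ℕ → ℤ → ℕ
  quot c n with c Nₚ.<? 7
  ... | yes l = proj₁ (split c n l)
  ... | no _ = 0

  e-class : ∀ c n → c < 7 → e (index c n) ≡ res c N.+ quot c n N.* 7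
  e-class c n l with c Nₚ.<? 7
  ... | yes l′ = proj₁ (proj₂ (split c n l′))
  ... | no ¬l = contradiction l ¬l

  quot-ℤ : ∀ c n → c < 7 → + 2 Z.* + quot c n ≡ double c n
  quot-ℤ c n l with c Nₚ.<? 7
  ... | yes l′ = proj₂ (proj₂ (split c n l′))
  ... | no ¬l = contradiction l ¬l

  κ : ℤ → ℤ
  κ s = sign s Z.* s

  module C = Classes κ e res res<7 quot e-class

  expansion : HasSum (λ s → term⟨ κ s , e s ⟩) (- (poch 0 ^ 3))
  expansion = HasSum-cong (λ _ → ≋-refl) (jacobi 0) (Theta.HasSum-theta 0 1 0 refl (λ s → s))

  positive : ∀ {r} → section r (- (poch 0 ^ 3)) ≋ 0# → section r (poch 0 ^ 3) ≋ 0#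
  positive {r} h = solve 1 (λ a → a , :- (:- a)) (section r (poch 0 ^ 3) ∷ []) ⟫ -‿cong (≋-sym (section-neg r (poch 0 ^ 3)) ⟫ h) ⟫ neg-0

  cube-2 : section 2 (poch 0 ^ 3) ≋ 0#
  cube-2 = positive {2} (C.no-class expansion 2 (Nₚ.≤ᵇ⇒≤ 3 7 tt) (by-cases _ (λ ()) (λ ()) (λ ()) (λ ()) (λ ()) (λ ()) (λ ())))

  cube-4 : section 4 (poch 0 ^ 3) ≋ 0#
  cube-4 = positive {4} (C.no-class expansion 4 (Nₚ.≤ᵇ⇒≤ 5 7 tt) (by-cases _ (λ ()) (λ ()) (λ ()) (λ ()) (λ ()) (λ ()) (λ ())))

  cube-5 : section 5 (poch 0 ^ 3) ≋ 0#
  cube-5 = positive {5} (C.no-class expansion 5 (Nₚ.≤ᵇ⇒≤ 6 7 tt) (by-cases _ (λ ()) (λ ()) (λ ()) (λ ()) (λ ()) (λ ()) (λ ())))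

  -- In the class 4 one has s = 7(n + 1) - 3. The weight s splits accordingly into 7 times the
  -- weight of Jacobi's series with base q⁷ and a constant, whose alternating sum vanishes.
  cube-6 : section 6 (poch 0 ^ 3) ≋ - (fromℤ (+ 7) * poch 6 ^ 3)
  cube-6 = solve 1 (λ a → a , :- (:- a)) (section 6 (poch 0 ^ 3) ∷ []) ⟫ -‿cong (≋-sym (section-neg 6 (poch 0 ^ 3)) ⟫ HasSum-unique Zₚ._≟_
    (reindex (bijection (λ n → + 1 Z.+ n) (λ m → m Z.- + 1) (λ n → solveℤ 1 (λ n → :1 :+ n :- :1 , n) (n ∷ []))
        (λ m → solveℤ 1 (λ m → :1 :+ (m :- :1) , m) (m ∷ [])) agree)
      (C.one-class expansion 4 (Nₚ.≤ᵇ⇒≤ 5 7 tt) (by-cases _ (λ ()) (λ ()) (λ ()) (λ ()) (λ _ → refl) (λ ()) (λ ()))))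
    (HasSum-cong (λ _ → ≋-refl) (+-cong (*-congˡ (jacobi 6)) (*-congˡ (alternating-sum 6))
        ⟫ solve 1 (λ e → con -[1+ 6 ] :* (:- e) :+ nat 3 :* nat 0 , nat 7 :* e) (poch 6 ^ 3 ∷ []))
      (HasSum-+ Zₚ._≟_ (HasSum-*ˡ (fromℤ -[1+ 6 ]) (Theta.HasSum-theta 0 7 6 refl (λ m → m)))
        (HasSum-*ˡ (fromℤ (+ 3)) (Theta.HasSum-theta 0 7 6 refl (λ _ → + 1))))))
    where
    exponents : ∀ n → quot 4 n ≡ exponent 0 7 (+ 1 Z.+ n)
    exponents n = +-injective2 (quot-ℤ 4 n (Nₚ.≤ᵇ⇒≤ 5 7 tt) ∙ solveℤ 1 (λ n → nat 0 :+ nat 2 :* nat 4 :* n :+ nat 7 :* (n :* n) :- n ,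
         nat 2 :* (:1 :+ n) :* nat 0 :+ (nat 0 :+ nat 7) :* ((:1 :+ n) :* (:1 :+ n) :- (:1 :+ n))) (n ∷ [])
      ∙ sym (exponent-ℤ 0 7 (+ 1 Z.+ n)))
    coefficient : ∀ n → κ (index 4 n) ≡ -[1+ 6 ] Z.* (sign (+ 1 Z.+ n) Z.* (+ 1 Z.+ n)) Z.+ + 3 Z.* (sign (+ 1 Z.+ n) Z.* + 1)
    coefficient n = cong (Z._* index 4 n) (sign-index 4 n) ∙ solveℤ 2 (λ a n → nat 1 :* a :* (nat 4 :+ n :* nat 7) , con -[1+ 6 ] :* ((:- :1) :* a :* (:1 :+ n)) :+ nat 3 :* ((:- :1) :* a :* :1)) (sign n ∷ n ∷ [])
      ∙ cong (λ t → -[1+ 6 ] Z.* (t Z.* (+ 1 Z.+ n)) Z.+ + 3 Z.* (t Z.* + 1)) (sym (sign-+ (+ 1) n))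
    agree : ∀ n → term⟨ κ (index 4 n) , quot 4 n ⟩ ≋
            fromℤ -[1+ 6 ] * term⟨ sign (+ 1 Z.+ n) Z.* (+ 1 Z.+ n) , exponent 0 7 (+ 1 Z.+ n) ⟩ + fromℤ (+ 3) * term⟨ sign (+ 1 Z.+ n) Z.* + 1 , exponent 0 7 (+ 1 Z.+ n) ⟩
    agree n = term-cong (coefficient n) (exponents n) ⟫ *-congʳ (fromℤ-+ (-[1+ 6 ] Z.* p) (+ 3 Z.* q))
      ⟫ distribʳ x _ _ ⟫ +-cong (≋-sym (term-scale -[1+ 6 ] p _)) (≋-sym (term-scale (+ 3) q _))
      where
      p = sign (+ 1 Z.+ n) Z.* (+ 1 Z.+ n)
      q = sign (+ 1 Z.+ n) Z.* + 1
      x = X^ (exponent 0 7 (+ 1 Z.+ n))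

cancel-constant : ∀ (c : ℚ) z {f} → c ℚ.* ℚSolver.fromℤ z ≡ 1ℚ → fromℤ z * f ≋ 0# → f ≋ 0#
cancel-constant c z {f} h p = ≋-sym (*-identityˡ f) ⟫ *-congʳ (≋-sym unit≋) ⟫ *-assoc (constant c) (fromℤ z) f
  ⟫ *-congˡ p ⟫ zeroʳ (constant c)
  where
  unit≋ : constant c * fromℤ z ≋ 1#
  unit≋ = *-congˡ (≋-sym (constant-fromℤ z)) ⟫ (coeffs λ
    { zero → at-constant* c (constant (ℚSolver.fromℤ z)) 0
    ; (suc n) → at-constant* c (constant (ℚSolver.fromℤ z)) (suc n) ∙ ℚₚ.*-zeroʳ c }) ⟫ ≋-reflexive (cong constant h) ⟫ constant-1

-- The 7-dissection (q;q)_∞ = A(q⁷) + q B(q⁷) - q² E(q⁷) + q⁵ D(q⁷).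
A B D E : Ser
A = section 0 (poch 0)
B = section 1 (poch 0)
D = section 5 (poch 0)
E = poch 6

euler : Vec Ser 4
euler = A ∷ B ∷ D ∷ E ∷ []

vx va vb vd ve : Expr 5
vx = var Fin.zero
va = var (Fin.suc Fin.zero)
vb = var (Fin.suc (Fin.suc Fin.zero))
vd = var (Fin.suc (Fin.suc (Fin.suc Fin.zero)))
ve = var (Fin.suc (Fin.suc (Fin.suc (Fin.suc Fin.zero))))

-- μ c i j k l n stands for c xⁱ aʲ bᵏ dˡ eⁿ.
μ : ℕ → ℕ → ℕ → ℕ → ℕ → ℕ → Expr 5
μ c i j k l n = nat c :* (vx :^ i :* (va :^ j :* (vb :^ k :* (vd :^ l :* ve :^ n))))

eulerParts : ℕ → Expr 5
eulerParts 0 = va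
eulerParts 1 = vb
eulerParts 2 = :- ve
eulerParts 5 = vd
eulerParts _ = nat 0

euler-dissection : Dissection (poch 0) eulerParts euler
euler-dissection = dissected (by-cases _ ≋-refl ≋-refl Pentagonal.section-2 Pentagonal.section-3 Pentagonal.section-4 ≋-refl Pentagonal.section-6)

env : Vec Ser 5
env = X^ 1 ∷ euler

powerParts : ∀ {n} → (ℕ → Expr (suc n)) → ℕ → ℕ → Expr (suc n)
powerParts es zero = only 0 :1
powerParts es (suc k) = es ⊙ powerParts es k

Dissection-^ : ∀ {n f} {es : ℕ → Expr (suc n)} {ρ} k → Dissection f es ρ → Dissection (f ^ k) (powerParts es k) ρ
Dissection-^ {ρ = ρ} zero p = Dissection-X^ 0 ρ (s≤s z≤n)
Dissection-^ (suc k) p = Dissection-* p (Dissection-^ k p)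

-- `rel1`, `rel2` and `rel3` are a third of the sections 2, 4 and 5 of the cube, which Jacobi's
-- exponents avoid. `rel0` comes from section 6, where -E³ + 6ABD has to be -7E³.
rel0 rel1 rel2 rel3 : Expr 5
rel0 = va :* vb :* vd :+ ve :^ 3
rel1 = va :* vb :^ 2 :- va :^ 2 :* ve :+ vx :* ve :^ 2 :* vd
rel2 = va :* ve :^ 2 :- vb :^ 2 :* ve :+ vx :* vb :* vd :^ 2
rel3 = va :^ 2 :* vd :+ vb :* ve :^ 2 :- vx :* ve :* vd :^ 2

cubeParts : ℕ → Expr 5
cubeParts 0 = va :^ 3 :+ nat 3 :* vx :* vb :^ 2 :* vd :- nat 6 :* vx :* va :* vd :* ve
cubeParts 1 = nat 3 :* va :^ 2 :* vb :- nat 6 :* vx :* vb :* vd :* ve :+ vx :^ 2 :* vd :^ 3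
cubeParts 2 = nat 3 :* va :* vb :^ 2 :- nat 3 :* va :^ 2 :* ve :+ nat 3 :* vx :* vd :* ve :^ 2
cubeParts 3 = vb :^ 3 :- nat 6 :* va :* vb :* ve :+ nat 3 :* vx :* va :* vd :^ 2
cubeParts 4 = :- (nat 3 :* vb :^ 2 :* ve) :+ nat 3 :* va :* ve :^ 2 :+ nat 3 :* vx :* vb :* vd :^ 2
cubeParts 5 = nat 3 :* vb :* ve :^ 2 :+ nat 3 :* va :^ 2 :* vd :- nat 3 :* vx :* vd :^ 2 :* ve
cubeParts _ = :- (ve :^ 3) :+ nat 6 :* va :* vb :* vd

cube : Dissection (poch 0 ^ 3) cubeParts euler
cube = dissected (λ r l → component (Dissection-^ 3 euler-dissection) r l ⟫ values r l)
  where
  values : ∀ r → r < 7 → ⟦ powerParts eulerParts 3 r ⟧ env ≋ ⟦ cubeParts r ⟧ env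
  values = by-cases _ (prove (powerParts eulerParts 3 0) (cubeParts 0) env) (prove (powerParts eulerParts 3 1) (cubeParts 1) env) (prove (powerParts eulerParts 3 2) (cubeParts 2) env) (prove (powerParts eulerParts 3 3) (cubeParts 3) env) (prove (powerParts eulerParts 3 4) (cubeParts 4) env) (prove (powerParts eulerParts 3 5) (cubeParts 5) env) (prove (powerParts eulerParts 3 6) (cubeParts 6) env)

triple : ∀ r (rel : Expr 5) → r < 7 → {_ : T (vanishes (toPoly (nat 3 :* rel :- cubeParts r)))} →
         section r (poch 0 ^ 3) ≋ 0# → ⟦ rel ⟧ env ≋ 0#
triple r rel l {t} h = cancel-constant (+ 1 ℚ./ 3) (+ 3) refl (prove (nat 3 :* rel) (cubeParts r) {t} env ⟫ ≋-sym (component cube r l) ⟫ h)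

relation1 : ⟦ rel1 ⟧ env ≋ 0#
relation1 = triple 2 rel1 (Nₚ.≤ᵇ⇒≤ 3 7 tt) TriangularClasses.cube-2

relation2 : ⟦ rel2 ⟧ env ≋ 0#
relation2 = triple 4 rel2 (Nₚ.≤ᵇ⇒≤ 5 7 tt) TriangularClasses.cube-4

relation3 : ⟦ rel3 ⟧ env ≋ 0#
relation3 = triple 5 rel3 (Nₚ.≤ᵇ⇒≤ 6 7 tt) TriangularClasses.cube-5

relation0 : ⟦ rel0 ⟧ env ≋ 0#
relation0 = cancel-constant (+ 1 ℚ./ 6) (+ 6) refl (prove (nat 6 :* rel0) (cubeParts 6 :+ nat 7 :* ve :^ 3) env
  ⟫ +-congʳ (≋-sym (component cube 6 (Nₚ.≤ᵇ⇒≤ 7 7 tt)) ⟫ TriangularClasses.cube-6) ⟫ -‿inverseˡ _)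

relations : ∀ (c0 c1 c2 c3 : Expr 5) → All (λ cr → ⟦ proj₂ cr ⟧ env ≋ 0#) ((c0 , rel0) ∷ (c1 , rel1) ∷ (c2 , rel2) ∷ (c3 , rel3) ∷ [])
relations _ _ _ _ = relation0 ∷ relation1 ∷ relation2 ∷ relation3 ∷ []

-- The norm N(q⁷) = ∏ (ωq;ωq)_∞ over the seventh roots of unity ω, and the parts of the cofactor of (q;q)_∞ in it.
normₑ : Expr 5
normₑ = va :^ 7 :+ vx :* vb :^ 7 :+ μ 7 1 1 5 0 1 :+ μ 14 1 2 3 0 2 :+ μ 7 1 3 1 0 3 :+ μ 7 1 4 2 1 0 :+ μ 7 1 5 0 1 1 :- μ 1 2 0 0 0 7 :+ μ 7 2 0 3 1 3 :+ μ 14 2 1 1 1 4 :+ μ 7 2 1 4 2 0 :+ μ 7 2 2 2 2 1 :+ μ 14 2 3 0 2 2 :+ μ 14 3 0 2 3 2 :+ μ 7 3 1 0 3 3 :+ μ 7 3 2 1 4 0 :+ μ 7 4 0 1 5 1 :+ μ 1 5 0 0 7 0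

cofactorParts : ℕ → Expr 5
cofactorParts 0 = va :^ 6 :+ μ 1 1 0 5 0 1 :+ μ 4 1 1 3 0 2 :+ μ 3 1 2 1 0 3 :+ μ 4 1 3 2 1 0 :+ μ 5 1 4 0 1 1 :+ μ 2 2 0 1 1 4 :+ μ 1 2 0 4 2 0 :+ μ 2 2 1 2 2 1 :+ μ 6 2 2 0 2 2 :+ μ 1 3 0 0 3 3 :+ μ 2 3 1 1 4 0
cofactorParts 1 = :- (va :^ 5 :* vb) :+ μ 1 1 0 4 0 2 :+ μ 3 1 1 2 0 3 :+ μ 1 1 2 0 0 4 :- μ 3 1 2 3 1 0 :- μ 1 1 3 1 1 1 :+ μ 1 2 0 0 1 5 :+ μ 3 2 0 3 2 1 :- μ 2 2 1 1 2 2 :- μ 1 2 3 0 3 0 :+ μ 1 3 0 2 4 0 :- μ 2 3 1 0 4 1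
cofactorParts 2 = μ 1 0 4 2 0 0 :+ va :^ 5 :* ve :+ μ 1 1 0 3 0 3 :+ μ 2 1 1 1 0 4 :+ μ 2 1 1 4 1 0 :+ μ 2 1 2 2 1 1 :+ μ 4 1 3 0 1 2 :+ μ 6 2 0 2 2 2 :+ μ 3 2 1 0 2 3 :+ μ 4 2 2 1 3 0 :+ μ 5 3 0 1 4 1 :+ μ 1 4 0 0 6 0
cofactorParts 3 = :- (μ 1 0 3 3 0 0) :- μ 2 0 4 1 0 1 :+ μ 1 1 0 2 0 4 :- μ 1 1 0 5 1 0 :+ μ 1 1 1 0 0 5 :- μ 1 1 1 3 1 1 :- μ 2 1 2 1 1 2 :+ μ 1 1 4 0 2 0 :+ μ 3 2 0 1 2 3 :- μ 3 2 1 2 3 0 :+ μ 3 2 2 0 3 1 :+ μ 1 3 0 0 4 2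
cofactorParts 4 = μ 1 0 2 4 0 0 :+ μ 3 0 3 2 0 1 :+ μ 1 0 4 0 0 2 :+ μ 1 1 0 1 0 5 :- μ 2 1 0 4 1 1 :- μ 2 1 1 2 1 2 :+ μ 3 1 2 0 1 3 :- μ 3 1 3 1 2 0 :+ μ 1 2 0 0 2 4 :- μ 1 2 0 3 3 0 :- μ 1 2 1 1 3 1 :- μ 1 3 1 0 5 0
cofactorParts 5 = :- (va :* vb :^ 5) :- μ 4 0 2 3 0 1 :- μ 3 0 3 1 0 2 :- va :^ 5 :* vd :+ vx :* ve :^ 6 :- μ 3 1 0 3 1 2 :- μ 8 1 1 1 1 3 :- μ 1 1 2 2 2 0 :- μ 4 1 3 0 2 1 :- μ 4 2 0 2 3 1 :- μ 3 2 1 0 3 2 :- μ 1 3 0 1 5 0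
cofactorParts _ = vb :^ 6 :+ μ 5 0 1 4 0 1 :+ μ 6 0 2 2 0 2 :+ μ 1 0 3 0 0 3 :+ μ 2 0 4 1 1 0 :+ μ 3 1 0 2 1 3 :+ μ 2 1 1 0 1 4 :+ μ 4 1 1 3 2 0 :+ μ 2 1 2 1 2 1 :+ μ 4 2 0 1 3 2 :+ μ 1 2 2 0 4 0 :+ μ 1 3 0 0 5 1

N cofactor : Ser
N = ⟦ normₑ ⟧ env
cofactor = recompose (λ r → ⟦ cofactorParts r ⟧ env)

cofactor-dissection : Dissection cofactor cofactorParts euler
cofactor-dissection = Dissection-recompose cofactorParts euler

norm-factorisation : poch 0 * cofactor ≋ expand N
norm-factorisation = sections-≋ (λ r l → component (Dissection-* euler-dissection cofactor-dissection) r l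
  ⟫ values r l ⟫ ≋-sym (component (Dissection-expand normₑ euler) r l))
  where
  values : ∀ r → r < 7 → ⟦ (eulerParts ⊙ cofactorParts) r ⟧ env ≋ ⟦ only 0 normₑ r ⟧ env
  values = by-cases _ (prove ((eulerParts ⊙ cofactorParts) 0) normₑ env)
    (prove ((eulerParts ⊙ cofactorParts) 1) (nat 0) env) (prove ((eulerParts ⊙ cofactorParts) 2) (nat 0) env)
    (prove ((eulerParts ⊙ cofactorParts) 3) (nat 0) env) (prove ((eulerParts ⊙ cofactorParts) 4) (nat 0) env)
    (prove ((eulerParts ⊙ cofactorParts) 5) (nat 0) env) (prove ((eulerParts ⊙ cofactorParts) 6) (nat 0) env)

-- Up to the term with E⁴ this is the quartic of Klein in A, B and D. Modulo the relations its
-- square is E times the norm, which turns the sections below into expressions linear in `M`.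
rootₑ : Expr 5
rootₑ = :- (va :^ 3 :* vb :+ vx :* vb :^ 3 :* vd :+ vx :^ 2 :* vd :^ 3 :* va :+ nat 8 :* vx :* ve :^ 4)

M : Ser
M = ⟦ rootₑ ⟧ env

root-square : M * M ≋ E * N
root-square = proveModulo (rootₑ :* rootₑ) (ve :* normₑ)
  (((μ 2 1 2 3 0 0 :- μ 15 1 3 1 0 1 :+ μ 65 2 0 0 0 5 :+ μ 17 2 0 3 1 1 :- μ 55 2 1 1 1 2 :+ μ 2 2 3 0 2 0 :+ μ 10 3 0 2 3 0 :- μ 15 3 1 0 3 1) , rel0) ∷ ((va :^ 5 :- μ 8 1 0 3 0 2 :- μ 24 1 1 1 0 3 :+ μ 8 1 3 0 1 1 :- μ 24 2 0 2 2 1 :+ μ 24 2 1 0 2 2 :- μ 8 3 0 1 4 0) , rel1) ∷ ((vx :* vb :^ 5) , rel2) ∷ ((μ 1 4 0 0 5 0) , rel3) ∷ []) env (relations _ _ _ _)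

-- Ramanujan's identity modulo 7 before the norm is known: it remains to identify `N` and `M` with
-- eta quotients.
cofactor-5 : section 5 cofactor ≋ fromℤ (+ 7) * E ^ 2 * M + fromℤ (+ 49) * X^ 1 * E ^ 6
cofactor-5 = component cofactor-dissection 5 (Nₚ.≤ᵇ⇒≤ 6 7 tt) ⟫ proveModulo (cofactorParts 5) (nat 7 :* ve :^ 2 :* rootₑ :+ nat 49 :* vx :* ve :^ 6)
  (((μ 8 1 0 0 0 3 :- μ 6 1 1 1 1 0) , rel0) ∷ ((:- (vb :^ 3) :- μ 5 0 1 1 0 1 :+ μ 5 1 1 0 2 0) , rel1) ∷ ((:- (μ 5 1 0 1 1 1) :- μ 1 2 0 0 3 0) , rel2) ∷ ((:- (va :^ 3)) , rel3) ∷ []) env (relations _ _ _ _)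

-- Seven-dissections of (q⁷;q⁷)_∞ times the two Eisenstein series, up to the term 8(q⁷;q⁷)_∞ of the first.
firstEisenstein secondEisenstein : Ser
firstEisenstein = - (fromℤ (+ 8) * poch 0 ^ 7 + fromℤ (+ 49) * (X^ 1 * (poch 0 ^ 3 * expand M)))
secondEisenstein = fromℤ (+ 8) * (X^ 2 * (cofactor * expand E)) + X^ 1 * (poch 0 ^ 3 * expand M)

constantParts : ∀ z → Dissection (fromℤ z) (only 0 (con z)) euler
constantParts z = record { component = λ r l → section-cong r (≋-sym (expand-fromℤ z)) ⟫ component (Dissection-expand (con z) euler) r l }

firstParts secondParts : ℕ → Expr 5
firstParts r = :- ((only 0 (nat 8) ⊙ (eulerParts ⊙ (cubeParts ⊙ cubeParts))) r :+ (only 0 (nat 49) ⊙ (only 1 :1 ⊙ (cubeParts ⊙ only 0 rootₑ))) r)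
secondParts r = (only 0 (nat 8) ⊙ (only 2 :1 ⊙ (cofactorParts ⊙ only 0 ve))) r :+ (only 1 :1 ⊙ (cubeParts ⊙ only 0 rootₑ)) r

cubeTimes : Dissection (X^ 1 * (poch 0 ^ 3 * expand M)) (only 1 :1 ⊙ (cubeParts ⊙ only 0 rootₑ)) euler
cubeTimes = Dissection-* (Dissection-X^ 1 euler (s≤s (s≤s z≤n))) (Dissection-* cube (Dissection-expand rootₑ euler))

seventh : Dissection (poch 0 ^ 7) (eulerParts ⊙ (cubeParts ⊙ cubeParts)) euler
seventh = dissected (λ r l → section-cong r (solve 1 (λ u → u :^ 7 , u :* (u :^ 3 :* u :^ 3)) (poch 0 ∷ []))
  ⟫ component (Dissection-* euler-dissection (Dissection-* cube cube)) r l)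

first-dissection : Dissection firstEisenstein firstParts euler
first-dissection = Dissection-neg (Dissection-+ (Dissection-* (constantParts (+ 8)) seventh) (Dissection-* (constantParts (+ 49)) cubeTimes))

second-dissection : Dissection secondEisenstein secondParts euler
second-dissection = Dissection-+ (Dissection-* (constantParts (+ 8)) (Dissection-* (Dissection-X^ 2 euler (s≤s (s≤s (s≤s z≤n)))) (Dissection-* cofactor-dissection (Dissection-expand ve euler)))) cubeTimes

-- Once `N` and `M` are known, this says that the expected series is fixed by n ↦ 7n.
eisenstein-0 : section 0 firstEisenstein ≋ - (fromℤ (+ 8) * N + fromℤ (+ 49) * X^ 1 * E ^ 3 * M)
eisenstein-0 = component first-dissection 0 (s≤s z≤n) ⟫ proveModulo (firstParts 0) (:- (nat 8 :* normₑ :+ nat 49 :* vx :* ve :^ 3 :* rootₑ))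
  ((:- (μ 98 1 3 1 0 0 :+ μ 784 2 0 0 0 4 :- μ 686 2 0 3 1 0 :- μ 2744 2 1 1 1 1 :+ μ 490 3 1 0 3 0) , rel0) ∷ (:- (:- (μ 392 1 0 3 0 1) :+ μ 1176 1 1 1 0 2 :+ μ 392 1 3 0 1 0 :+ μ 1176 2 0 2 2 0 :- μ 1176 2 1 0 2 1) , rel1) ∷ (:- (:- (μ 392 3 0 0 3 1)) , rel2) ∷ (:- (nat 0) , rel3) ∷ []) env (relations _ _ _ _)

-- The constant z will be 7 for the squares r = 1, 2, 4 and -7 for r = 3, 5, 6; here the Legendre
-- symbol appears as the sign in a polynomial identity. The four cᵢ are the multipliers of the
-- relations.
eisenstein : ∀ r → r < 7 → ∀ z (c0 c1 c2 c3 : Expr 5) →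
  {_ : T (vanishes (toPoly (firstParts r :- (con z :* secondParts r :+ linearCombination ((c0 , rel0) ∷ (c1 , rel1) ∷ (c2 , rel2) ∷ (c3 , rel3) ∷ [])))))} →
  section r firstEisenstein ≋ fromℤ z * section r secondEisenstein
eisenstein r l z c0 c1 c2 c3 {h} = component first-dissection r l ⟫ proveModulo (firstParts r) (con z :* secondParts r) ((c0 , rel0) ∷ (c1 , rel1) ∷ (c2 , rel2) ∷ (c3 , rel3) ∷ []) {h} env (relations _ _ _ _)
  ⟫ *-congˡ (≋-sym (component second-dissection r l))

eisenstein-1 : section 1 firstEisenstein ≋ fromℤ (+ 7) * section 1 secondEisenstein
eisenstein-1 = eisenstein 1 (Nₚ.<ᵇ⇒< 1 7 tt) (+ 7) (:- (μ 896 1 2 2 0 0) :+ μ 1232 1 3 0 0 1 :+ μ 1456 2 0 2 1 1 :- μ 3584 2 1 0 1 2 :- μ 448 3 0 1 3 0)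
  (:- (μ 1120 1 0 2 0 2) :+ μ 1120 1 1 0 0 3 :+ μ 1344 2 0 1 2 1 :- μ 224 3 0 0 4 0)
  (nat 0) (:- (μ 224 2 2 0 2 0))

eisenstein-2 : section 2 firstEisenstein ≋ fromℤ (+ 7) * section 2 secondEisenstein
eisenstein-2 = eisenstein 2 (Nₚ.<ᵇ⇒< 2 7 tt) (+ 7) (:- (μ 672 1 1 3 0 0) :+ μ 1680 1 2 1 0 1 :- μ 3808 2 0 1 1 2 :- μ 896 2 2 0 2 0 :+ μ 1232 3 0 0 3 1)
  (μ 1344 1 0 1 0 3 :+ μ 1120 1 2 0 1 1 :- μ 1120 2 0 0 2 2)
  (μ 224 1 0 3 0 1 :- μ 224 2 0 2 2 0) (nat 0)

eisenstein-3 : section 3 firstEisenstein ≋ fromℤ (-[1+ 6 ]) * section 3 secondEisenstein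
eisenstein-3 = eisenstein 3 (Nₚ.<ᵇ⇒< 3 7 tt) (-[1+ 6 ]) (μ 336 1 0 4 0 0 :+ μ 2520 1 1 2 0 1 :- μ 2968 1 2 0 0 2 :+ μ 3192 2 0 0 1 3 :- μ 784 2 1 1 2 0)
  (:- (μ 154 0 3 1 0 0) :- μ 2184 1 0 0 0 4 :- μ 546 1 0 3 1 0 :- μ 770 2 1 0 3 0)
  (μ 840 2 0 1 2 1 :- μ 56 3 0 0 4 0) (:- (μ 168 1 3 0 1 0))

eisenstein-4 : section 4 firstEisenstein ≋ fromℤ (+ 7) * section 4 secondEisenstein
eisenstein-4 = eisenstein 4 (Nₚ.<ᵇ⇒< 4 7 tt) (+ 7) (μ 112 1 0 3 0 1 :- μ 2464 1 1 1 0 2 :- μ 672 1 3 0 1 0 :+ μ 224 2 0 2 2 0 :+ μ 1680 2 1 0 2 1)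
  (:- (μ 224 0 2 2 0 0) :+ μ 224 0 3 0 0 1 :+ μ 1120 1 0 2 1 1 :- μ 1344 1 1 0 1 2 :- μ 1120 2 0 1 3 0)
  (nat 0) (nat 0)

eisenstein-5 : section 5 firstEisenstein ≋ fromℤ (-[1+ 6 ]) * section 5 secondEisenstein
eisenstein-5 = eisenstein 5 (Nₚ.<ᵇ⇒< 5 7 tt) (-[1+ 6 ]) (:- (μ 784 1 0 2 0 2) :+ μ 1008 1 1 0 0 3 :- μ 714 1 2 1 1 0 :+ μ 2520 2 0 1 2 1 :- μ 210 3 0 0 4 0)
  (:- (μ 168 0 1 3 0 0) :+ μ 770 0 2 1 0 1 :- μ 2184 1 0 1 1 2 :- μ 840 1 2 0 2 0 :+ μ 546 2 0 0 3 1)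
  (:- (μ 154 1 0 3 1 0)) (:- (μ 56 0 4 0 0 0))

eisenstein-6 : section 6 firstEisenstein ≋ fromℤ (-[1+ 6 ]) * section 6 secondEisenstein
eisenstein-6 = eisenstein 6 (Nₚ.<ᵇ⇒< 6 7 tt) (-[1+ 6 ]) (:- (μ 210 0 4 0 0 0) :+ μ 1008 1 0 1 0 3 :- μ 1554 1 1 2 1 0 :+ μ 3066 1 2 0 1 1 :- μ 2968 2 0 0 2 2)
  (:- (μ 56 0 0 4 0 0) :+ μ 840 0 1 2 0 1 :- μ 546 0 2 0 0 2 :+ μ 2184 1 0 0 1 3)
  (μ 770 1 0 2 1 1 :- μ 168 2 0 1 3 0) (:- (μ 154 2 1 0 3 0))

-- Lambert series

module Fℚ′ = FiniteSums ℚ-ring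

-- q d/dq
derive : Ser → Ser
derive f .at n = ℚSolver.fromℕ n ℚ.* at f n

derive-cong : ∀ {f g} → f ≋ g → derive f ≋ derive g
derive-cong p = coeffs λ n → cong (ℚSolver.fromℕ n ℚ.*_) (coeff p n)

derive-+ : ∀ f g → derive (f + g) ≋ derive f + derive g
derive-+ f g = coeffs λ n → ℚₚ.*-distribˡ-+ (ℚSolver.fromℕ n) (at f n) (at g n)

derive-neg : ∀ f → derive (- f) ≋ - derive f
derive-neg f = coeffs λ n → sym (ℚₚ.neg-distribʳ-* (ℚSolver.fromℕ n) (at f n))

derive-* : ∀ f g → derive (f * g) ≋ derive f * g + f * derive g
derive-* f g = coeffs λ n → sym (Fℚ′.sum<-*ˡ (suc n) (ℚSolver.fromℕ n) (λ i → at f i ℚ.* at g (n ∸ i)))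
  ∙ Fℚ′.sum<-cong (suc n) (λ i i≤n → term n i (Nₚ.≤-pred i≤n)) ∙ Fℚ′.sum<-+ (suc n) (λ i → at (derive f) i ℚ.* at g (n ∸ i)) (λ i → at f i ℚ.* at (derive g) (n ∸ i))
  where
  term : ∀ n i → i ≤ n → ℚSolver.fromℕ n ℚ.* (at f i ℚ.* at g (n ∸ i)) ≡ at (derive f) i ℚ.* at g (n ∸ i) ℚ.+ at f i ℚ.* at (derive g) (n ∸ i)
  term n i i≤n = cong (ℚ._* (at f i ℚ.* at g (n ∸ i))) (cong ℚSolver.fromℕ (sym (Nₚ.m+[n∸m]≡n i≤n)) ∙ ℚSolver.fromℕ-+ i (n ∸ i))
    ∙ ℚSolver.solve 4 (λ a b x y → (a :+ b) :* (x :* y) , (a :* x) :* y :+ x :* (b :* y)) (ℚSolver.fromℕ i ∷ ℚSolver.fromℕ (n ∸ i) ∷ at f i ∷ at g (n ∸ i) ∷ [])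

derive-X^ : ∀ e → derive (X^ e) ≋ fromℕ e * X^ e
derive-X^ e = coeffs λ n → go e n ∙ sym (coeff (*-congʳ {x = X^ e} (≋-sym (constant-fromℤ (+ e)))) n ∙ at-constant* (ℚSolver.fromℕ e) (X^ e) n)
  where
  shifted : ∀ k e n → ℚSolver.fromℕ (k N.+ n) ℚ.* unit e n ≡ ℚSolver.fromℕ (k N.+ e) ℚ.* unit e n
  shifted k zero zero = refl
  shifted k zero (suc n) = ℚₚ.*-zeroʳ (ℚSolver.fromℕ (k N.+ suc n)) ∙ sym (ℚₚ.*-zeroʳ (ℚSolver.fromℕ (k N.+ 0)))
  shifted k (suc e) zero = ℚₚ.*-zeroʳ (ℚSolver.fromℕ (k N.+ 0)) ∙ sym (ℚₚ.*-zeroʳ (ℚSolver.fromℕ (k N.+ suc e)))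
  shifted k (suc e) (suc n) rewrite Nₚ.+-suc k n | Nₚ.+-suc k e = shifted (suc k) e n
  go : ∀ e n → ℚSolver.fromℕ n ℚ.* unit e n ≡ ℚSolver.fromℕ e ℚ.* unit e n
  go = shifted 0

derive-X : derive (X^ 1) ≋ X^ 1
derive-X = derive-X^ 1 ⟫ *-congʳ (+-identityʳ 1#) ⟫ *-identityˡ (X^ 1)

derive-1 : derive 1# ≋ 0#
derive-1 = derive-X^ 0 ⟫ zeroˡ _

derive-fromℤ : ∀ z → derive (fromℤ z) ≋ 0#
derive-fromℤ z = derive-cong (≋-sym (constant-fromℤ z)) ⟫ (coeffs λ { zero → ℚₚ.*-zeroˡ (ℚSolver.fromℤ z) ; (suc n) → ℚₚ.*-zeroʳ (ℚSolver.fromℕ (suc n)) })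

derive-expand : ∀ f → derive (expand f) ≋ fromℤ (+ 7) * expand (derive f)
derive-expand f = sections-≋ λ { zero l → coeffs (λ n → zeroth n) ⟫ ≋-sym (section-fromℤ* 0 (+ 7) (expand (derive f)) ⟫ *-congˡ (section-0-expand (derive f)))
                              ; (suc r) l → coeffs (λ n → cong (ℚSolver.fromℕ (suc r N.+ n N.* 7) ℚ.*_) (coeff (section-suc-expand r f l) n) ∙ ℚₚ.*-zeroʳ (ℚSolver.fromℕ (suc r N.+ n N.* 7)))
                                  ⟫ ≋-sym (section-fromℤ* (suc r) (+ 7) (expand (derive f)) ⟫ *-congˡ (section-suc-expand r (derive f) l) ⟫ zeroʳ (fromℤ (+ 7))) }
  where
  zeroth : ∀ n → at (section 0 (derive (expand f))) n ≡ at (fromℤ (+ 7) * derive f) n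
  zeroth n = cong₂ ℚ._*_ (cong ℚSolver.fromℕ (Nₚ.*-comm n 7) ∙ ℚSolver.fromℕ-* 7 n) (coeff (section-0-expand f) n)
    ∙ ℚₚ.*-assoc (ℚSolver.fromℕ 7) (ℚSolver.fromℕ n) (at f n) ∙ sym (at-constant* (ℚSolver.fromℤ (+ 7)) (derive f) n) ∙ coeff (*-congʳ {x = derive f} (constant-fromℤ (+ 7))) n

rename : ∀ {n m} → (Fin n → Fin m) → Expr n → Expr m
rename σ (var i) = var (σ i)
rename σ (con z) = con z
rename σ :1 = :1
rename σ (e :+ f) = rename σ e :+ rename σ f
rename σ (e :* f) = rename σ e :* rename σ f
rename σ (e :- f) = rename σ e :- rename σ f
rename σ (:- e) = :- rename σ e
rename σ (e :^ k) = rename σ e :^ k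

module _ {n m} (σ : Fin n → Fin m) (ρ : Vec Ser n) (ρ′ : Vec Ser m) (same : ∀ i → Vec.lookup ρ′ (σ i) ≡ Vec.lookup ρ i) where
  ⟦rename⟧ : ∀ e → ⟦ rename σ e ⟧ ρ′ ≡ ⟦ e ⟧ ρ
  ⟦rename⟧ (var i) = same i
  ⟦rename⟧ (con z) = refl
  ⟦rename⟧ :1 = refl
  ⟦rename⟧ (e :+ f) = cong₂ _+_ (⟦rename⟧ e) (⟦rename⟧ f)
  ⟦rename⟧ (e :* f) = cong₂ _*_ (⟦rename⟧ e) (⟦rename⟧ f)
  ⟦rename⟧ (e :- f) = cong₂ _-_ (⟦rename⟧ e) (⟦rename⟧ f)
  ⟦rename⟧ (:- e) = cong -_ (⟦rename⟧ e)
  ⟦rename⟧ (e :^ k) = cong (_^ k) (⟦rename⟧ e)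

-- δ i is the derivative of the i-th variable.
derivative : ∀ {n m} → (Fin n → Fin m) → (Fin n → Expr m) → Expr n → Expr m
derivative σ δ (var i) = δ i
derivative σ δ (con z) = nat 0
derivative σ δ :1 = nat 0
derivative σ δ (e :+ f) = derivative σ δ e :+ derivative σ δ f
derivative σ δ (e :* f) = derivative σ δ e :* rename σ f :+ rename σ e :* derivative σ δ f
derivative σ δ (e :- f) = derivative σ δ e :- derivative σ δ f
derivative σ δ (:- e) = :- derivative σ δ e
derivative σ δ (e :^ zero) = nat 0
derivative σ δ (e :^ suc k) = derivative σ δ e :* rename σ e :^ k :+ rename σ e :* derivative σ δ (e :^ k)

module _ {n m} (σ : Fin n → Fin m) (δ : Fin n → Expr m) (ρ : Vec Ser n) (ρ′ : Vec Ser m) (same : ∀ i → Vec.lookup ρ′ (σ i) ≡ Vec.lookup ρ i)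
         (h : ∀ i → derive (Vec.lookup ρ i) ≋ ⟦ δ i ⟧ ρ′) where
  private
    back : ∀ e → ⟦ e ⟧ ρ ≋ ⟦ rename σ e ⟧ ρ′
    back e = ≋-reflexive (sym (⟦rename⟧ σ ρ ρ′ same e))

  derive-⟦⟧ : ∀ e → derive (⟦ e ⟧ ρ) ≋ ⟦ derivative σ δ e ⟧ ρ′
  derive-⟦⟧ (var i) = h i
  derive-⟦⟧ (con z) = derive-fromℤ z
  derive-⟦⟧ :1 = derive-1
  derive-⟦⟧ (e :+ f) = derive-+ (⟦ e ⟧ ρ) (⟦ f ⟧ ρ) ⟫ +-cong (derive-⟦⟧ e) (derive-⟦⟧ f)
  derive-⟦⟧ (e :* f) = derive-* (⟦ e ⟧ ρ) (⟦ f ⟧ ρ) ⟫ +-cong (*-cong (derive-⟦⟧ e) (back f)) (*-cong (back e) (derive-⟦⟧ f))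
  derive-⟦⟧ (e :- f) = derive-+ (⟦ e ⟧ ρ) (- ⟦ f ⟧ ρ) ⟫ +-cong (derive-⟦⟧ e) (derive-neg (⟦ f ⟧ ρ) ⟫ -‿cong (derive-⟦⟧ f))
  derive-⟦⟧ (:- e) = derive-neg (⟦ e ⟧ ρ) ⟫ -‿cong (derive-⟦⟧ e)
  derive-⟦⟧ (e :^ zero) = derive-1
  derive-⟦⟧ (e :^ suc k) = derive-* (⟦ e ⟧ ρ) (⟦ e ⟧ ρ ^ k) ⟫ +-cong (*-cong (derive-⟦⟧ e) (^-congˡ k (back e))) (*-cong (back e) (derive-⟦⟧ (e :^ k)))

-- As P has no constant term, the equation expresses n times the n-th coefficient through earlier
-- coefficients, and n is invertible in ℚ for n > 0.
logarithmic-unique : ∀ {P f g} → Vanishes 1 P → derive f ≋ - (P * f) → derive g ≋ - (P * g) → at f 0 ≡ at g 0 → f ≋ g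
logarithmic-unique {P} {f} {g} P0 p q init = ≈[]⇒≋ λ N → vanishing-difference (go N)
  where
  h = f - g
  equation : derive h ≋ - (P * h)
  equation = derive-+ f (- g) ⟫ +-cong p (derive-neg g ⟫ -‿cong q)
    ⟫ solve 3 (λ P f g → :- (P :* f) :+ :- (:- (P :* g)) , :- (P :* (f :- g))) (P ∷ f ∷ g ∷ [])
  0<1 : 0ℚ ℚ.< 1ℚ
  0<1 = ℚ.*<* (Z.+<+ (s≤s z≤n))
  positive : ∀ n → 0ℚ ℚ.< ℚSolver.fromℕ (suc n)
  positive zero = 0<1
  positive (suc n) = ℚₚ.+-mono-< {0ℚ} {1ℚ} {0ℚ} {ℚSolver.fromℕ (suc n)} 0<1 (positive n)
  cancel : ∀ p x → 0ℚ ≢ p → p ℚ.* x ≡ 0ℚ → x ≡ 0ℚ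
  cancel p x p≢0 e = sym (ℚₚ.*-identityˡ x) ∙ cong (ℚ._* x) (sym (ℚₚ.*-inverseˡ p))
    ∙ ℚₚ.*-assoc (ℚ.1/ p) p x ∙ cong (ℚ.1/ p ℚ.*_) e ∙ ℚₚ.*-zeroʳ (ℚ.1/ p)
    where
    instance
      nonZero : ℚ.NonZero p
      nonZero = ℚ.≢-nonZero (λ z → p≢0 (sym z))
  step : ∀ N → Vanishes (suc N) h → at h (suc N) ≡ 0ℚ
  step N v = cancel (ℚSolver.fromℕ (suc N)) (at h (suc N)) (ℚₚ.<⇒≢ (positive N))
    (coeff equation (suc N) ∙ cong ℚ.-_ (upto (Vanishes-* P0 v) (suc N) Nₚ.≤-refl))
  extend : ∀ N → Vanishes (suc N) h → Vanishes (suc (suc N)) h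
  extend N v = below λ n l → [ upto v n , (λ { refl → step N v }) ]′ (Nₚ.m≤n⇒m<n∨m≡n (Nₚ.≤-pred l))
  go : ∀ N → Vanishes N h
  go zero = below λ _ ()
  go (suc zero) = below λ { zero _ → cong (at f 0 ℚ.+_) (cong ℚ.-_ (sym init)) ∙ ℚₚ.+-inverseʳ (at f 0) ; (suc n) (s≤s ()) }
  go (suc (suc N)) = extend N (go (suc N))

Pairs : Set
Pairs = ℕ × ℕ

_≟ₚ_ : DecidableEquality Pairs
_≟ₚ_ = ×ₚ.≡-dec Nₚ._≟_ Nₚ._≟_

-- Lambert series Σ c(k, m) q^(km) over k, m ≥ 1; the index pair is (k - 1, m - 1).
module Lambert (c : ℕ → ℕ → ℤ) where
  open FiniteSums seriesRing using (sum<; sum<-cong)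

  lambertTerm : Pairs → Ser
  lambertTerm (i , j) = term⟨ c (suc i) (suc j) , suc i N.* suc j ⟩

  private
    square : ℕ → List Pairs
    square N = cartesianProduct (downFrom N) (downFrom N)

    summable : Summable lambertTerm
    summable = record { support = square ; unique = λ N → Uniqueₚ.cartesianProduct⁺ (Uniqueₚ.downFrom⁺ N) (Uniqueₚ.downFrom⁺ N) ; outside = out }
      where
      large : ∀ N i j → N ≤ suc i N.* suc j → Vanishes N (lambertTerm (i , j))
      large N i j l = ≈[]-mono l (Vanishes-*ˡ (fromℤ (c (suc i) (suc j))) (X^-vanishes (suc i N.* suc j)))
      out : ∀ N p → p ∉ square N → Vanishes N (lambertTerm p)
      out N (i , j) p∉ with i Nₚ.<? N | j Nₚ.<? N
      ... | yes l | yes l′ = contradiction (∈ₚ.∈-cartesianProduct⁺ (∈ₚ.∈-downFrom⁺ l) (∈ₚ.∈-downFrom⁺ l′)) p∉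
      ... | no ¬l | _ = large N i j (Nₚ.≤-trans (Nₚ.m≤n⇒m≤1+n (Nₚ.≮⇒≥ ¬l)) (Nₚ.m≤m*n (suc i) (suc j)))
      ... | yes _ | no ¬l = large N i j (Nₚ.≤-trans (Nₚ.m≤n⇒m≤1+n (Nₚ.≮⇒≥ ¬l)) (Nₚ.m≤n*m (suc j) (suc i)))

  lambert : Ser
  lambert = total summable

  HasSum-lambert : HasSum lambertTerm lambert
  HasSum-lambert = HasSum-total _≟ₚ_ summable

  private
    ∑-sum< : ∀ (f : ℕ → Ser) N → ∑ f (downFrom N) ≋ sum< N f
    ∑-sum< f zero = ≋-refl
    ∑-sum< f (suc N) = +-comm (f N) _ ⟫ +-congʳ (∑-sum< f N)

    ∑-nested : ∀ L M → ∑ lambertTerm (cartesianProduct L M) ≋ ∑ (λ i → ∑ (λ j → lambertTerm (i , j)) M) L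
    ∑-nested [] M = ≋-refl
    ∑-nested (i ∷ L) M = ∑-++ lambertTerm (List.map (i ,_) M) _ ⟫ +-cong (∑-map lambertTerm (i ,_) M) (∑-nested L M)

  lambert-rows : ∀ (row : ℕ → Ser) → (∀ i N → sum< N (λ j → lambertTerm (i , j)) ≈[ N ] row i) → Tends (λ n → sum< n row) lambert
  lambert-rows row h N M N≤M = ≈[]-mono N≤M (≈[]-trans (rows M) (HasSum.sums HasSum-lambert M))
    where
    sum<-cong[] : ∀ n {N f g} → (∀ i → f i ≈[ N ] g i) → sum< n f ≈[ N ] sum< n g
    sum<-cong[] zero h = ≈[]-refl
    sum<-cong[] (suc n) h = ≈[]-+ (sum<-cong[] n h) (h n)
    rows : ∀ M → sum< M row ≈[ M ] ∑ lambertTerm (square M)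
    rows M = ≈[]-trans (sum<-cong[] M (λ i → ≈[]-sym (h i M))) (≋⇒≈[] (sum<-cong M (λ i _ → ≋-sym (∑-sum< (λ j → lambertTerm (i , j)) M))
      ⟫ ≋-sym (∑-sum< (λ i → ∑ (λ j → lambertTerm (i , j)) (downFrom M)) M) ⟫ ≋-sym (∑-nested (downFrom M) (downFrom M))))

open FiniteSums seriesRing using () renaming (sum< to sumₛ; sum<-cong to sumₛ-cong; sum<-*ˡ to sumₛ-*ˡ)

X^-power : ∀ k j → X^ (k N.* j) ≋ X^ k ^ j
X^-power k j = ≋-sym (X^-* k j ⟫ ≋-reflexive (cong X^ (Nₚ.*-comm j k)))

geometric-row : ∀ i N → sumₛ N (λ j → X^ (suc i N.* suc j)) ≈[ N ] X^ (suc i) * geometric (suc i)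
geometric-row i N = Monic-cancel[] (Monic-1-X^ i) (≈[]-trans (≋⇒≈[] (finite N)) (≈[]-trans (≈[]-+ ≈[]-refl (≈[]-neg small))
  (≋⇒≈[] (solve 1 (λ y → y :- nat 0 , :1 :* y) (y ∷ []) ⟫ *-congʳ (≋-sym (⁻¹-inverse (Monic-1-X^ i)))
    ⟫ solve 3 (λ p y g → p :* g :* y , p :* (y :* g)) (1# - y ∷ y ∷ geometric (suc i) ∷ [])))))
  where
  y = X^ (suc i)
  finite : ∀ N → (1# - y) * sumₛ N (λ j → X^ (suc i N.* suc j)) ≋ y - y ^ suc N
  finite zero = solve 1 (λ y → (:1 :- y) :* nat 0 , y :- y :^ 1) (y ∷ [])
  finite (suc N) = distribˡ (1# - y) _ _ ⟫ +-cong (finite N) (*-congˡ (X^-power (suc i) (suc N)))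
    ⟫ solve 2 (λ y z → (y :- z) :+ (:1 :- y) :* z , y :- y :* z) (y ∷ y ^ suc N ∷ [])
  small : Vanishes N (y ^ suc N)
  small = ≈[]-trans (≋⇒≈[] (≋-sym (X^-power (suc i) (suc N)))) (≈[]-mono (Nₚ.≤-trans (Nₚ.n≤1+n N) (Nₚ.m≤n*m (suc N) (suc i))) (X^-vanishes _))

cubic-row : ∀ i N → sumₛ N (λ j → fromℤ (+ suc j Z.* + suc j) * X^ (suc i N.* suc j)) ≈[ N ] cubicPole (suc i)
cubic-row i N = Monic-cancel[] (Monic-^ 3 (Monic-1-X^ i)) (≈[]-trans (≋⇒≈[] (finite N)) (≈[]-trans (≈[]-+ ≈[]-refl (≈[]-neg small))
  (≋⇒≈[] (solve 1 (λ y → y :* (:1 :+ y) :- nat 0 , :1 :^ 3 :* (y :* (:1 :+ y))) (y ∷ [])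
    ⟫ *-congʳ (^-congˡ 3 (≋-sym (⁻¹-inverse (Monic-1-X^ i))))
      ⟫ solve 3 (λ p y g → (p :* g) :^ 3 :* (y :* (:1 :+ y)) , p :^ 3 :* (y :* (:1 :+ y) :* g :^ 3)) (1# - y ∷ y ∷ geometric (suc i) ∷ [])))))
  where
  y = X^ (suc i)
  -- The remainder in the closed form of the sum of m² yᵐ over m ≤ ν, after y^(ν + 1) has been taken
  -- out.
  error : Ser → Ser
  error ν = (ν + 1#) ^ 2 - (fromℤ (+ 2) * ν ^ 2 + fromℤ (+ 2) * ν - 1#) * y + ν ^ 2 * y ^ 2
  finite : ∀ N → (1# - y) ^ 3 * sumₛ N (λ j → fromℤ (+ suc j Z.* + suc j) * X^ (suc i N.* suc j)) ≋ y * (1# + y) - y ^ suc N * error (fromℕ N)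
  finite zero = solve 1 (λ y → (:1 :- y) :^ 3 :* nat 0 ,
    y :* (:1 :+ y) :- y :^ 1 :* ((nat 0 :+ :1) :^ 2 :- (nat 2 :* nat 0 :^ 2 :+ nat 2 :* nat 0 :- :1) :* y :+ nat 0 :^ 2 :* y :^ 2)) (y ∷ [])
  finite (suc N) = distribˡ ((1# - y) ^ 3) _ _ ⟫ +-cong (finite N) (*-congˡ (*-cong (fromℤ-* (+ suc N) (+ suc N)) (X^-power (suc i) (suc N))))
    ⟫ solve 3 (λ y z n → (y :* (:1 :+ y) :- z :* ((n :+ :1) :^ 2 :- (nat 2 :* n :^ 2 :+ nat 2 :* n :- :1) :* y :+ n :^ 2 :* y :^ 2)) :+ (:1 :- y) :^ 3 :* ((:1 :+ n) :* (:1 :+ n) :* z) ,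
       let n′ = :1 :+ n in y :* (:1 :+ y) :- y :* z :* ((n′ :+ :1) :^ 2 :- (nat 2 :* n′ :^ 2 :+ nat 2 :* n′ :- :1) :* y :+ n′ :^ 2 :* y :^ 2))
       (y ∷ y ^ suc N ∷ fromℕ N ∷ [])
  small : Vanishes N (y ^ suc N * error (fromℕ N))
  small = Vanishes-*ʳ (error (fromℕ N)) (≈[]-trans (≋⇒≈[] (≋-sym (X^-power (suc i) (suc N)))) (≈[]-mono (Nₚ.≤-trans (Nₚ.n≤1+n N) (Nₚ.m≤n*m (suc N) (suc i))) (X^-vanishes _)))

module DivisorSum = Lambert (λ k m → + k)

divisorSum : Ser
divisorSum = DivisorSum.lambert

divisorRow : ℕ → Ser
divisorRow i = fromℤ (+ suc i) * (X^ (suc i) * geometric (suc i))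

divisorSum-tends : Tends (λ n → sumₛ n divisorRow) divisorSum
divisorSum-tends = DivisorSum.lambert-rows divisorRow (λ i N → ≈[]-trans (≋⇒≈[] (sumₛ-*ˡ N (fromℤ (+ suc i)) (λ j → X^ (suc i N.* suc j))))
  (≈[]-* ≈[]-refl (geometric-row i N)))

-- The factor 1 - qⁿ contributes -n qⁿ/(1 - qⁿ) to the logarithmic derivative.
derive-euler : derive (poch 0) ≋ - (divisorSum * poch 0)
derive-euler = Tends-unique {λ n → derive (B1.qfac n)} (λ N M N≤M → derive-[] (poch-tends 0 N M N≤M))
  (λ N M N≤M → ≈[]-trans (≋⇒≈[] (finite M)) (≈[]-neg (≈[]-* (divisorSum-tends N M N≤M) (poch-tends 0 N M N≤M))))
  where
  module B1 = TripleProduct.WithBase ℚ-ring 0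
  derive-[] : ∀ {N f g} → f ≈[ N ] g → derive f ≈[ N ] derive g
  derive-[] p = below λ n l → cong (ℚSolver.fromℕ n ℚ.*_) (upto p n l)
  factor : ∀ n → 1# - B1.Q (suc n) ≋ 1# - X^ (suc n)
  factor n = +-congˡ (-‿cong (B1.Q≋X^ (suc n) ⟫ ≋-reflexive (cong X^ (Nₚ.*-identityʳ (suc n)))))
  derive-factor : ∀ n → derive (1# - X^ (suc n)) ≋ - (fromℤ (+ suc n) * X^ (suc n))
  derive-factor n = derive-+ 1# (- X^ (suc n)) ⟫ +-cong derive-1 (derive-neg (X^ (suc n)) ⟫ -‿cong (derive-X^ (suc n))) ⟫ +-identityˡ _
  finite : ∀ n → derive (B1.qfac n) ≋ - (sumₛ n divisorRow * B1.qfac n)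
  finite zero = derive-1 ⟫ solve 0 (nat 0 , :- (nat 0 :* :1)) []
  finite (suc n) = derive-cong (*-congˡ {B1.qfac n} (factor n)) ⟫ derive-* (B1.qfac n) (1# - X^ (suc n))
    ⟫ +-cong (*-congʳ (finite n)) (*-congˡ (derive-factor n)) ⟫ +-congˡ (*-congˡ (-‿cong (≋-sym (*-identityˡ _) ⟫ *-congʳ (≋-sym (⁻¹-inverse (Monic-1-X^ n))))))
        ⟫ solve 6 (λ s f p k y g → (:- (s :* f)) :* p :+ f :* (:- (p :* g :* (k :* y))) , :- ((s :+ k :* (y :* g)) :* (f :* p)))
          (sumₛ n divisorRow ∷ B1.qfac n ∷ 1# - X^ (suc n) ∷ fromℤ (+ suc n) ∷ X^ (suc n) ∷ geometric (suc n) ∷ [])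
      ⟫ -‿cong (*-congˡ (*-congˡ (≋-sym (factor n))))

expand-[] : ∀ {N f g} → f ≈[ N ] g → expand f ≈[ N ] expand g
expand-[] p = below λ n l → cong (λ x → if n DivMod.% 7 N.≡ᵇ 0 then x else 0ℚ) (upto p (n DivMod./ 7) (Nₚ.≤-<-trans (DivMod.m/n≤m n 7) l))

HasSum-expand : {I : Set} {f : I → Ser} {s : Ser} → HasSum f s → HasSum (λ i → expand (f i)) (expand s)
HasSum-expand {f = f} p = record
  { summable = record { support = support ; unique = unique ; outside = λ N i i∉ → ≈[]-trans (expand-[] (outside N i i∉)) (≋⇒≈[] expand-0) }
  ; sums = λ N → ≈[]-trans (≋⇒≈[] (≋-sym (expand-∑ (support N)))) (expand-[] (sums N)) }
  where
  open HasSum p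
  expand-∑ : ∀ L → expand (∑ f L) ≋ ∑ (λ i → expand (f i)) L
  expand-∑ [] = expand-0
  expand-∑ (i ∷ L) = expand-+ (f i) (∑ f L) ⟫ +-congˡ (expand-∑ L)

expand-term : ∀ x e → expand term⟨ x , e ⟩ ≋ term⟨ x , e N.* 7 ⟩
expand-term x e = expand-* (fromℤ x) (X^ e) ⟫ *-cong (expand-fromℤ x) (expand-X^ e)

expand-poch : expand (poch 0) ≋ E
expand-poch = Tends-unique {λ n → expand (B1.qfac n)} (λ N M l → expand-[] (poch-tends 0 N M l)) (Tends-cong (λ n → ≋-sym (finite n)) (poch-tends 6))
  where
  module B1 = TripleProduct.WithBase ℚ-ring 0
  module B7 = TripleProduct.WithBase ℚ-ring 6
  finite : ∀ n → expand (B1.qfac n) ≋ B7.qfac n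
  finite zero = expand-1
  finite (suc n) = expand-* (B1.qfac n) _ ⟫ *-cong (finite n) (expand-+ 1# (- B1.Q (suc n))
    ⟫ +-cong expand-1 (expand-neg (B1.Q (suc n)) ⟫ -‿cong (expand-cong (B1.Q≋X^ (suc n))
      ⟫ expand-X^ (suc n N.* 1) ⟫ ≋-reflexive (cong (λ t → X^ (t N.* 7)) (Nₚ.*-identityʳ (suc n))) ⟫ ≋-sym (B7.Q≋X^ (suc n)))))

prime-7 : Prime 7
prime-7 = from-yes (prime? 7)

multiple-7 : ∀ {n} → 7 ℕ∣.∣ suc n → Σ ℕ λ m → n ≡ 6 N.+ m N.* 7
multiple-7 (ℕ∣.divides (suc m) e) = m , Nₚ.suc-injective e

section-0-miss : ∀ x e → ¬ (7 ℕ∣.∣ e) → section 0 term⟨ x , e ⟩ ≋ 0#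
section-0-miss x e h = section-cong 0 (≋-reflexive (cong (λ t → term⟨ x , t ⟩) (DivMod.m≡m%n+[m/n]*n e 7)))
  ⟫ section-term-≢ 0 (e DivMod.% 7) x (e DivMod./ 7) (s≤s z≤n) (DivMod.m%n<n e 7) (λ q → h (ℕ∣.m%n≡0⇒n∣m e 7 (sym q)))

section-0-hit : ∀ x e e′ → e ≡ e′ N.* 7 → section 0 term⟨ x , e ⟩ ≋ term⟨ x , e′ ⟩
section-0-hit x _ e′ refl = section-term 0 x e′ (s≤s z≤n)

times-7ʳ : ∀ i j → suc i N.* suc (6 N.+ j N.* 7) ≡ (suc i N.* suc j) N.* 7
times-7ʳ i j = sym (Nₚ.*-assoc (suc i) (suc j) 7)

times-7ˡ : ∀ i j → suc (6 N.+ i N.* 7) N.* suc j ≡ (suc i N.* suc j) N.* 7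
times-7ˡ i j = Nₚ.*-assoc (suc i) 7 (suc j) ∙ cong (suc i N.*_) (Nₚ.*-comm 7 (suc j)) ∙ sym (Nₚ.*-assoc (suc i) (suc j) 7)

shift2 shift1 : Pairs → Pairs
shift2 (i , j) = i , 6 N.+ j N.* 7
shift1 (i , j) = 6 N.+ i N.* 7 , j

unshift : ∀ i i′ → 6 N.+ i N.* 7 ≡ 6 N.+ i′ N.* 7 → i ≡ i′
unshift i i′ e = Nₚ.*-cancelʳ-≡ i i′ 7 (Nₚ.+-cancelˡ-≡ 6 _ _ e)

shift2-injective : ∀ p p′ → shift2 p ≡ shift2 p′ → p ≡ p′
shift2-injective (i , j) (i′ , j′) e = cong₂ _,_ (cong proj₁ e) (unshift j j′ (cong proj₂ e))

shift1-injective : ∀ p p′ → shift1 p ≡ shift1 p′ → p ≡ p′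
shift1-injective (i , j) (i′ , j′) e = cong₂ _,_ (unshift i i′ (cong proj₁ e)) (cong proj₂ e)

module _ (c : ℕ → ℕ → ℤ) where
  open Lambert c

  -- If 7 divides km and 7 does not divide k, then 7 divides m. Cancelling this 7 is a bijection on
  -- the pairs that matter, and c does not change.
  lambert-section-0 : (∀ i m → c (suc (6 N.+ i N.* 7)) m ≡ + 0) → (∀ k j → c k (suc (6 N.+ j N.* 7)) ≡ c k (suc j)) → section 0 lambert ≋ lambert
  lambert-section-0 c0 c7 = HasSum-unique _≟ₚ_ (HasSum-section 0 HasSum-lambert) (reindex R HasSum-lambert)
    where
    onto : ∀ p → section 0 (lambertTerm p) ≋ 0# ⊎ Σ Pairs (λ q → ⊤ × shift2 q ≡ p)
    onto (i , j) with 7 ℕ∣.∣? suc j | 7 ℕ∣.∣? suc i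
    ... | yes d | _ = let j′ , e = multiple-7 d in inj₂ ((i , j′) , tt , cong (i ,_) (sym e))
    ... | no _ | yes d = inj₁ (vanishing (multiple-7 d))
      where
      vanishing : (Σ ℕ λ i′ → i ≡ 6 N.+ i′ N.* 7) → section 0 (lambertTerm (i , j)) ≋ 0#
      vanishing (i′ , refl) = section-cong 0 (*-congʳ (≋-reflexive (cong fromℤ (c0 i′ (suc j)))) ⟫ zeroˡ _) ⟫ (coeffs λ _ → refl)
    ... | no ¬d | no ¬d′ = inj₁ (section-0-miss (c (suc i) (suc j)) (suc i N.* suc j) (λ d → [ ¬d′ , ¬d ]′ (euclidsLemma (suc i) (suc j) prime-7 d)))
    R : Reindexing lambertTerm (λ p → section 0 (lambertTerm p))
    R = record
      { to = shift2 ; Relevant = λ _ → ⊤ ; relevant? = all? ; irrelevant = λ _ n → ⊥-elim (n tt)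
      ; agree = λ { (i , j) _ → ≋-sym (section-0-hit (c (suc i) (suc (6 N.+ j N.* 7))) _ (suc i N.* suc j) (times-7ʳ i j) ⟫ term-cong (c7 (suc i) j) refl) }
      ; injective = λ p p′ _ _ → shift2-injective p p′ ; onto = onto }

-- σ(7n) = 8 σ(n) - 7 σ(n/7)
divisorSum-section : section 0 divisorSum ≋ fromℤ (+ 8) * divisorSum - fromℤ (+ 7) * expand divisorSum
divisorSum-section = HasSum-split _≟ₚ_ second? sections (reindex hits HasSum-lambert) (reindex misses (HasSum-*ˡ (fromℤ (+ 7)) (proj₂ rest)))
  ⟫ +-congˡ (*-congˡ restValue) ⟫ solve 2 (λ p q → p :+ nat 7 :* (p :- q) , nat 8 :* p :- nat 7 :* q) (divisorSum ∷ expand divisorSum ∷ [])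
  where
  open DivisorSum
  Second : Pairs → Set
  Second (i , j) = 7 ℕ∣.∣ suc j
  second? : ∀ p → Dec (Second p)
  second? (i , j) = 7 ℕ∣.∣? suc j
  other? : ∀ p → Dec (¬ Second p)
  other? p = ¬? (second? p)
  g : Pairs → Ser
  g p = section 0 (lambertTerm p)
  sections : HasSum g (section 0 divisorSum)
  sections = HasSum-section 0 HasSum-lambert
  rest : Σ Ser (HasSum (restrict other? lambertTerm))
  rest = restricted-sum _≟ₚ_ other? HasSum-lambert
  divisible : ∀ j → 7 ℕ∣.∣ suc (6 N.+ j N.* 7)
  divisible j = ℕ∣.divides (suc j) refl
  preimage : ∀ p → Second p → Σ Pairs (λ q → ⊤ × shift2 q ≡ p)
  preimage (i , j) d = let j′ , e = multiple-7 d in (i , j′) , tt , cong (i ,_) (sym e)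
  hits : Reindexing lambertTerm (restrict second? g)
  hits = record
    { to = shift2 ; Relevant = λ _ → ⊤ ; relevant? = all? ; irrelevant = λ _ n → ⊥-elim (n tt)
    ; agree = λ { (i , j) _ → ≋-sym (restrict-yes second? g (i , 6 N.+ j N.* 7) (divisible j) ⟫ section-0-hit (+ suc i) _ (suc i N.* suc j) (times-7ʳ i j)) }
    ; injective = λ p p′ _ _ → shift2-injective p p′
    ; onto = λ p → [ (λ d → inj₂ (preimage p d)) , (λ ¬d → inj₁ (restrict-no second? g p ¬d)) ]′ (toSum (second? p)) }
  expanded : Reindexing (λ p → expand (lambertTerm p)) (restrict second? lambertTerm)
  expanded = record
    { to = shift2 ; Relevant = λ _ → ⊤ ; relevant? = all? ; irrelevant = λ _ n → ⊥-elim (n tt)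
    ; agree = λ { (i , j) _ → expand-term (+ suc i) (suc i N.* suc j) ⟫ term-cong {+ suc i} refl (sym (times-7ʳ i j)) ⟫ ≋-sym (restrict-yes second? lambertTerm (i , 6 N.+ j N.* 7) (divisible j)) }
    ; injective = λ p p′ _ _ → shift2-injective p p′
    ; onto = λ p → [ (λ d → inj₂ (preimage p d)) , (λ ¬d → inj₁ (restrict-no second? lambertTerm p ¬d)) ]′ (toSum (second? p)) }
  restValue : proj₁ rest ≋ divisorSum - expand divisorSum
  restValue = solve 2 (λ e r → r , (e :+ r) :- e) (expand divisorSum ∷ proj₁ rest ∷ [])
    ⟫ +-congʳ (≋-sym (HasSum-split _≟ₚ_ second? HasSum-lambert (reindex expanded (HasSum-expand HasSum-lambert)) (proj₂ rest)))
  misses : Reindexing (λ p → fromℤ (+ 7) * restrict other? lambertTerm p) (restrict other? g)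
  misses = record
    { to = shift1 ; Relevant = λ p → ¬ Second p ; relevant? = other?
    ; irrelevant = λ p ¬o → *-congˡ (restrict-no other? lambertTerm p ¬o) ⟫ zeroʳ _
    ; agree = λ { (i , j) o → *-congˡ (restrict-yes other? lambertTerm (i , j) o) ⟫ term-scale (+ 7) (+ suc i) (suc i N.* suc j)
        ⟫ term-cong (sym (Zₚ.pos-* 7 (suc i)) ∙ cong +_ (Nₚ.*-comm 7 (suc i))) refl
          ⟫ ≋-sym (section-0-hit (+ (suc i N.* 7)) _ (suc i N.* suc j) (times-7ˡ i j)) ⟫ ≋-sym (restrict-yes other? g (6 N.+ i N.* 7 , j) o) }
    ; injective = λ p p′ _ _ → shift1-injective p p′
    ; onto = λ p → [ (λ d → inj₁ (restrict-no other? g p (λ o → o d))) , (λ o → find p o) ]′ (toSum (second? p)) }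
    where
    find : ∀ p → ¬ Second p → restrict other? g p ≋ 0# ⊎ Σ Pairs (λ q → ¬ Second q × shift1 q ≡ p)
    find (i , j) o with 7 ℕ∣.∣? suc i
    ... | yes d = let i′ , e = multiple-7 d in inj₂ ((i′ , j) , o , cong (_, j) (sym e))
    ... | no ¬d = inj₁ (restrict-yes other? g (i , j) o ⟫ section-0-miss (+ suc i) (suc i N.* suc j) (λ d → [ ¬d , o ]′ (euclidsLemma (suc i) (suc j) prime-7 d)))

section-derive : ∀ r f → section r (derive f) ≋ fromℤ (+ r) * section r f + fromℤ (+ 7) * derive (section r f)
section-derive r f = coeffs λ n → cong (ℚ._* at f (r N.+ n N.* 7)) (ℚSolver.fromℕ-+ r (n N.* 7) ∙ cong (ℚSolver.fromℕ r ℚ.+_) (cong ℚSolver.fromℕ (Nₚ.*-comm n 7) ∙ ℚSolver.fromℕ-* 7 n))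
  ∙ ℚₚ.*-distribʳ-+ (at f (r N.+ n N.* 7)) (ℚSolver.fromℕ r) (ℚSolver.fromℕ 7 ℚ.* ℚSolver.fromℕ n)
    ∙ cong₂ ℚ._+_ (sym (scaled r (section r f) n)) (ℚₚ.*-assoc (ℚSolver.fromℕ 7) (ℚSolver.fromℕ n) _ ∙ sym (scaled 7 (derive (section r f)) n))
  where
  scaled : ∀ k f n → at (fromℤ (+ k) * f) n ≡ ℚSolver.fromℕ k ℚ.* at f n
  scaled k f n = coeff (*-congʳ {x = f} (≋-sym (constant-fromℤ (+ k)))) n ∙ at-constant* (ℚSolver.fromℤ (+ k)) f n

env8 : Vec Ser 8
env8 = A ∷ B ∷ D ∷ E ∷ derive A ∷ derive B ∷ derive D ∷ derive E ∷ []

env9 : Vec Ser 9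
env9 = X^ 1 ∷ env8

σ : Fin 5 → Fin 9
σ i = i Fin.↑ˡ 4

renamed-var : ∀ i → Vec.lookup env9 (σ i) ≡ Vec.lookup env i
renamed-var Fin.zero = refl
renamed-var (Fin.suc Fin.zero) = refl
renamed-var (Fin.suc (Fin.suc Fin.zero)) = refl
renamed-var (Fin.suc (Fin.suc (Fin.suc Fin.zero))) = refl
renamed-var (Fin.suc (Fin.suc (Fin.suc (Fin.suc Fin.zero)))) = refl

varDerivative : Fin 5 → Expr 9
varDerivative Fin.zero = var Fin.zero
varDerivative (Fin.suc i) = var (5 Fin.↑ʳ i)

derived : ∀ i → derive (Vec.lookup env i) ≋ ⟦ varDerivative i ⟧ env9
derived Fin.zero = derive-X
derived (Fin.suc Fin.zero) = ≋-refl
derived (Fin.suc (Fin.suc Fin.zero)) = ≋-refl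
derived (Fin.suc (Fin.suc (Fin.suc Fin.zero))) = ≋-refl
derived (Fin.suc (Fin.suc (Fin.suc (Fin.suc Fin.zero)))) = ≋-refl

renamed : ∀ {f es} → Dissection f es euler → Dissection f (λ r → rename σ (es r)) env8
renamed {es = es} p = dissected λ r l → component p r l ⟫ ≋-reflexive (sym (⟦rename⟧ σ env env9 renamed-var (es r)))

derivedParts : ℕ → Expr 9
derivedParts r = con (+ r) :* rename σ (eulerParts r) :+ nat 7 :* derivative σ varDerivative (eulerParts r)

derived-euler : Dissection (derive (poch 0)) derivedParts env8
derived-euler = dissected λ r l → section-derive r (poch 0) ⟫ +-cong
  (*-congˡ (component (renamed euler-dissection) r l))
  (*-congˡ (derive-cong (component euler-dissection r l) ⟫ derive-⟦⟧ σ varDerivative env env9 renamed-var derived (eulerParts r)))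

-- The derivative of a norm is the trace of the cofactor times the derivative. The trace to series
-- in q⁷ is 7 times the section 0, and this 7 cancels against the one from differentiating in q⁷.
derive-norm : derive N ≋ - (section 0 divisorSum * N)
derive-norm = derive-⟦⟧ σ varDerivative env env9 renamed-var derived normₑ ⟫ prove (derivative σ varDerivative normₑ) (((λ r → rename σ (cofactorParts r)) ⊙ derivedParts) 0) env9
  ⟫ ≋-sym (component (Dissection-* (renamed cofactor-dissection) derived-euler) 0 (s≤s z≤n))
    ⟫ section-cong 0 (*-congˡ derive-euler ⟫ solve 3 (λ c p u → c :* (:- (p :* u)) , :- ((u :* c) :* p)) (cofactor ∷ divisorSum ∷ poch 0 ∷ [])
        ⟫ -‿cong (*-congʳ norm-factorisation))
      ⟫ section-neg 0 (expand N * divisorSum) ⟫ -‿cong (section-expand-* 0 N divisorSum (s≤s z≤n) ⟫ *-comm N _)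

-- Both sides have the logarithmic derivative -8 `divisorSum`: the norm contributes -8 σ(n) + 7
-- σ(n/7) to the coefficient of qⁿ, and E contributes -7 σ(n/7).
norm-value : N * E ≋ poch 0 ^ 8
norm-value = logarithmic-unique {fromℤ (+ 8) * divisorSum} vanishing
    (derive-* N E ⟫ +-cong (*-congʳ (derive-norm ⟫ -‿cong (*-congʳ divisorSum-section))) (*-congˡ deriveE)
      ⟫ solve 4 (λ p q n e → (:- ((nat 8 :* p :- nat 7 :* q) :* n)) :* e :+ n :* (:- (nat 7 :* (q :* e))) , :- (nat 8 :* p :* (n :* e))) (divisorSum ∷ expand divisorSum ∷ N ∷ E ∷ []))
    (derive-⟦⟧ {1} {2} (λ { Fin.zero → Fin.zero }) (λ { Fin.zero → var (Fin.suc Fin.zero) }) (poch 0 ∷ []) (poch 0 ∷ derive (poch 0) ∷ []) (λ { Fin.zero → refl }) (λ { Fin.zero → ≋-refl }) (var Fin.zero :^ 8)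
      ⟫ prove (derivative {1} {2} (λ { Fin.zero → Fin.zero }) (λ { Fin.zero → var (Fin.suc Fin.zero) }) (var Fin.zero :^ 8)) (nat 8 :* var Fin.zero :^ 7 :* var (Fin.suc Fin.zero)) (poch 0 ∷ derive (poch 0) ∷ [])
        ⟫ *-congˡ derive-euler ⟫ solve 2 (λ u p → nat 8 :* u :^ 7 :* (:- (p :* u)) , :- (nat 8 :* p :* u :^ 8)) (poch 0 ∷ divisorSum ∷ []))
    (leading {N * E} (Monic-* {N} (monic N0) (Monic-poch 6)) ∙ sym (leading (Monic-^ {poch 0} 8 (Monic-poch 0))))
  where
  deriveE : derive E ≋ - (fromℤ (+ 7) * (expand divisorSum * E))
  deriveE = derive-cong (≋-sym expand-poch) ⟫ derive-expand (poch 0) ⟫ *-congˡ (expand-cong derive-euler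
    ⟫ expand-neg (divisorSum * poch 0) ⟫ -‿cong (expand-* divisorSum (poch 0) ⟫ *-congˡ expand-poch))
    ⟫ solve 1 (λ a → nat 7 :* (:- a) , :- (nat 7 :* a)) (expand divisorSum * E ∷ [])
  vanishing : Vanishes 1 (fromℤ (+ 8) * divisorSum)
  vanishing = Vanishes-*ˡ (fromℤ (+ 8)) (≈[]-sym (≈[]-trans (below λ { zero _ → refl ; (suc n) (s≤s ()) }) (divisorSum-tends 1 1 Nₚ.≤-refl)))
  N0 : at N 0 ≡ 1ℚ
  N0 = refl

-- Both series have the square N E. Half of their sum has constant term 1 and can be cancelled,
-- which excludes the opposite sign.
root-value : M ≋ poch 0 ^ 4
root-value = Monic-cancel {constant ℚ.½ * (M + poch 0 ^ 4)} (monic refl) (solve 3 (λ h m u → h :* (m :+ u :^ 4) :* m , h :* (m :* m) :+ h :* (u :^ 4 :* m)) (constant ℚ.½ ∷ M ∷ poch 0 ∷ [])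
  ⟫ +-congʳ (*-congˡ (root-square ⟫ *-comm E N ⟫ norm-value))
    ⟫ solve 3 (λ h m u → h :* u :^ 8 :+ h :* (u :^ 4 :* m) , h :* (m :+ u :^ 4) :* u :^ 4) (constant ℚ.½ ∷ M ∷ poch 0 ∷ []))

partitionSeries : Ser
partitionSeries = poch 0 ⁻¹

ramanujan-7 : poch 0 ^ 8 * section 5 partitionSeries ≋ fromℤ (+ 7) * (E ^ 3 * poch 0 ^ 4) + fromℤ (+ 49) * (X^ 1 * E ^ 7)
ramanujan-7 = *-congʳ (≋-sym norm-value) ⟫ solve 3 (λ n e s → n :* e :* s , e :* (n :* s)) (N ∷ E ∷ section 5 partitionSeries ∷ [])
  ⟫ *-congˡ (≋-sym (section-expand-* 5 N partitionSeries (Nₚ.≤ᵇ⇒≤ 6 7 tt)) ⟫ section-cong 5 quotient≋ ⟫ cofactor-5 ⟫ +-congʳ (*-congˡ root-value))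
    ⟫ solve 3 (λ e u x → e :* (nat 7 :* e :^ 2 :* u :^ 4 :+ nat 49 :* x :* e :^ 6) , nat 7 :* (e :^ 3 :* u :^ 4) :+ nat 49 :* (x :* e :^ 7)) (E ∷ poch 0 ∷ X^ 1 ∷ [])
  where
  quotient≋ : expand N * partitionSeries ≋ cofactor
  quotient≋ = *-congʳ (≋-sym norm-factorisation) ⟫ solve 3 (λ u c p → u :* c :* p , (u :* p) :* c) (poch 0 ∷ cofactor ∷ partitionSeries ∷ [])
    ⟫ *-congʳ (⁻¹-inverse (Monic-poch 0)) ⟫ *-identityˡ cofactor

-- Lambert series with the quadratic character modulo 7

χ7 : ℕ → ℤ
χ7 1 = + 1
χ7 2 = + 1
χ7 3 = -[1+ 0 ]
χ7 4 = + 1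
χ7 5 = -[1+ 0 ]
χ7 6 = -[1+ 0 ]
χ7 _ = + 0

χ : ℕ → ℤ
χ k = χ7 (k DivMod.% 7)

legendre-χ : ∀ k → legendre k 7 ≡ χ k
legendre-χ k = cong (λ b → if b then + 0 else (if isSquareMod 7 k then + 1 else -[1+ 0 ])) (isYes≗does (7 ℕ∣.∣? k) ∙ sym (isYes≗does (k DivMod.% 7 Nₚ.≟ 0)))
  ∙ table (k DivMod.% 7) (DivMod.m%n<n k 7)
  where
  table : ∀ r → r < 7 → (if ⌊ r Nₚ.≟ 0 ⌋ then + 0 else (if any (λ x → ⌊ (x N.* x) DivMod.% 7 Nₚ.≟ r ⌋) (List.upTo 7) then + 1 else -[1+ 0 ])) ≡ χ7 r
  table = by-cases _ refl refl refl refl refl refl refl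

-- Multiplicativity solved for χ(m), using χ(k)² = 1; it is decided on the 49 pairs of residues.
χ-* : ∀ k m → (k N.* m) DivMod.% 7 ≢ 0 → χ m ≡ χ (k N.* m) Z.* χ k
χ-* k m h = [ (λ z → ⊥-elim (h (DivMod.%-distribˡ-* k m 7 ∙ z))) , (λ e → e ∙ cong (λ t → χ7 t Z.* χ k) (sym (DivMod.%-distribˡ-* k m 7))) ]′
  (table (DivMod.m%n<n k 7) (DivMod.m%n<n m 7))
  where
  table : ∀ {a} → a < 7 → ∀ {b} → b < 7 → (a N.* b) DivMod.% 7 ≡ 0 ⊎ χ7 b ≡ χ7 ((a N.* b) DivMod.% 7) Z.* χ7 a
  table = from-yes (Nₚ.allUpTo? (λ a → Nₚ.allUpTo? (λ b → ((a N.* b) DivMod.% 7 Nₚ.≟ 0) ⊎-dec (χ7 b Zₚ.≟ χ7 ((a N.* b) DivMod.% 7) Z.* χ7 a)) 7) 7)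

module SquareFirst = Lambert (λ k m → χ k Z.* + (k N.* k))
module SquareSecond = Lambert (λ k m → χ k Z.* (+ m Z.* + m))

firstLambert secondLambert : Ser
firstLambert = SquareFirst.lambert
secondLambert = SquareSecond.lambert

firstRow secondRow : ℕ → Ser
firstRow i = fromℤ (χ (suc i) Z.* + (suc i N.* suc i)) * (X^ (suc i) * geometric (suc i))
secondRow i = fromℤ (χ (suc i)) * cubicPole (suc i)

firstLambert-tends : Tends (λ n → sumₛ n firstRow) firstLambert
firstLambert-tends = SquareFirst.lambert-rows firstRow (λ i N → ≈[]-trans (≋⇒≈[] (sumₛ-*ˡ N (fromℤ (χ (suc i) Z.* + (suc i N.* suc i))) (λ j → X^ (suc i N.* suc j))))
  (≈[]-* ≈[]-refl (geometric-row i N)))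

secondLambert-tends : Tends (λ n → sumₛ n secondRow) secondLambert
secondLambert-tends = SquareSecond.lambert-rows secondRow (λ i N → ≈[]-trans (≋⇒≈[] (sumₛ-cong N (λ j _ → ≋-sym (term-scale (χ (suc i)) (+ suc j Z.* + suc j) (suc i N.* suc j)))
    ⟫ sumₛ-*ˡ N (fromℤ (χ (suc i))) (λ j → term⟨ + suc j Z.* + suc j , suc i N.* suc j ⟩)))
  (≈[]-* ≈[]-refl (cubic-row i N)))

section-firstLambert-0 : section 0 firstLambert ≋ firstLambert
section-firstLambert-0 = lambert-section-0 (λ k m → χ k Z.* + (k N.* k))
  (λ i m → cong (λ r → χ7 r Z.* + (suc (6 N.+ i N.* 7) N.* suc (6 N.+ i N.* 7))) (DivMod.m*n%n≡0 (suc i) 7)) (λ k j → refl)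

-- Exchanging k and m turns the coefficient χ(k) m² into χ(m) k² up to χ(k) χ(m), and this product
-- is the constant χ(r) as long as km ≡ r is prime to 7.
section-firstLambert : ∀ r → r < 7 → r ≢ 0 → section r firstLambert ≋ fromℤ (χ7 r) * section r secondLambert
section-firstLambert r l r≢0 = HasSum-unique _≟ₚ_ (HasSum-section r SquareFirst.HasSum-lambert)
  (reindex (bijection swap swap (λ _ → refl) (λ _ → refl) (λ { (i , j) → agree i j })) (HasSum-*ˡ (fromℤ (χ7 r)) (HasSum-section r SquareSecond.HasSum-lambert)))
  where
  swap : Pairs → Pairs
  swap (i , j) = j , i
  agree : ∀ i j → fromℤ (χ7 r) * section r (SquareSecond.lambertTerm (i , j)) ≋ section r (SquareFirst.lambertTerm (j , i))
  agree i j = [ hit , miss ]′ (toSum (r Nₚ.≟ (suc i N.* suc j) DivMod.% 7))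
    where
    split : ∀ x → section r term⟨ x , suc i N.* suc j ⟩ ≋ section r term⟨ x , (suc i N.* suc j) DivMod.% 7 N.+ (suc i N.* suc j) DivMod./ 7 N.* 7 ⟩
    split x = section-cong r (term-cong {x} refl (DivMod.m≡m%n+[m/n]*n (suc i N.* suc j) 7))
    coefficient : r ≡ (suc i N.* suc j) DivMod.% 7 → χ7 r Z.* (χ (suc i) Z.* (+ suc j Z.* + suc j)) ≡ χ (suc j) Z.* + (suc j N.* suc j)
    coefficient e = sym (Zₚ.*-assoc (χ7 r) (χ (suc i)) _) ∙ cong₂ Z._*_
      (cong (λ t → χ7 t Z.* χ (suc i)) e ∙ sym (χ-* (suc i) (suc j) (λ z → r≢0 (e ∙ z)))) (sym (Zₚ.pos-* (suc j) (suc j)))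
    hit : r ≡ (suc i N.* suc j) DivMod.% 7 → fromℤ (χ7 r) * section r (SquareSecond.lambertTerm (i , j)) ≋ section r (SquareFirst.lambertTerm (j , i))
    hit e = ≋-sym (section-fromℤ* r (χ7 r) (SquareSecond.lambertTerm (i , j))) ⟫ section-cong r
      (term-scale (χ7 r) (χ (suc i) Z.* (+ suc j Z.* + suc j)) (suc i N.* suc j) ⟫ term-cong (coefficient e) (Nₚ.*-comm (suc i) (suc j)))
    miss : r ≢ (suc i N.* suc j) DivMod.% 7 → fromℤ (χ7 r) * section r (SquareSecond.lambertTerm (i , j)) ≋ section r (SquareFirst.lambertTerm (j , i))
    miss h = *-congˡ (vanish (χ (suc i) Z.* (+ suc j Z.* + suc j))) ⟫ zeroʳ _ ⟫ ≋-sym (section-cong r (term-cong {χ (suc j) Z.* + (suc j N.* suc j)} refl (Nₚ.*-comm (suc j) (suc i))) ⟫ vanish (χ (suc j) Z.* + (suc j N.* suc j)))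
      where
      vanish : ∀ x → section r term⟨ x , suc i N.* suc j ⟩ ≋ 0#
      vanish x = split x ⟫ section-term-≢ r _ x ((suc i N.* suc j) DivMod./ 7) l (DivMod.m%n<n (suc i N.* suc j) 7) h

-- The coefficients at n and 7n agree, so by strong induction each coefficient is traced back to
-- index 0 or to an index prime to 7.
section-fixed : ∀ {f} → at f 0 ≡ 0ℚ → section 0 f ≋ f → (∀ r → r < 7 → r ≢ 0 → section r f ≋ 0#) → f ≋ 0#
section-fixed {f} f0 fixed others = coeffs (<-rec (λ n → at f n ≡ 0ℚ) go)
  where
  step : ∀ r m → r < 7 → (∀ {k} → k < r N.+ m N.* 7 → at f k ≡ 0ℚ) → at f (r N.+ m N.* 7) ≡ 0ℚ
  step zero zero l ih = f0
  step zero (suc m) l ih = coeff fixed (suc m) ∙ ih (Nₚ.m<m*n (suc m) 7 (s≤s (s≤s z≤n)))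
  step (suc r) m l ih = coeff (others (suc r) l (λ ())) m
  go : ∀ n → (∀ {k} → k < n → at f k ≡ 0ℚ) → at f n ≡ 0ℚ
  go n ih = cong (at f) e ∙ step (n DivMod.% 7) (n DivMod./ 7) (DivMod.m%n<n n 7) (λ l → ih (subst (_ <_) (sym e) l))
    where e = DivMod.m≡m%n+[m/n]*n n 7

-- The three theta functions with base q⁷ and the values of the Lambert series

module Θ1 = Theta 1 6 6 refl
module Θ2 = Theta 2 5 6 refl
module Θ3 = Theta 3 4 6 refl

theta1 theta2 theta3 : Ser
theta1 = Θ1.theta (power 0)
theta2 = Θ2.theta (power 0)
theta3 = Θ3.theta (power 0)

Monic-theta1 : Monic theta1
Monic-theta1 = monic (sym (upto (Θ1.theta-product 1 1 Nₚ.≤-refl) 0 (s≤s z≤n)))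

Monic-theta2 : Monic theta2
Monic-theta2 = monic (sym (upto (Θ2.theta-product 1 1 Nₚ.≤-refl) 0 (s≤s z≤n)))

Monic-theta3 : Monic theta3
Monic-theta3 = monic (sym (upto (Θ3.theta-product 1 1 Nₚ.≤-refl) 0 (s≤s z≤n)))

theta-flip : ∀ r r′ b′ eq eq′ → Theta.theta r r′ b′ eq (λ _ → + 1) ≋ Theta.theta r′ r b′ eq′ (λ _ → + 1)
theta-flip r r′ b′ eq eq′ = HasSum-unique Zₚ._≟_
  (reindex (bijection Z.-_ Z.-_ Zₚ.neg-involutive Zₚ.neg-involutive (λ s → term-cong (cong (Z._* + 1) (sym (sign-neg s))) (exponents s))) (Theta.HasSum-theta r r′ b′ eq (λ _ → + 1)))
  (Theta.HasSum-theta r′ r b′ eq′ (λ _ → + 1))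
  where
  exponents : ∀ s → exponent r r′ s ≡ exponent r′ r (Z.- s)
  exponents s = +-injective2 (exponent-ℤ r r′ s ∙ solveℤ 3 (λ s r r′ → nat 2 :* s :* r :+ (r :+ r′) :* (s :* s :- s) , nat 2 :* (:- s) :* r′ :+ (r′ :+ r) :* ((:- s) :* (:- s) :- (:- s))) (s ∷ + r ∷ + r′ ∷ [])
    ∙ sym (exponent-ℤ r′ r (Z.- s)))

-- The residues ±1, ±2, ±3 and 0 modulo 7 exhaust the factors of (q;q)_∞. Each theta function brings
-- its own copy of the class 0, so two copies of E are left over.
theta-triple : theta1 * (theta2 * theta3) ≋ E ^ 2 * poch 0
theta-triple = Tends-unique
  (Tends-* Θ1.theta-product (Tends-* Θ2.theta-product Θ3.theta-product))
  (Tends-cong (λ m → ≋-sym (regroup m)) (Tends-* (Tends-^ 2 (poch-tends 6)) (Tends-sub (N._* 7) (λ n → Nₚ.m≤m*n n 7) (poch-tends 0))))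
  where
  module B1 = TripleProduct.WithBase ℚ-ring 0
  module B7 = TripleProduct.WithBase ℚ-ring 6
  pieces : ℕ → Ser
  pieces m = B7.qfac m * (Θ1.zFactors m * (Θ1.wFactors m * (Θ2.zFactors m * (Θ2.wFactors m * (Θ3.zFactors m * Θ3.wFactors m)))))
  factor : ∀ n {e} → n ≡ e → 1# - B1.Q n ≋ 1# - X^ e
  factor n refl = +-congˡ (-‿cong (B1.Q≋X^ n ⟫ ≋-reflexive (cong X^ (Nₚ.*-identityʳ n))))
  whole : ∀ m → B1.qfac (m N.* 7) ≋ pieces m
  whole zero = solve 0 (:1 , :1 :* (:1 :* (:1 :* (:1 :* (:1 :* (:1 :* :1)))))) []
  whole (suc m) = *-cong (*-cong (*-cong (*-cong (*-cong (*-cong (*-cong (whole m) (factor _ refl)) (factor _ refl)) (factor _ refl)) (factor _ refl)) (factor _ refl)) (factor _ refl))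
      (+-congˡ (-‿cong (B1.Q≋X^ (suc m N.* 7) ⟫ ≋-reflexive (cong X^ (Nₚ.*-identityʳ (suc m N.* 7))) ⟫ ≋-sym (B7.Q≋X^ (suc m)))))
    ⟫ order (B7.qfac m) (Θ1.zFactors m) (Θ1.wFactors m) (Θ2.zFactors m) (Θ2.wFactors m) (Θ3.zFactors m) (Θ3.wFactors m) _ _ _ _ _ _ _
    where
    order : ∀ q a b c d e f a′ c′ e′ f′ d′ b′ q′ → ((((((q * (a * (b * (c * (d * (e * f)))))) * a′) * c′) * e′) * f′) * d′) * b′ * q′ ≋
            (q * q′) * ((a * a′) * ((b * b′) * ((c * c′) * ((d * d′) * ((e * e′) * (f * f′))))))
    order q a b c d e f a′ c′ e′ f′ d′ b′ q′ = solve 14 (λ q a b c d e f a′ c′ e′ f′ d′ b′ q′ →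
      ((((((q :* (a :* (b :* (c :* (d :* (e :* f)))))) :* a′) :* c′) :* e′) :* f′) :* d′) :* b′ :* q′ ,
      (q :* q′) :* ((a :* a′) :* ((b :* b′) :* ((c :* c′) :* ((d :* d′) :* ((e :* e′) :* (f :* f′)))))))
      (q ∷ a ∷ b ∷ c ∷ d ∷ e ∷ f ∷ a′ ∷ c′ ∷ e′ ∷ f′ ∷ d′ ∷ b′ ∷ q′ ∷ [])
  regroup : ∀ m → B7.qfac m * (Θ1.zFactors m * Θ1.wFactors m) * (B7.qfac m * (Θ2.zFactors m * Θ2.wFactors m) * (B7.qfac m * (Θ3.zFactors m * Θ3.wFactors m))) ≋ B7.qfac m ^ 2 * B1.qfac (m N.* 7)
  regroup m = solve 7 (λ q a b c d e f → q :* (a :* b) :* (q :* (c :* d) :* (q :* (e :* f))) , q :^ 2 :* (q :* (a :* (b :* (c :* (d :* (e :* f)))))))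
      (B7.qfac m ∷ Θ1.zFactors m ∷ Θ1.wFactors m ∷ Θ2.zFactors m ∷ Θ2.wFactors m ∷ Θ3.zFactors m ∷ Θ3.wFactors m ∷ [])
    ⟫ *-congˡ (≋-sym (whole m))

module Poles1 = LogDerivative 0 5 6 refl
module Poles2 = LogDerivative 1 4 6 refl
module Poles3 = LogDerivative 2 3 6 refl

-- Doubling modulo 7 and the symmetry r ↦ 7 - r take 1 to 2, 2 to 3 and 3 to 1, so the three
-- evaluations form a cycle.
poleSum-weierstrass1 : theta1 ^ 4 * Poles1.poleSum ≋ - (E ^ 9 * (X^ 1 * theta2))
poleSum-weierstrass1 = ≋-sym Poles1.thirdLog-theta ⟫ Weierstrass.weierstrass 0 5

poleSum-weierstrass2 : theta2 ^ 4 * Poles2.poleSum ≋ - (E ^ 9 * (X^ 2 * theta3))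
poleSum-weierstrass2 = ≋-sym Poles2.thirdLog-theta ⟫ Weierstrass.weierstrass 1 3 ⟫ -‿cong (*-congˡ (*-congˡ (theta-flip 4 3 6 refl refl)))

poleSum-weierstrass3 : theta3 ^ 4 * Poles3.poleSum ≋ - (E ^ 9 * (X^ 3 * theta1))
poleSum-weierstrass3 = ≋-sym Poles3.thirdLog-theta ⟫ Weierstrass.weierstrass 2 1 ⟫ -‿cong (*-congˡ (*-congˡ (theta-flip 6 1 6 refl refl)))

-- Eliminates the theta quotients u/t = a/e and v/u = -b/e: the value of cp is -e⁷ x (u/t)³ (v/u).
pole-value : ∀ {t u v a b e x c p} → Monic t → Monic u → Monic e → t * a ≋ e * u → u * b ≋ - (e * v) →
             t ^ 4 * p ≋ - (e ^ 9 * (x * u)) → t * (u * v) ≋ e ^ 2 * c → c * p ≋ x * (e ^ 3 * (a ^ 3 * b))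
pole-value {t} {u} {v} {a} {b} {e} {x} {c} {p} t0 u0 e0 ta ub tp tuv = Monic-cancel (Monic-* (Monic-^ 2 e0) (Monic-* (Monic-^ 4 t0) u0)) (solve 5 (λ t u e c p → (e :^ 2 :* (t :^ 4 :* u)) :* (c :* p) , (e :^ 2 :* c) :* u :* (t :^ 4 :* p)) (t ∷ u ∷ e ∷ c ∷ p ∷ [])
  ⟫ *-cong (*-congʳ (≋-sym tuv)) tp ⟫ solve 5 (λ t u v e x → (t :* (u :* v)) :* u :* (:- (e :^ 9 :* (x :* u))) , e :^ 5 :* x :* t :* ((e :* u) :^ 3 :* (:- (e :* v)))) (t ∷ u ∷ v ∷ e ∷ x ∷ [])
    ⟫ *-congˡ (*-cong (^-congˡ 3 (≋-sym ta)) (≋-sym ub))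
      ⟫ solve 6 (λ t u a b e x → e :^ 5 :* x :* t :* ((t :* a) :^ 3 :* (u :* b)) , (e :^ 2 :* (t :^ 4 :* u)) :* (x :* (e :^ 3 :* (a :^ 3 :* b)))) (t ∷ u ∷ a ∷ b ∷ e ∷ x ∷ []))

quintuple-A : theta1 * A ≋ E * theta2
quintuple-A = Pentagonal.quintuple-0
quintuple-B : theta2 * B ≋ - (E * theta3)
quintuple-B = Pentagonal.quintuple-1 ⟫ -‿cong (*-congˡ (theta-flip 4 3 6 refl refl))
quintuple-D : theta3 * D ≋ E * theta1
quintuple-D = Pentagonal.quintuple-5 ⟫ *-congˡ (theta-flip 6 1 6 refl refl)
negated : ∀ {t a e u} → t * a ≋ e * u → t * - a ≋ - (e * u)
negated {t} {a} h = solve 2 (λ t a → t :* (:- a) , :- (t :* a)) (t ∷ a ∷ []) ⟫ -‿cong h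
negated′ : ∀ {t a e u} → t * a ≋ - (e * u) → t * - a ≋ e * u
negated′ {t} {a} {e} {u} h = solve 2 (λ t a → t :* (:- a) , :- (t :* a)) (t ∷ a ∷ []) ⟫ -‿cong h ⟫ solve 2 (λ e u → :- (:- (e :* u)) , e :* u) (e ∷ u ∷ [])
rotate : ∀ {t u v} {s : Ser} → t * (u * v) ≋ s → u * (v * t) ≋ s
rotate {t} {u} {v} h = solve 3 (λ t u v → u :* (v :* t) , t :* (u :* v)) (t ∷ u ∷ v ∷ []) ⟫ h

poleSum-value1 : poch 0 * Poles1.poleSum ≋ X^ 1 * (E ^ 3 * (A ^ 3 * B))
poleSum-value1 = pole-value Monic-theta1 Monic-theta2 (Monic-poch 6) quintuple-A quintuple-B poleSum-weierstrass1 theta-triple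

poleSum-value2 : poch 0 * Poles2.poleSum ≋ X^ 2 * (E ^ 3 * ((- B) ^ 3 * - D))
poleSum-value2 = pole-value Monic-theta2 Monic-theta3 (Monic-poch 6) (negated′ quintuple-B) (negated quintuple-D) poleSum-weierstrass2 (rotate theta-triple)

poleSum-value3 : poch 0 * Poles3.poleSum ≋ X^ 3 * (E ^ 3 * (D ^ 3 * - A))
poleSum-value3 = pole-value Monic-theta3 Monic-theta1 (Monic-poch 6) quintuple-D (negated quintuple-A) poleSum-weierstrass3 (rotate (rotate theta-triple))

-- `poleSum` for r is the class of 7 - r minus the class of r. The squares 1, 2, 4 modulo 7 count
-- positively, whence the signs.
secondLambert-poles : secondLambert ≋ Poles3.poleSum - Poles1.poleSum - Poles2.poleSum
secondLambert-poles = Tends-unique (Tends-sub (N._* 7) (λ n → Nₚ.m≤m*n n 7) secondLambert-tends)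
  (Tends-cong (λ n → ≋-sym (classes n)) (Tends-- (Tends-- poles3 poles1) poles2))
  where
  Tends-- : ∀ {u v : ℕ → Ser} {s t} → Tends u s → Tends v t → Tends (λ n → u n - v n) (s - t)
  Tends-- p q N M l = ≈[]-+ (p N M l) (≈[]-neg (q N M l))
  small : ∀ a i → i ≤ suc a N.+ i N.* 7
  small a i = Nₚ.≤-trans (Nₚ.m≤m*n i 7) (Nₚ.m≤n+m _ (suc a))
  poles : ∀ a b → Tends (λ n → sumₛ n (λ i → cubicPole (suc a N.+ i N.* 7)) - sumₛ n (λ i → cubicPole (suc b N.+ i N.* 7)))
                        (sum<-limit (λ i → cubicPole (suc a N.+ i N.* 7)) - sum<-limit (λ i → cubicPole (suc b N.+ i N.* 7)))
  poles a b = Tends-- (sum<-tends _ (λ i → ≈[]-mono (small a i) (Poles1.cubicPole-vanishes _))) (sum<-tends _ (λ i → ≈[]-mono (small b i) (Poles1.cubicPole-vanishes _)))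
  poles1 = poles 5 0
  poles2 = poles 4 1
  poles3 = poles 3 2
  column : ℕ → ℕ → Ser
  column c n = sumₛ n (λ i → cubicPole (suc c N.+ i N.* 7))
  row : ∀ c i → secondRow (c N.+ i N.* 7) ≋ fromℤ (χ7 (suc c DivMod.% 7)) * cubicPole (suc c N.+ i N.* 7)
  row c i = *-congʳ (≋-reflexive (cong (λ r → fromℤ (χ7 r)) (DivMod.[m+kn]%n≡m%n (suc c) i 7)))
  classes : ∀ n → sumₛ (n N.* 7) secondRow ≋ ((column 3 n - column 2 n) - (column 5 n - column 0 n)) - (column 4 n - column 1 n)
  classes zero = solve 0 (nat 0 , ((nat 0 :- nat 0) :- (nat 0 :- nat 0)) :- (nat 0 :- nat 0)) []
  classes (suc n) = +-cong (+-cong (+-cong (+-cong (+-cong (+-cong (+-cong (classes n) (row 0 n)) (row 1 n)) (row 2 n)) (row 3 n)) (row 4 n)) (row 5 n)) (row 6 n)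
    ⟫ order (column 0 n) (column 1 n) (column 2 n) (column 3 n) (column 4 n) (column 5 n) (pole 0) (pole 1) (pole 2) (pole 3) (pole 4) (pole 5) (pole 6)
    where
    pole : ℕ → Ser
    pole c = cubicPole (suc c N.+ n N.* 7)
    order : ∀ s0 s1 s2 s3 s4 s5 p0 p1 p2 p3 p4 p5 p6 →
      ((((((((s3 - s2) - (s5 - s0)) - (s4 - s1)) + fromℤ (+ 1) * p0) + fromℤ (+ 1) * p1) + fromℤ -[1+ 0 ] * p2) + fromℤ (+ 1) * p3) + fromℤ -[1+ 0 ] * p4) + fromℤ -[1+ 0 ] * p5 + fromℤ (+ 0) * p6
      ≋ (((s3 + p3) - (s2 + p2)) - ((s5 + p5) - (s0 + p0))) - ((s4 + p4) - (s1 + p1))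
    order s0 s1 s2 s3 s4 s5 p0 p1 p2 p3 p4 p5 p6 = solve 13 (λ s0 s1 s2 s3 s4 s5 p0 p1 p2 p3 p4 p5 p6 →
      ((((((((s3 :- s2) :- (s5 :- s0)) :- (s4 :- s1)) :+ nat 1 :* p0) :+ nat 1 :* p1) :+ con -[1+ 0 ] :* p2) :+ nat 1 :* p3) :+ con -[1+ 0 ] :* p4) :+ con -[1+ 0 ] :* p5 :+ nat 0 :* p6 ,
      (((s3 :+ p3) :- (s2 :+ p2)) :- ((s5 :+ p5) :- (s0 :+ p0))) :- ((s4 :+ p4) :- (s1 :+ p1)))
      (s0 ∷ s1 ∷ s2 ∷ s3 ∷ s4 ∷ s5 ∷ p0 ∷ p1 ∷ p2 ∷ p3 ∷ p4 ∷ p5 ∷ p6 ∷ [])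

-- The three values add up to a multiple of the Klein quartic form, which is `M` up to a multiple of
-- q E⁴; the term with 8 is this correction.
secondLambert-value : poch 0 * secondLambert ≋ X^ 1 * (E ^ 3 * poch 0 ^ 4) + fromℤ (+ 8) * (X^ 1 ^ 2 * E ^ 7)
secondLambert-value = *-congˡ secondLambert-poles ⟫ solve 4 (λ c p q r → c :* (r :- p :- q) , c :* r :- c :* p :- c :* q) (poch 0 ∷ Poles1.poleSum ∷ Poles2.poleSum ∷ Poles3.poleSum ∷ [])
  ⟫ +-cong (+-cong (poleSum-value3 ⟫ *-congʳ (≋-sym (X^-* 1 3))) (-‿cong poleSum-value1)) (-‿cong (poleSum-value2 ⟫ *-congʳ (≋-sym (X^-* 1 2))))
    ⟫ solve 5 (λ x a b d e → x :^ 3 :* (e :^ 3 :* (d :^ 3 :* (:- a))) :- x :* (e :^ 3 :* (a :^ 3 :* b)) :- x :^ 2 :* (e :^ 3 :* ((:- b) :^ 3 :* (:- d))) ,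
        x :* (e :^ 3 :* (:- (a :^ 3 :* b :+ x :* b :^ 3 :* d :+ x :^ 2 :* d :^ 3 :* a :+ nat 8 :* x :* e :^ 4))) :+ nat 8 :* (x :^ 2 :* e :^ 7)) (X^ 1 ∷ A ∷ B ∷ D ∷ E ∷ [])
      ⟫ +-congʳ (*-congˡ (*-congˡ root-value))

second≋ : secondEisenstein ≋ secondLambert * expand (poch 0)
second≋ = Monic-cancel (Monic-poch 0) (solve 6 (λ u x y v w m → u :* (nat 8 :* (y :* (v :* w)) :+ x :* (u :^ 3 :* m)) , nat 8 :* (y :* ((u :* v) :* w)) :+ x :* (u :^ 4 :* m)) (poch 0 ∷ X^ 1 ∷ X^ 2 ∷ cofactor ∷ expand E ∷ expand M ∷ [])
  ⟫ +-cong (*-congˡ (*-cong (≋-sym (X^-* 1 2)) eighth)) (*-congˡ (*-congˡ fourth))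
    ⟫ solve 3 (λ u x e → nat 8 :* (x :^ 2 :* e :^ 8) :+ x :* (u :^ 4 :* e :^ 4) , (x :* (e :^ 3 :* u :^ 4) :+ nat 8 :* (x :^ 2 :* e :^ 7)) :* e) (poch 0 ∷ X^ 1 ∷ E ∷ [])
      ⟫ *-cong (≋-sym secondLambert-value) (≋-sym expand-poch) ⟫ *-assoc (poch 0) secondLambert (expand (poch 0)))
  where
  eighth : (poch 0 * cofactor) * expand E ≋ E ^ 8
  eighth = *-congʳ norm-factorisation ⟫ ≋-sym (expand-* N E) ⟫ expand-cong norm-value ⟫ expand-^ (poch 0) 8 ⟫ ^-congˡ 8 expand-poch
  fourth : expand M ≋ E ^ 4
  fourth = expand-cong root-value ⟫ expand-^ (poch 0) 4 ⟫ ^-congˡ 4 expand-poch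

first≋ : firstEisenstein ≋ - (fromℤ (+ 8) * poch 0 ^ 7 + fromℤ (+ 49) * (X^ 1 * (poch 0 ^ 3 * E ^ 4)))
first≋ = -‿cong (+-congˡ (*-congˡ (*-congˡ (*-congˡ (expand-cong root-value ⟫ expand-^ (poch 0) 4 ⟫ ^-congˡ 4 expand-poch)))))

-- The expected value of 7 times `firstLambert`. Its constant term vanishes, because
-- `firstEisenstein` begins with -8.
G : Ser
G = fromℤ (+ 8) + firstEisenstein * E ⁻¹

G-E : G * E ≋ fromℤ (+ 8) * E + firstEisenstein
G-E = solve 3 (λ e f i → (nat 8 :+ f :* i) :* e , nat 8 :* e :+ f :* (e :* i)) (E ∷ firstEisenstein ∷ E ⁻¹ ∷ [])
  ⟫ +-congˡ (*-congˡ (⁻¹-inverse (Monic-poch 6)) ⟫ *-identityʳ _)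

section-G : ∀ r → r < 7 → poch 0 * section r G ≋ section r (fromℤ (+ 8) * E) + section r firstEisenstein
section-G r l = ≋-sym (section-expand-* r (poch 0) G l) ⟫ section-cong r (*-congʳ expand-poch ⟫ *-comm E G ⟫ G-E) ⟫ section-+ r (fromℤ (+ 8) * E) firstEisenstein

section-8E-0 : section 0 (fromℤ (+ 8) * E) ≋ fromℤ (+ 8) * poch 0
section-8E-0 = section-fromℤ* 0 (+ 8) E ⟫ *-congˡ (section-cong 0 (≋-sym expand-poch) ⟫ section-0-expand (poch 0))

section-8E-suc : ∀ r → suc r < 7 → section (suc r) (fromℤ (+ 8) * E) ≋ 0#
section-8E-suc r l = section-fromℤ* (suc r) (+ 8) E ⟫ *-congˡ (section-cong (suc r) (≋-sym expand-poch) ⟫ section-suc-expand r (poch 0) l) ⟫ zeroʳ _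

section-G-0 : section 0 G ≋ G
section-G-0 = Monic-cancel (Monic-* (Monic-poch 6) (Monic-poch 0)) (*-assoc E (poch 0) (section 0 G) ⟫ *-congˡ (section-G 0 (s≤s z≤n) ⟫ +-cong section-8E-0 (eisenstein-0 ⟫ -‿cong (+-congˡ (*-congˡ root-value))))
  ⟫ solve 4 (λ e u n x → e :* (nat 8 :* u :+ :- (nat 8 :* n :+ nat 49 :* x :* e :^ 3 :* u :^ 4)) , nat 8 :* (e :* u) :- (nat 8 :* (n :* e) :+ nat 49 :* (x :* (e :^ 4 :* u :^ 4)))) (E ∷ poch 0 ∷ N ∷ X^ 1 ∷ [])
    ⟫ +-congˡ (-‿cong (+-congʳ (*-congˡ norm-value)))
      ⟫ solve 3 (λ e u x → nat 8 :* (e :* u) :- (nat 8 :* u :^ 8 :+ nat 49 :* (x :* (e :^ 4 :* u :^ 4))) ,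
          u :* (nat 8 :* e :+ :- (nat 8 :* u :^ 7 :+ nat 49 :* (x :* (u :^ 3 :* e :^ 4))))) (E ∷ poch 0 ∷ X^ 1 ∷ [])
        ⟫ *-congˡ (+-congˡ (≋-sym first≋) ⟫ ≋-sym G-E) ⟫ solve 3 (λ u g e → u :* (g :* e) , e :* u :* g) (poch 0 ∷ G ∷ E ∷ []))

section-G-suc : ∀ r → suc r < 7 → ∀ z → section (suc r) firstEisenstein ≋ fromℤ z * section (suc r) secondEisenstein → section (suc r) G ≋ fromℤ z * section (suc r) secondLambert
section-G-suc r l z h = Monic-cancel (Monic-poch 0) (section-G (suc r) l ⟫ +-cong (section-8E-suc r l) h ⟫ +-identityˡ _
  ⟫ *-congˡ (section-cong (suc r) (second≋ ⟫ *-comm secondLambert (expand (poch 0))) ⟫ section-expand-* (suc r) (poch 0) secondLambert l)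
    ⟫ solve 3 (λ z u s → z :* (u :* s) , u :* (z :* s)) (fromℤ z ∷ poch 0 ∷ section (suc r) secondLambert ∷ []))

difference-section : ∀ r → r < 7 → r ≢ 0 → ∀ z → fromℤ (+ 7) * fromℤ (χ7 r) ≋ fromℤ z → section r G ≋ fromℤ z * section r secondLambert → section r (fromℤ (+ 7) * firstLambert - G) ≋ 0#
difference-section r l r≢0 z e h = section-+ r (fromℤ (+ 7) * firstLambert) (- G) ⟫ +-cong (section-fromℤ* r (+ 7) firstLambert ⟫ *-congˡ (section-firstLambert r l r≢0) ⟫ ≋-sym (*-assoc _ _ _) ⟫ *-congʳ e)
          (section-neg r G ⟫ -‿cong h)
  ⟫ -‿inverseʳ _

firstLambert-value : fromℤ (+ 7) * firstLambert * E ≋ fromℤ (+ 8) * E - (fromℤ (+ 8) * poch 0 ^ 7 + fromℤ (+ 49) * (X^ 1 * (poch 0 ^ 3 * E ^ 4)))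
firstLambert-value = *-congʳ equal ⟫ G-E ⟫ +-congˡ first≋
  where
  cases : ∀ r → r < 7 → r ≢ 0 → section r (fromℤ (+ 7) * firstLambert - G) ≋ 0#
  cases = by-cases _ (λ n → ⊥-elim (n refl))
    (λ n → difference-section 1 1< n (+ 7) plus (section-G-suc 0 1< (+ 7) eisenstein-1))
    (λ n → difference-section 2 2< n (+ 7) plus (section-G-suc 1 2< (+ 7) eisenstein-2))
    (λ n → difference-section 3 3< n -[1+ 6 ] minus (section-G-suc 2 3< -[1+ 6 ] eisenstein-3))
    (λ n → difference-section 4 4< n (+ 7) plus (section-G-suc 3 4< (+ 7) eisenstein-4))
    (λ n → difference-section 5 5< n -[1+ 6 ] minus (section-G-suc 4 5< -[1+ 6 ] eisenstein-5))
    (λ n → difference-section 6 6< n -[1+ 6 ] minus (section-G-suc 5 6< -[1+ 6 ] eisenstein-6))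
    where
    1< = Nₚ.<ᵇ⇒< 1 7 tt
    2< = Nₚ.<ᵇ⇒< 2 7 tt
    3< = Nₚ.<ᵇ⇒< 3 7 tt
    4< = Nₚ.<ᵇ⇒< 4 7 tt
    5< = Nₚ.<ᵇ⇒< 5 7 tt
    6< = Nₚ.<ᵇ⇒< 6 7 tt
    plus = solve 0 (nat 7 :* nat 1 , nat 7) []
    minus = solve 0 (nat 7 :* con -[1+ 0 ] , con -[1+ 6 ]) []
  leading-0 : at (fromℤ (+ 7) * firstLambert - G) 0 ≡ 0ℚ
  leading-0 = upto {fromℤ (+ 7) * firstLambert - G} {1} {0#} (≈[]-trans (≈[]-+ (≈[]-* ≈[]-refl (≈[]-sym (firstLambert-tends 1 1 Nₚ.≤-refl))) ≈[]-refl) (below λ { zero _ → refl ; (suc n) (s≤s ()) })) 0 (s≤s z≤n)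
  fixed : section 0 (fromℤ (+ 7) * firstLambert - G) ≋ fromℤ (+ 7) * firstLambert - G
  fixed = section-+ 0 (fromℤ (+ 7) * firstLambert) (- G) ⟫ +-cong (section-fromℤ* 0 (+ 7) firstLambert ⟫ *-congˡ section-firstLambert-0) (section-neg 0 G ⟫ -‿cong section-G-0)
  equal : fromℤ (+ 7) * firstLambert ≋ G
  equal = solve 2 (λ a g → a , (a :- g) :+ g) (fromℤ (+ 7) * firstLambert ∷ G ∷ []) ⟫ +-congʳ (section-fixed leading-0 fixed cases) ⟫ +-identityˡ G

-- Lattice sums

weightedSum : (ℕ → ℤ) → ∀ {n} → Vec ℤ n → ℤ
weightedSum a [] = + 0
weightedSum a (s ∷ v) = s Z.* a 0 Z.+ weightedSum (λ k → a (suc k)) v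

energy : (ℕ → ℕ) → (ℕ → ℕ) → ∀ {n} → Vec ℤ n → ℕ
energy r r′ [] = 0
energy r r′ (s ∷ v) = exponent (r 0) (r′ 0) s N.+ energy (λ k → r (suc k)) (λ k → r′ (suc k)) v

one-^ : ∀ n → 1ℚ ℚSolver.^ n ≡ 1ℚ
one-^ zero = refl
one-^ (suc n) = ℚₚ.*-identityˡ _ ∙ one-^ n

-- Parametrised by the admissible test functions: all functions for sums over plain lattices, the
-- cyclotomic ones for the twisted sum.
module LatticeProducts (Φ : (ℤ² → ℚ) → Set) (translate : ∀ φ g → Φ φ → Φ (λ h → φ (g ⊞ h))) where
  module P = Pairing ℚ-ring Φ translate
  open P using (pairₛ; pairₛ-cong; pairₛ-cong[]; pairₛ-X^; pairₛ-+; pairₛ-neg; pairₛ-monomial; HasSum-pair; monomial; monomial-*; monomial-^; monomial-cong; monomial-1; module L; module LSum)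
  open LSum using () renaming (productSeq to seqProduct; productFamily to familyProduct) public
  module BaseL (b′ : ℕ) = TripleProduct.WithBase P.groupRing b′
  module BaseQ (b′ : ℕ) = TripleProduct.WithBase ℚ-ring b′

  tested-≋ : ∀ {f g} → (∀ φ → Φ φ → pairₛ φ f ≋ pairₛ φ g) → f L.≋ g
  tested-≋ h = L.coeffs λ n → P.tested λ φ Φφ → coeff (h φ Φφ) n

  seqProduct-cong : ∀ {a b : ℕ → L.Ser} n → (∀ k → a k L.≋ b k) → seqProduct a n L.≋ seqProduct b n
  seqProduct-cong zero h = L.≋-refl
  seqProduct-cong (suc n) h = L.*-cong (h 0) (seqProduct-cong n (λ k → h (suc k)))

  seqProduct-* : ∀ (a b : ℕ → L.Ser) n → seqProduct (λ k → a k L.* b k) n L.≋ seqProduct a n L.* seqProduct b n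
  seqProduct-* a b zero = L.≋-sym (L.*-identityˡ L.1#)
  seqProduct-* a b (suc n) = L.*-congˡ (seqProduct-* (λ k → a (suc k)) (λ k → b (suc k)) n)
    L.⟫ L.solve 4 (λ a b c d → (a :* b) :* (c :* d) , (a :* c) :* (b :* d)) (a 0 ∷ b 0 ∷ seqProduct (λ k → a (suc k)) n ∷ seqProduct (λ k → b (suc k)) n ∷ [])

  seqProduct-const : ∀ (a : L.Ser) n → seqProduct (λ _ → a) n L.≋ a L.^ n
  seqProduct-const a zero = L.≋-refl
  seqProduct-const a (suc n) = L.*-congˡ (seqProduct-const a n)

  seqProduct-tends : ∀ {u : ℕ → ℕ → L.Ser} {s : ℕ → L.Ser} n → (∀ k → L.Tends (u k) (s k)) → L.Tends (λ M → seqProduct (λ k → u k M) n) (seqProduct s n)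
  seqProduct-tends zero h N M l = L.≈[]-refl
  seqProduct-tends (suc n) h N M l = L.≈[]-* (h 0 N M l) (seqProduct-tends n (λ k → h (suc k)) N M l)

  module _ {φ : ℤ² → ℚ} (Φφ : Φ φ) where
    pair-qfac-^ : ∀ b′ m k f → pairₛ φ (BaseL.qfac b′ m L.^ k L.* f) ≋ BaseQ.qfac b′ m ^ k * pairₛ φ f
    pair-qfac-^ b′ m zero f = pairₛ-cong Φφ (L.*-identityˡ f) ⟫ ≋-sym (*-identityˡ _)
    pair-qfac-^ b′ m (suc k) f = pairₛ-cong Φφ (L.*-assoc (BaseL.qfac b′ m) _ f) ⟫ P.pairₛ-qfac Φφ b′ m _
      ⟫ *-congˡ (pair-qfac-^ b′ m k f) ⟫ ≋-sym (*-assoc (BaseQ.qfac b′ m) _ _)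

  product-monomial : ∀ (g : ℕ → ℤ²) (r r′ : ℕ → ℕ) b′ (eq : ∀ k → r k N.+ r′ k ≡ suc b′) {n} (v : Vec ℤ n) →
    familyProduct (λ k → P.MonomialTheta.term 1ℚ refl (g k) (r k) (r′ k) b′ (eq k)) v L.≋
    monomial 1ℚ (weightedSum (λ k → proj₁ (g k)) v , weightedSum (λ k → proj₂ (g k)) v) (energy r r′ v)
  product-monomial g r r′ b′ eq [] = L.≋-sym monomial-1
  product-monomial g r r′ b′ eq (s ∷ v) = L.*-cong (P.MonomialTheta.term-monomial 1ℚ refl (g 0) (r 0) (r′ 0) b′ (eq 0) s L.⟫ monomial-cong {g = s · g 0} {e = exponent (r 0) (r′ 0) s} (one-^ Z.∣ s ∣) refl refl)
      (product-monomial (λ k → g (suc k)) (λ k → r (suc k)) (λ k → r′ (suc k)) b′ (λ k → eq (suc k)) v)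
    L.⟫ monomial-* 1ℚ (s · g 0) (exponent (r 0) (r′ 0) s) 1ℚ _ _

  module Seven (g : ℕ → ℤ²) (r r′ : ℕ → ℕ) (b′ : ℕ) (eq : ∀ k → r k N.+ r′ k ≡ suc b′) where
    module T (k : ℕ) = P.MonomialTheta 1ℚ refl (g k) (r k) (r′ k) b′ (eq k)

    whole : L.Ser
    whole = seqProduct (λ k → T.theta k) 7

    HasSum-whole : (w : ℤ → ℤ → ℤ) → Φ (λ sn → ℚSolver.fromℤ (w (proj₁ sn) (proj₂ sn))) →
      HasSum (λ (v : Vec ℤ 7) → term⟨ w (weightedSum (λ k → proj₁ (g k)) v) (weightedSum (λ k → proj₂ (g k)) v) , energy r r′ v ⟩)
             (pairₛ (λ sn → ℚSolver.fromℤ (w (proj₁ sn) (proj₂ sn))) whole)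
    HasSum-whole w Φw = HasSum-cong (λ v → pairₛ-cong Φw (product-monomial g r r′ b′ eq v) ⟫ pairₛ-monomial Φw 1ℚ _ (energy r r′ v)
        ⟫ *-congʳ (≋-reflexive (cong constant (ℚₚ.*-identityˡ _)) ⟫ constant-fromℤ (w (weightedSum (λ k → proj₁ (g k)) v) (weightedSum (λ k → proj₂ (g k)) v))))
      ≋-refl (HasSum-pair Φw (LSum.HasSum-Vec Zₚ._≟_ 7 (λ k → T.HasSum-theta k)))

    productZ productW : ℕ → L.Ser
    productZ M = seqProduct (λ k → T.prodZ k M) 7
    productW M = seqProduct (λ k → T.prodW k M) 7

    whole-tends : L.Tends (λ M → BaseL.qfac b′ M L.^ 7 L.* (productZ M L.* productW M)) whole
    whole-tends = L.Tends-cong (λ M → seqProduct-* (λ _ → BaseL.qfac b′ M) (λ k → T.prodZ k M L.* T.prodW k M) 7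
        L.⟫ L.*-cong (seqProduct-const (BaseL.qfac b′ M) 7) (seqProduct-* (λ k → T.prodZ k M) (λ k → T.prodW k M) 7))
      (seqProduct-tends 7 (λ k → T.triple-product k))

  module SingleTheta (c : ℤ) (r r′ b′ : ℕ) (eq : r N.+ r′ ≡ suc b′) (c≢0 : c ≢ + 0) where
    module T = P.MonomialTheta 1ℚ refl (c , + 0) r r′ b′ eq

    -- As c is nonzero, the index 0 is the only one whose power of z meets the support of the
    -- weight, and its term is 1.
    pair-theta : (w : ℤ → ℤ → ℤ) → Φ (λ sn → ℚSolver.fromℤ (w (proj₁ sn) (proj₂ sn))) → w (+ 0) (+ 0) ≡ + 1 → (∀ s n → s ≢ + 0 → w s n ≡ + 0) →
                 pairₛ (λ sn → ℚSolver.fromℤ (w (proj₁ sn) (proj₂ sn))) T.theta ≋ 1#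
    pair-theta w Φw w0 w≢ = HasSum-unique Zₚ._≟_ sums (HasSum-1 Zₚ._≟_ (+ 0) (λ s s≢0 → *-congʳ (≋-reflexive (cong fromℤ (w≢ _ _ (nonzero s s≢0)))) ⟫ zeroˡ _))
        ⟫ *-congʳ (≋-reflexive (cong fromℤ (cong₂ w (Zₚ.*-zeroˡ c) refl ∙ w0)) ⟫ fromℤ-1) ⟫ *-identityˡ 1#
      where
      nonzero : ∀ s → s ≢ + 0 → s Z.* c ≢ + 0
      nonzero s s≢0 e = [ s≢0 , c≢0 ]′ (Zₚ.i*j≡0⇒i≡0∨j≡0 s e)
      sums : HasSum (λ s → term⟨ w (s Z.* c) (s Z.* + 0) , exponent r r′ s ⟩) (pairₛ (λ sn → ℚSolver.fromℤ (w (proj₁ sn) (proj₂ sn))) T.theta)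
      sums = HasSum-cong (λ s → pairₛ-cong Φw (T.term-monomial s) ⟫ pairₛ-monomial Φw (1ℚ ℚSolver.^ Z.∣ s ∣) (s · (c , + 0)) (exponent r r′ s)
          ⟫ *-congʳ (≋-reflexive (cong constant (cong (ℚ._* ℚSolver.fromℤ (w (s Z.* c) (s Z.* + 0))) (one-^ Z.∣ s ∣) ∙ ℚₚ.*-identityˡ _)) ⟫ constant-fromℤ (w (s Z.* c) (s Z.* + 0))))
        ≋-refl (HasSum-pair Φw T.HasSum-theta)

δ : ℤ → ℤ
δ s = if does (s Zₚ.≟ + 0) then + 1 else + 0

δ-≢ : ∀ s → s ≢ + 0 → δ s ≡ + 0
δ-≢ s h with s Zₚ.≟ + 0
... | yes e = contradiction e h
... | no _ = refl

module Laurent = LatticeProducts (λ _ → ⊤) (λ _ _ _ → tt)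

charge moment1 : Vec ℤ 7 → ℤ
charge = weightedSum (λ _ → + 1)
moment1 = weightedSum (λ k → + k)

constantTerm : ℤ² → ℚ
constantTerm sn = ℚSolver.fromℤ (δ (proj₁ sn))

module Frobenius where
  open Laurent
  open P using (pairₛ; pairₛ-cong; pairₛ-cong[]; module L)
  module F = Seven (λ _ → + 1 , + 0) (λ _ → 0) (λ _ → 1) 0 (λ _ → refl)

  latticeTheta : Ser
  latticeTheta = pairₛ constantTerm F.whole

  HasSum-latticeTheta : HasSum (λ v → term⟨ δ (charge v) , energy (λ _ → 0) (λ _ → 1) v ⟩) latticeTheta
  HasSum-latticeTheta = F.HasSum-whole (λ s _ → δ s) tt

  frobenius-theta : ∀ {C} → Tends (λ M → pairₛ constantTerm (F.productZ M L.* F.productW M)) C → poch 0 ^ 7 * C ≋ latticeTheta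
  frobenius-theta t = Tends-unique (Tends-* (Tends-^ 7 (poch-tends 0)) t)
    (Tends-cong (λ M → pair-qfac-^ tt 0 M 7 _) (λ N M l → pairₛ-cong[] tt (F.whole-tends N M l)))

module Cores where
  open Laurent
  open P using (pairₛ; pairₛ-cong; pairₛ-cong[]; monomial; module L)

  -- The offsets 0, ..., 6 of the seven theta functions with base q⁷. Taking the remainder extends
  -- them to all indices in such a way that both values always add up to 7.
  lower upper : ℕ → ℕ
  lower k = k DivMod.% 7
  upper k = 7 ∸ lower k

  module F = Seven (λ _ → + 1 , + 0) lower upper 6 (λ k → Nₚ.m+[n∸m]≡n (Nₚ.<⇒≤ (DivMod.m%n<n k 7)))
  module S = SingleTheta (+ 1) 0 1 0 refl (λ ())

  coreSeries : Ser
  coreSeries = pairₛ constantTerm F.whole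

  HasSum-cores : HasSum (λ v → term⟨ δ (charge v) , energy lower upper v ⟩) coreSeries
  HasSum-cores = F.HasSum-whole (λ s _ → δ s) tt

  shift : ∀ g e n e′ m → e N.+ n ≡ e′ N.+ m N.* 7 → L.1# L.+ monomial 1ℚ g e L.* BaseL.Q 0 n L.≋ L.1# L.+ monomial 1ℚ g e′ L.* BaseL.Q 6 m
  shift g e n e′ m h = L.+-congˡ (gather e (BaseL.Q≋X^ 0 n L.⟫ L.≋-reflexive (cong L.X^ (Nₚ.*-identityʳ n)))
      L.⟫ L.*-congˡ (L.≋-reflexive (cong L.X^ h)) L.⟫ L.≋-sym (gather e′ (BaseL.Q≋X^ 6 m)))
    where
    gather : ∀ e {q n} → q L.≋ L.X^ n → monomial 1ℚ g e L.* q L.≋ L.constant (P.single 1ℚ g) L.* L.X^ (e N.+ n)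
    gather e {q} {n} p = L.*-assoc _ (L.X^ e) q L.⟫ L.*-congˡ (L.*-congˡ p L.⟫ L.X^-+ e n)

  wholeZ : ∀ M → S.T.prodZ (M N.* 7) L.≋ F.productZ M
  wholeZ zero = L.≋-sym (seqProduct-const L.1# 7 L.⟫ L.solve 0 (:1 :^ 7 , :1) [])
  wholeZ (suc M) = L.*-cong (L.*-cong (L.*-cong (L.*-cong (L.*-cong (L.*-cong (L.*-cong (wholeZ M) (s 0)) (s 1)) (s 2)) (s 3)) (s 4)) (s 5)) (s 6)
    L.⟫ L.solve 8 (λ p a b c d e f g → ((((((p :* a) :* b) :* c) :* d) :* e) :* f) :* g , p :* (a :* (b :* (c :* (d :* (e :* (f :* (g :* :1))))))))
        (F.productZ M ∷ φ 0 ∷ φ 1 ∷ φ 2 ∷ φ 3 ∷ φ 4 ∷ φ 5 ∷ φ 6 ∷ [])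
      L.⟫ L.≋-sym (seqProduct-* (λ k → F.T.prodZ k M) φ 7)
    where
    φ : ℕ → L.Ser
    φ k = L.1# L.+ monomial 1ℚ (+ 1 , + 0) (lower k) L.* BaseL.Q 6 M
    s : ∀ k → L.1# L.+ monomial 1ℚ (+ 1 , + 0) 0 L.* BaseL.Q 0 (k N.+ M N.* 7) L.≋ L.1# L.+ monomial 1ℚ (+ 1 , + 0) k L.* BaseL.Q 6 M
    s k = shift (+ 1 , + 0) 0 (k N.+ M N.* 7) k M refl

  wholeW : ∀ M → S.T.prodW (M N.* 7) L.≋ F.productW M
  wholeW zero = L.≋-sym (seqProduct-const L.1# 7 L.⟫ L.solve 0 (:1 :^ 7 , :1) [])
  wholeW (suc M) = L.*-cong (L.*-cong (L.*-cong (L.*-cong (L.*-cong (L.*-cong (L.*-cong (wholeW M) (s 0)) (s 1)) (s 2)) (s 3)) (s 4)) (s 5)) (s 6)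
    L.⟫ L.solve 8 (λ p a b c d e f g → ((((((p :* a) :* b) :* c) :* d) :* e) :* f) :* g , p :* (g :* (f :* (e :* (d :* (c :* (b :* (a :* :1))))))))
        (F.productW M ∷ φ 6 ∷ φ 5 ∷ φ 4 ∷ φ 3 ∷ φ 2 ∷ φ 1 ∷ φ 0 ∷ [])
      L.⟫ L.≋-sym (seqProduct-* (λ k → F.T.prodW k M) φ 7)
    where
    φ : ℕ → L.Ser
    φ k = L.1# L.+ monomial 1ℚ (-[1+ 0 ] , + 0) (upper k) L.* BaseL.Q 6 M
    s : ∀ k → L.1# L.+ monomial 1ℚ (-[1+ 0 ] , + 0) 1 L.* BaseL.Q 0 (k N.+ M N.* 7) L.≋ L.1# L.+ monomial 1ℚ (-[1+ 0 ] , + 0) (suc k) L.* BaseL.Q 6 M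
    s k = shift (-[1+ 0 ] , + 0) 1 (k N.+ M N.* 7) (suc k) M refl

  -- The seven products with base q⁷ interleave to a single one with base q. Multiplied by (q;q)_∞
  -- it is a theta series with constant term 1, and E⁷ is what the seven theta series brought along.
  core-product : poch 0 * coreSeries ≋ E ^ 7
  core-product = Tends-unique
      (Tends-* (Tends-sub (N._* 7) (λ n → Nₚ.m≤m*n n 7) (poch-tends 0)) (λ N M l → pairₛ-cong[] tt (F.whole-tends N M l)))
      (Tends-cong (λ M → ≋-sym (rearranged M)) (Tends-* (Tends-^ 7 (poch-tends 6)) (Tends-sub (N._* 7) (λ n → Nₚ.m≤m*n n 7) (λ N M l → pairₛ-cong[] tt (S.T.triple-product N M l)))))
    ⟫ *-congˡ (S.pair-theta (λ s _ → δ s) tt refl (λ s _ → δ-≢ s)) ⟫ *-identityʳ _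
    where
    rearranged : ∀ M → BaseQ.qfac 0 (M N.* 7) * pairₛ constantTerm (BaseL.qfac 6 M L.^ 7 L.* (F.productZ M L.* F.productW M)) ≋
                       BaseQ.qfac 6 M ^ 7 * pairₛ constantTerm (BaseL.qfac 0 (M N.* 7) L.* (S.T.prodZ (M N.* 7) L.* S.T.prodW (M N.* 7)))
    rearranged M = *-congˡ (pair-qfac-^ tt 6 M 7 _) ⟫ solve 3 (λ a b c → a :* (b :* c) , b :* (a :* c)) (BaseQ.qfac 0 (M N.* 7) ∷ BaseQ.qfac 6 M ^ 7 ∷ pairₛ constantTerm (F.productZ M L.* F.productW M) ∷ [])
      ⟫ *-congˡ (≋-sym (P.pairₛ-qfac tt 0 (M N.* 7) _) ⟫ pairₛ-cong tt (L.*-congˡ (L.*-cong (L.≋-sym (wholeZ M)) (L.≋-sym (wholeW M)))))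

-- The twist by seventh roots of unity

open FiniteSums ℚ-ring using () renaming (sum< to sumℚ; sum<-cong to sumℚ-cong)

-- Functions on ℤ² killed by 1 + ζ + ⋯ + ζ⁶, where ζ is the translation by (0 , 1).
Cyclotomic : (ℤ² → ℚ) → Set
Cyclotomic φ = ∀ s n → sumℚ 7 (λ j → φ (s , + j Z.+ n)) ≡ 0ℚ

cyclotomic-translate : ∀ φ g → Cyclotomic φ → Cyclotomic (λ h → φ (g ⊞ h))
cyclotomic-translate φ (a , b) h s n = sumℚ-cong 7 (λ j _ → cong (λ t → φ (a Z.+ s , t)) (move (+ j))) ∙ h (a Z.+ s) (b Z.+ n)
  where
  move : ∀ j → b Z.+ (j Z.+ n) ≡ j Z.+ (b Z.+ n)
  move j = solveℤ 3 (λ b j n → b :+ (j :+ n) , j :+ (b :+ n)) (b ∷ j ∷ n ∷ [])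

isSix : ℕ → ℤ
isSix 6 = + 1
isSix _ = + 0

sixClass : ℤ → ℤ
sixClass n = isSix (residue n)

-- One residue class is hit in each run of seven consecutive integers.
sixClass-run : ∀ n → (((((((+ 0 Z.+ sixClass (+ 0 Z.+ n)) Z.+ sixClass (+ 1 Z.+ n)) Z.+ sixClass (+ 2 Z.+ n)) Z.+ sixClass (+ 3 Z.+ n)) Z.+ sixClass (+ 4 Z.+ n)) Z.+ sixClass (+ 5 Z.+ n)) Z.+ sixClass (+ 6 Z.+ n)) ≡ + 1
sixClass-run n = subst Run (sym (index-residue n)) (by-cases (λ r → Run (index r (quotient n)))
    (run 0 (unwrapped 0 0 refl) (unwrapped 0 1 refl) (unwrapped 0 2 refl) (unwrapped 0 3 refl) (unwrapped 0 4 refl) (unwrapped 0 5 refl) (unwrapped 0 6 refl) refl)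
    (run 1 (unwrapped 1 0 refl) (unwrapped 1 1 refl) (unwrapped 1 2 refl) (unwrapped 1 3 refl) (unwrapped 1 4 refl) (unwrapped 1 5 refl) (wrapped 1 6 0 refl) refl)
    (run 2 (unwrapped 2 0 refl) (unwrapped 2 1 refl) (unwrapped 2 2 refl) (unwrapped 2 3 refl) (unwrapped 2 4 refl) (wrapped 2 5 0 refl) (wrapped 2 6 1 refl) refl)
    (run 3 (unwrapped 3 0 refl) (unwrapped 3 1 refl) (unwrapped 3 2 refl) (unwrapped 3 3 refl) (wrapped 3 4 0 refl) (wrapped 3 5 1 refl) (wrapped 3 6 2 refl) refl)
    (run 4 (unwrapped 4 0 refl) (unwrapped 4 1 refl) (unwrapped 4 2 refl) (wrapped 4 3 0 refl) (wrapped 4 4 1 refl) (wrapped 4 5 2 refl) (wrapped 4 6 3 refl) refl)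
    (run 5 (unwrapped 5 0 refl) (unwrapped 5 1 refl) (wrapped 5 2 0 refl) (wrapped 5 3 1 refl) (wrapped 5 4 2 refl) (wrapped 5 5 3 refl) (wrapped 5 6 4 refl) refl)
    (run 6 (unwrapped 6 0 refl) (wrapped 6 1 0 refl) (wrapped 6 2 1 refl) (wrapped 6 3 2 refl) (wrapped 6 4 3 refl) (wrapped 6 5 4 refl) (wrapped 6 6 5 refl) refl)
    (residue n) (residue<7 n))
  where
  Run : ℤ → Set
  Run n = (((((((+ 0 Z.+ sixClass (+ 0 Z.+ n)) Z.+ sixClass (+ 1 Z.+ n)) Z.+ sixClass (+ 2 Z.+ n)) Z.+ sixClass (+ 3 Z.+ n)) Z.+ sixClass (+ 4 Z.+ n)) Z.+ sixClass (+ 5 Z.+ n)) Z.+ sixClass (+ 6 Z.+ n)) ≡ + 1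
  t = quotient n
  unwrapped : ∀ r j → {_ : T (r N.+ j N.<ᵇ 7)} → ∀ {x} → isSix (r N.+ j) ≡ x → sixClass (+ j Z.+ index r t) ≡ x
  unwrapped r j {l} e = cong isSix (cong residue (solveℤ 3 (λ j r t → j :+ (r :+ t) , (r :+ j) :+ t) (+ j ∷ + r ∷ t Z.* + 7 ∷ [])) ∙ proj₁ (residue-index (r N.+ j) t (Nₚ.<ᵇ⇒< (r N.+ j) 7 l))) ∙ e
  wrapped : ∀ r j k → {_ : T (k N.<ᵇ 7)} → {_ : T (r N.+ j N.≡ᵇ k N.+ 7)} → ∀ {x} → isSix k ≡ x → sixClass (+ j Z.+ index r t) ≡ x
  wrapped r j k {l} {h} e = cong isSix (cong residue (solveℤ 3 (λ j r t → j :+ (r :+ t :* nat 7) , (r :+ j) :+ t :* nat 7) (+ j ∷ + r ∷ t ∷ [])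
      ∙ cong (λ x → + x Z.+ t Z.* + 7) (Nₚ.≡ᵇ⇒≡ (r N.+ j) (k N.+ 7) h) ∙ solveℤ 2 (λ k t → (k :+ nat 7) :+ t :* nat 7 , k :+ (:1 :+ t) :* nat 7) (+ k ∷ t ∷ []))
    ∙ proj₁ (residue-index k (+ 1 Z.+ t) (Nₚ.<ᵇ⇒< k 7 l))) ∙ e
  run : ∀ r {a b c d e f g} → sixClass (+ 0 Z.+ index r t) ≡ a → sixClass (+ 1 Z.+ index r t) ≡ b → sixClass (+ 2 Z.+ index r t) ≡ c → sixClass (+ 3 Z.+ index r t) ≡ d →
        sixClass (+ 4 Z.+ index r t) ≡ e → sixClass (+ 5 Z.+ index r t) ≡ f → sixClass (+ 6 Z.+ index r t) ≡ g →
        (((((((+ 0 Z.+ a) Z.+ b) Z.+ c) Z.+ d) Z.+ e) Z.+ f) Z.+ g) ≡ + 1 → Run (index r t)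
  run r a b c d e f g h = cong₂ Z._+_ (cong₂ Z._+_ (cong₂ Z._+_ (cong₂ Z._+_ (cong₂ Z._+_ (cong₂ Z._+_ (cong (λ x → + 0 Z.+ x) a) b) c) d) e) f) g ∙ h

-- The constant term in z of f - 7 [ζ⁶] f.
ψ : ℤ → ℤ → ℤ
ψ s n = δ s Z.* (+ 1 Z.- + 7 Z.* sixClass n)

weightψ : ℤ² → ℚ
weightψ sn = ℚSolver.fromℤ (ψ (proj₁ sn) (proj₂ sn))

-- In a run of seven the second factor takes the value 1 six times and the value 1 - 7 once.
ψ-cyclotomic : Cyclotomic weightψ
ψ-cyclotomic s n = collect (λ j → ψ s (+ j Z.+ n)) 7 ∙ cong ℚSolver.fromℤ (total-weight (sixClass (+ 0 Z.+ n)) (sixClass (+ 1 Z.+ n)) (sixClass (+ 2 Z.+ n)) (sixClass (+ 3 Z.+ n)) (sixClass (+ 4 Z.+ n)) (sixClass (+ 5 Z.+ n)) (sixClass (+ 6 Z.+ n)) (sixClass-run n))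
  where
  sumℤ : ℕ → (ℕ → ℤ) → ℤ
  sumℤ zero f = + 0
  sumℤ (suc n) f = sumℤ n f Z.+ f n
  collect : ∀ (f : ℕ → ℤ) k → sumℚ k (λ j → ℚSolver.fromℤ (f j)) ≡ ℚSolver.fromℤ (sumℤ k f)
  collect f zero = refl
  collect f (suc k) = cong (ℚ._+ ℚSolver.fromℤ (f k)) (collect f k) ∙ sym (ℚSolver.fromℤ-+ (sumℤ k f) (f k))
  total-weight : ∀ a b c d e f g → (((((((+ 0 Z.+ a) Z.+ b) Z.+ c) Z.+ d) Z.+ e) Z.+ f) Z.+ g) ≡ + 1 →
    (((((((+ 0 Z.+ δ s Z.* (+ 1 Z.- + 7 Z.* a)) Z.+ δ s Z.* (+ 1 Z.- + 7 Z.* b)) Z.+ δ s Z.* (+ 1 Z.- + 7 Z.* c)) Z.+ δ s Z.* (+ 1 Z.- + 7 Z.* d)) Z.+ δ s Z.* (+ 1 Z.- + 7 Z.* e)) Z.+ δ s Z.* (+ 1 Z.- + 7 Z.* f)) Z.+ δ s Z.* (+ 1 Z.- + 7 Z.* g)) ≡ + 0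
  total-weight a b c d e f g h = solveℤ 8 (λ y a b c d e f g → let w = λ x → y :* (nat 1 :- nat 7 :* x) in
      ((((((nat 0 :+ w a) :+ w b) :+ w c) :+ w d) :+ w e) :+ w f) :+ w g , y :* nat 7 :* (nat 1 :- (((((((nat 0 :+ a) :+ b) :+ c) :+ d) :+ e) :+ f) :+ g))) (δ s ∷ a ∷ b ∷ c ∷ d ∷ e ∷ f ∷ g ∷ [])
    ∙ cong (λ t → δ s Z.* + 7 Z.* (+ 1 Z.- t)) h ∙ Zₚ.*-zeroʳ (δ s Z.* + 7)

module CyclotomicProducts = LatticeProducts Cyclotomic cyclotomic-translate

module Kolitsch where
  open CyclotomicProducts
  open P using (pairₛ; pairₛ-cong; pairₛ-cong[]; pairₛ-+; pairₛ-monomial; monomial; monomial-*; monomial-^; monomial-cong; module L)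
  open RingSolver L.seriesRing using () renaming (proveModulo to proveModuloᴸ; ⟦_⟧ to ⟦_⟧ᴸ)

  module F = Seven (λ k → + 1 , + k) (λ _ → 0) (λ _ → 1) 0 (λ _ → refl)
  module S = SingleTheta (+ 7) 0 7 6 refl (λ ())

  z y cyclotomicₑ : Expr 2
  z = var Fin.zero
  y = var (Fin.suc Fin.zero)
  cyclotomicₑ = z :^ 0 :+ z :^ 1 :+ z :^ 2 :+ z :^ 3 :+ z :^ 4 :+ z :^ 5 :+ z :^ 6

  root : ℤ → L.Ser
  root ε = monomial 1ℚ (+ 0 , ε) 0

  -- The hypothesis states the vanishing of the seven values seen by a test function. The sign ε
  -- admits the inverse root as well, which the factors with w need; a run of seven then starts at
  -- -6.
  root-sum : ∀ ε y → (∀ φ → Cyclotomic φ → φ (+ 0 , + 0 Z.* ε) ℚ.+ φ (+ 0 , + 1 Z.* ε) ℚ.+ φ (+ 0 , + 2 Z.* ε) ℚ.+ φ (+ 0 , + 3 Z.* ε) ℚ.+ φ (+ 0 , + 4 Z.* ε) ℚ.+ φ (+ 0 , + 5 Z.* ε) ℚ.+ φ (+ 0 , + 6 Z.* ε) ≡ 0ℚ) →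
             ⟦ cyclotomicₑ ⟧ᴸ (root ε ∷ y ∷ []) L.≋ L.0#
  root-sum ε y h = tested-≋ λ φ Φφ →
    add φ (add φ (add φ (add φ (add φ (add φ (part φ Φφ 0) (part φ Φφ 1)) (part φ Φφ 2)) (part φ Φφ 3)) (part φ Φφ 4)) (part φ Φφ 5)) (part φ Φφ 6)
      ⟫ ≋-reflexive (cong constant (h φ Φφ)) ⟫ constant-0 ⟫ (coeffs λ _ → refl)
    where
    part : ∀ φ → Cyclotomic φ → ∀ j → pairₛ φ (root ε L.^ j) ≋ constant (φ (+ 0 , + j Z.* ε))
    part φ Φφ j = pairₛ-cong Φφ (monomial-^ 1ℚ (+ 0) ε 0 j L.⟫ monomial-cong (one-^ j) (cong (_, + j Z.* ε) (Zₚ.*-zeroʳ (+ j))) (Nₚ.*-zeroʳ j))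
      ⟫ pairₛ-monomial Φφ 1ℚ (+ 0 , + j Z.* ε) 0 ⟫ *-identityʳ _ ⟫ ≋-reflexive (cong constant (ℚₚ.*-identityˡ (φ (+ 0 , + j Z.* ε))))
    add : ∀ φ {f g a b} → pairₛ φ f ≋ constant a → pairₛ φ g ≋ constant b → pairₛ φ (f L.+ g) ≋ constant (a ℚ.+ b)
    add φ {f} {g} {a} {b} p q = pairₛ-+ φ f g ⟫ +-cong p q ⟫ ≋-sym (constant-+ a b)

  root-sum₊ : ∀ y → ⟦ cyclotomicₑ ⟧ᴸ (root (+ 1) ∷ y ∷ []) L.≋ L.0#
  root-sum₊ y = root-sum (+ 1) y λ φ Φφ → ℚSolver.solve 7 (λ a b c d e f g → a :+ b :+ c :+ d :+ e :+ f :+ g , nat 0 :+ a :+ b :+ c :+ d :+ e :+ f :+ g)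
    (φ (+ 0 , + 0) ∷ φ (+ 0 , + 1) ∷ φ (+ 0 , + 2) ∷ φ (+ 0 , + 3) ∷ φ (+ 0 , + 4) ∷ φ (+ 0 , + 5) ∷ φ (+ 0 , + 6) ∷ []) ∙ Φφ (+ 0) (+ 0)

  root-sum₋ : ∀ y → ⟦ cyclotomicₑ ⟧ᴸ (root -[1+ 0 ] ∷ y ∷ []) L.≋ L.0#
  root-sum₋ y = root-sum -[1+ 0 ] y λ φ Φφ → ℚSolver.solve 7 (λ a b c d e f g → a :+ b :+ c :+ d :+ e :+ f :+ g , nat 0 :+ g :+ f :+ e :+ d :+ c :+ b :+ a)
    (φ (+ 0 , + 0) ∷ φ (+ 0 , -[1+ 0 ]) ∷ φ (+ 0 , -[1+ 1 ]) ∷ φ (+ 0 , -[1+ 2 ]) ∷ φ (+ 0 , -[1+ 3 ]) ∷ φ (+ 0 , -[1+ 4 ]) ∷ φ (+ 0 , -[1+ 5 ]) ∷ []) ∙ Φφ (+ 0) -[1+ 5 ]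

  -- Subtracting 1 + y⁷ from the product leaves a multiple of 1 + ζ + ⋯ + ζ⁶. The sign in front of
  -- y⁷ is positive because ζ²¹ = 1.
  cyclotomic-factors : ∀ ζ y → ⟦ cyclotomicₑ ⟧ᴸ (ζ ∷ y ∷ []) L.≋ L.0# → seqProduct (λ k → L.1# L.+ ζ L.^ k L.* y) 7 L.≋ L.1# L.+ y L.^ 7
  cyclotomic-factors ζ u h = proveModuloᴸ
    ((:1 :+ z :^ 0 :* y) :* ((:1 :+ z :^ 1 :* y) :* ((:1 :+ z :^ 2 :* y) :* ((:1 :+ z :^ 3 :* y) :* ((:1 :+ z :^ 4 :* y) :* ((:1 :+ z :^ 5 :* y) :* ((:1 :+ z :^ 6 :* y) :* :1)))))))
    (:1 :+ y :^ 7)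
    -- The quotient of that difference by 1 + z + ⋯ + z⁶, ordered by powers of y.
    (((nat 1 :* z :^ 0) :* y :^ 1 :+ (nat 1 :* z :^ 1 :+ nat 1 :* z :^ 3 :+ nat 1 :* z :^ 5) :* y :^ 2 :+ (nat 1 :* z :^ 3 :+ nat 1 :* z :^ 5 :+ nat 1 :* z :^ 6 :+ nat 1 :* z :^ 7 :+ nat 1 :* z :^ 9) :* y :^ 3 :+ (nat 1 :* z :^ 6 :+ nat 1 :* z :^ 8 :+ nat 1 :* z :^ 9 :+ nat 1 :* z :^ 10 :+ nat 1 :* z :^ 12) :* y :^ 4 :+ (nat 1 :* z :^ 10 :+ nat 1 :* z :^ 12 :+ nat 1 :* z :^ 14) :* y :^ 5 :+ (nat 1 :* z :^ 15) :* y :^ 6 :+ (con -[1+ 0 ] :* z :^ 0 :+ nat 1 :* z :^ 1 :+ con -[1+ 0 ] :* z :^ 7 :+ nat 1 :* z :^ 8 :+ con -[1+ 0 ] :* z :^ 14 :+ nat 1 :* z :^ 15) :* y :^ 7 , cyclotomicₑ) ∷ [])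
    (ζ ∷ u ∷ []) (h ∷ [])

  factor : ∀ ε a e e′ M → (e N.+ M N.* 1) N.* 7 ≡ e′ N.+ M N.* 7 → (∀ y → ⟦ cyclotomicₑ ⟧ᴸ (root ε ∷ y ∷ []) L.≋ L.0#) →
    seqProduct (λ k → L.1# L.+ monomial 1ℚ (a , + k Z.* ε) e L.* BaseL.Q 0 M) 7 L.≋ L.1# L.+ monomial 1ℚ (+ 7 Z.* a , + 0) e′ L.* BaseL.Q 6 M
  factor ε a e e′ M h r = seqProduct-cong 7 (λ k → L.+-congˡ {L.1#} (L.*-congʳ {BaseL.Q 0 M} (split k) L.⟫ L.*-assoc (root ε L.^ k) (monomial 1ℚ (a , + 0) e) (BaseL.Q 0 M)))
    L.⟫ cyclotomic-factors (root ε) u (r u) L.⟫ L.+-congˡ power-7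
    where
    u = monomial 1ℚ (a , + 0) e L.* BaseL.Q 0 M
    split : ∀ k → monomial 1ℚ (a , + k Z.* ε) e L.≋ root ε L.^ k L.* monomial 1ℚ (a , + 0) e
    split k = L.≋-sym (L.*-congʳ (monomial-^ 1ℚ (+ 0) ε 0 k L.⟫ monomial-cong (one-^ k) (cong (_, + k Z.* ε) (Zₚ.*-zeroʳ (+ k))) (Nₚ.*-zeroʳ k))
      L.⟫ monomial-* 1ℚ (+ 0 , + k Z.* ε) 0 1ℚ (a , + 0) e L.⟫ monomial-cong refl (cong₂ _,_ (Zₚ.+-identityˡ a) (Zₚ.+-identityʳ (+ k Z.* ε))) refl)
    asMonomial : ∀ g e b m → monomial 1ℚ g e L.* BaseL.Q b m L.≋ monomial 1ℚ g (e N.+ m N.* suc b)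
    asMonomial g e b m = L.*-assoc _ (L.X^ e) _ L.⟫ L.*-congˡ (L.*-congˡ (BaseL.Q≋X^ b m) L.⟫ L.X^-+ e (m N.* suc b))
    power-7 : u L.^ 7 L.≋ monomial 1ℚ (+ 7 Z.* a , + 0) e′ L.* BaseL.Q 6 M
    power-7 = L.^-congˡ 7 (asMonomial (a , + 0) e 0 M) L.⟫ monomial-^ 1ℚ a (+ 0) (e N.+ M N.* 1) 7
      L.⟫ monomial-cong (one-^ 7) refl (Nₚ.*-comm 7 (e N.+ M N.* 1) ∙ h) L.⟫ L.≋-sym (asMonomial (+ 7 Z.* a , + 0) e′ 6 M)

  wholeZ : ∀ M → F.productZ M L.≋ S.T.prodZ M
  wholeZ zero = seqProduct-const L.1# 7 L.⟫ L.solve 0 (:1 :^ 7 , :1) []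
  wholeZ (suc M) = seqProduct-* (λ k → F.T.prodZ k M) (λ k → L.1# L.+ F.T.zᵐ k L.* BaseL.Q 0 M) 7 L.⟫ L.*-cong (wholeZ M) (seqProduct-cong 7 (λ k → L.+-congˡ {L.1#} (L.*-congʳ {BaseL.Q 0 M} (monomial-cong {1ℚ} {1ℚ} {e = 0} refl (cong (+ 1 ,_) (sym (Zₚ.*-identityʳ (+ k)))) refl)))
    L.⟫ factor (+ 1) (+ 1) 0 0 M (cong (N._* 7) (Nₚ.*-identityʳ M)) root-sum₊)

  wholeW : ∀ M → F.productW M L.≋ S.T.prodW M
  wholeW zero = seqProduct-const L.1# 7 L.⟫ L.solve 0 (:1 :^ 7 , :1) []
  wholeW (suc M) = seqProduct-* (λ k → F.T.prodW k M) (λ k → L.1# L.+ F.T.wᵐ k L.* BaseL.Q 0 M) 7 L.⟫ L.*-cong (wholeW M) (seqProduct-cong 7 (λ k → L.+-congˡ {L.1#} (L.*-congʳ {BaseL.Q 0 M} (monomial-cong {1ℚ} {1ℚ} {e = 1} refl (cong (-[1+ 0 ] ,_) (negative k)) refl)))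
    L.⟫ factor -[1+ 0 ] -[1+ 0 ] 1 7 M (cong (λ t → suc t N.* 7) (Nₚ.*-identityʳ M)) root-sum₋)
    where
    negative : ∀ k → Z.- (+ k) ≡ + k Z.* -[1+ 0 ]
    negative k = sym (Zₚ.*-comm (+ k) -[1+ 0 ] ∙ Zₚ.-1*i≡-i (+ k))

  twisted : Ser
  twisted = pairₛ weightψ F.whole

  HasSum-twisted : HasSum (λ v → term⟨ ψ (charge v) (moment1 v) , energy (λ _ → 0) (λ _ → 1) v ⟩) twisted
  HasSum-twisted = F.HasSum-whole ψ ψ-cyclotomic

  -- The seven twisted products collapse to one theta product in z⁷ with base q⁷. Only its term with
  -- z⁰ is seen by ψ, with weight 1 because 0 is not in the class 6.
  twisted-product : E * twisted ≋ poch 0 ^ 7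
  twisted-product = Tends-unique
      (Tends-* (poch-tends 6) (λ N M l → pairₛ-cong[] ψ-cyclotomic (F.whole-tends N M l)))
      (Tends-cong (λ M → ≋-sym (rearranged M)) (Tends-* (Tends-^ 7 (poch-tends 0)) (λ N M l → pairₛ-cong[] ψ-cyclotomic (S.T.triple-product N M l))))
    ⟫ *-congˡ (S.pair-theta ψ ψ-cyclotomic refl (λ s n h → cong (Z._* (+ 1 Z.- + 7 Z.* sixClass n)) (δ-≢ s h))) ⟫ *-identityʳ _
    where
    rearranged : ∀ M → BaseQ.qfac 6 M * pairₛ weightψ (BaseL.qfac 0 M L.^ 7 L.* (F.productZ M L.* F.productW M)) ≋
                       BaseQ.qfac 0 M ^ 7 * pairₛ weightψ (BaseL.qfac 6 M L.* (S.T.prodZ M L.* S.T.prodW M))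
    rearranged M = *-congˡ (pair-qfac-^ ψ-cyclotomic 0 M 7 _) ⟫ solve 3 (λ a b c → a :* (b :* c) , b :* (a :* c)) (BaseQ.qfac 6 M ∷ BaseQ.qfac 0 M ^ 7 ∷ pairₛ weightψ (F.productZ M L.* F.productW M) ∷ [])
      ⟫ *-congˡ (≋-sym (P.pairₛ-qfac ψ-cyclotomic 6 M _) ⟫ pairₛ-cong ψ-cyclotomic (L.*-congˡ (L.*-cong (wholeZ M) (wholeW M))))

-- Coordinates on { v ∈ ℤ⁷ : Σ vᵢ = 0 , Σ i vᵢ ≡ c (mod 7) }.
coset : ℕ → Vec ℤ 6 → Vec ℤ 7
coset c (t ∷ a ∷ b ∷ d ∷ e ∷ f ∷ []) = Z.- (v1 Z.+ (a Z.+ b Z.+ d Z.+ e Z.+ f)) ∷ v1 ∷ a ∷ b ∷ d ∷ e ∷ f ∷ []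
  where v1 = + c Z.+ t Z.* + 7 Z.- (+ 2 Z.* a Z.+ + 3 Z.* b Z.+ + 4 Z.* d Z.+ + 5 Z.* e Z.+ + 6 Z.* f)

InCoset : ℕ → Vec ℤ 7 → Set
InCoset c v = charge v ≡ + 0 × residue (moment1 v) ≡ c

inCoset? : ∀ c v → Dec (InCoset c v)
inCoset? c v = (charge v Zₚ.≟ + 0) ×-dec (residue (moment1 v) Nₚ.≟ c)

coordinates : Vec ℤ 7 → Vec ℤ 6
coordinates v@(_ ∷ _ ∷ w) = quotient (moment1 v) ∷ w

sumₑ : ∀ {k} → (ℕ → ℤ) → ∀ {n} → Vec (Expr k) n → Expr k
sumₑ a [] = nat 0
sumₑ a (s ∷ v) = s :* con (a 0) :+ sumₑ (λ k → a (suc k)) v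

energyₑ : ∀ {k} → (ℕ → ℕ) → (ℕ → ℕ) → ∀ {n} → Vec (Expr k) n → Expr k
energyₑ r r′ [] = nat 0
energyₑ r r′ (s ∷ v) = (nat 2 :* s :* con (+ r 0) :+ (con (+ r 0) :+ con (+ r′ 0)) :* (s :* s :- s)) :+ energyₑ (λ k → r (suc k)) (λ k → r′ (suc k)) v

cosetₑ : ∀ {k} → Expr k → Vec (Expr k) 6 → Vec (Expr k) 7
cosetₑ c (t ∷ a ∷ b ∷ d ∷ e ∷ f ∷ []) = :- (v1 :+ (a :+ b :+ d :+ e :+ f)) ∷ v1 ∷ a ∷ b ∷ d ∷ e ∷ f ∷ []
  where v1 = c :+ t :* nat 7 :- (nat 2 :* a :+ nat 3 :* b :+ nat 4 :* d :+ nat 5 :* e :+ nat 6 :* f)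

charge-coset : ∀ c p → charge (coset c p) ≡ + 0
charge-coset c p@(_ ∷ _ ∷ _ ∷ _ ∷ _ ∷ _ ∷ []) = ℤSolver.prove {7} (sumₑ (λ _ → + 1) (cosetₑ (Vec.head variables) (Vec.tail variables))) (nat 0) (+ c ∷ p)

moment-coset : ∀ c p → moment1 (coset c p) ≡ index c (Vec.head p)
moment-coset c p@(_ ∷ _ ∷ _ ∷ _ ∷ _ ∷ _ ∷ []) = ℤSolver.prove {7} (sumₑ (λ k → + k) (cosetₑ (Vec.head variables) (Vec.tail variables))) (var Fin.zero :+ var (Fin.suc Fin.zero) :* nat 7) (+ c ∷ p)

coset-inCoset : ∀ c p → c < 7 → InCoset c (coset c p)
coset-inCoset c p l = charge-coset c p , cong residue (moment-coset c p) ∙ proj₁ (residue-index c (Vec.head p) l)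

coordinates-coset : ∀ c p → c < 7 → coordinates (coset c p) ≡ p
coordinates-coset c p@(_ ∷ _ ∷ _ ∷ _ ∷ _ ∷ _ ∷ []) l = cong (_∷ _) (cong quotient (moment-coset c p) ∙ proj₂ (residue-index c (Vec.head p) l))

coset-coordinates : ∀ c v → InCoset c v → coset c (coordinates v) ≡ v
coset-coordinates c v@(x ∷ y ∷ a ∷ b ∷ d ∷ e ∷ f ∷ []) (h0 , h1) = cong₂ (λ x y → x ∷ y ∷ a ∷ b ∷ d ∷ e ∷ f ∷ []) first second
  where
  w = + 2 Z.* a Z.+ + 3 Z.* b Z.+ + 4 Z.* d Z.+ + 5 Z.* e Z.+ + 6 Z.* f
  moment≡ : + c Z.+ quotient (moment1 v) Z.* + 7 ≡ moment1 v
  moment≡ = cong (λ r → index r (quotient (moment1 v))) (sym h1) ∙ sym (index-residue (moment1 v))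
  second : + c Z.+ quotient (moment1 v) Z.* + 7 Z.- w ≡ y
  second = cong (λ k → k Z.- w) moment≡ ∙ solveℤ 7 (λ x y a b d e f →
    sumₑ (λ k → + k) (x ∷ y ∷ a ∷ b ∷ d ∷ e ∷ f ∷ []) :- (nat 2 :* a :+ nat 3 :* b :+ nat 4 :* d :+ nat 5 :* e :+ nat 6 :* f) , y) v
  first : Z.- ((+ c Z.+ quotient (moment1 v) Z.* + 7 Z.- w) Z.+ (a Z.+ b Z.+ d Z.+ e Z.+ f)) ≡ x
  first = cong (λ k → Z.- (k Z.+ (a Z.+ b Z.+ d Z.+ e Z.+ f))) second ∙ solveℤ 7 (λ x y a b d e f → :- (y :+ (a :+ b :+ d :+ e :+ f)) , x :- sumₑ (λ _ → + 1) (x ∷ y ∷ a ∷ b ∷ d ∷ e ∷ f ∷ [])) v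
    ∙ cong (λ k → x Z.- k) h0 ∙ Zₚ.+-identityʳ x

coset-sum : ∀ c → c < 7 → {g : Vec ℤ 7 → Ser} {S : Ser} → (∀ v → ¬ InCoset c v → g v ≋ 0#) → HasSum g S → HasSum (λ p → g (coset c p)) S
coset-sum c l {g} h = reindex record
  { to = coordinates ; Relevant = InCoset c ; relevant? = inCoset? c ; irrelevant = h
  ; agree = λ v v∈ → ≋-reflexive (cong g (sym (coset-coordinates c v v∈)))
  ; injective = λ v v′ v∈ v′∈ e → sym (coset-coordinates c v v∈) ∙ cong (coset c) e ∙ coset-coordinates c v′ v′∈
  ; onto = λ p → inj₂ (coset c p , coset-inCoset c p l , coordinates-coset c p l) }

-- Rows hold the constant term first.
affine : ∀ {m n} → Vec (Vec ℤ (suc n)) m → Vec ℤ n → Vec ℤ m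
affine A p = Vec.map (λ { (c ∷ r) → c Z.+ Vec.foldr′ Z._+_ (+ 0) (Vec.zipWith Z._*_ r p) }) A

-- With αᵢ the coordinates of v with respect to the seven vectors of least energy 5 in the coset 5,
-- normalised by Σ αᵢ = 1, these matrices express the cyclic differences xᵢ of the αᵢ, which lie in the
-- coset 6, through v and back.
forwardRows backwardRows : Vec (Vec ℤ 7) 6
forwardRows =
    (+ 2 ∷ + 4 ∷ -[1+ 0 ] ∷ -[1+ 0 ] ∷ -[1+ 1 ] ∷ -[1+ 2 ] ∷ -[1+ 2 ] ∷ []) ∷
    (-[1+ 1 ] ∷ -[1+ 2 ] ∷ + 1 ∷ + 1 ∷ + 1 ∷ + 2 ∷ + 3 ∷ []) ∷
    (-[1+ 2 ] ∷ -[1+ 3 ] ∷ + 0 ∷ + 1 ∷ + 2 ∷ + 2 ∷ + 3 ∷ []) ∷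
    (+ 1 ∷ + 2 ∷ + 0 ∷ -[1+ 0 ] ∷ -[1+ 0 ] ∷ -[1+ 1 ] ∷ -[1+ 1 ] ∷ []) ∷
    (+ 6 ∷ + 8 ∷ -[1+ 1 ] ∷ -[1+ 2 ] ∷ -[1+ 3 ] ∷ -[1+ 4 ] ∷ -[1+ 5 ] ∷ []) ∷
    (+ 0 ∷ + 0 ∷ + 0 ∷ + 1 ∷ + 0 ∷ + 0 ∷ + 0 ∷ []) ∷ []
backwardRows =
    (+ 3 ∷ + 5 ∷ -[1+ 0 ] ∷ -[1+ 1 ] ∷ -[1+ 2 ] ∷ -[1+ 2 ] ∷ -[1+ 3 ] ∷ []) ∷
    (+ 1 ∷ + 1 ∷ + 0 ∷ -[1+ 0 ] ∷ + 0 ∷ -[1+ 0 ] ∷ -[1+ 0 ] ∷ []) ∷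
    (+ 0 ∷ + 0 ∷ + 0 ∷ + 0 ∷ + 0 ∷ + 0 ∷ + 1 ∷ []) ∷
    (+ 5 ∷ + 6 ∷ -[1+ 1 ] ∷ -[1+ 1 ] ∷ -[1+ 2 ] ∷ -[1+ 3 ] ∷ -[1+ 4 ] ∷ []) ∷
    (-[1+ 1 ] ∷ -[1+ 1 ] ∷ + 0 ∷ + 0 ∷ + 0 ∷ + 1 ∷ + 1 ∷ []) ∷
    (+ 3 ∷ + 4 ∷ + 0 ∷ -[1+ 0 ] ∷ -[1+ 1 ] ∷ -[1+ 1 ] ∷ -[1+ 2 ] ∷ []) ∷ []

forth back : Vec ℤ 6 → Vec ℤ 6
forth = affine forwardRows
back = affine backwardRows

affineₑ : ∀ {m n} → Vec (Vec ℤ (suc n)) m → Vec (Expr n) n → Vec (Expr n) m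
affineₑ A p = Vec.map (λ { (c ∷ r) → con c :+ Vec.foldr′ _:+_ (nat 0) (Vec.zipWith (λ x e → con x :* e) r p) }) A

composite : Vec (Vec ℤ 7) 6 → Vec (Vec ℤ 7) 6 → Fin 6 → Expr 6
composite A B = Vec.lookup (affineₑ A (affineₑ B variables))

forth-back : ∀ p → forth (back p) ≡ p
forth-back p@(_ ∷ _ ∷ _ ∷ _ ∷ _ ∷ _ ∷ []) = cong₂ _∷_ (ℤSolver.prove (composite forwardRows backwardRows (Fin.# 0)) (var (Fin.# 0)) p) (cong₂ _∷_ (ℤSolver.prove (composite forwardRows backwardRows (Fin.# 1)) (var (Fin.# 1)) p) (cong₂ _∷_ (ℤSolver.prove (composite forwardRows backwardRows (Fin.# 2)) (var (Fin.# 2)) p) (cong₂ _∷_ (ℤSolver.prove (composite forwardRows backwardRows (Fin.# 3)) (var (Fin.# 3)) p) (cong₂ _∷_ (ℤSolver.prove (composite forwardRows backwardRows (Fin.# 4)) (var (Fin.# 4)) p) (cong₂ _∷_ (ℤSolver.prove (composite forwardRows backwardRows (Fin.# 5)) (var (Fin.# 5)) p) refl)))))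

back-forth : ∀ p → back (forth p) ≡ p
back-forth p@(_ ∷ _ ∷ _ ∷ _ ∷ _ ∷ _ ∷ []) = cong₂ _∷_ (ℤSolver.prove (composite backwardRows forwardRows (Fin.# 0)) (var (Fin.# 0)) p) (cong₂ _∷_ (ℤSolver.prove (composite backwardRows forwardRows (Fin.# 1)) (var (Fin.# 1)) p) (cong₂ _∷_ (ℤSolver.prove (composite backwardRows forwardRows (Fin.# 2)) (var (Fin.# 2)) p) (cong₂ _∷_ (ℤSolver.prove (composite backwardRows forwardRows (Fin.# 3)) (var (Fin.# 3)) p) (cong₂ _∷_ (ℤSolver.prove (composite backwardRows forwardRows (Fin.# 4)) (var (Fin.# 4)) p) (cong₂ _∷_ (ℤSolver.prove (composite backwardRows forwardRows (Fin.# 5)) (var (Fin.# 5)) p) refl)))))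

doubleEnergy : (ℕ → ℕ) → (ℕ → ℕ) → ∀ {n} → Vec ℤ n → ℤ
doubleEnergy r r′ [] = + 0
doubleEnergy r r′ (s ∷ v) = (+ 2 Z.* s Z.* + r 0 Z.+ (+ r 0 Z.+ + r′ 0) Z.* (s Z.* s Z.- s)) Z.+ doubleEnergy (λ k → r (suc k)) (λ k → r′ (suc k)) v

energy-ℤ : ∀ r r′ {n} (v : Vec ℤ n) → + 2 Z.* + energy r r′ v ≡ doubleEnergy r r′ v
energy-ℤ r r′ [] = refl
energy-ℤ r r′ (s ∷ v) = Zₚ.*-distribˡ-+ (+ 2) (+ exponent (r 0) (r′ 0) s) (+ energy (λ k → r (suc k)) (λ k → r′ (suc k)) v)
  ∙ cong₂ Z._+_ (exponent-ℤ (r 0) (r′ 0) s) (energy-ℤ (λ k → r (suc k)) (λ k → r′ (suc k)) v)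

coreEnergy triangleEnergy : Vec ℤ 7 → ℕ
coreEnergy = energy Cores.lower Cores.upper
triangleEnergy = energy (λ _ → 0) (λ _ → 1)

-- A core of size 7n - 2 corresponds to a vector of energy n, which explains the shift by 2.
-- Doubling makes both energies quadratic polynomials in the six coordinates.
isometry : ∀ p → 2 N.+ coreEnergy (coset 5 p) ≡ triangleEnergy (coset 6 (forth p)) N.* 7
isometry p@(_ ∷ _ ∷ _ ∷ _ ∷ _ ∷ _ ∷ []) = +-injective2 (Zₚ.*-distribˡ-+ (+ 2) (+ 2) (+ coreEnergy (coset 5 p)) ∙ cong (λ k → + 4 Z.+ k) (energy-ℤ Cores.lower Cores.upper (coset 5 p)) ∙ quadratic ∙ sym (cong (λ k → + 2 Z.* k) (Zₚ.pos-* (triangleEnergy (coset 6 (forth p))) 7)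
    ∙ solveℤ 1 (λ k → nat 2 :* (k :* nat 7) , nat 7 :* (nat 2 :* k)) (+ triangleEnergy (coset 6 (forth p)) ∷ []) ∙ cong (λ k → + 7 Z.* k) (energy-ℤ (λ _ → 0) (λ _ → 1) (coset 6 (forth p)))))
  where
  quadratic : + 4 Z.+ doubleEnergy Cores.lower Cores.upper (coset 5 p) ≡ + 7 Z.* doubleEnergy (λ _ → 0) (λ _ → 1) (coset 6 (forth p))
  quadratic = ℤSolver.prove (nat 4 :+ energyₑ Cores.lower Cores.upper (cosetₑ (nat 5) variables))
    (nat 7 :* energyₑ (λ _ → 0) (λ _ → 1) (cosetₑ (nat 6) (affineₑ forwardRows variables))) p

-- Twice the energy is 2 Σ i vᵢ modulo 7 when Σ vᵢ = 0.
coreEnergy-residue : ∀ v → charge v ≡ + 0 → 7 ℕ∣.∣ 2 N.+ coreEnergy v → residue (moment1 v) ≡ 5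
coreEnergy-residue v@(_ ∷ _ ∷ _ ∷ _ ∷ _ ∷ _ ∷ _ ∷ []) h (ℕ∣.divides k eq) = cong residue explicit ∙ proj₁ (residue-index 5 (+ 8 Z.* + k Z.- + 4 Z.* Q Z.- moment1 v Z.- + 3) (Nₚ.<ᵇ⇒< 5 7 tt))
  where
  squares : Vec (Expr 7) 7 → Expr 7
  squares w = Vec.foldr′ (λ s t → s :* s :+ t) (nat 0) w
  Q = Vec.foldr′ (λ s t → s Z.* s Z.+ t) (+ 0) v
  expanded : doubleEnergy Cores.lower Cores.upper v ≡ + 2 Z.* moment1 v Z.+ + 7 Z.* Q Z.- + 7 Z.* charge v
  expanded = ℤSolver.prove (energyₑ Cores.lower Cores.upper variables)
    (nat 2 :* sumₑ (λ k → + k) variables :+ nat 7 :* squares variables :- nat 7 :* sumₑ (λ _ → + 1) variables) v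
  doubled : + 4 Z.+ (+ 2 Z.* moment1 v Z.+ + 7 Z.* Q) ≡ + 2 Z.* (+ k Z.* + 7)
  doubled = cong (λ z → + 4 Z.+ z) (sym (energy-ℤ Cores.lower Cores.upper v ∙ expanded ∙ cong (λ z → + 2 Z.* moment1 v Z.+ + 7 Z.* Q Z.- + 7 Z.* z) h ∙ Zₚ.+-identityʳ (+ 2 Z.* moment1 v Z.+ + 7 Z.* Q)))
    ∙ sym (Zₚ.*-distribˡ-+ (+ 2) (+ 2) (+ coreEnergy v)) ∙ cong (λ z → + 2 Z.* z) (cong +_ eq ∙ Zₚ.pos-* k 7)
  explicit : moment1 v ≡ index 5 (+ 8 Z.* + k Z.- + 4 Z.* Q Z.- moment1 v Z.- + 3)
  explicit = solveℤ 2 (λ L Q → L , nat 4 :* (nat 4 :+ (nat 2 :* L :+ nat 7 :* Q)) :- nat 16 :- nat 28 :* Q :- nat 7 :* L) (moment1 v ∷ Q ∷ [])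
    ∙ cong (λ z → + 4 Z.* z Z.- + 16 Z.- + 28 Z.* Q Z.- + 7 Z.* moment1 v) doubled
      ∙ solveℤ 3 (λ k L Q → nat 4 :* (nat 2 :* (k :* nat 7)) :- nat 16 :- nat 28 :* Q :- nat 7 :* L ,
         nat 5 :+ (nat 8 :* k :- nat 4 :* Q :- L :- nat 3) :* nat 7) (+ k ∷ moment1 v ∷ Q ∷ [])

section-0-shift : ∀ f → section 0 (X^ 2 * f) ≋ X^ 1 * section 5 f
section-0-shift f = coeffs λ
  { zero → at-X^*-< 2 0 f (s≤s z≤n) ∙ sym (at-X^*-< 1 0 (section 5 f) (s≤s z≤n))
  ; (suc n) → at-X^* 2 (5 N.+ n N.* 7) f ∙ sym (at-X^* 1 n (section 5 f)) }

core-sum : HasSum (λ p → term⟨ + 1 , triangleEnergy (coset 6 p) ⟩) (X^ 1 * section 5 Cores.coreSeries)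
core-sum = HasSum-cong (λ _ → ≋-refl) (section-0-shift Cores.coreSeries) (reindex (bijection forth back back-forth forth-back values)
  (coset-sum 5 (Nₚ.<ᵇ⇒< 5 7 tt) {λ v → section 0 (X^ 2 * term⟨ δ (charge v) , coreEnergy v ⟩)} outside (HasSum-section 0 (HasSum-*ˡ (X^ 2) Cores.HasSum-cores))))
  where
  shifted : ∀ x e → X^ 2 * term⟨ x , e ⟩ ≋ term⟨ x , 2 N.+ e ⟩
  shifted x e = solve 3 (λ y c z → y :* (c :* z) , c :* (y :* z)) (X^ 2 ∷ fromℤ x ∷ X^ e ∷ []) ⟫ *-congˡ (X^-+ 2 e)
  values : ∀ p → section 0 (X^ 2 * term⟨ δ (charge (coset 5 p)) , coreEnergy (coset 5 p) ⟩) ≋ term⟨ + 1 , triangleEnergy (coset 6 (forth p)) ⟩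
  values p = section-cong 0 (shifted (δ (charge (coset 5 p))) (coreEnergy (coset 5 p)) ⟫ term-cong {δ (charge (coset 5 p))} {+ 1} (cong δ (charge-coset 5 p)) refl)
    ⟫ section-0-hit (+ 1) (2 N.+ coreEnergy (coset 5 p)) (triangleEnergy (coset 6 (forth p))) (isometry p)
  outside : ∀ v → ¬ InCoset 5 v → section 0 (X^ 2 * term⟨ δ (charge v) , coreEnergy v ⟩) ≋ 0#
  outside v h = section-cong 0 (shifted (δ (charge v)) (coreEnergy v)) ⟫ ([ charged , neutral ]′ (toSum (charge v Zₚ.≟ + 0)))
    where
    neutral : charge v ≢ + 0 → section 0 term⟨ δ (charge v) , 2 N.+ coreEnergy v ⟩ ≋ 0#
    neutral c = section-cong 0 (*-congʳ (≋-reflexive (cong fromℤ (δ-≢ (charge v) c))) ⟫ zeroˡ _) ⟫ (coeffs λ _ → refl)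
    charged : charge v ≡ + 0 → section 0 term⟨ δ (charge v) , 2 N.+ coreEnergy v ⟩ ≋ 0#
    charged c = section-0-miss (δ (charge v)) (2 N.+ coreEnergy v) (λ d → h (c , coreEnergy-residue v c d))

-- The two weights δ and ψ differ by 7 times the indicator of the class 6, so the difference of the
-- two lattice sums counts that class alone.
class-sum-6 : HasSum (λ p → fromℤ (+ 7) * term⟨ + 1 , triangleEnergy (coset 6 p) ⟩) (Frobenius.latticeTheta - Kolitsch.twisted)
class-sum-6 = HasSum-cong values ≋-refl (coset-sum 6 (Nₚ.<ᵇ⇒< 6 7 tt) {g} outside (HasSum-+ ≟-vec Frobenius.HasSum-latticeTheta (HasSum-neg Kolitsch.HasSum-twisted)))
  where
  ≟-vec = Vecₚ.≡-dec Zₚ._≟_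
  g : Vec ℤ 7 → Ser
  g v = term⟨ δ (charge v) , triangleEnergy v ⟩ + - term⟨ ψ (charge v) (moment1 v) , triangleEnergy v ⟩
  merge : ∀ x y e → term⟨ x , e ⟩ + - term⟨ y , e ⟩ ≋ term⟨ x Z.- y , e ⟩
  merge x y e = solve 3 (λ a b x → a :* x :+ :- (b :* x) , (a :- b) :* x) (fromℤ x ∷ fromℤ y ∷ X^ e ∷ []) ⟫ *-congʳ (≋-sym (fromℤ-+ x (Z.- y) ⟫ +-congˡ (fromℤ-neg y)))
  difference : ∀ s n → δ s Z.- ψ s n ≡ + 7 Z.* (δ s Z.* sixClass n)
  difference s n = solveℤ 2 (λ d i → d :- d :* (nat 1 :- nat 7 :* i) , nat 7 :* (d :* i)) (δ s ∷ sixClass n ∷ [])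
  g≋ : ∀ v → g v ≋ term⟨ + 7 Z.* (δ (charge v) Z.* sixClass (moment1 v)) , triangleEnergy v ⟩
  g≋ v = merge (δ (charge v)) (ψ (charge v) (moment1 v)) (triangleEnergy v) ⟫ term-cong {δ (charge v) Z.- ψ (charge v) (moment1 v)} {+ 7 Z.* (δ (charge v) Z.* sixClass (moment1 v))} (difference (charge v) (moment1 v)) refl
  isSix-≢ : ∀ r → r ≢ 6 → isSix r ≡ + 0
  isSix-≢ 0 _ = refl
  isSix-≢ 1 _ = refl
  isSix-≢ 2 _ = refl
  isSix-≢ 3 _ = refl
  isSix-≢ 4 _ = refl
  isSix-≢ 5 _ = refl
  isSix-≢ 6 h = ⊥-elim (h refl)
  isSix-≢ (suc (suc (suc (suc (suc (suc (suc r))))))) _ = refl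
  weight-0 : ∀ v → ¬ InCoset 6 v → + 7 Z.* (δ (charge v) Z.* sixClass (moment1 v)) ≡ + 0
  weight-0 v h = [ (λ c → cong (λ z → + 7 Z.* (δ (charge v) Z.* z)) (isSix-≢ (residue (moment1 v)) (λ r → h (c , r))) ∙ cong (λ z → + 7 Z.* z) (Zₚ.*-zeroʳ (δ (charge v))))
                 , (λ c → cong (λ z → + 7 Z.* (z Z.* sixClass (moment1 v))) (δ-≢ (charge v) c) ∙ refl) ]′ (toSum (charge v Zₚ.≟ + 0))
  outside : ∀ v → ¬ InCoset 6 v → g v ≋ 0#
  outside v h = g≋ v ⟫ *-congʳ (≋-reflexive (cong fromℤ (weight-0 v h))) ⟫ zeroˡ _
  values : ∀ p → g (coset 6 p) ≋ fromℤ (+ 7) * term⟨ + 1 , triangleEnergy (coset 6 p) ⟩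
  values p = g≋ (coset 6 p) ⟫ term-cong {+ 7 Z.* (δ (charge (coset 6 p)) Z.* sixClass (moment1 (coset 6 p)))} {+ 7} (cong₂ (λ x y → + 7 Z.* (δ x Z.* isSix y)) (charge-coset 6 p) (proj₂ (coset-inCoset 6 p (Nₚ.<ᵇ⇒< 6 7 tt)))) refl
    ⟫ ≋-sym (term-scale (+ 7) (+ 1) (triangleEnergy (coset 6 p)))

theta-difference : Frobenius.latticeTheta - Kolitsch.twisted ≋ fromℤ (+ 7) * (X^ 1 * section 5 Cores.coreSeries)
theta-difference = HasSum-unique (Vecₚ.≡-dec Zₚ._≟_) class-sum-6 (HasSum-*ˡ (fromℤ (+ 7)) core-sum)

-- By `core-product` the core series is E⁷ times the partition series. As E⁷ is (q;q)_∞⁷ taken at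
-- q⁷, it passes through the section.
core-section : section 5 Cores.coreSeries ≋ poch 0 ^ 7 * section 5 partitionSeries
core-section = section-cong 5 (divide (Monic-poch 0) Cores.core-product ⟫ *-congʳ (^-congˡ 7 (≋-sym expand-poch) ⟫ ≋-sym (expand-^ (poch 0) 7)))
  ⟫ section-expand-* 5 (poch 0 ^ 7) partitionSeries (Nₚ.<ᵇ⇒< 5 7 tt)

kolitsch : ∀ {C} → Frobenius.latticeTheta ≋ poch 0 ^ 7 * C → C ≋ E ⁻¹ + fromℤ (+ 7) * (X^ 1 * section 5 partitionSeries)
kolitsch {C} h = solve 2 (λ c k → c , (c :- k) :+ k) (C ∷ K ∷ []) ⟫ +-congʳ (⁻¹-unique (Monic-poch 6) quotient≋)
  where
  K = fromℤ (+ 7) * (X^ 1 * section 5 partitionSeries)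
  twisted≋ : Kolitsch.twisted ≋ poch 0 ^ 7 * (C - K)
  twisted≋ = solve 2 (λ t w → w , t :- (t :- w)) (Frobenius.latticeTheta ∷ Kolitsch.twisted ∷ [])
    ⟫ +-cong h (-‿cong (theta-difference ⟫ *-congˡ (*-congˡ core-section)))
      ⟫ solve 4 (λ u c x s → u :^ 7 :* c :- nat 7 :* (x :* (u :^ 7 :* s)) , u :^ 7 :* (c :- nat 7 :* (x :* s))) (poch 0 ∷ C ∷ X^ 1 ∷ section 5 partitionSeries ∷ [])
  quotient≋ : E * (C - K) ≋ 1#
  quotient≋ = Monic-cancel (Monic-^ 7 (Monic-poch 0)) (solve 3 (λ u e w → u :^ 7 :* (e :* w) , e :* (u :^ 7 :* w)) (poch 0 ∷ E ∷ C - K ∷ [])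
    ⟫ *-congˡ (≋-sym twisted≋) ⟫ Kolitsch.twisted-product ⟫ ≋-sym (*-identityʳ _))

-- Counting

at-term-≢ : ∀ x e n → e ≢ n → at term⟨ x , e ⟩ n ≡ 0ℚ
at-term-≢ x e n h = coeff (*-congʳ {x = X^ e} (≋-sym (constant-fromℤ x))) n ∙ at-constant* (ℚSolver.fromℤ x) (X^ e) n
  ∙ cong (ℚSolver.fromℤ x ℚ.*_) (unit-≢ e n h) ∙ ℚₚ.*-zeroʳ (ℚSolver.fromℤ x)
  where
  unit-≢ : ∀ e n → e ≢ n → unit e n ≡ 0ℚ
  unit-≢ zero zero h = ⊥-elim (h refl)
  unit-≢ zero (suc n) h = refl
  unit-≢ (suc e) zero h = refl
  unit-≢ (suc e) (suc n) h = unit-≢ e n (λ q → h (cong suc q))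

at-X^-≡ : ∀ n → at (X^ n) n ≡ 1ℚ
at-X^-≡ zero = refl
at-X^-≡ (suc n) = at-X^-≡ n

-- The coefficients of qⁿ are regarded as constant series, for which `∑-covers` at precision 1
-- compares `L` with the enumeration by `Fin m`: indices outside the image have coefficient 0.
count-list : ∀ {I A : Set} (_≟_ : DecidableEquality I) {m} → Fin m ↔ A → (f : A → I) → (∀ {a b} → f a ≡ f b → a ≡ b) →
             ∀ (g : I → Ser) n L → Unique L → (∀ a → f a ∈ L) → (∀ a → at (g (f a)) n ≡ 1ℚ) →
             (∀ i → i ∈ L → at (g i) n ≡ 0ℚ ⊎ Σ A (λ a → f a ≡ i)) → at (∑ g L) n ≡ ℚSolver.fromℕ m
count-list {I} {A} _≟_ {m} iso f f-injective g n L uL f∈ ones others =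
  sym (coefficients L) ∙ upto (∑-covers _≟_ {1} {h} L (List.tabulate k) uL (Uniqueₚ.tabulate⁺ k-injective) outside (λ i i∈ i∉ → ⊥-elim (i∉ (covered i i∈)))) 0 (s≤s z≤n) ∙ all-ones m k (λ j → ones (Inverse.to iso j))
  where
  h : I → Ser
  h i = constant (at (g i) n)
  k : Fin m → I
  k j = f (Inverse.to iso j)
  k-injective : ∀ {i j} → k i ≡ k j → i ≡ j
  k-injective {i} {j} e = sym (Inverse.strictlyInverseʳ iso i) ∙ cong (Inverse.from iso) (f-injective e) ∙ Inverse.strictlyInverseʳ iso j
  coefficients : ∀ L → at (∑ h L) 0 ≡ at (∑ g L) n
  coefficients [] = zero-at n
    where
    zero-at : ∀ n → 0ℚ ≡ at 0# n
    zero-at n = refl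
  coefficients (i ∷ L) = cong (at (g i) n ℚ.+_) (coefficients L)
  all-ones : ∀ m (k : Fin m → I) → (∀ j → at (g (k j)) n ≡ 1ℚ) → at (∑ h (List.tabulate k)) 0 ≡ ℚSolver.fromℕ m
  all-ones zero k e = refl
  all-ones (suc m) k e = cong₂ ℚ._+_ (e Fin.zero) (all-ones m (λ j → k (Fin.suc j)) (λ j → e (Fin.suc j)))
  member : ∀ a → f a ∈ List.tabulate k
  member a = subst (λ b → f b ∈ List.tabulate k) (Inverse.strictlyInverseˡ iso a) (∈ₚ.∈-tabulate⁺ (Inverse.from iso a))
  outside : ∀ i → i ∈ L → i ∉ List.tabulate k → Vanishes 1 (h i)
  outside i i∈ i∉ = [ (λ z → below λ { zero _ → z ; (suc n) (s≤s ()) }) , (λ { (a , refl) → ⊥-elim (i∉ (member a)) }) ]′ (others i i∈)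
  covered : ∀ i → i ∈ List.tabulate k → i ∈ L
  covered i i∈ = let j , e = ∈ₚ.∈-tabulate⁻ i∈ in subst (_∈ L) (sym e) (f∈ (Inverse.to iso j))

-- Multiplicity vectors list the multiplicities of the parts m, m - 1, …, 1.
multiplicityWeight : ∀ {m} → Vec ℕ m → ℕ
multiplicityWeight [] = 0
multiplicityWeight {suc m} (k ∷ v) = k N.* suc m N.+ multiplicityWeight v

decode : ∀ {m} → Vec ℕ m → List ℕ
decode [] = []
decode {suc m} (k ∷ v) = replicate k (suc m) ++ decode v

decode-≤ : ∀ {m} (v : Vec ℕ m) → All (_≤ m) (decode v)
decode-≤ [] = []
decode-≤ {suc m} (k ∷ v) = Allₚ.++⁺ (Allₚ.replicate⁺ k Nₚ.≤-refl) (All.map Nₚ.m≤n⇒m≤1+n (decode-≤ v))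

decode-positive : ∀ {m} (v : Vec ℕ m) → All (0 <_) (decode v)
decode-positive [] = []
decode-positive (k ∷ v) = Allₚ.++⁺ (Allₚ.replicate⁺ k (s≤s z≤n)) (decode-positive v)

decode-nonincreasing : ∀ {m} (v : Vec ℕ m) → AllPairs N._≥_ (decode v)
decode-nonincreasing [] = []
decode-nonincreasing {suc m} (k ∷ v) = go k
  where
  go : ∀ k → AllPairs N._≥_ (replicate k (suc m) ++ decode v)
  go zero = decode-nonincreasing v
  go (suc k) = decode-≤ (k ∷ v) ∷ go k

sum-decode : ∀ {m} (v : Vec ℕ m) → sum (decode v) ≡ multiplicityWeight v
sum-decode [] = refl
sum-decode {suc m} (k ∷ v) = go k
  where
  go : ∀ k → sum (replicate k (suc m) ++ decode v) ≡ k N.* suc m N.+ multiplicityWeight v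
  go zero = sum-decode v
  go (suc k) = cong (suc m N.+_) (go k) ∙ sym (Nₚ.+-assoc (suc m) (k N.* suc m) (multiplicityWeight v))

decode-injective : ∀ {m} (v w : Vec ℕ m) → decode v ≡ decode w → v ≡ w
decode-injective [] [] _ = refl
decode-injective {suc m} (k ∷ v) (l ∷ w) = go k l
  where
  clash : ∀ {A : Set} (u : Vec ℕ m) l → decode u ≡ suc m ∷ l → A
  clash u l e = ⊥-elim (Nₚ.1+n≰n (All.head (subst (All (_≤ m)) e (decode-≤ u))))
  go : ∀ k l → replicate k (suc m) ++ decode v ≡ replicate l (suc m) ++ decode w → k ∷ v ≡ l ∷ w
  go zero zero e = cong (0 ∷_) (decode-injective v w e)
  go zero (suc l) e = clash v _ e
  go (suc k) zero e = clash w _ (sym e)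
  go (suc k) (suc l) e = cong (λ { (k ∷ v) → suc k ∷ v }) (go k l (Listₚ.∷-injectiveʳ e))

encode : ∀ m l → AllPairs N._≥_ l → All (0 <_) l → All (_≤ m) l → Σ (Vec ℕ m) (λ v → decode v ≡ l)
encode zero [] _ _ _ = [] , refl
encode zero (x ∷ l) _ (p ∷ _) (q ∷ _) = ⊥-elim (Nₚ.<⇒≱ p q)
encode (suc m) l d p q = go l d p q
  where
  smaller : ∀ l → AllPairs N._≥_ l → All (0 <_) l → All (_≤ m) l → Σ (Vec ℕ (suc m)) (λ v → decode v ≡ l)
  smaller l d p q = let v , e = encode m l d p q in 0 ∷ v , e
  go : ∀ l → AllPairs N._≥_ l → All (0 <_) l → All (_≤ suc m) l → Σ (Vec ℕ (suc m)) (λ v → decode v ≡ l)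
  go [] d p q = smaller [] d p []
  go (x ∷ l) (h ∷ d) (p ∷ ps) (q ∷ qs) with Nₚ.m≤n⇒m<n∨m≡n q
  ... | inj₁ x≤m = smaller (x ∷ l) (h ∷ d) (p ∷ ps) (Nₚ.≤-pred x≤m ∷ All.map (λ y≤x → Nₚ.≤-trans y≤x (Nₚ.≤-pred x≤m)) h)
  ... | inj₂ refl with go l d ps qs
  ... | k ∷ v , e = suc k ∷ v , cong (suc m ∷_) e

HasSum-geometric : ∀ i → HasSum (λ j → X^ (j N.* suc i)) (geometric (suc i))
HasSum-geometric i = record
  { summable = record { support = downFrom ; unique = Uniqueₚ.downFrom⁺
                      ; outside = λ N j j∉ → ≈[]-mono (Nₚ.≤-trans (Nₚ.≮⇒≥ (λ l → j∉ (∈ₚ.∈-downFrom⁺ l))) (Nₚ.m≤m*n j (suc i))) (X^-vanishes (j N.* suc i)) }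
  ; sums = λ N → Monic-cancel[] (Monic-1-X^ i) (≈[]-trans (≋⇒≈[] (finite N)) (≈[]-trans (≈[]-+ ≈[]-refl (≈[]-neg (≈[]-mono (Nₚ.m≤m*n N (suc i)) (X^-vanishes (N N.* suc i)))))
      (≋⇒≈[] (solve 0 (:1 :- nat 0 , :1) [] ⟫ ≋-sym (⁻¹-inverse (Monic-1-X^ i)))))) }
  where
  finite : ∀ N → (1# - X^ (suc i)) * ∑ (λ j → X^ (j N.* suc i)) (downFrom N) ≋ 1# - X^ (N N.* suc i)
  finite zero = solve 1 (λ y → (:1 :- y) :* nat 0 , :1 :- :1) (X^ (suc i) ∷ [])
  finite (suc N) = distribˡ (1# - X^ (suc i)) _ _ ⟫ +-congˡ (finite N) ⟫ solve 2 (λ y z → (:1 :- y) :* z :+ (:1 :- z) , :1 :- y :* z) (X^ (suc i) ∷ X^ (N N.* suc i) ∷ []) ⟫ +-congˡ (-‿cong (X^-+ (suc i) (N N.* suc i)))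

-- The part m - k for k < m, in the order of the multiplicity vectors. It is written as a successor
-- so that the lemmas on `geometric` apply to it.
partSize : ℕ → ℕ → ℕ
partSize m k = suc (m ∸ suc k)

multiplicityTerm : ∀ {m} (v : Vec ℕ m) → productFamily (λ k j → X^ (j N.* partSize m k)) v ≋ X^ (multiplicityWeight v)
multiplicityTerm [] = ≋-refl
multiplicityTerm {suc m} (k ∷ v) = *-congˡ (multiplicityTerm v) ⟫ X^-+ (k N.* suc m) (multiplicityWeight v)

boundedPartitions : ∀ m → TripleProduct.WithBase.qfac ℚ-ring 0 m * productSeq (λ k → geometric (partSize m k)) m ≋ 1#
boundedPartitions zero = *-identityˡ 1#
boundedPartitions (suc m) = solve 4 (λ q f g p → (q :* f) :* (g :* p) , (q :* p) :* (f :* g)) (B1.qfac m ∷ 1# - B1.Q (suc m) ∷ geometric (suc m) ∷ productSeq (λ k → geometric (partSize m k)) m ∷ [])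
  ⟫ *-cong (boundedPartitions m) (*-congʳ (+-congˡ (-‿cong (B1.Q≋X^ (suc m) ⟫ ≋-reflexive (cong X^ (Nₚ.*-identityʳ (suc m)))))) ⟫ ⁻¹-inverse (Monic-1-X^ m)) ⟫ *-identityˡ 1#
  where module B1 = TripleProduct.WithBase ℚ-ring 0

boundedPartitions-limit : ∀ n → productSeq (λ k → geometric (partSize n k)) n ≈[ suc n ] partitionSeries
boundedPartitions-limit n = Monic-cancel[] (Monic-poch 0) (≈[]-trans (≈[]-* (≈[]-trans (≈[]-sym (poch-tends 0 (suc n) (suc n) Nₚ.≤-refl)) (B1.qfac-stable (Nₚ.n≤1+n n))) ≈[]-refl)
  (≋⇒≈[] (boundedPartitions n ⟫ ≋-sym (⁻¹-inverse (Monic-poch 0)))))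
  where module B1 = TripleProduct.WithBase ℚ-ring 0

parts-injective : ∀ {n} {P Q : Partition n} → Partition.parts P ≡ Partition.parts Q → P ≡ Q
parts-injective {P = record { nonincreasing = a ; positive = b ; total = c }} {record { nonincreasing = a′ ; positive = b′ ; total = c′ }} refl
  with Linked.irrelevant Nₚ.≤-irrelevant a a′ | All.irrelevant Nₚ.≤-irrelevant b b′ | Nₚ.≡-irrelevant c c′
... | refl | refl | refl = refl

≤-sum : ∀ l → All (_≤ sum l) l
≤-sum [] = []
≤-sum (x ∷ l) = Nₚ.m≤m+n x (sum l) ∷ All.map (λ h → Nₚ.≤-trans h (Nₚ.m≤n+m (sum l) x)) (≤-sum l)

partitionSeries-counts : ∀ {n m} → Fin m ↔ Partition n → at partitionSeries n ≡ ℚSolver.fromℕ m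
partitionSeries-counts {n} {m} iso = sym (upto (≈[]-trans (HasSum.sums sums (suc n)) (boundedPartitions-limit n)) n Nₚ.≤-refl)
  ∙ count-list ≟-vec iso (λ P → proj₁ (code P)) (λ {P} {Q} e → parts-injective (sym (proj₂ (code P)) ∙ cong decode e ∙ proj₂ (code Q)))
    (λ v → X^ (multiplicityWeight v)) n (HasSum.support sums (suc n)) (HasSum.unique sums (suc n)) inSupport one classified
  where
  ≟-vec : DecidableEquality (Vec ℕ n)
  ≟-vec = Vecₚ.≡-dec Nₚ._≟_
  open DecMembership ≟-vec using (_∈?_)
  -- No part of a partition of n exceeds n, so vectors of length n are enough for the coefficient of
  -- qⁿ.
  sums : HasSum (λ (v : Vec ℕ n) → X^ (multiplicityWeight v)) (productSeq (λ k → geometric (partSize n k)) n)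
  sums = HasSum-cong multiplicityTerm ≋-refl (HasSum-Vec Nₚ._≟_ {λ k j → X^ (j N.* partSize n k)} {λ k → geometric (partSize n k)} n (λ k → HasSum-geometric (n ∸ suc k)))
  code : (P : Partition n) → Σ (Vec ℕ n) (λ v → decode v ≡ Partition.parts P)
  code P = encode n parts (Linkedₚ.Linked⇒AllPairs (λ p q → Nₚ.≤-trans q p) nonincreasing) positive (subst (λ k → All (_≤ k) parts) (Partition.total P) (≤-sum parts))
    where open Partition P using (parts; nonincreasing; positive)
  weight-code : ∀ P → multiplicityWeight (proj₁ (code P)) ≡ n
  weight-code P = sym (sum-decode (proj₁ (code P))) ∙ cong sum (proj₂ (code P)) ∙ Partition.total P
  one : ∀ P → at (X^ (multiplicityWeight (proj₁ (code P)))) n ≡ 1ℚ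
  one P = cong (λ k → at (X^ k) n) (weight-code P) ∙ at-X^-≡ n
  inSupport : ∀ P → proj₁ (code P) ∈ HasSum.support sums (suc n)
  -- Outside the support the coefficient of qⁿ would be 0, but the code of a partition of n has
  -- coefficient 1.
  inSupport P with proj₁ (code P) ∈? HasSum.support sums (suc n)
  ... | yes v∈ = v∈
  ... | no v∉ = contradiction (sym (one P) ∙ upto (HasSum.outside sums (suc n) (proj₁ (code P)) v∉) n Nₚ.≤-refl) λ ()
  classified : ∀ v → v ∈ HasSum.support sums (suc n) → at (X^ (multiplicityWeight v)) n ≡ 0ℚ ⊎ Σ (Partition n) (λ P → proj₁ (code P) ≡ v)
  classified v _ with multiplicityWeight v Nₚ.≟ n
  ... | no w≢n = inj₁ (coeff (≋-sym (*-congʳ fromℤ-1 ⟫ *-identityˡ (X^ (multiplicityWeight v)))) n ∙ at-term-≢ (+ 1) (multiplicityWeight v) n w≢n)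
  ... | yes w≡n = inj₂ (P , decode-injective (proj₁ (code P)) v (proj₂ (code P)))
    where
    P : Partition n
    P = record { parts = decode v ; nonincreasing = Linkedₚ.AllPairs⇒Linked (decode-nonincreasing v) ; positive = decode-positive v ; total = sum-decode v ∙ w≡n }

-- Frobenius symbols as pairs of subsets

sublists : {A : Set} → List A → List (List A)
sublists [] = [] ∷ []
sublists (x ∷ xs) = List.map (x ∷_) (sublists xs) ++ sublists xs

module _ {A : Set} {R : A → A → Set} where
  sublists-members : ∀ es {s : List A} → s ∈ sublists es → All (_∈ es) s
  sublists-members [] (here refl) = []
  sublists-members (x ∷ es) s∈ with ∈ₚ.∈-++⁻ (List.map (x ∷_) (sublists es)) s∈
  ... | inj₂ s∈ʳ = All.map there (sublists-members es s∈ʳ)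
  ... | inj₁ s∈ˡ with ∈ₚ.∈-map⁻ (x ∷_) s∈ˡ
  ... | t , t∈ , refl = here refl ∷ All.map there (sublists-members es t∈)

  sublists-pairs : ∀ es {s : List A} → AllPairs R es → s ∈ sublists es → AllPairs R s
  sublists-pairs [] _ (here refl) = []
  sublists-pairs (x ∷ es) (h ∷ d) s∈ with ∈ₚ.∈-++⁻ (List.map (x ∷_) (sublists es)) s∈
  ... | inj₂ s∈ʳ = sublists-pairs es d s∈ʳ
  ... | inj₁ s∈ˡ with ∈ₚ.∈-map⁻ (x ∷_) s∈ˡ
  ... | t , t∈ , refl = All.map (λ y∈ → All.lookup h y∈) (sublists-members es t∈) ∷ sublists-pairs es d t∈

  sublists-unique : ∀ {es : List A} → Unique es → Unique (sublists es)
  sublists-unique [] = [] ∷ []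
  sublists-unique {x ∷ es} (h ∷ u) = Uniqueₚ.++⁺ (Uniqueₚ.map⁺ Listₚ.∷-injectiveʳ (sublists-unique u)) (sublists-unique u) disjoint
    where
    disjoint : ∀ {s} → ¬ (s ∈ List.map (x ∷_) (sublists es) × s ∈ sublists es)
    disjoint (p , q) with ∈ₚ.∈-map⁻ (x ∷_) p
    ... | t , _ , refl = All.lookup h (All.head (sublists-members es q)) refl

  module _ (transitive : ∀ {x y z} → R x y → R y z → R x z) (irreflexive : ∀ {x} → ¬ R x x) where
    -- Strict order decides at each head: once an entry y has been met, later entries lie strictly
    -- beyond it and cannot return to an earlier head of the alphabet.
    sublists-complete : ∀ es s → AllPairs R es → AllPairs R s → All (_∈ es) s → s ∈ sublists es
    sublists-complete [] [] _ _ _ = here refl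
    sublists-complete [] (y ∷ s) _ _ (() ∷ _)
    sublists-complete (x ∷ es) [] (_ ∷ d) _ _ = ∈ₚ.∈-++⁺ʳ (List.map (x ∷_) (sublists es)) (sublists-complete es [] d [] [])
    sublists-complete (x ∷ es) (y ∷ s) (h ∷ d) (h′ ∷ d′) (here refl ∷ s∈) = ∈ₚ.∈-++⁺ˡ (∈ₚ.∈-map⁺ (x ∷_) (sublists-complete es s d d′ (All.zipWith (λ { (r , z∈) → inTail r z∈ }) (h′ , s∈))))
      where
      inTail : ∀ {z} → R x z → z ∈ x ∷ es → z ∈ es
      inTail r (here refl) = ⊥-elim (irreflexive r)
      inTail r (there z∈) = z∈
    sublists-complete (x ∷ es) (y ∷ s) (h ∷ d) (h′ ∷ d′) (there y∈ ∷ s∈) = ∈ₚ.∈-++⁺ʳ (List.map (x ∷_) (sublists es)) (sublists-complete es (y ∷ s) d (h′ ∷ d′) (y∈ ∷ All.zipWith (λ { (r , z∈) → inTail r z∈ }) (h′ , s∈)))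
      where
      inTail : ∀ {z} → R y z → z ∈ x ∷ es → z ∈ es
      inTail r (here refl) = ⊥-elim (irreflexive (transitive (All.lookup h y∈) r))
      inTail r (there z∈) = z∈

_≻_ : Entry 7 → Entry 7 → Set
x ≻ y = y ≺ x

≻-trans : ∀ {x y z} → x ≻ y → y ≻ z → x ≻ z
≻-trans (inj₁ a) (inj₁ b) = inj₁ (Nₚ.<-trans b a)
≻-trans (inj₁ a) (inj₂ (b , _)) = inj₁ (subst (_< _) (sym b) a)
≻-trans (inj₂ (a , _)) (inj₁ b) = inj₁ (subst (_ <_) a b)
≻-trans (inj₂ (a , c)) (inj₂ (b , d)) = inj₂ (b ∙ a , Nₚ.<-trans d c)

≻-irrefl : ∀ {x} → ¬ (x ≻ x)
≻-irrefl (inj₁ l) = Nₚ.<-irrefl refl l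
≻-irrefl (inj₂ (_ , l)) = Nₚ.<-irrefl refl l

≻-irrelevant : ∀ {x y} (p q : x ≻ y) → p ≡ q
≻-irrelevant (inj₁ a) (inj₁ b) = cong inj₁ (Nₚ.≤-irrelevant a b)
≻-irrelevant (inj₁ a) (inj₂ (b , _)) = ⊥-elim (Nₚ.<-irrefl b a)
≻-irrelevant (inj₂ (a , _)) (inj₁ b) = ⊥-elim (Nₚ.<-irrefl a b)
≻-irrelevant (inj₂ (a , c)) (inj₂ (b , d)) = cong inj₂ (cong₂ _,_ (Nₚ.≡-irrelevant a b) (Nₚ.≤-irrelevant c d))

_≟ₑ_ : DecidableEquality (Entry 7)
(v [ c ]) ≟ₑ (w [ d ]) with v Nₚ.≟ w | c Finₚ.≟ d
... | yes refl | yes refl = yes refl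
... | no h | _ = no λ { refl → h refl }
... | yes _ | no h = no λ { refl → h refl }

-- In decreasing order, so that the alphabet below is decreasing and its sublists are exactly the
-- possible rows.
colours : List (Fin 7)
colours = List.reverse (List.allFin 7)

colour∈ : ∀ c → c ∈ colours
colour∈ c = from-yes (Finₚ.all? (λ c → c ∈? colours)) c
  where open DecMembership Finₚ._≟_ using (_∈?_)

alphabet : ℕ → List (Entry 7)
alphabet zero = []
alphabet (suc M) = List.map (M [_]) colours ++ alphabet M

alphabet-bound : ∀ M → All (λ e → value e < M) (alphabet M)
alphabet-bound zero = []
alphabet-bound (suc M) = Allₚ.++⁺ (Allₚ.map⁺ {f = M [_]} (All.tabulate (λ _ → Nₚ.≤-refl))) (All.map Nₚ.m≤n⇒m≤1+n (alphabet-bound M))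

alphabet-decreasing : ∀ M → AllPairs _≻_ (alphabet M)
alphabet-decreasing zero = []
alphabet-decreasing (suc M) = AllPairsₚ.++⁺ (AllPairsₚ.map⁺ {f = M [_]} (AllPairs.map (λ l → inj₂ (refl , l)) decreasing)) (alphabet-decreasing M)
  (Allₚ.map⁺ {f = M [_]} (All.tabulate (λ _ → All.map inj₁ (alphabet-bound M))))
  where
  decreasing : AllPairs (λ c d → Fin.toℕ d < Fin.toℕ c) colours
  decreasing = from-yes (AllPairs.allPairs? (λ c d → Fin.toℕ d Nₚ.<? Fin.toℕ c) colours)

∈-alphabet : ∀ M e → value e < M → e ∈ alphabet M
∈-alphabet (suc M) (v [ c ]) (s≤s l) with Nₚ.m≤n⇒m<n∨m≡n l
... | inj₁ v<M = ∈ₚ.∈-++⁺ʳ (List.map (M [_]) colours) (∈-alphabet M (v [ c ]) v<M)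
... | inj₂ refl = ∈ₚ.∈-++⁺ˡ (∈ₚ.∈-map⁺ (M [_]) (colour∈ c))

alphabet-unique : ∀ M → Unique (alphabet M)
alphabet-unique M = AllPairs.map (λ { r refl → ≻-irrefl r }) (alphabet-decreasing M)

symbol-injective : ∀ {n} {S T : FrobSymbol 7 n} → FrobSymbol.top S ≡ FrobSymbol.top T → FrobSymbol.bottom S ≡ FrobSymbol.bottom T → S ≡ T
symbol-injective {S = record { topDec = a ; botDec = b ; sameLength = c ; weight = d }} {record { topDec = a′ ; botDec = b′ ; sameLength = c′ ; weight = d′ }} refl refl
  with Linked.irrelevant ≻-irrelevant a a′ | Linked.irrelevant ≻-irrelevant b b′ | Nₚ.≡-irrelevant c c′ | Nₚ.≡-irrelevant d d′
... | refl | refl | refl | refl = refl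

module FrobeniusCount where
  open Laurent
  open P using (pairₛ; pairₛ-cong; pairₛ-+; pairₛ-monomial; monomial; monomial-*; monomial-1; module L)
  open P.LSum using () renaming (∑ to ∑ᴸ; ∑-++ to ∑ᴸ-++; ∑-map to ∑ᴸ-map; ∑-*ˡ to ∑ᴸ-*ˡ; ∑-cong to ∑ᴸ-cong; ∑-product to ∑ᴸ-product)
  module F = Frobenius.F

  listProduct : {A : Set} → (A → L.Ser) → List A → L.Ser
  listProduct f [] = L.1#
  listProduct f (x ∷ xs) = f x L.* listProduct f xs

  subsetTerm : {A : Set} → ℤ → (A → ℕ) → List A → L.Ser
  subsetTerm c e s = monomial 1ℚ (+ length s Z.* c , + 0) (sum (List.map e s))

  subset-expansion : ∀ {A : Set} c (e : A → ℕ) es → listProduct (λ x → L.1# L.+ monomial 1ℚ (c , + 0) (e x)) es L.≋ ∑ᴸ (subsetTerm c e) (sublists es)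
  subset-expansion c e [] = L.≋-sym monomial-1 L.⟫ L.≋-sym (L.+-identityʳ _)
  subset-expansion c e (x ∷ es) = L.*-congˡ (subset-expansion c e es) L.⟫ L.solve 2 (λ m s → (:1 :+ m) :* s , m :* s :+ s) (monomial 1ℚ (c , + 0) (e x) ∷ ∑ᴸ (subsetTerm c e) (sublists es) ∷ [])
    L.⟫ L.≋-sym (∑ᴸ-++ (subsetTerm c e) (List.map (x ∷_) (sublists es)) (sublists es) L.⟫ L.+-congʳ (∑ᴸ-map (subsetTerm c e) (x ∷_) (sublists es)
      L.⟫ ∑ᴸ-cong (sublists es) (λ s → L.≋-sym (prepend s)) L.⟫ ∑ᴸ-*ˡ (monomial 1ℚ (c , + 0) (e x)) (subsetTerm c e) (sublists es)))
    where
    prepend : ∀ s → monomial 1ℚ (c , + 0) (e x) L.* subsetTerm c e s L.≋ subsetTerm c e (x ∷ s)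
    prepend s = monomial-* 1ℚ (c , + 0) (e x) 1ℚ (+ length s Z.* c , + 0) (sum (List.map e s)) L.⟫ P.monomial-cong {e = e x N.+ sum (List.map e s)} refl (cong (_, + 0) (sym (Zₚ.suc-* (+ length s) c))) refl

  asMonomial : ∀ g e M → monomial 1ℚ g e L.* BaseL.Q 0 M L.≋ monomial 1ℚ g (e N.+ M)
  asMonomial g e M = L.*-assoc _ (L.X^ e) _ L.⟫ L.*-congˡ (L.*-congˡ (BaseL.Q≋X^ 0 M) L.⟫ L.X^-+ e (M N.* 1) L.⟫ L.≋-reflexive (cong (λ k → L.X^ (e N.+ k)) (Nₚ.*-identityʳ M)))

  -- The seven colours of one value contribute the same factor, which turns a product over coloured
  -- entries into a seventh power.
  alphabet-product : ∀ (f : ℕ → L.Ser) (G : ℕ → L.Ser) → G 0 L.≋ L.1# → (∀ M → G (suc M) L.≋ G M L.* f M) → ∀ M → listProduct (λ x → f (value x)) (alphabet M) L.≋ G M L.^ 7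
  alphabet-product f G g0 gₛ zero = L.≋-sym (L.^-congˡ 7 g0 L.⟫ L.solve 0 (:1 :^ 7 , :1) [])
  alphabet-product f G g0 gₛ (suc M) = L.solve 2 (λ f r → f :* (f :* (f :* (f :* (f :* (f :* (f :* r)))))) , r :* f :^ 7) (f M ∷ listProduct (λ x → f (value x)) (alphabet M) ∷ [])
    L.⟫ L.*-congʳ (alphabet-product f G g0 gₛ M) L.⟫ L.solve 2 (λ g f → g :^ 7 :* f :^ 7 , (g :* f) :^ 7) (G M ∷ f M ∷ []) L.⟫ L.^-congˡ 7 (L.≋-sym (gₛ M))

  -- The number of columns is charged to the bottom row: each of its entries carries the extra q of
  -- w = q z⁻¹. Equal lengths of the rows are the condition z⁰.
  topFactor bottomFactor : ℕ → L.Ser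
  topFactor v = L.1# L.+ monomial 1ℚ (+ 1 , + 0) v
  bottomFactor v = L.1# L.+ monomial 1ℚ (-[1+ 0 ] , + 0) (suc v)

  productZ≋ : ∀ M → F.productZ M L.≋ ∑ᴸ (subsetTerm (+ 1) value) (sublists (alphabet M))
  productZ≋ M = seqProduct-const (F.T.prodZ 0 M) 7 L.⟫ L.≋-sym (alphabet-product topFactor (F.T.prodZ 0) L.≋-refl (λ M → L.*-congˡ (L.+-congˡ (asMonomial (+ 1 , + 0) 0 M))) M)
    L.⟫ subset-expansion (+ 1) value (alphabet M)

  productW≋ : ∀ M → F.productW M L.≋ ∑ᴸ (subsetTerm -[1+ 0 ] (λ x → suc (value x))) (sublists (alphabet M))
  productW≋ M = seqProduct-const (F.T.prodW 0 M) 7 L.⟫ L.≋-sym (alphabet-product bottomFactor (F.T.prodW 0) L.≋-refl (λ M → L.*-congˡ (L.+-congˡ (asMonomial (-[1+ 0 ] , + 0) 1 M))) M)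
    L.⟫ subset-expansion -[1+ 0 ] (λ x → suc (value x)) (alphabet M)

  Rows : Set
  Rows = List (Entry 7) × List (Entry 7)

  balance : Rows → ℤ
  balance (s , t) = + length s Z.* + 1 Z.+ + length t Z.* -[1+ 0 ]

  size : Rows → ℕ
  size (s , t) = rowSum s N.+ sum (List.map (λ x → suc (value x)) t)

  rows : ℕ → List Rows
  rows M = cartesianProduct (sublists (alphabet M)) (sublists (alphabet M))

  constantTerm-rows : ∀ M → pairₛ constantTerm (F.productZ M L.* F.productW M) ≋ ∑ (λ st → term⟨ δ (balance st) , size st ⟩) (rows M)
  constantTerm-rows M = pairₛ-cong tt (L.*-cong (productZ≋ M) (productW≋ M) L.⟫ L.≋-sym (∑ᴸ-product (subsetTerm (+ 1) value) (subsetTerm -[1+ 0 ] (λ x → suc (value x))) (sublists (alphabet M)) (sublists (alphabet M)))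
      L.⟫ ∑ᴸ-cong (rows M) (λ st → monomial-* 1ℚ (+ length (proj₁ st) Z.* + 1 , + 0) (rowSum (proj₁ st)) 1ℚ (+ length (proj₂ st) Z.* -[1+ 0 ] , + 0) (sum (List.map (λ x → suc (value x)) (proj₂ st)))))
    ⟫ pair-rows (rows M)
    where
    pair-rows : ∀ L → pairₛ constantTerm (∑ᴸ (λ st → monomial (1ℚ ℚ.* 1ℚ) ((+ length (proj₁ st) Z.* + 1 , + 0) ⊞ (+ length (proj₂ st) Z.* -[1+ 0 ] , + 0)) (size st)) L) ≋ ∑ (λ st → term⟨ δ (balance st) , size st ⟩) L
    pair-rows [] = coeffs λ _ → refl
    pair-rows (st ∷ L) = pairₛ-+ constantTerm _ _ ⟫ +-cong (pairₛ-monomial tt (1ℚ ℚ.* 1ℚ) _ (size st)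
      ⟫ *-congʳ (≋-reflexive (cong constant (ℚₚ.*-identityˡ (ℚSolver.fromℤ (δ (balance st))))) ⟫ constant-fromℤ (δ (balance st)))) (pair-rows L)

  sum-suc : ∀ (t : List (Entry 7)) → sum (List.map (λ x → suc (value x)) t) ≡ length t N.+ rowSum t
  sum-suc [] = refl
  sum-suc (x ∷ t) = cong suc (cong (value x N.+_) (sum-suc t) ∙ ℕ-swap (value x) (length t) (rowSum t))
    where
    ℕ-swap : ∀ a b c → a N.+ (b N.+ c) ≡ b N.+ (a N.+ c)
    ℕ-swap a b c = sym (Nₚ.+-assoc a b c) ∙ cong (N._+ c) (Nₚ.+-comm a b) ∙ Nₚ.+-assoc b a c

  size-symbol : ∀ s t → length s ≡ length t → size (s , t) ≡ length s N.+ (rowSum s N.+ rowSum t)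
  size-symbol s t e = cong (rowSum s N.+_) (sum-suc t ∙ cong (N._+ rowSum t) (sym e))
    ∙ sym (Nₚ.+-assoc (rowSum s) (length s) (rowSum t)) ∙ cong (N._+ rowSum t) (Nₚ.+-comm (rowSum s) (length s)) ∙ Nₚ.+-assoc (length s) (rowSum s) (rowSum t)

  balance-ℤ : ∀ s t → balance (s , t) ≡ + length s Z.- + length t
  balance-ℤ s t = solveℤ 2 (λ a b → a :* nat 1 :+ b :* con -[1+ 0 ] , a :- b) (+ length s ∷ + length t ∷ [])

  values≤rowSum : ∀ (s : List (Entry 7)) → All (λ x → value x ≤ rowSum s) s
  values≤rowSum [] = []
  values≤rowSum (x ∷ s) = Nₚ.m≤m+n (value x) (rowSum s) ∷ All.map (λ h → Nₚ.≤-trans h (Nₚ.m≤n+m (rowSum s) (value x))) (values≤rowSum s)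

  module _ {n m : ℕ} (iso : Fin m ↔ FrobSymbol 7 n) (M : ℕ) (n<M : n < M) where
    toRows : FrobSymbol 7 n → Rows
    toRows S = FrobSymbol.top S , FrobSymbol.bottom S

    ≟-rows : DecidableEquality Rows
    ≟-rows = ×ₚ.≡-dec (Listₚ.≡-dec _≟ₑ_) (Listₚ.≡-dec _≟ₑ_)

    row∈ : ∀ s → StrictlyDecreasing s → rowSum s ≤ n → s ∈ sublists (alphabet M)
    row∈ s d l = sublists-complete {R = _≻_} ≻-trans ≻-irrefl (alphabet M) s (alphabet-decreasing M) (Linkedₚ.Linked⇒AllPairs ≻-trans d)
      (All.map (λ h → ∈-alphabet M _ (Nₚ.≤-<-trans h (Nₚ.≤-<-trans l n<M))) (values≤rowSum s))

    rows∈ : ∀ S → toRows S ∈ rows M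
    rows∈ S = ∈ₚ.∈-cartesianProduct⁺ (row∈ top topDec (bound (Nₚ.m≤m+n (rowSum top) (rowSum bottom)))) (row∈ bottom botDec (bound (Nₚ.m≤n+m (rowSum bottom) (rowSum top))))
      where
      open FrobSymbol S
      bound : ∀ {k} → k ≤ rowSum top N.+ rowSum bottom → k ≤ n
      bound h = Nₚ.≤-trans h (Nₚ.≤-trans (Nₚ.m≤n+m _ (length top)) (Nₚ.≤-reflexive weight))

    one : ∀ S → at term⟨ δ (balance (toRows S)) , size (toRows S) ⟩ n ≡ 1ℚ
    one S = coeff (term-cong (cong δ balanced) (size-symbol top bottom sameLength ∙ weight)) n
        ∙ coeff (*-congʳ fromℤ-1 ⟫ *-identityˡ (X^ n)) n ∙ at-X^-≡ n
      where
      open FrobSymbol S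
      balanced : balance (toRows S) ≡ + 0
      balanced = balance-ℤ top bottom ∙ cong (λ k → + length top Z.- + k) (sym sameLength) ∙ Zₚ.+-inverseʳ (+ length top)

    classified : ∀ st → st ∈ rows M → at term⟨ δ (balance st) , size st ⟩ n ≡ 0ℚ ⊎ Σ (FrobSymbol 7 n) (λ S → toRows S ≡ st)
    classified (s , t) st∈ with length s Nₚ.≟ length t | size (s , t) Nₚ.≟ n
    ... | no h | _ = inj₁ (coeff (*-congʳ (≋-reflexive (cong fromℤ (δ-≢ (balance (s , t)) unbalanced))) ⟫ zeroˡ (X^ (size (s , t)))) n ∙ refl)
      where
      unbalanced : balance (s , t) ≢ + 0
      unbalanced e = h (Zₚ.+-injective (Zₚ.i-j≡0⇒i≡j (+ length s) (+ length t) (sym (balance-ℤ s t) ∙ e)))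
    ... | yes _ | no h = inj₁ (at-term-≢ (δ (balance (s , t))) (size (s , t)) n h)
    ... | yes e | yes w = inj₂ (record
        { top = s ; bottom = t
        ; topDec = Linkedₚ.AllPairs⇒Linked (sublists-pairs (alphabet M) (alphabet-decreasing M) (proj₁ (∈ₚ.∈-cartesianProduct⁻ (sublists (alphabet M)) (sublists (alphabet M)) st∈)))
        ; botDec = Linkedₚ.AllPairs⇒Linked (sublists-pairs (alphabet M) (alphabet-decreasing M) (proj₂ (∈ₚ.∈-cartesianProduct⁻ (sublists (alphabet M)) (sublists (alphabet M)) st∈)))
        ; sameLength = e ; weight = sym (size-symbol s t e) ∙ w } , refl)

    frobenius-count : at (pairₛ constantTerm (F.productZ M L.* F.productW M)) n ≡ ℚSolver.fromℕ m
    frobenius-count = coeff (constantTerm-rows M) n ∙ count-list ≟-rows iso toRows (λ e → symbol-injective (cong proj₁ e) (cong proj₂ e))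
      (λ st → term⟨ δ (balance st) , size st ⟩) n (rows M) (Uniqueₚ.cartesianProduct⁺ (sublists-unique {R = _≻_} (alphabet-unique M)) (sublists-unique {R = _≻_} (alphabet-unique M)))
      rows∈ one classified

  frobeniusSeries : (ℕ → ℕ) → Ser
  frobeniusSeries cφ .at n = ℚSolver.fromℕ (cφ n)

  frobeniusSeries-value : ∀ cφ → (∀ n → Fin (cφ n) ↔ FrobSymbol 7 n) → frobeniusSeries cφ ≋ E ⁻¹ + fromℤ (+ 7) * (X^ 1 * section 5 partitionSeries)
  frobeniusSeries-value cφ iso = kolitsch (≋-sym (Frobenius.frobenius-theta (λ N M l → below λ n n<N → frobenius-count (iso n) M (Nₚ.<-≤-trans n<N l))))

-- Comparison with the definitions

infix 4 _≐_
record _≐_ (f : PS) (F : Ser) : Set where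
  constructor coincide
  field coincides : ∀ n → f n ≡ at F n
open _≐_

≐-≋ : ∀ {f F G} → f ≐ F → F ≋ G → f ≐ G
≐-≋ p q = coincide λ n → coincides p n ∙ coeff q n

Σ<-sum : ∀ n f → Σ< n f ≡ sumℚ n f
Σ<-sum zero f = refl
Σ<-sum (suc n) f = cong (ℚ._+ f n) (Σ<-sum n f)

≐-1 : oneS ≐ 1#
≐-1 = coincide λ { zero → refl ; (suc n) → refl }

≐-X^ : ∀ m → Defs.X^ m ≐ X^ m
≐-X^ m = coincide λ n → cong (λ b → if b then 1ℚ else 0ℚ) (isYes≗does (n Nₚ.≟ m)) ∙ go m n
  where
  go : ∀ m n → (if n N.≡ᵇ m then 1ℚ else 0ℚ) ≡ unit m n
  go zero zero = refl
  go zero (suc n) = refl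
  go (suc m) zero = refl
  go (suc m) (suc n) = go m n

module _ {f g : PS} {F G : Ser} (p : f ≐ F) (q : g ≐ G) where
  ≐-+ : f +ₛ g ≐ F + G
  ≐-+ = coincide λ n → cong₂ ℚ._+_ (coincides p n) (coincides q n)

  ≐-sub : f -ₛ g ≐ F - G
  ≐-sub = coincide λ n → cong₂ ℚ._-_ (coincides p n) (coincides q n)

  ≐-* : f *ₛ g ≐ F * G
  ≐-* = coincide λ n → Σ<-sum (suc n) (λ i → f i ℚ.* g (n ∸ i)) ∙ sumℚ-cong (suc n) (λ i _ → cong₂ ℚ._*_ (coincides p i) (coincides q (n ∸ i)))

≐-· : ∀ c {f F} → f ≐ F → c ·ₛ f ≐ constant c * F
≐-· c {F = F} p = coincide λ n → cong (c ℚ.*_) (coincides p n) ∙ sym (at-constant* c F n)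

≐-^ : ∀ {f F} k → f ≐ F → f ^ₛ k ≐ F ^ k
≐-^ zero p = ≐-1
≐-^ (suc k) p = ≐-* p (≐-^ k p)

≐-inv : ∀ {f F} → Monic F → f ≐ F → inv f ≐ F ⁻¹
≐-inv {f} {F} F0 p = coincide (coeff (⁻¹-unique F0 (*-congʳ (≋-sym same) ⟫ ⁻¹-inverse (monic (coincides p 0 ∙ leading F0)))))
  where
  same : ser f ≋ F
  same = coeffs (coincides p)

≐-qPoch : ∀ b → qPoch (suc b) ≐ poch b
≐-qPoch b = coincide λ n → coincides (finite n) n
  where
  module B = TripleProduct.WithBase ℚ-ring b
  finite : ∀ N → finProd (suc b) N ≐ B.qfac N
  finite zero = ≐-1
  finite (suc N) = ≐-* (finite N) (≐-≋ (≐-sub ≐-1 (≐-X^ (suc b N.* suc N))) (+-congˡ (-‿cong (≋-reflexive (cong X^ (Nₚ.*-comm (suc b) (suc N))) ⟫ ≋-sym (B.Q≋X^ (suc N))))))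

/1-+ : ∀ a b → (a Z.+ b) ℚ./ 1 ≡ a ℚ./ 1 ℚ.+ b ℚ./ 1
/1-+ a b = ℚₚ.toℚᵘ-injective (ℚᵘₚ.≃-trans (ℚₚ.toℚᵘ-fromℚᵘ (ℚᵘ.mkℚᵘ (a Z.+ b) 0)) (ℚᵘₚ.≃-sym (ℚᵘₚ.≃-trans (ℚₚ.toℚᵘ-homo-+ (a ℚ./ 1) (b ℚ./ 1))
  (ℚᵘₚ.≃-trans (ℚᵘₚ.+-cong (ℚₚ.toℚᵘ-fromℚᵘ (ℚᵘ.mkℚᵘ a 0)) (ℚₚ.toℚᵘ-fromℚᵘ (ℚᵘ.mkℚᵘ b 0)))
    (ℚᵘ.*≡* (solveℤ 2 (λ a b → (a :* nat 1 :+ b :* nat 1) :* nat 1 , (a :+ b) :* nat 1) (a ∷ b ∷ [])))))))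

ℕ→ℚ-fromℕ : ∀ n → ℚ[ n ] ≡ ℚSolver.fromℕ n
ℕ→ℚ-fromℕ zero = refl
ℕ→ℚ-fromℕ (suc n) = /1-+ (+ 1) (+ n) ∙ cong (1ℚ ℚ.+_) (ℕ→ℚ-fromℕ n)

ℤ→ℚ-fromℤ : ∀ z → ℤ→ℚ z ≡ ℚSolver.fromℤ z
ℤ→ℚ-fromℤ (+ n) = ℕ→ℚ-fromℕ n
ℤ→ℚ-fromℤ -[1+ n ] = cong ℚ.-_ (ℕ→ℚ-fromℕ (suc n))

≐-ΣLambert : ∀ {T row S} → (∀ i → T (suc i) ≐ row i) → (∀ i → Vanishes (suc i) (row i)) → Tends (λ n → sumₛ n row) S → ΣLambert T ≐ S
≐-ΣLambert {T} {row} {S} h v t = coincide λ n → Σ<-sum n (λ i → T (suc i) n) ∙ sumℚ-cong n (λ i _ → coincides (h i) n) ∙ sym (at-sum n n)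
  -- The coefficient of qⁿ is read from the limit at precision n + 1, hence with one row more than
  -- in the definition; that row starts at q^(n + 1).
  ∙ sym (cong (at (sumₛ n row) n ℚ.+_) (upto (v n) n Nₚ.≤-refl) ∙ ℚₚ.+-identityʳ _) ∙ upto (t (suc n) (suc n) Nₚ.≤-refl) n Nₚ.≤-refl
  where
  at-sum : ∀ k n → at (sumₛ k row) n ≡ sumℚ k (λ i → at (row i) n)
  at-sum zero n = refl
  at-sum (suc k) n = cong (ℚ._+ at (row k) n) (at-sum k n)

≐-lambert1 : lambert1 ≐ firstLambert
≐-lambert1 = ≐-ΣLambert {λ k → (ℤ→ℚ (legendre k 7) ℚ.* ℚ[ k N.* k ]) ·ₛ (Defs.X^ k *ₛ inv (oneS -ₛ Defs.X^ k))} row (λ i → Vanishes-*ˡ (fromℤ (χ (suc i) Z.* + (suc i N.* suc i))) (Vanishes-*ʳ (geometric (suc i)) (X^-vanishes (suc i)))) firstLambert-tends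
  where
  coefficient : ∀ i → ℤ→ℚ (legendre (suc i) 7) ℚ.* ℚ[ suc i N.* suc i ] ≡ ℚSolver.fromℤ (χ (suc i) Z.* + (suc i N.* suc i))
  coefficient i = cong₂ ℚ._*_ (ℤ→ℚ-fromℤ (legendre (suc i) 7) ∙ cong ℚSolver.fromℤ (legendre-χ (suc i))) (ℕ→ℚ-fromℕ (suc i N.* suc i))
    ∙ sym (ℚSolver.fromℤ-* (χ (suc i)) (+ (suc i N.* suc i)))
  row : ∀ i → (ℤ→ℚ (legendre (suc i) 7) ℚ.* ℚ[ suc i N.* suc i ]) ·ₛ (Defs.X^ (suc i) *ₛ inv (oneS -ₛ Defs.X^ (suc i))) ≐ firstRow i
  row i = ≐-≋ (≐-· _ (≐-* (≐-X^ (suc i)) (≐-inv (Monic-1-X^ i) (≐-sub ≐-1 (≐-X^ (suc i))))))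
    (*-congʳ (≋-reflexive (cong constant (coefficient i)) ⟫ constant-fromℤ (χ (suc i) Z.* + (suc i N.* suc i))))

≐-lambert2 : lambert2 ≐ secondLambert
≐-lambert2 = ≐-ΣLambert {λ k → ℤ→ℚ (legendre k 7) ·ₛ ((Defs.X^ k +ₛ Defs.X^ (2 N.* k)) *ₛ inv ((oneS -ₛ Defs.X^ k) ^ₛ 3))} row (λ i → Vanishes-*ˡ (fromℤ (χ (suc i))) (Poles1.cubicPole-vanishes (suc i))) secondLambert-tends
  where
  cube⁻¹ : ∀ i → ((1# - X^ (suc i)) ^ 3) ⁻¹ ≋ geometric (suc i) ^ 3
  cube⁻¹ i = ≋-sym (⁻¹-unique (Monic-^ 3 (Monic-1-X^ i)) (solve 2 (λ a b → a :^ 3 :* b :^ 3 , (a :* b) :^ 3) (1# - X^ (suc i) ∷ geometric (suc i) ∷ [])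
    ⟫ ^-congˡ 3 (⁻¹-inverse (Monic-1-X^ i)) ⟫ solve 0 (:1 :^ 3 , :1) []))
  pole : ∀ i → (X^ (suc i) + X^ (2 N.* suc i)) * ((1# - X^ (suc i)) ^ 3) ⁻¹ ≋ cubicPole (suc i)
  pole i = *-cong (+-congˡ (≋-sym (X^-* (suc i) 2)) ⟫ solve 1 (λ x → x :+ x :^ 2 , x :* (:1 :+ x)) (X^ (suc i) ∷ [])) (cube⁻¹ i)
  row : ∀ i → ℤ→ℚ (legendre (suc i) 7) ·ₛ ((Defs.X^ (suc i) +ₛ Defs.X^ (2 N.* suc i)) *ₛ inv ((oneS -ₛ Defs.X^ (suc i)) ^ₛ 3)) ≐ secondRow i
  row i = ≐-≋ (≐-· _ (≐-* (≐-+ (≐-X^ (suc i)) (≐-X^ (2 N.* suc i))) (≐-inv (Monic-^ 3 (Monic-1-X^ i)) (≐-^ 3 (≐-sub ≐-1 (≐-X^ (suc i)))))))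
    (*-cong (≋-reflexive (cong constant (ℤ→ℚ-fromℤ (legendre (suc i) 7) ∙ cong ℚSolver.fromℤ (legendre-χ (suc i)))) ⟫ constant-fromℤ (χ (suc i))) (pole i))

u : Ser
u = poch 0

eighth : Ser
eighth = constant (+ 1 ℚ./ 8)

constant-* : ∀ a b → constant a * constant b ≋ constant (a ℚ.* b)
constant-* a b = coeffs λ { zero → at-constant* a (constant b) 0 ; (suc n) → at-constant* a (constant b) (suc n) ∙ ℚₚ.*-zeroʳ a }

eight-eighth : fromℤ (+ 8) * eighth ≋ 1#
eight-eighth = *-congʳ (≋-sym (constant-fromℤ (+ 8))) ⟫ constant-* (ℚSolver.fromℤ (+ 8)) (+ 1 ℚ./ 8) ⟫ constant-1

eighths : ∀ z c → ℚSolver.fromℤ z ℚ.* (+ 1 ℚ./ 8) ≡ c → constant c ≋ fromℤ z * eighth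
eighths z c e = ≋-reflexive (cong constant (sym e)) ⟫ ≋-sym (constant-* (ℚSolver.fromℤ z) (+ 1 ℚ./ 8)) ⟫ *-congʳ (constant-fromℤ z)

integral : ∀ n → constant ℚ[ n ] ≋ fromℤ (+ n)
integral n = ≋-reflexive (cong constant (ℕ→ℚ-fromℕ n)) ⟫ constant-fromℤ (+ n)

lambertForm eulerForm partitionForm : Ser
lambertForm = (u ^ 7) ⁻¹ * ((1# - (fromℤ (+ 7) * eighth) * firstLambert) + (fromℤ (+ 343) * eighth) * secondLambert)
eulerForm = E ⁻¹ + (fromℤ (+ 49) * (X^ 1 * (E ^ 3 * (u ^ 4) ⁻¹)) + fromℤ (+ 343) * (X^ 2 * (E ^ 7 * (u ^ 8) ⁻¹)))
partitionForm = E ⁻¹ + fromℤ (+ 7) * (X^ 1 * section 5 partitionSeries)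

≐-rhs1 : rhs1 ≐ lambertForm
≐-rhs1 = ≐-* (≐-inv (Monic-^ 7 (Monic-poch 0)) (≐-^ 7 (≐-qPoch 0)))
  (≐-+ (≐-sub ≐-1 (≐-≋ (≐-· (+ 7 ℚ./ 8) ≐-lambert1) (*-congʳ (eighths (+ 7) (+ 7 ℚ./ 8) refl)))) (≐-≋ (≐-· (+ 343 ℚ./ 8) ≐-lambert2) (*-congʳ (eighths (+ 343) (+ 343 ℚ./ 8) refl))))

≐-rhs2 : rhs2 ≐ eulerForm
≐-rhs2 = ≐-+ (≐-inv (Monic-poch 6) (≐-qPoch 6))
  (≐-+ (≐-≋ (≐-· ℚ[ 49 ] (≐-* (≐-X^ 1) (≐-* (≐-^ 3 (≐-qPoch 6)) (≐-inv (Monic-^ 4 (Monic-poch 0)) (≐-^ 4 (≐-qPoch 0)))))) (*-congʳ (integral 49)))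
       (≐-≋ (≐-· ℚ[ 343 ] (≐-* (≐-X^ 2) (≐-* (≐-^ 7 (≐-qPoch 6)) (≐-inv (Monic-^ 8 (Monic-poch 0)) (≐-^ 8 (≐-qPoch 0)))))) (*-congʳ (integral 343))))

≐-rhs3 : ∀ p → (∀ n → Fin (p n) ↔ Partition n) → rhs3 p ≐ partitionForm
≐-rhs3 p iso = coincide λ n → split n ∙ cong₂ ℚ._+_ (coincides (≐-inv (Monic-poch 6) (≐-qPoch 6)) n) (tail≡ n)
  where
  partitions : ℕ → ℚ
  partitions zero = 0ℚ
  partitions (suc j) = ℚ[ 7 ] ℚ.* ℚ[ p (7 N.* suc j ∸ 2) ]
  split : ∀ n → rhs3 p n ≡ inv (qPoch 7) n ℚ.+ partitions n
  split zero = refl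
  split (suc j) = refl
  index≡ : ∀ j → 7 N.* suc j ∸ 2 ≡ 5 N.+ j N.* 7
  index≡ j = cong (_∸ 2) (Nₚ.*-comm 7 (suc j))
  tail≡ : ∀ n → partitions n ≡ at (fromℤ (+ 7) * (X^ 1 * section 5 partitionSeries)) n
  tail≡ n = go n ∙ sym (at-constant* ℚ[ 7 ] (X^ 1 * section 5 partitionSeries) n) ∙ coeff (*-congʳ {x = X^ 1 * section 5 partitionSeries} (integral 7)) n
    where
    go : ∀ n → partitions n ≡ ℚ[ 7 ] ℚ.* at (X^ 1 * section 5 partitionSeries) n
    go zero = sym (cong (ℚ[ 7 ] ℚ.*_) (at-X^*-< 1 0 (section 5 partitionSeries) (s≤s z≤n)) ∙ ℚₚ.*-zeroʳ ℚ[ 7 ])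
    go (suc j) = cong (ℚ[ 7 ] ℚ.*_) (ℕ→ℚ-fromℕ (p (7 N.* suc j ∸ 2)) ∙ sym (partitionSeries-counts (iso (7 N.* suc j ∸ 2)))
      ∙ cong (at partitionSeries) (index≡ j) ∙ sym (at-X^* 1 j (section 5 partitionSeries)))

-- After multiplication by (q;q)_∞⁸ E, the leading 1 cancels against the term 8E in the value of
-- `firstLambert`, and the contributions 49/8 and 343/8 of the two series to the middle term add up
-- to 49.
lambertForm≋eulerForm : lambertForm ≋ eulerForm
lambertForm≋eulerForm = Monic-cancel (Monic-* (Monic-^ 8 (Monic-poch 0)) (Monic-poch 6)) (left ⟫ ≋-sym right)
  where
  e4 = (u ^ 4) ⁻¹
  e7 = (u ^ 7) ⁻¹
  e8 = (u ^ 8) ⁻¹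
  target : Ser
  target = u ^ 8 + (fromℤ (+ 49) * (X^ 1 * (E ^ 4 * u ^ 4)) + fromℤ (+ 343) * (X^ 1 ^ 2 * E ^ 8))
  right : u ^ 8 * E * eulerForm ≋ target
  right = solve 7 (λ u e i x y a b → u :^ 8 :* e :* (i :+ (nat 49 :* (x :* (e :^ 3 :* a)) :+ nat 343 :* (y :* (e :^ 7 :* b)))) ,
      u :^ 8 :* (e :* i) :+ (nat 49 :* (x :* (e :^ 4 :* (u :^ 4 :* (u :^ 4 :* a)))) :+ nat 343 :* (y :* (e :^ 8 :* (u :^ 8 :* b))))) (u ∷ E ∷ E ⁻¹ ∷ X^ 1 ∷ X^ 2 ∷ e4 ∷ e8 ∷ [])
    ⟫ +-cong (*-congˡ (⁻¹-inverse (Monic-poch 6))) (+-cong (*-congˡ (*-congˡ (*-congˡ (*-congˡ (⁻¹-inverse (Monic-^ 4 (Monic-poch 0)))))))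
        (*-congˡ (*-cong (≋-sym (X^-* 1 2)) (*-congˡ (⁻¹-inverse (Monic-^ 8 (Monic-poch 0)))))))
      ⟫ solve 3 (λ u e x → u :^ 8 :* :1 :+ (nat 49 :* (x :* (e :^ 4 :* (u :^ 4 :* :1))) :+ nat 343 :* (x :^ 2 :* (e :^ 8 :* :1))) ,
         u :^ 8 :+ (nat 49 :* (x :* (e :^ 4 :* u :^ 4)) :+ nat 343 :* (x :^ 2 :* e :^ 8))) (u ∷ E ∷ X^ 1 ∷ [])
  left : u ^ 8 * E * lambertForm ≋ target
  left = solve 6 (λ u e i h k l → u :^ 8 :* e :* (i :* ((:1 :- (nat 7 :* h) :* k) :+ (nat 343 :* h) :* l)) ,
      (u :^ 7 :* i) :* (u :* e :- h :* u :* (nat 7 :* k :* e) :+ nat 343 :* h :* e :* (u :* l))) (u ∷ E ∷ e7 ∷ eighth ∷ firstLambert ∷ secondLambert ∷ [])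
    ⟫ *-cong (⁻¹-inverse (Monic-^ 7 (Monic-poch 0))) (+-cong (+-cong (≋-sym (*-identityˡ _) ⟫ *-congʳ (≋-sym eight-eighth)) (-‿cong (*-congˡ firstLambert-value))) (*-congˡ secondLambert-value))
      ⟫ solve 4 (λ u e h x → :1 :* (((nat 8 :* h) :* (u :* e) :- h :* u :* (nat 8 :* e :- (nat 8 :* u :^ 7 :+ nat 49 :* (x :* (u :^ 3 :* e :^ 4))))) :+ nat 343 :* h :* e :* (x :* (e :^ 3 :* u :^ 4) :+ nat 8 :* (x :^ 2 :* e :^ 7))) ,
          (nat 8 :* h) :* (u :^ 8 :+ (nat 49 :* (x :* (e :^ 4 :* u :^ 4)) :+ nat 343 :* (x :^ 2 :* e :^ 8)))) (u ∷ E ∷ eighth ∷ X^ 1 ∷ [])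
        ⟫ *-congʳ eight-eighth ⟫ *-identityˡ target

eulerForm≋partitionForm : eulerForm ≋ partitionForm
eulerForm≋partitionForm = +-congˡ (Monic-cancel (Monic-^ 8 (Monic-poch 0)) (solve 6 (λ u e x y a b → u :^ 8 :* (nat 49 :* (x :* (e :^ 3 :* a)) :+ nat 343 :* (y :* (e :^ 7 :* b))) ,
     nat 49 :* (x :* (e :^ 3 :* (u :^ 4 :* (u :^ 4 :* a)))) :+ nat 343 :* (y :* (e :^ 7 :* (u :^ 8 :* b)))) (u ∷ E ∷ X^ 1 ∷ X^ 2 ∷ (u ^ 4) ⁻¹ ∷ (u ^ 8) ⁻¹ ∷ [])
  ⟫ +-cong (*-congˡ (*-congˡ (*-congˡ (*-congˡ (⁻¹-inverse (Monic-^ 4 (Monic-poch 0))))))) (*-congˡ (*-cong (≋-sym (X^-* 1 2)) (*-congˡ (⁻¹-inverse (Monic-^ 8 (Monic-poch 0))))))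
    ⟫ solve 3 (λ u e x → nat 49 :* (x :* (e :^ 3 :* (u :^ 4 :* :1))) :+ nat 343 :* (x :^ 2 :* (e :^ 7 :* :1)) ,
        nat 7 :* (x :* (nat 7 :* (e :^ 3 :* u :^ 4) :+ nat 49 :* (x :* e :^ 7)))) (u ∷ E ∷ X^ 1 ∷ [])
      ⟫ *-congˡ (*-congˡ (≋-sym ramanujan-7)) ⟫ solve 3 (λ u x s → nat 7 :* (x :* (u :^ 8 :* s)) , u :^ 8 :* (nat 7 :* (x :* s))) (u ∷ X^ 1 ∷ section 5 partitionSeries ∷ [])))

theorem3p2 : (cφ₇ p : ℕ → ℕ)
           → (∀ n → Fin (cφ₇ n) ↔ FrobSymbol 7 n)
           → (∀ n → Fin (p n) ↔ Partition n)
           → ∀ n → (ℚ[ cφ₇ n ] ≡ rhs1 n) × (rhs1 n ≡ rhs2 n) × (rhs2 n ≡ rhs3 p n)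
theorem3p2 cφ₇ p symbols partitions n =
    ℕ→ℚ-fromℕ (cφ₇ n) ∙ coeff (FrobeniusCount.frobeniusSeries-value cφ₇ symbols ⟫ ≋-sym (lambertForm≋eulerForm ⟫ eulerForm≋partitionForm)) n ∙ sym (coincides ≐-rhs1 n)
  , coincides ≐-rhs1 n ∙ coeff lambertForm≋eulerForm n ∙ sym (coincides ≐-rhs2 n)
  , coincides ≐-rhs2 n ∙ coeff eulerForm≋partitionForm n ∙ sym (coincides (≐-rhs3 p partitions) n)
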